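{- Let $k\in\mathbb N$ and let $f:\{ -1,1\}^k\to\{0,1\}$ be a symmetric function (invariant under all permutations of its $k$ inputs). Then $\mathsf{Max\text{ - }CSP}(f)$ is approximation resistant if and only if $f$ supports a one-wise independent distribution.
   Context: $\mathbb{N}=\{1,2,\dots\}$, $[n]=\{1,\dots,n\}$. $f$ supports a one-wise independent distribution if there is a probability distribution $D$ supported on $f^{ -1}(1)\subseteq\{ -1,1\}^k$ with $\mathbb E_{\mathbf a\sim D}[a_j]=0$ for every $j\in[k]$. $\rho(f)=2^{ -k}|\{\mathbf a\in\{ -1,1\}^k: f(\mathbf a)=1\}|$. $\mathsf{Max\text{ - }CSP}(f)$ is approximation resistant (in the streaming setting) if for every $\epsilon>0$ there exists $\delta>0$ such that every (randomized) streaming algorithm solving $(1,\rho(f)+\epsilon)$-$\mathsf{Max\text{ - }CSP}(f)$ requires $\Omega(n^\delta)$ space. CSPs. A constraint on $n$ variables is a pair $C=(\mathbf j,\mathbf b)$ with $\mathbf j=(j_1,\dots,j_k)\in[n]^k$ having distinct entries and $\mathbf b\in\{ -1,1\}^k$; for $\sigma\in\{ -1,1\}^n$ let $C(\sigma)=f(b_1\sigma_{j_1},\dots,b_k\sigma_{j_k})$. An instance $\Psi=(C_1,\dots,C_m)$, $m\ge 1$, is a finite sequence of constraints on $n$ variables (repetitions allowed), presented as a stream. Put $\mathrm{val}_\Psi(\sigma)=\frac1m\sum_i C_i(\sigma)$ and $\mathrm{val}_\Psi=\max_{\sigma\in\{ -1,1\}^n}\mathrm{val}_\Psi(\sigma)$.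 For reals $\gamma,\beta$, an algorithm solves $(\gamma,\beta)$-$\mathsf{Max\text{ - }CSP}(f)$ if, on instances with $m\le\mathrm{poly}(n)$ (a fixed, sufficiently large polynomial bound), it outputs $1$ with probability at least $2/3$ whenever $\mathrm{val}_\Psi\ge\gamma$ and outputs $1$ with probability at most $1/3$ whenever $\mathrm{val}_\Psi\le\beta$. (If the two classes of instances overlap no algorithm solves the problem and lower bounds hold vacuously.) Streaming algorithms. Let $\mathcal C_n$ be the set of constraints on $n$ variables. A deterministic space-$s$ streaming algorithm is a pair $(S,v)$, $S:\{0,1\}^s\times\mathcal C_n\to\{0,1\}^s$, $v:\{0,1\}^s\to[0,1]$; starting from state $0^s$ it updates its state by $z\mapsto S(z,C)$ as each constraint $C$ of the stream arrives, and outputs $v$ of the final state. A randomized streaming algorithm is a probability distribution over deterministic ones. "Requires $\Omega(n^\delta)$ space" means there are $c>0$ and $n_0$ such that for all $n\ge n_0$ every such algorithm for instances on $n$ variables has $s\ge c\,n^\delta$. -}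

module Defs where

open import Data.Bool using (Bool; false)
open import Data.Fin using (Fin)
open import Data.Fin.Permutation using (Permutation′; _⟨$⟩ʳ_)
open import Data.Integer using (+_)
open import Data.List as List using (List)
open import Data.List.NonEmpty as List⁺ using (List⁺; _∷_; _⁺++⁺_)
open import Data.Nat as ℕ using (ℕ; zero; suc; NonZero)
import Data.Nat.Properties as ℕ
open import Data.Product using (∃; _×_; _,_)
open import Data.Rational as ℚ using (ℚ; 0ℚ; 1ℚ; ½)
import Data.Rational.Properties as ℚ
open import Data.Rational.Solver using (module +-*-Solver)
open import Data.Sign as Sign using (Sign)
open import Data.Sum using (inj₁; inj₂)
open import Data.Vec as Vec using (Vec; []; _∷_; lookup; tabulate)
open import Data.Vec.Relation.Unary.Unique.Propositional using (Unique)
open import Relation.Binary.PropositionalEquality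

-- Real numbers are Cauchy sequences of rationals, identified by _≈_.

IsCauchy : (ℕ → ℚ) → Set
IsCauchy x = ∀ ε → 0ℚ ℚ.< ε →
  ∃ λ N → ∀ {m n} → N ℕ.≤ m → N ℕ.≤ n → ℚ.∣ x m ℚ.- x n ∣ ℚ.≤ ε

record ℝ : Set where
  constructor mkℝ
  field
    seq    : ℕ → ℚ
    cauchy : IsCauchy seq

open ℝ public

private
  half>0 : ∀ {ε} → 0ℚ ℚ.< ε → 0ℚ ℚ.< ½ ℚ.* ε
  half>0 {ε} 0<ε = subst (ℚ._< ½ ℚ.* ε) (ℚ.*-zeroʳ ½) (ℚ.*-monoʳ-<-pos ½ 0<ε)

  half+half : ∀ ε → ½ ℚ.* ε ℚ.+ ½ ℚ.* ε ≡ ε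
  half+half ε = trans (sym (ℚ.*-distribʳ-+ ε ½ ½)) (ℚ.*-identityˡ ε)

  dist-comm : ∀ p q → ℚ.∣ p ℚ.- q ∣ ≡ ℚ.∣ q ℚ.- p ∣
  dist-comm p q = trans (cong ℚ.∣_∣ lem) (ℚ.∣-p∣≡∣p∣ (q ℚ.- p))
    where
    open +-*-Solver
    lem : p ℚ.- q ≡ ℚ.- (q ℚ.- p)
    lem = solve 2 (λ a b → a :- b := :- (b :- a)) refl p q

  ∣p∣≤∣p-q∣+∣q∣ : ∀ p q → ℚ.∣ p ∣ ℚ.≤ ℚ.∣ p ℚ.- q ∣ ℚ.+ ℚ.∣ q ∣
  ∣p∣≤∣p-q∣+∣q∣ p q =
    subst (λ r → ℚ.∣ r ∣ ℚ.≤ ℚ.∣ p ℚ.- q ∣ ℚ.+ ℚ.∣ q ∣) lem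
      (ℚ.∣p+q∣≤∣p∣+∣q∣ (p ℚ.- q) q)
    where
    open +-*-Solver
    lem : (p ℚ.- q) ℚ.+ q ≡ p
    lem = solve 2 (λ a b → (a :- b) :+ b := a) refl p q

  ∣p∣-∣q∣≤∣p-q∣ : ∀ p q → ℚ.∣ p ∣ ℚ.- ℚ.∣ q ∣ ℚ.≤ ℚ.∣ p ℚ.- q ∣
  ∣p∣-∣q∣≤∣p-q∣ p q =
    subst (ℚ.∣ p ∣ ℚ.- ℚ.∣ q ∣ ℚ.≤_) lem
      (ℚ.+-monoˡ-≤ (ℚ.- ℚ.∣ q ∣) (∣p∣≤∣p-q∣+∣q∣ p q))
    where
    open +-*-Solver
    lem : (ℚ.∣ p ℚ.- q ∣ ℚ.+ ℚ.∣ q ∣) ℚ.- ℚ.∣ q ∣ ≡ ℚ.∣ p ℚ.- q ∣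
    lem = solve 2 (λ a b → (a :+ b) :- b := a) refl ℚ.∣ p ℚ.- q ∣ ℚ.∣ q ∣

  ∣∣p∣-∣q∣∣≤∣p-q∣ : ∀ p q → ℚ.∣ ℚ.∣ p ∣ ℚ.- ℚ.∣ q ∣ ∣ ℚ.≤ ℚ.∣ p ℚ.- q ∣
  ∣∣p∣-∣q∣∣≤∣p-q∣ p q with ℚ.∣p∣≡p∨∣p∣≡-p (ℚ.∣ p ∣ ℚ.- ℚ.∣ q ∣)
  ... | inj₁ eq = subst (ℚ._≤ ℚ.∣ p ℚ.- q ∣) (sym eq) (∣p∣-∣q∣≤∣p-q∣ p q)
  ... | inj₂ eq = subst₂ ℚ._≤_ (sym (trans eq lem)) (dist-comm q p) (∣p∣-∣q∣≤∣p-q∣ q p)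
    where
    open +-*-Solver
    lem : ℚ.- (ℚ.∣ p ∣ ℚ.- ℚ.∣ q ∣) ≡ ℚ.∣ q ∣ ℚ.- ℚ.∣ p ∣
    lem = solve 2 (λ a b → :- (a :- b) := b :- a) refl ℚ.∣ p ∣ ℚ.∣ q ∣

  eventuallyBounded : ∀ x → IsCauchy x →
    ∃ λ B → 0ℚ ℚ.< B × ∃ λ N → ∀ {n} → N ℕ.≤ n → ℚ.∣ x n ∣ ℚ.≤ B
  eventuallyBounded x cx =
    let N , h = cx 1ℚ (ℚ.positive⁻¹ 1ℚ) in
    1ℚ ℚ.+ ℚ.∣ x N ∣ ,
    ℚ.+-mono-<-≤ (ℚ.positive⁻¹ 1ℚ) (ℚ.0≤∣p∣ (x N)) ,
    N ,
    λ {n} N≤n → ℚ.≤-trans (∣p∣≤∣p-q∣+∣q∣ (x n) (x N))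
                  (ℚ.+-monoˡ-≤ ℚ.∣ x N ∣ (h N≤n ℕ.≤-refl))

  scale : ∀ B → 0ℚ ℚ.< B → ∀ ε → 0ℚ ℚ.< ε → ∃ λ δ → 0ℚ ℚ.< δ × B ℚ.* δ ≡ ε
  scale B 0<B ε 0<ε = ℚ.1/ B ℚ.* ε , ℚ.positive⁻¹ _ {{ℚ.pos*pos⇒pos (ℚ.1/ B) ε}} ,
    (begin
      B ℚ.* (ℚ.1/ B ℚ.* ε)  ≡⟨ ℚ.*-assoc B (ℚ.1/ B) ε ⟨
      B ℚ.* ℚ.1/ B ℚ.* ε    ≡⟨ cong (ℚ._* ε) (ℚ.*-inverseʳ B) ⟩
      1ℚ ℚ.* ε              ≡⟨ ℚ.*-identityˡ ε ⟩
      ε ∎)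
    where
    open ≡-Reasoning
    instance
      posB : ℚ.Positive B
      posB = ℚ.positive 0<B
      nzB : ℚ.NonZero B
      nzB = ℚ.pos⇒nonZero B
      posε : ℚ.Positive ε
      posε = ℚ.positive 0<ε
      pos1/B : ℚ.Positive (ℚ.1/ B)
      pos1/B = ℚ.1/pos⇒pos B

  ∣*∣-mono : ∀ a b {B δ} → 0ℚ ℚ.< B → ℚ.∣ a ∣ ℚ.≤ B → ℚ.∣ b ∣ ℚ.≤ δ →
             ℚ.∣ a ℚ.* b ∣ ℚ.≤ B ℚ.* δ
  ∣*∣-mono a b {B} {δ} 0<B p q = begin
    ℚ.∣ a ℚ.* b ∣        ≡⟨ ℚ.∣p*q∣≡∣p∣*∣q∣ a b ⟩
    ℚ.∣ a ∣ ℚ.* ℚ.∣ b ∣  ≤⟨ ℚ.*-monoʳ-≤-nonNeg ℚ.∣ b ∣ {{ℚ.nonNegative (ℚ.0≤∣p∣ b)}} p ⟩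
    B ℚ.* ℚ.∣ b ∣        ≤⟨ ℚ.*-monoˡ-≤-nonNeg B {{ℚ.nonNegative (ℚ.<⇒≤ 0<B)}} q ⟩
    B ℚ.* δ ∎
    where open ℚ.≤-Reasoning

  product-close : ∀ a b c d {B C δ ε} → 0ℚ ℚ.< B → 0ℚ ℚ.< C → (B ℚ.+ C) ℚ.* δ ≡ ε →
    ℚ.∣ a ∣ ℚ.≤ B → ℚ.∣ d ∣ ℚ.≤ C → ℚ.∣ a ℚ.- b ∣ ℚ.≤ δ → ℚ.∣ c ℚ.- d ∣ ℚ.≤ δ →
    ℚ.∣ a ℚ.* c ℚ.- b ℚ.* d ∣ ℚ.≤ ε
  product-close a b c d {B} {C} {δ} {ε} 0<B 0<C eq a≤B d≤C ab cd = begin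
    ℚ.∣ a ℚ.* c ℚ.- b ℚ.* d ∣                             ≡⟨ cong ℚ.∣_∣ lem ⟨
    ℚ.∣ a ℚ.* (c ℚ.- d) ℚ.+ d ℚ.* (a ℚ.- b) ∣             ≤⟨ ℚ.∣p+q∣≤∣p∣+∣q∣ (a ℚ.* (c ℚ.- d)) (d ℚ.* (a ℚ.- b)) ⟩
    ℚ.∣ a ℚ.* (c ℚ.- d) ∣ ℚ.+ ℚ.∣ d ℚ.* (a ℚ.- b) ∣       ≤⟨ ℚ.+-mono-≤ (∣*∣-mono a (c ℚ.- d) 0<B a≤B cd) (∣*∣-mono d (a ℚ.- b) 0<C d≤C ab) ⟩
    B ℚ.* δ ℚ.+ C ℚ.* δ                                   ≡⟨ ℚ.*-distribʳ-+ δ B C ⟨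
    (B ℚ.+ C) ℚ.* δ                                       ≡⟨ eq ⟩
    ε ∎
    where
    open ℚ.≤-Reasoning
    lem : a ℚ.* (c ℚ.- d) ℚ.+ d ℚ.* (a ℚ.- b) ≡ a ℚ.* c ℚ.- b ℚ.* d
    lem = solve 4 (λ a b c d → a :* (c :- d) :+ d :* (a :- b) := a :* c :- b :* d) refl a b c d
      where open +-*-Solver

abstract
  +-cauchy : ∀ x y → IsCauchy x → IsCauchy y → IsCauchy λ n → x n ℚ.+ y n
  +-cauchy x y cx cy ε 0<ε =
    let M , hx = cx (½ ℚ.* ε) (half>0 0<ε)
        N , hy = cy (½ ℚ.* ε) (half>0 0<ε)
    in M ℕ.⊔ N , λ {m} {n} p q →
      subst₂ ℚ._≤_ (cong ℚ.∣_∣ (lem (x m) (x n) (y m) (y n))) (half+half ε)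
        (ℚ.≤-trans (ℚ.∣p+q∣≤∣p∣+∣q∣ (x m ℚ.- x n) (y m ℚ.- y n))
          (ℚ.+-mono-≤ (hx (ℕ.m⊔n≤o⇒m≤o M N p) (ℕ.m⊔n≤o⇒m≤o M N q))
                      (hy (ℕ.m⊔n≤o⇒n≤o M N p) (ℕ.m⊔n≤o⇒n≤o M N q))))
    where
    lem : ∀ a b c d → (a ℚ.- b) ℚ.+ (c ℚ.- d) ≡ (a ℚ.+ c) ℚ.- (b ℚ.+ d)
    lem = solve 4 (λ a b c d → (a :- b) :+ (c :- d) := (a :+ c) :- (b :+ d)) refl
      where open +-*-Solver

  *-cauchy : ∀ x y → IsCauchy x → IsCauchy y → IsCauchy λ n → x n ℚ.* y n
  *-cauchy x y cx cy ε 0<ε =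
    let B , 0<B , Mx , bx = eventuallyBounded x cx
        C , 0<C , My , by = eventuallyBounded y cy
        δ , 0<δ , eq      = scale (B ℚ.+ C) (ℚ.+-mono-< 0<B 0<C) ε 0<ε
        Nx , hx           = cx δ 0<δ
        Ny , hy           = cy δ 0<δ
    in close B C δ 0<B 0<C eq Mx bx My by Nx hx Ny hy
    where
    close : ∀ B C δ → 0ℚ ℚ.< B → 0ℚ ℚ.< C → (B ℚ.+ C) ℚ.* δ ≡ ε →
      ∀ Mx → (∀ {n} → Mx ℕ.≤ n → ℚ.∣ x n ∣ ℚ.≤ B) →
      ∀ My → (∀ {n} → My ℕ.≤ n → ℚ.∣ y n ∣ ℚ.≤ C) →
      ∀ Nx → (∀ {m n} → Nx ℕ.≤ m → Nx ℕ.≤ n → ℚ.∣ x m ℚ.- x n ∣ ℚ.≤ δ) →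
      ∀ Ny → (∀ {m n} → Ny ℕ.≤ m → Ny ℕ.≤ n → ℚ.∣ y m ℚ.- y n ∣ ℚ.≤ δ) →
      ∃ λ N → ∀ {m n} → N ℕ.≤ m → N ℕ.≤ n → ℚ.∣ x m ℚ.* y m ℚ.- x n ℚ.* y n ∣ ℚ.≤ ε
    close B C δ 0<B 0<C eq Mx bx My by Nx hx Ny hy =
      (Mx ℕ.⊔ My) ℕ.⊔ (Nx ℕ.⊔ Ny) , λ {m} {n} p q →
        let M≤m = ℕ.m⊔n≤o⇒m≤o (Mx ℕ.⊔ My) (Nx ℕ.⊔ Ny) p
            M≤n = ℕ.m⊔n≤o⇒m≤o (Mx ℕ.⊔ My) (Nx ℕ.⊔ Ny) q
            N≤m = ℕ.m⊔n≤o⇒n≤o (Mx ℕ.⊔ My) (Nx ℕ.⊔ Ny) p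
            N≤n = ℕ.m⊔n≤o⇒n≤o (Mx ℕ.⊔ My) (Nx ℕ.⊔ Ny) q
        in product-close (x m) (x n) (y m) (y n) {B} {C} {δ} {ε} 0<B 0<C eq
             (bx (ℕ.m⊔n≤o⇒m≤o Mx My M≤m)) (by (ℕ.m⊔n≤o⇒n≤o Mx My M≤n))
             (hx (ℕ.m⊔n≤o⇒m≤o Nx Ny N≤m) (ℕ.m⊔n≤o⇒m≤o Nx Ny N≤n))
             (hy (ℕ.m⊔n≤o⇒n≤o Nx Ny N≤m) (ℕ.m⊔n≤o⇒n≤o Nx Ny N≤n))

  ∣∣-cauchy : ∀ x → IsCauchy x → IsCauchy λ n → ℚ.∣ x n ∣
  ∣∣-cauchy x cx ε 0<ε =
    let N , h = cx ε 0<ε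
    in N , λ {m} {n} p q → ℚ.≤-trans (∣∣p∣-∣q∣∣≤∣p-q∣ (x m) (x n)) (h p q)

  const-cauchy : ∀ q → IsCauchy λ _ → q
  const-cauchy q ε 0<ε = 0 , λ _ _ →
    subst (λ r → ℚ.∣ r ∣ ℚ.≤ ε) (sym (ℚ.+-inverseʳ q)) (ℚ.<⇒≤ 0<ε)

fromℚ : ℚ → ℝ
fromℚ q = mkℝ (λ _ → q) (const-cauchy q)

fromℕ : ℕ → ℝ
fromℕ n = fromℚ (+ n ℚ./ 1)

0ℝ 1ℝ : ℝ
0ℝ = fromℚ 0ℚ
1ℝ = fromℚ 1ℚ

infixl 6 _+_
infixl 7 _*_
infixr 8 _^_
infix 4 _≤_ _<_ _≈_

_+_ : ℝ → ℝ → ℝ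
x + y = mkℝ (λ n → seq x n ℚ.+ seq y n) (+-cauchy (seq x) (seq y) (cauchy x) (cauchy y))

_*_ : ℝ → ℝ → ℝ
x * y = mkℝ (λ n → seq x n ℚ.* seq y n) (*-cauchy (seq x) (seq y) (cauchy x) (cauchy y))

∣_∣ : ℝ → ℝ
∣ x ∣ = mkℝ (λ n → ℚ.∣ seq x n ∣) (∣∣-cauchy (seq x) (cauchy x))

_^_ : ℝ → ℕ → ℝ
x ^ zero  = 1ℝ
x ^ suc n = x * x ^ n

_≤_ _<_ _≈_ : ℝ → ℝ → Set
x ≤ y = ∀ ε → 0ℚ ℚ.< ε → ∃ λ N → ∀ {n} → N ℕ.≤ n → seq x n ℚ.≤ seq y n ℚ.+ ε
x < y = ∃ λ ε → 0ℚ ℚ.< ε × ∃ λ N → ∀ {n} → N ℕ.≤ n → seq x n ℚ.+ ε ℚ.≤ seq y n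
x ≈ y = x ≤ y × y ≤ x

ConvergesTo0 : (ℕ → ℝ) → Set
ConvergesTo0 x = ∀ ε → 0ℝ < ε → ∃ λ N → ∀ {n} → N ℕ.≤ n → ∣ x n ∣ ≤ ε

-- For n ≥ 1, real c > 0 and real δ > 0, this says c · n^δ ≤ s, where n^δ is the
-- supremum of n^(p/q) over the nonnegative rationals p/q < δ: the inequality
-- c · n^(p/q) ≤ s between nonnegative numbers is raised to the power q = suc q-1.
_·_^_≤ˢ_ : ℝ → ℕ → ℝ → ℕ → Set
c · n ^ δ ≤ˢ s = ∀ p q-1 → fromℚ (+ p ℚ./ suc q-1) < δ →
  c ^ suc q-1 * fromℕ (n ℕ.^ p) ≤ fromℕ (s ℕ.^ suc q-1)

cube : ∀ n → List⁺ (Vec Sign n)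
cube zero    = [] ∷ List.[]
cube (suc n) = List⁺.map (Sign.+ ∷_) (cube n) ⁺++⁺ List⁺.map (Sign.- ∷_) (cube n)

∑cube : ∀ n → (Vec Sign n → ℝ) → ℝ
∑cube n g = List⁺.foldr₁ _+_ (List⁺.map g (cube n))

maxcube : ∀ n → (Vec Sign n → ℚ) → ℚ
maxcube n g = List⁺.foldr₁ ℚ._⊔_ (List⁺.map g (cube n))

count : ∀ {A : Set} → (A → Bool) → List⁺ A → ℕ
count P xs = List.length (List.filterᵇ P (List⁺.toList xs))

signℝ : Sign → ℝ
signℝ Sign.+ = 1ℝ
signℝ Sign.- = fromℚ (ℚ.- 1ℚ)

Predicate : ℕ → Set
Predicate k = Vec Sign k → Bool

Symmetric : ∀ {k} → Predicate k → Set
Symmetric {k} f = ∀ (π : Permutation′ k) a → f (tabulate λ i → lookup a (π ⟨$⟩ʳ i)) ≡ f a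

record SupportsOneWiseIndependent {k} (f : Predicate k) : Set where
  field
    D         : Vec Sign k → ℝ
    D-nonneg  : ∀ a → 0ℝ ≤ D a
    D-total   : ∑cube k D ≈ 1ℝ
    D-support : ∀ a → f a ≡ false → D a ≈ 0ℝ
    D-mean    : ∀ j → ∑cube k (λ a → D a * signℝ (lookup a j)) ≈ 0ℝ

ρ : ∀ {k} → Predicate k → ℚ
ρ {k} f = ℚ._/_ (+ count f (cube k)) (2 ℕ.^ k) {{ℕ.m^n≢0 2 k}}

-- Distinctness is proof-irrelevant, so that an algorithm reading a constraint
-- sees only (j , b).
record Constraint (k n : ℕ) : Set where
  constructor mkConstraint
  field
    j         : Vec (Fin n) k
    b         : Vec Sign k
    .distinct : Unique j

Instance : ℕ → ℕ → Set
Instance k n = List⁺ (Constraint k n)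

module _ {k n : ℕ} (f : Predicate k) where

  satisfies : Vec Sign n → Constraint k n → Bool
  satisfies σ C = f (Vec.zipWith Sign._*_ b (Vec.map (lookup σ) j))
    where open Constraint C

  valAt : Instance k n → Vec Sign n → ℚ
  valAt Ψ σ = + count (satisfies σ) Ψ ℚ./ List⁺.length Ψ

  val : Instance k n → ℚ
  val Ψ = maxcube n (valAt Ψ)

-- A probability distribution on an arbitrary set A (such as the uncountable set
-- of deterministic algorithms below), given as a Daniell integral: a vector
-- lattice of integrable functions with a positive, normalised linear expectation
-- that is continuous along sequences decreasing to 0.
record Distribution (A : Set) : Set₁ where
  field
    Integrable : (A → ℝ) → Set
    E          : ∀ g → Integrable g → ℝ

    int-resp   : ∀ {g h} → (∀ a → g a ≈ h a) → Integrable g → Integrable h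
    int-const  : ∀ c → Integrable λ _ → c
    int-+      : ∀ {g h} → Integrable g → Integrable h → Integrable λ a → g a + h a
    int-*      : ∀ c {g} → Integrable g → Integrable λ a → c * g a
    int-abs    : ∀ {g} → Integrable g → Integrable λ a → ∣ g a ∣

    E-one      : E (λ _ → 1ℝ) (int-const 1ℝ) ≈ 1ℝ
    E-+        : ∀ {g h} (ig : Integrable g) (ih : Integrable h) →
                 E _ (int-+ ig ih) ≈ E g ig + E h ih
    E-*        : ∀ c {g} (ig : Integrable g) → E _ (int-* c ig) ≈ c * E g ig
    E-mono     : ∀ {g h} (ig : Integrable g) (ih : Integrable h) →
                 (∀ a → g a ≤ h a) → E g ig ≤ E h ih
    E-cont     : ∀ (g : ℕ → A → ℝ) (ig : ∀ i → Integrable (g i)) →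
                 (∀ i a → g (suc i) a ≤ g i a) →
                 (∀ a → ConvergesTo0 λ i → g i a) →
                 ConvergesTo0 λ i → E (g i) (ig i)

record DetAlgorithm (k n s : ℕ) : Set where
  field
    S   : Vec Bool s → Constraint k n → Vec Bool s
    v   : Vec Bool s → ℝ
    0≤v : ∀ z → 0ℝ ≤ v z
    v≤1 : ∀ z → v z ≤ 1ℝ

  output : Instance k n → ℝ
  output Ψ = v (List.foldl S (Vec.replicate s false) (List⁺.toList Ψ))

record RandAlgorithm (k n s : ℕ) : Set₁ where
  field
    law        : Distribution (DetAlgorithm k n s)
    measurable : ∀ Ψ → Distribution.Integrable law λ A → DetAlgorithm.output A Ψ

  Pr1 : Instance k n → ℝ
  Pr1 Ψ = Distribution.E law (λ A → DetAlgorithm.output A Ψ) (measurable Ψ)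

-- Polynomials with natural coefficients, constant coefficient first.
Polynomial : Set
Polynomial = List ℕ

eval : Polynomial → ℕ → ℕ
eval P n = List.foldr (λ c r → c ℕ.+ n ℕ.* r) 0 P

_≼_ : Polynomial → Polynomial → Set
P ≼ Q = ∀ n → eval P n ℕ.≤ eval Q n

-- P below is the bound m ≤ P(n) on the number of constraints.

Solves : ∀ {k n s} → Polynomial → Predicate k → (γ β : ℝ) → RandAlgorithm k n s → Set
Solves {n = n} P f γ β 𝒜 = ∀ Ψ → List⁺.length Ψ ℕ.≤ eval P n →
  (γ ≤ fromℚ (val f Ψ) → fromℚ (+ 2 ℚ./ 3) ≤ RandAlgorithm.Pr1 𝒜 Ψ) ×
  (fromℚ (val f Ψ) ≤ β → RandAlgorithm.Pr1 𝒜 Ψ ≤ fromℚ (+ 1 ℚ./ 3))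

RequiresΩ : ∀ {k} → Polynomial → Predicate k → (γ β δ : ℝ) → Set₁
RequiresΩ {k} P f γ β δ = ∃ λ c → 0ℝ < c × ∃ λ n₀ → ∀ n → n₀ ℕ.≤ n → ∀ s →
  (𝒜 : RandAlgorithm k n s) → Solves P f γ β 𝒜 → c · n ^ δ ≤ˢ s

ApproximationResistant : ∀ {k} → Polynomial → Predicate k → Set₁
ApproximationResistant P f = ∀ ε → 0ℝ < ε →
  ∃ λ δ → 0ℝ < δ × RequiresΩ P f 1ℝ (fromℚ (ρ f) + ε) δ

{-# OPTIONS --safe #-}

module Submission where

-- A symmetric f fails to support a one-wise independent distribution exactly when all its
-- satisfying assignments lean to the same side, that is, when ς Σ aᵢ ≥ 1 on them for one sign ς.
--
-- If f does support such a distribution, there is a permutation-invariant one; let 1 + u be its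
-- density. The Fourier expansion of u starts in degree 2. Draw the constraints independently,
-- uniformly or, for a hidden uniform σ, with density 1 + u(b σ_j). Uniform streams have value at
-- most ρ(f) + ε with high probability, planted streams have value 1. Given a memory state of
-- probability p, a pair of bits of σ has correlation O(log(1/p)/n) in quadratic mean (level-2
-- inequality, from moments of bilinear forms in random signs), so that the density of the next
-- constraint given the state has variance O(s²/n²). These variances, and not their square roots,
-- add up along the stream: a potential concave in the acceptance probability pays for the linear
-- term. After O(n) constraints the total is O(s²/n), so s = Ω(√n).
--
-- If the satisfying assignments lean to one side, let xᵢ be the sum of the signs of the occurrences
-- of the variable i. If the value is 1, then Σ|xᵢ| ≥ m; if the value is at most ρ(f) + ε, then
-- Σ|xᵢ| ≤ m/4, as otherwise a random assignment slightly biased towards the signs of x does better.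
-- The sum telescopes over the occurrences in the stream, into ±1 terms that depend only on later
-- occurrences of the same variable, so averages over a few reservoir samples distinguish the two
-- cases in logarithmic space.

-- A hybrid argument that adds total variation distances along the stream would add about `n` terms
-- of size `s / n`, which says nothing. This is why each step must be charged with a variance. The
-- level-2 inequality is of use only for states that are not too rare. Instead of the logarithm of
-- the probability of each state, one exponent `suc s` serves all states: it costs an additive
-- `¼ ^ suc s` per state, and the `2 ^ s` states together pay at most 1. The variables of a random
-- constraint come from `k` disjoint blocks, so that they are independent and yet distinct. The
-- probabilistic estimates are made with finitely supported rational measures. Finitely many
-- inequalities between Cauchy sequences hold at a common index, so real numbers are treated there
-- as rational numbers with small errors. The union bound over all assignments needs streams whose
-- length is a fixed multiple of `n`, and therefore the length bound `n ^ 2` is large enough. In the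
-- other direction algorithms are built for `n = 2 ^ h` only, which suffices because resistance
-- claims its space bound for all large `n`.

-- Encoding states as bit strings

module Coding where

  open import Data.Bool using (Bool; true; false)
  open import Data.Integer as ℤ using (ℤ)
  import Data.Integer.Properties as ℤ
  open import Data.Nat
  open import Data.Nat.Properties
  open import Data.Nat.DivMod
  import Data.Nat.Tactic.RingSolver as ℕR
  open import Data.Product using (∃; _×_; _,_; proj₁; proj₂)
  open import Data.Sign as Sign using (Sign)
  open import Data.Unit using (⊤; tt)
  open import Data.Vec as Vec using (Vec; []; _∷_; take; drop; _++_)
  import Data.Vec.Properties as Vec
  open import Data.Vec.Relation.Unary.All using (All; []; _∷_)
  open import Relation.Binary.PropositionalEquality

  -- Decoding has to invert encoding on `Ok` values only: the counters of the streaming algorithm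
  -- are unbounded as a type and fit into a fixed number of bits only while the stream is short.
  record Code (A : Set) (Ok : A → Set) : Set where
    field
      bits    : ℕ
      enc     : A → Vec Bool bits
      dec     : Vec Bool bits → A
      dec-enc : ∀ {a} → Ok a → dec (enc a) ≡ a

  open Code public

  private
    variable
      A B : Set
      P Q : A → Set

  bit : Bool → ℕ
  bit false = 0
  bit true  = 1

  lsb : ℕ → Bool
  lsb zero          = false
  lsb (suc zero)    = true
  lsb (suc (suc n)) = lsb n

  bit-lsb : ∀ {r} → r < 2 → bit (lsb r) ≡ r
  bit-lsb (s≤s z≤n)       = refl
  bit-lsb (s≤s (s≤s z≤n)) = refl

  natCode : ∀ e → Code ℕ (_< 2 ^ e)
  natCode e = record { bits = e ; enc = enc′ e ; dec = dec′ ; dec-enc = dec-enc′ e }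
    where
    enc′ : ∀ e → ℕ → Vec Bool e
    enc′ zero    x = []
    enc′ (suc e) x = lsb (x % 2) ∷ enc′ e (x / 2)
    dec′ : ∀ {e} → Vec Bool e → ℕ
    dec′ []      = 0
    dec′ (b ∷ v) = bit b + dec′ v * 2
    dec-enc′ : ∀ e {x} → x < 2 ^ e → dec′ (enc′ e x) ≡ x
    dec-enc′ zero    {zero} _ = refl
    dec-enc′ zero    {suc x} (s≤s ())
    dec-enc′ (suc e) {x} x<  = trans
      (cong₂ (λ a b → a + b * 2) (bit-lsb (m%n<n x 2)) (dec-enc′ e (m<n*o⇒m/o<n (subst (x <_) (*-comm 2 (2 ^ e)) x<))))
      (sym (m≡m%n+[m/n]*n x 2))

  signCode : Code Sign (λ _ → ⊤)
  signCode = record { bits = 1 ; enc = enc′ ; dec = dec′ ; dec-enc = λ {a} _ → eq a }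
    where
    enc′ : Sign → Vec Bool 1
    enc′ Sign.+ = true ∷ []
    enc′ Sign.- = false ∷ []
    dec′ : Vec Bool 1 → Sign
    dec′ (true ∷ [])  = Sign.+
    dec′ (false ∷ []) = Sign.-
    eq : ∀ a → dec′ (enc′ a) ≡ a
    eq Sign.+ = refl
    eq Sign.- = refl

  take-++ : ∀ {m n} (xs : Vec A m) (ys : Vec A n) → take m (xs ++ ys) ≡ xs
  take-++ {m = m} xs ys = Vec.++-injectiveˡ (take m (xs ++ ys)) xs (Vec.take++drop≡id m (xs ++ ys))

  drop-++ : ∀ {m n} (xs : Vec A m) (ys : Vec A n) → drop m (xs ++ ys) ≡ ys
  drop-++ {m = m} xs ys = Vec.++-injectiveʳ (take m (xs ++ ys)) xs (Vec.take++drop≡id m (xs ++ ys))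

  pairCode : Code A P → Code B Q → Code (A × B) (λ (a , b) → P a × Q b)
  pairCode c d = record
    { bits    = bits c + bits d
    ; enc     = λ (a , b) → enc c a ++ enc d b
    ; dec     = λ v → dec c (take (bits c) v) , dec d (drop (bits c) v)
    ; dec-enc = λ {(a , b)} (p , q) → cong₂ _,_
        (trans (cong (dec c) (take-++ (enc c a) (enc d b))) (dec-enc c p))
        (trans (cong (dec d) (drop-++ (enc c a) (enc d b))) (dec-enc d q))
    }

  vecCode : ∀ R → Code A P → Code (Vec A R) (All P)
  vecCode zero    c = record { bits = 0 ; enc = λ _ → [] ; dec = λ _ → [] ; dec-enc = λ { {[]} _ → refl } }
  vecCode {A = A} {P} (suc R) c = record
    { bits    = bits p
    ; enc     = λ { (a ∷ as) → enc p (a , as) }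
    ; dec     = λ v → proj₁ (dec p v) ∷ proj₂ (dec p v)
    ; dec-enc = λ { {a ∷ as} (pa ∷ pas) → cong (λ (x , xs) → x ∷ xs) (dec-enc p {a , as} (pa , pas)) }
    }
    where p = pairCode c (vecCode R c)

  bits-vecCode : ∀ R (c : Code A P) → bits (vecCode R c) ≡ R * bits c
  bits-vecCode zero    c = refl
  bits-vecCode (suc R) c = cong (bits c +_) (bits-vecCode R c)

  intCode : ∀ e → Code ℤ (λ i → ℤ.∣ i ∣ < 2 ^ e)
  intCode e = record
    { bits    = bits p
    ; enc     = λ i → enc p (ℤ.sign i , ℤ.∣ i ∣)
    ; dec     = λ v → proj₁ (dec p v) ℤ.◃ proj₂ (dec p v)
    ; dec-enc = λ {i} ok → trans (cong (λ (s , n) → s ℤ.◃ n) (dec-enc p (tt , ok))) (ℤ.signᵢ◃∣i∣≡i i)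
    }
    where p = pairCode signCode (natCode e)

  n<2^n : ∀ n → n < 2 ^ n
  n<2^n zero    = s≤s z≤n
  n<2^n (suc n) = begin-strict
    suc n         ≤⟨ n<2^n n ⟩
    2 ^ n         <⟨ m<m+n (2 ^ n) (m^n>0 2 n) ⟩
    2 ^ n + 2 ^ n ≡⟨ cong (2 ^ n +_) (+-identityʳ (2 ^ n)) ⟨
    2 ^ suc n ∎
    where open ≤-Reasoning

  ℕ^-distrib-* : ∀ k m n → m ^ k * n ^ k ≡ (m * n) ^ k
  ℕ^-distrib-* zero    m n = refl
  ℕ^-distrib-* (suc k) m n = trans (lem m (m ^ k) n (n ^ k)) (cong (m * n *_) (ℕ^-distrib-* k m n))
    where
    lem : ∀ m x n y → m * x * (n * y) ≡ m * n * (x * y)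
    lem = ℕR.solve-∀

  -- h + 1 is a power 2^y, so that a power of h + 1 has an exponent linear in y.
  abstract
    growth : ∀ h₀ C D q → ∃ λ h → h₀ ≤ h × C ^ suc q * ((D * suc h) ^ suc q + 1) < 2 ^ h
    growth h₀ C D q = h , ≤-trans h₀≤x (≤-trans (≤-trans (m≤m+n x (x + 0)) (m+n≤o⇒m≤o y (≤-trans (≤-reflexive (+-identityʳ y)) (≤-pred (subst (y <_) (sym suc-h) (n<2^n y)))))) ≤-refl) , (begin-strict
      C ^ suc q * ((D * suc h) ^ suc q + 1)
        ≤⟨ *-monoʳ-≤ (C ^ suc q) (+-mono-≤ (^-monoˡ-≤ (suc q) (m≤n+m (D * suc h) 1)) (≤-trans (≤-reflexive (sym (^-zeroˡ (suc q)))) (^-monoˡ-≤ (suc q) (s≤s (z≤n {D * suc h}))))) ⟩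
      C ^ suc q * (suc (D * suc h) ^ suc q + suc (D * suc h) ^ suc q)
        ≡⟨ cong (C ^ suc q *_) (cong (suc (D * suc h) ^ suc q +_) (sym (+-identityʳ _))) ⟩
      C ^ suc q * (2 * suc (D * suc h) ^ suc q)
        ≤⟨ *-monoʳ-≤ (C ^ suc q) (*-mono-≤ 2≤2^ (^-monoˡ-≤ (suc q) (+-monoˡ-≤ (D * suc h) (s≤s (z≤n {h}))))) ⟩
      C ^ suc q * (2 ^ suc q * (suc D * suc h) ^ suc q)
        ≡⟨ trans (cong (C ^ suc q *_) (ℕ^-distrib-* (suc q) 2 (suc D * suc h))) (ℕ^-distrib-* (suc q) C (2 * (suc D * suc h))) ⟩
      (C * (2 * (suc D * suc h))) ^ suc q
        ≡⟨ cong (_^ suc q) (trans (lem C (suc D) (suc h)) (cong (G *_) suc-h)) ⟩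
      (G * 2 ^ y) ^ suc q
        ≤⟨ ^-monoˡ-≤ (suc q) (*-monoˡ-≤ (2 ^ y) (<⇒≤ (n<2^n G))) ⟩
      (2 ^ G * 2 ^ y) ^ suc q
        ≡⟨ trans (cong (_^ suc q) (sym (^-distribˡ-+-* 2 G y))) (^-*-assoc 2 (G + y) (suc q)) ⟩
      2 ^ ((G + y) * suc q)
        <⟨ ^-monoʳ-< 2 (s≤s (s≤s z≤n)) exponent ⟩
      2 ^ h ∎)
      where
      open ≤-Reasoning
      G x y h : ℕ
      G = C * 2 * suc D
      -- As `suc h` is `2 ^ (2 * x)`, the square of `2 ^ x`, it is at least `suc x * suc x`. The
      -- choice of `x` makes this quadratic exceed the exponent `(G + 2 * x) * suc q`, which is
      -- linear in `x`.
      x = G * suc q + 2 * suc q + 2 + h₀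
      y = 2 * x
      h = pred (2 ^ y)
      suc-h : suc h ≡ 2 ^ y
      suc-h = suc-pred (2 ^ y) {{m^n≢0 2 y}}
      h₀≤x : h₀ ≤ x
      h₀≤x = m≤n+m h₀ (G * suc q + 2 * suc q + 2)
      lem : ∀ C D h → C * (2 * (D * h)) ≡ C * 2 * D * h
      lem = ℕR.solve-∀
      2≤2^ : 2 ≤ 2 ^ suc q
      2≤2^ = subst (_≤ 2 ^ suc q) (*-identityʳ 2) (*-monoʳ-≤ 2 (m^n>0 2 q))
      lem₁ : ∀ G x q → suc (suc ((G + 2 * x) * q)) + (G * q * x + 2 * x + x + h₀ * suc x) ≡ 2 + G * q + (G * q + 2 * q + 2 + h₀) * x + x + h₀
      lem₁ G x q = solve G x q h₀
        where
        solve : ∀ G x q h → suc (suc ((G + 2 * x) * q)) + (G * q * x + 2 * x + x + h * suc x) ≡ 2 + G * q + (G * q + 2 * q + 2 + h) * x + x + h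
        solve = ℕR.solve-∀
      lem₂ : ∀ x → suc x * suc x ≡ x * x + x + suc x
      lem₂ = ℕR.solve-∀
      exponent : (G + y) * suc q < h
      exponent = ≤-pred (begin
        suc (suc ((G + 2 * x) * suc q))
          ≤⟨ m≤m+n _ (G * suc q * x + 2 * x + x + h₀ * suc x) ⟩
        suc (suc ((G + 2 * x) * suc q)) + (G * suc q * x + 2 * x + x + h₀ * suc x)
          ≡⟨ lem₁ G x (suc q) ⟩
        2 + G * suc q + x * x + x + h₀
          ≤⟨ bound ⟩
        suc x * suc x
          ≤⟨ *-mono-≤ (n<2^n x) (n<2^n x) ⟩
        2 ^ x * 2 ^ x
          ≡⟨ trans (sym (^-distribˡ-+-* 2 x x)) (cong (λ z → 2 ^ (x + z)) (sym (+-identityʳ x))) ⟩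
        2 ^ y
          ≡⟨ suc-h ⟨
        suc h ∎)
        where
        bound : 2 + G * suc q + x * x + x + h₀ ≤ suc x * suc x
        bound = begin
          2 + G * suc q + x * x + x + h₀       ≤⟨ m≤m+n _ (2 * suc q + 1) ⟩
          2 + G * suc q + x * x + x + h₀ + (2 * suc q + 1) ≡⟨ lem₃ (G * suc q) (suc q) h₀ (x * x) x ⟩
          x * x + x + suc (G * suc q + 2 * suc q + 2 + h₀)   ≡⟨ lem₂ x ⟨
          suc x * suc x ∎
          where
          lem₃ : ∀ g q h y x → 2 + g + y + x + h + (2 * q + 1) ≡ y + x + suc (g + 2 * q + 2 + h)
          lem₃ = ℕR.solve-∀

import Defs as R
open import Defs using (0ℝ; 1ℝ; ApproximationResistant; Constraint; ConvergesTo0; DetAlgorithm;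
  Distribution; Instance; Polynomial; Predicate; RandAlgorithm; Solves;
  SupportsOneWiseIndependent; Symmetric; _·_^_≤ˢ_; _≼_; count; cube; eval; fromℚ; maxcube;
  mkConstraint; satisfies; seq; signℝ; val; valAt; ρ; ℝ; ∑cube)
open import Algebra.Bundles using (CommutativeRing)
open import Data.Bool as Bool using (Bool; _∧_; false; if_then_else_; true)
open import Data.Empty using (⊥; ⊥-elim)
open import Data.Fin as Fin using (Fin; suc; toℕ; zero)
open import Data.Fin.Permutation as Perm using (Permutation′; _⟨$⟩ʳ_; _⟨$⟩ˡ_)
open import Data.Integer as ℤ using (ℤ) renaming (+_ to pos)
open import Data.List as List using (List; []; _∷_)
open import Data.List.NonEmpty as List⁺ using (List⁺; _⁺++⁺_; _∷_)
open import Data.Nat as ℕ using (ℕ; zero; suc)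
open import Data.Product using (_,_; _×_; proj₁; proj₂; ∃)
open import Data.Rational hiding (pos)
open import Data.Rational.Properties
open import Data.Sign as Sign using (Sign; opposite)
open import Data.Sum using (_⊎_; inj₁; inj₂)
open import Data.Unit using (tt; ⊤)
open import Data.Vec as Vec using (Vec; []; _[_]≔_; _∷_; lookup; replicate; tabulate; updateAt; zipWith)
open import Data.Vec.Relation.Unary.All as All using (All; []; _∷_)
open import Data.Vec.Relation.Unary.AllPairs as AllPairs using ([]; _∷_)
open import Data.Vec.Relation.Unary.Unique.Propositional using (Unique)
open import Function using (_∘_; id)
open import Function.Bundles using (_⇔_; mk⇔)
open import Level using (0ℓ)
open import Relation.Binary.Definitions using (DecidableEquality; Tri; tri<; tri>; tri≈)
open import Relation.Binary.PropositionalEquality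
open import Relation.Nullary using (Dec; does; no; yes; ¬_)
open import Relation.Nullary.Decidable using (dec-false; dec-true; dec⇒maybe; from-yes; ¬?)
open import Relation.Nullary.Decidable.Core using (recompute)
open import Tactic.RingSolver using (solve-∀)
import Data.Bool.Properties as Bool
import Data.Fin.Properties as Fin
import Data.Integer.Properties as ℤ
import Data.List.Properties as List
import Data.Nat.DivMod as ℕ
import Data.Nat.Properties as ℕ
import Data.Nat.Tactic.RingSolver as ℕR
import Data.Rational.Unnormalised as ℚᵘ
import Data.Rational.Unnormalised.Properties as ℚᵘ
import Data.Sign.Properties as Sign
import Data.Vec.Properties as Vec
import Tactic.RingSolver.Core.AlmostCommutativeRing as ACR
open import Algebra.Properties.CommutativeMonoid.Sum +-0-commutativeMonoid
  using (sum; sum-permute; sum-cong-≗)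

-- Rational inequalities and finitely supported means

module FiniteMeans where

  open import Algebra.Properties.CommutativeSemiring.Exp
    (CommutativeRing.commutativeSemiring +-*-commutativeRing) public
    using (_^_; ^-homo-*; ^-distrib-*; ^-assocʳ)

  ℚ-ring : ACR.AlmostCommutativeRing 0ℓ 0ℓ
  ℚ-ring = ACR.fromCommutativeRing +-*-commutativeRing λ x → dec⇒maybe (0ℚ ≟ x)

  private
    variable
      A B C : Set

  0≤1 : 0ℚ ≤ 1ℚ
  0≤1 = nonNegative⁻¹ 1ℚ

  0≤½ : 0ℚ ≤ ½
  0≤½ = nonNegative⁻¹ ½

  ½≤1 : ½ ≤ 1ℚ
  ½≤1 = ≤ᵇ⇒≤ _

  ≤-by : ∀ {x y d} → 0ℚ ≤ d → y ≡ x + d → x ≤ y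
  ≤-by {x} {y} {d} 0≤d eq = subst₂ _≤_ (+-identityʳ x) (sym eq) (+-monoʳ-≤ x 0≤d)

  0≤-diff : ∀ {x y} → x ≤ y → 0ℚ ≤ y - x
  0≤-diff {x} {y} h = subst (_≤ y - x) (+-inverseʳ x) (+-monoˡ-≤ (- x) h)

  diff-0≤ : ∀ {x y} → 0ℚ ≤ y - x → x ≤ y
  diff-0≤ {x} {y} h = ≤-by h (lem x y)
    where
    lem : ∀ x y → y ≡ x + (y - x)
    lem = solve-∀ ℚ-ring

  0≤+ : ∀ {x y} → 0ℚ ≤ x → 0ℚ ≤ y → 0ℚ ≤ x + y
  0≤+ = +-mono-≤

  *-monoˡ : ∀ {r p q} → 0ℚ ≤ r → p ≤ q → r * p ≤ r * q
  *-monoˡ {r} 0≤r = *-monoˡ-≤-nonNeg r {{nonNegative 0≤r}}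

  *-monoʳ : ∀ {r p q} → 0ℚ ≤ r → p ≤ q → p * r ≤ q * r
  *-monoʳ {r} 0≤r = *-monoʳ-≤-nonNeg r {{nonNegative 0≤r}}

  0≤* : ∀ {x y} → 0ℚ ≤ x → 0ℚ ≤ y → 0ℚ ≤ x * y
  0≤* {x} {y} h h′ = subst (_≤ x * y) (*-zeroʳ x) (*-monoˡ h h′)

  0<* : ∀ {x y} → 0ℚ < x → 0ℚ < y → 0ℚ < x * y
  0<* {x} {y} h h′ = positive⁻¹ _ {{pos*pos⇒pos x {{positive h}} y {{positive h′}}}}

  *-mono : ∀ {a b c d} → 0ℚ ≤ a → 0ℚ ≤ c → a ≤ b → c ≤ d → a * c ≤ b * d
  *-mono 0≤a 0≤c a≤b c≤d = ≤-trans (*-monoʳ 0≤c a≤b) (*-monoˡ (≤-trans 0≤a a≤b) c≤d)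

  *-cancelˡ : ∀ {r p q} → 0ℚ < r → r * p ≤ r * q → p ≤ q
  *-cancelˡ {r} 0<r = *-cancelˡ-≤-pos r {{positive 0<r}}

  0≤sq : ∀ x → 0ℚ ≤ x * x
  0≤sq x with ≤-total 0ℚ x
  ... | inj₁ h = 0≤* h h
  ... | inj₂ h = subst (0ℚ ≤_) (lem x) (0≤* (neg-antimono-≤ h) (neg-antimono-≤ h))
    where
    lem : ∀ x → - x * - x ≡ x * x
    lem = solve-∀ ℚ-ring

  0<⇒≢ : ∀ {x} → 0ℚ < x → x ≢ 0ℚ
  0<⇒≢ h eq = <-irrefl (sym eq) h

  0≤∧≢0⇒0< : ∀ {x} → 0ℚ ≤ x → x ≢ 0ℚ → 0ℚ < x
  0≤∧≢0⇒0< {x} h ne with <-cmp 0ℚ x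
  ... | tri< a _ _ = a
  ... | tri≈ _ b _ = ⊥-elim (ne (sym b))
  ... | tri> _ _ c = ⊥-elim (<-irrefl refl (<-≤-trans c h))

  0<⊎≤0 : ∀ x → 0ℚ < x ⊎ x ≤ 0ℚ
  0<⊎≤0 x with 0ℚ <? x
  ... | yes h = inj₁ h
  ... | no h  = inj₂ (≮⇒≥ h)

  ^-nonneg : ∀ {x} n → 0ℚ ≤ x → 0ℚ ≤ x ^ n
  ^-nonneg zero    h = 0≤1
  ^-nonneg (suc n) h = 0≤* h (^-nonneg n h)

  ^-pos : ∀ {x} n → 0ℚ < x → 0ℚ < x ^ n
  ^-pos zero    h = positive⁻¹ 1ℚ
  ^-pos (suc n) h = 0<* h (^-pos n h)

  ^-mono : ∀ {x y} n → 0ℚ ≤ x → x ≤ y → x ^ n ≤ y ^ n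
  ^-mono zero    _   _   = ≤-refl
  ^-mono (suc n) 0≤x x≤y = *-mono 0≤x (^-nonneg n 0≤x) x≤y (^-mono n 0≤x x≤y)

  ^-mono-< : ∀ {x y} n → 0ℚ ≤ x → x < y → x ^ suc n < y ^ suc n
  ^-mono-< {x} {y} n 0≤x x<y =
    ≤-<-trans (*-monoˡ 0≤x (^-mono n 0≤x (<⇒≤ x<y)))
      (*-monoˡ-<-pos (y ^ n) {{positive (^-pos n (≤-<-trans 0≤x x<y))}} x<y)

  ^-cancel : ∀ {x y} n → 0ℚ ≤ y → x ^ suc n ≤ y ^ suc n → x ≤ y
  ^-cancel {x} {y} n 0≤y h with x ≤? y
  ... | yes x≤y = x≤y
  ... | no x≰y  = ⊥-elim (<-irrefl refl (<-≤-trans (^-mono-< n 0≤y (≰⇒> x≰y)) h))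

  1≤^ : ∀ {x} n → 1ℚ ≤ x → 1ℚ ≤ x ^ n
  1≤^ zero    h = ≤-refl
  1≤^ (suc n) h = *-mono 0≤1 0≤1 h (1≤^ n h)

  1^ : ∀ n → 1ℚ ^ n ≡ 1ℚ
  1^ zero    = refl
  1^ (suc n) = trans (*-identityˡ _) (1^ n)

  abstract
    ιℤ : ℤ → ℚ
    ιℤ i = i / 1

    ιℤ-/1 : ∀ i → ιℤ i ≡ i / 1
    ιℤ-/1 i = refl

    ιℤ-0 : ιℤ (pos 0) ≡ 0ℚ
    ιℤ-0 = refl

    ιℤ-1 : ιℤ (pos 1) ≡ 1ℚ
    ιℤ-1 = refl

    toℚᵘ-ιℤ : ∀ i → toℚᵘ (ιℤ i) ℚᵘ.≃ ℚᵘ.mkℚᵘ i 0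
    toℚᵘ-ιℤ i = toℚᵘ-fromℚᵘ (ℚᵘ.mkℚᵘ i 0)

    ιℤ-+ : ∀ i j → ιℤ (i ℤ.+ j) ≡ ιℤ i + ιℤ j
    ιℤ-+ i j = toℚᵘ-injective (begin
      toℚᵘ (ιℤ (i ℤ.+ j))                ≈⟨ toℚᵘ-ιℤ (i ℤ.+ j) ⟩
      ℚᵘ.mkℚᵘ (i ℤ.+ j) 0                ≈⟨ ℚᵘ.*≡* (cong (ℤ._* pos 1) (sym (cong₂ ℤ._+_ (ℤ.*-identityʳ i) (ℤ.*-identityʳ j)))) ⟩
      ℚᵘ.mkℚᵘ i 0 ℚᵘ.+ ℚᵘ.mkℚᵘ j 0       ≈⟨ ℚᵘ.+-cong (toℚᵘ-ιℤ i) (toℚᵘ-ιℤ j) ⟨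
      toℚᵘ (ιℤ i) ℚᵘ.+ toℚᵘ (ιℤ j)       ≈⟨ toℚᵘ-homo-+ (ιℤ i) (ιℤ j) ⟨
      toℚᵘ (ιℤ i + ιℤ j)                 ∎)
      where open ℚᵘ.≃-Reasoning

    ιℤ-* : ∀ i j → ιℤ (i ℤ.* j) ≡ ιℤ i * ιℤ j
    ιℤ-* i j = toℚᵘ-injective (begin
      toℚᵘ (ιℤ (i ℤ.* j))                ≈⟨ toℚᵘ-ιℤ (i ℤ.* j) ⟩
      ℚᵘ.mkℚᵘ i 0 ℚᵘ.* ℚᵘ.mkℚᵘ j 0       ≈⟨ ℚᵘ.*-cong (toℚᵘ-ιℤ i) (toℚᵘ-ιℤ j) ⟨
      toℚᵘ (ιℤ i) ℚᵘ.* toℚᵘ (ιℤ j)       ≈⟨ toℚᵘ-homo-* (ιℤ i) (ιℤ j) ⟨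
      toℚᵘ (ιℤ i * ιℤ j)                 ∎)
      where open ℚᵘ.≃-Reasoning

    ιℤ-abs : ∀ i → ιℤ (pos ℤ.∣ i ∣) ≡ ∣ ιℤ i ∣
    ιℤ-abs i = toℚᵘ-injective (begin
      toℚᵘ (ιℤ (pos ℤ.∣ i ∣))     ≈⟨ toℚᵘ-ιℤ (pos ℤ.∣ i ∣) ⟩
      ℚᵘ.∣ ℚᵘ.mkℚᵘ i 0 ∣        ≈⟨ ℚᵘ.∣-∣-cong (toℚᵘ-ιℤ i) ⟨
      ℚᵘ.∣ toℚᵘ (ιℤ i) ∣        ≈⟨ toℚᵘ-homo-∣-∣ (ιℤ i) ⟨
      toℚᵘ ∣ ιℤ i ∣             ∎)
      where open ℚᵘ.≃-Reasoning

    ιℤ-mono : ∀ {i j} → i ℤ.≤ j → ιℤ i ≤ ιℤ j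
    ιℤ-mono {i} {j} h = toℚᵘ-cancel-≤
      (ℚᵘ.≤-respˡ-≃ (ℚᵘ.≃-sym (toℚᵘ-ιℤ i)) (ℚᵘ.≤-respʳ-≃ (ℚᵘ.≃-sym (toℚᵘ-ιℤ j))
        (ℚᵘ.*≤* (subst₂ ℤ._≤_ (sym (ℤ.*-identityʳ i)) (sym (ℤ.*-identityʳ j)) h))))

    ιℤ-cancel : ∀ {i j} → ιℤ i ≤ ιℤ j → i ℤ.≤ j
    ιℤ-cancel {i} {j} h with ℚᵘ.≤-respˡ-≃ (toℚᵘ-ιℤ i) (ℚᵘ.≤-respʳ-≃ (toℚᵘ-ιℤ j) (toℚᵘ-mono-≤ h))
    ... | ℚᵘ.*≤* h′ = subst₂ ℤ._≤_ (ℤ.*-identityʳ i) (ℤ.*-identityʳ j) h′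

  ι : ℕ → ℚ
  ι n = ιℤ (pos n)

  ι-+ : ∀ m n → ι (m ℕ.+ n) ≡ ι m + ι n
  ι-+ m n = ιℤ-+ (pos m) (pos n)

  ι-suc : ∀ n → ι (suc n) ≡ 1ℚ + ι n
  ι-suc n = trans (ι-+ 1 n) (cong (_+ ι n) ιℤ-1)

  ι-* : ∀ m n → ι (m ℕ.* n) ≡ ι m * ι n
  ι-* m n = trans (cong ιℤ (ℤ.pos-* m n)) (ιℤ-* (pos m) (pos n))

  ι-^ : ∀ m n → ι (m ℕ.^ n) ≡ ι m ^ n
  ι-^ m zero    = ιℤ-1
  ι-^ m (suc n) = trans (ι-* m (m ℕ.^ n)) (cong (ι m *_) (ι-^ m n))

  ι-mono : ∀ {m n} → m ℕ.≤ n → ι m ≤ ι n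
  ι-mono h = ιℤ-mono (ℤ.+≤+ h)

  ι-cancel : ∀ {m n} → ι m ≤ ι n → m ℕ.≤ n
  ι-cancel {m} {n} h with ιℤ-cancel {pos m} {pos n} h
  ... | ℤ.+≤+ h′ = h′

  0≤ι : ∀ n → 0ℚ ≤ ι n
  0≤ι n = subst (_≤ ι n) ιℤ-0 (ι-mono {0} {n} ℕ.z≤n)

  1≤ιsuc : ∀ n → 1ℚ ≤ ι (suc n)
  1≤ιsuc n = subst (_≤ ι (suc n)) ιℤ-1 (ι-mono {1} {suc n} (ℕ.s≤s ℕ.z≤n))

  0<ιsuc : ∀ n → 0ℚ < ι (suc n)
  0<ιsuc n = <-≤-trans (positive⁻¹ 1ℚ) (1≤ιsuc n)

  abstract
    *-/-cancel : ∀ i n .{{_ : ℕ.NonZero n}} → ι n * (i / n) ≡ ιℤ i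
    *-/-cancel i n@(suc n-1) = toℚᵘ-injective (begin
      toℚᵘ (ι n * (i / n))                       ≈⟨ toℚᵘ-homo-* (ι n) (i / n) ⟩
      toℚᵘ (ι n) ℚᵘ.* toℚᵘ (i / n)               ≈⟨ ℚᵘ.*-cong (toℚᵘ-ιℤ (pos n)) (toℚᵘ-fromℚᵘ (ℚᵘ.mkℚᵘ i n-1)) ⟩
      ℚᵘ.mkℚᵘ (pos n) 0 ℚᵘ.* ℚᵘ.mkℚᵘ i n-1          ≈⟨ ℚᵘ.*≡* (trans (ℤ.*-identityʳ _) (trans (ℤ.*-comm (pos n) i) (cong (i ℤ.*_) (cong pos (sym (ℕ.*-identityˡ n)))))) ⟩
      ℚᵘ.mkℚᵘ i 0                                ≈⟨ toℚᵘ-ιℤ i ⟨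
      toℚᵘ (ιℤ i)                                ∎)
      where open ℚᵘ.≃-Reasoning

    τ : ℕ → ℚ
    τ N = pos 1 / suc N

    ι*τ : ∀ N → ι (suc N) * τ N ≡ 1ℚ
    ι*τ N = trans (*-/-cancel (pos 1) (suc N)) ιℤ-1

    τ0 : τ 0 ≡ 1ℚ
    τ0 = refl

    τ-/ : ∀ N → τ N ≡ pos 1 / suc N
    τ-/ N = refl

    0<τ : ∀ N → 0ℚ < τ N
    0<τ N = positive⁻¹ (τ N) {{normalize-pos 1 (suc N)}}

  0≤τ : ∀ N → 0ℚ ≤ τ N
  0≤τ N = <⇒≤ (0<τ N)

  τ≤1 : ∀ N → τ N ≤ 1ℚ
  τ≤1 N = subst₂ _≤_ (*-identityˡ (τ N)) (ι*τ N) (*-monoʳ (0≤τ N) (1≤ιsuc N))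

  -- Finitely supported probability measures.
  data Mean (A : Set) : Set where
    dirac : A → Mean A
    mix   : (w : ℚ) → 0ℚ ≤ w → w ≤ 1ℚ → Mean A → Mean A → Mean A

  E : Mean A → (A → ℚ) → ℚ
  E (dirac a)       g = g a
  E (mix w _ _ M N) g = w * E M g + (1ℚ - w) * E N g

  E-cong : ∀ (M : Mean A) {f g} → (∀ x → f x ≡ g x) → E M f ≡ E M g
  E-cong (dirac a)       h = h a
  E-cong (mix w _ _ M N) h = cong₂ (λ x y → w * x + (1ℚ - w) * y) (E-cong M h) (E-cong N h)

  E-mono : ∀ (M : Mean A) {f g} → (∀ x → f x ≤ g x) → E M f ≤ E M g
  E-mono (dirac a)           h = h a
  E-mono (mix w 0≤w w≤1 M N) h =
    +-mono-≤ (*-monoˡ 0≤w (E-mono M h)) (*-monoˡ (0≤-diff w≤1) (E-mono N h))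

  E-+ : ∀ (M : Mean A) f g → E M (λ x → f x + g x) ≡ E M f + E M g
  E-+ (dirac a)       f g = refl
  E-+ (mix w _ _ M N) f g =
    trans (cong₂ (λ x y → w * x + (1ℚ - w) * y) (E-+ M f g) (E-+ N f g))
          (lem w (E M f) (E M g) (E N f) (E N g))
    where
    lem : ∀ w a b c d → w * (a + b) + (1ℚ - w) * (c + d) ≡ w * a + (1ℚ - w) * c + (w * b + (1ℚ - w) * d)
    lem = solve-∀ ℚ-ring

  E-*ˡ : ∀ (M : Mean A) c f → E M (λ x → c * f x) ≡ c * E M f
  E-*ˡ (dirac a)       c f = refl
  E-*ˡ (mix w _ _ M N) c f =
    trans (cong₂ (λ x y → w * x + (1ℚ - w) * y) (E-*ˡ M c f) (E-*ˡ N c f))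
          (lem w c (E M f) (E N f))
    where
    lem : ∀ w c a b → w * (c * a) + (1ℚ - w) * (c * b) ≡ c * (w * a + (1ℚ - w) * b)
    lem = solve-∀ ℚ-ring

  E-*ʳ : ∀ (M : Mean A) c f → E M (λ x → f x * c) ≡ E M f * c
  E-*ʳ M c f = trans (E-cong M (λ x → *-comm (f x) c)) (trans (E-*ˡ M c f) (*-comm c _))

  E-const : ∀ (M : Mean A) c → E M (λ _ → c) ≡ c
  E-const (dirac a)       c = refl
  E-const (mix w _ _ M N) c =
    trans (cong₂ (λ x y → w * x + (1ℚ - w) * y) (E-const M c) (E-const N c)) (lem w c)
    where
    lem : ∀ w c → w * c + (1ℚ - w) * c ≡ c
    lem = solve-∀ ℚ-ring

  E-neg : ∀ (M : Mean A) f → E M (λ x → - f x) ≡ - E M f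
  E-neg M f = trans (E-cong M (λ x → lem (f x))) (trans (E-*ˡ M (- 1ℚ) f) (sym (lem (E M f))))
    where
    lem : ∀ x → - x ≡ (- 1ℚ) * x
    lem = solve-∀ ℚ-ring

  E-- : ∀ (M : Mean A) f g → E M (λ x → f x - g x) ≡ E M f - E M g
  E-- M f g = trans (E-+ M f (λ x → - g x)) (cong (E M f +_) (E-neg M g))

  E-nonneg : ∀ (M : Mean A) {f} → (∀ x → 0ℚ ≤ f x) → 0ℚ ≤ E M f
  E-nonneg M {f} h = subst (_≤ E M f) (E-const M 0ℚ) (E-mono M h)

  E-zero : ∀ (M : Mean A) {f} → (∀ x → f x ≡ 0ℚ) → E M f ≡ 0ℚ
  E-zero M h = trans (E-cong M h) (E-const M 0ℚ)

  E-≤const : ∀ (M : Mean A) {f c} → (∀ x → f x ≤ c) → E M f ≤ c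
  E-≤const M {f} {c} h = subst (E M f ≤_) (E-const M c) (E-mono M h)

  E-swap : ∀ (M : Mean A) (N : Mean B) (f : A → B → ℚ) →
           E M (λ x → E N (f x)) ≡ E N (λ y → E M (λ x → f x y))
  E-swap (dirac a)       N f = refl
  E-swap (mix w _ _ M M′) N f = trans
    (cong₂ (λ x y → w * x + (1ℚ - w) * y) (E-swap M N f) (E-swap M′ N f))
    (sym (trans (E-+ N (λ y → w * E M (λ x → f x y)) (λ y → (1ℚ - w) * E M′ (λ x → f x y)))
                (cong₂ _+_ (E-*ˡ N w _) (E-*ˡ N (1ℚ - w) _))))

  bind : Mean A → (A → Mean B) → Mean B
  bind (dirac a)       k = k a
  bind (mix w p q M N) k = mix w p q (bind M k) (bind N k)

  E-bind : ∀ (M : Mean A) (k : A → Mean B) g → E (bind M k) g ≡ E M (λ x → E (k x) g)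
  E-bind (dirac a)       k g = refl
  E-bind (mix w _ _ M N) k g = cong₂ (λ x y → w * x + (1ℚ - w) * y) (E-bind M k g) (E-bind N k g)

  -- For facts such as the length of a random stream, which hold for all outcomes but not for all
  -- elements of the type.
  Supp : (A → Set) → Mean A → Set
  Supp P (dirac a)       = P a
  Supp P (mix _ _ _ M N) = Supp P M × Supp P N

  supp-bind : ∀ {P : B → Set} {Q : A → Set} (M : Mean A) {k : A → Mean B} →
              Supp Q M → (∀ {a} → Q a → Supp P (k a)) → Supp P (bind M k)
  supp-bind (dirac a)       q       h = h q
  supp-bind (mix _ _ _ M N) (p , q) h = supp-bind M p h , supp-bind N q h

  supp-all : ∀ {P : A → Set} (M : Mean A) → (∀ a → P a) → Supp P M
  supp-all (dirac a)       h = h a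
  supp-all (mix _ _ _ M N) h = supp-all M h , supp-all N h

  E-mono-supp : ∀ (M : Mean A) {f g} → Supp (λ a → f a ≤ g a) M → E M f ≤ E M g
  E-mono-supp (dirac a)           h       = h
  E-mono-supp (mix w 0≤w w≤1 M N) (p , q) =
    +-mono-≤ (*-monoˡ 0≤w (E-mono-supp M p)) (*-monoˡ (0≤-diff w≤1) (E-mono-supp N q))

  supp-map : ∀ {P Q : A → Set} (M : Mean A) → (∀ {a} → P a → Q a) → Supp P M → Supp Q M
  supp-map (dirac a)       h p       = h p
  supp-map (mix _ _ _ M N) h (p , q) = supp-map M h p , supp-map N h q

  mapM : (A → B) → Mean A → Mean B
  mapM h M = bind M (dirac ∘ h)

  E-map : ∀ (h : A → B) (M : Mean A) g → E (mapM h M) g ≡ E M (g ∘ h)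
  E-map h M g = E-bind M (dirac ∘ h) g

  unif : ∀ N → Mean (Fin (suc N))
  unif zero    = dirac zero
  unif (suc N) = mix (τ (suc N)) (0≤τ (suc N)) (τ≤1 (suc N)) (dirac zero) (mapM suc (unif N))

  private
    -- The reason why the recursive definition of `unif` gives every point the same mass.
    τ-step : ∀ N → (1ℚ - τ (suc N)) * τ N ≡ τ (suc N)
    τ-step N = begin
      (1ℚ - t) * τ N                       ≡⟨ cong (λ x → (x - t) * τ N) (sym (ι*τ (suc N))) ⟩
      (ι (suc (suc N)) * t - t) * τ N      ≡⟨ cong (λ x → (x * t - t) * τ N) (ι-suc (suc N)) ⟩
      ((1ℚ + ι (suc N)) * t - t) * τ N     ≡⟨ lem (ι (suc N)) t (τ N) ⟩
      t * (ι (suc N) * τ N)                ≡⟨ cong (t *_) (ι*τ N) ⟩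
      t * 1ℚ                               ≡⟨ *-identityʳ t ⟩
      t ∎
      where
      open ≡-Reasoning
      t = τ (suc N)
      lem : ∀ i t u → ((1ℚ + i) * t - t) * u ≡ t * (i * u)
      lem = solve-∀ ℚ-ring

  -- Measures what flipping a single sign does to a normalised linear form.
  E-unif-change : ∀ N (g h : Fin (suc N) → ℚ) a → (∀ b → b ≢ a → h b ≡ g b) →
                  E (unif N) h ≡ E (unif N) g + τ N * (h a - g a)
  E-unif-change zero    g h zero eq = trans (lem (g zero) (h zero)) (cong (λ t → g zero + t * (h zero - g zero)) (sym τ0))
    where
    lem : ∀ x y → y ≡ x + 1ℚ * (y - x)
    lem = solve-∀ ℚ-ring
  E-unif-change (suc N) g h zero eq =
    trans (cong (λ x → t * h zero + (1ℚ - t) * x)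
            (trans (E-map suc (unif N) h)
              (trans (E-cong (unif N) (λ b → eq (suc b) (λ ()))) (sym (E-map suc (unif N) g)))))
          (lem t (h zero) (g zero) (E (mapM suc (unif N)) g))
    where
    t = τ (suc N)
    lem : ∀ t h g x → t * h + (1ℚ - t) * x ≡ t * g + (1ℚ - t) * x + t * (h - g)
    lem = solve-∀ ℚ-ring
  E-unif-change (suc N) g h (suc a) eq = begin
    t * h zero + (1ℚ - t) * E (mapM suc (unif N)) h
      ≡⟨ cong₂ (λ x y → t * x + (1ℚ - t) * y) (eq zero (λ ()))
           (trans (E-map suc (unif N) h)
             (E-unif-change N (g ∘ suc) (h ∘ suc) a (λ b b≢a → eq (suc b) (b≢a ∘ Fin.suc-injective)))) ⟩
    t * g zero + (1ℚ - t) * (E (unif N) (g ∘ suc) + τ N * (h (suc a) - g (suc a)))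
      ≡⟨ lem t (g zero) (E (unif N) (g ∘ suc)) (τ N) (h (suc a) - g (suc a)) ⟩
    t * g zero + (1ℚ - t) * E (unif N) (g ∘ suc) + (1ℚ - t) * τ N * (h (suc a) - g (suc a))
      ≡⟨ cong₂ (λ x y → t * g zero + (1ℚ - t) * x + y * (h (suc a) - g (suc a)))
           (sym (E-map suc (unif N) g)) (τ-step N) ⟩
    E (unif (suc N)) g + t * (h (suc a) - g (suc a)) ∎
    where
    open ≡-Reasoning
    t = τ (suc N)
    lem : ∀ t g e u d → t * g + (1ℚ - t) * (e + u * d) ≡ t * g + (1ℚ - t) * e + (1ℚ - t) * u * d
    lem = solve-∀ ℚ-ring

  prodM : ∀ {n} → Vec (Mean A) n → Mean (Vec A n)
  prodM []       = dirac []
  prodM (M ∷ Ms) = bind M λ x → mapM (x ∷_) (prodM Ms)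

  E-prod : ∀ {n} (M : Mean A) (Ms : Vec (Mean A) n) g →
           E (prodM (M ∷ Ms)) g ≡ E M (λ x → E (prodM Ms) (λ xs → g (x ∷ xs)))
  E-prod M Ms g = trans (E-bind M _ g) (E-cong M (λ x → E-map (x ∷_) (prodM Ms) g))

  ∑ : List A → (A → ℚ) → ℚ
  ∑ []       g = 0ℚ
  ∑ (x ∷ xs) g = g x + ∑ xs g

  ∑-cong : ∀ (xs : List A) {f g} → (∀ x → f x ≡ g x) → ∑ xs f ≡ ∑ xs g
  ∑-cong []       h = refl
  ∑-cong (x ∷ xs) h = cong₂ _+_ (h x) (∑-cong xs h)

  ∑-mono : ∀ (xs : List A) {f g} → (∀ x → f x ≤ g x) → ∑ xs f ≤ ∑ xs g
  ∑-mono []       h = ≤-refl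
  ∑-mono (x ∷ xs) h = +-mono-≤ (h x) (∑-mono xs h)

  ∑-+ : ∀ (xs : List A) f g → ∑ xs (λ x → f x + g x) ≡ ∑ xs f + ∑ xs g
  ∑-+ []       f g = refl
  ∑-+ (x ∷ xs) f g = trans (cong (f x + g x +_) (∑-+ xs f g)) (lem (f x) (g x) (∑ xs f) (∑ xs g))
    where
    lem : ∀ a b c d → a + b + (c + d) ≡ a + c + (b + d)
    lem = solve-∀ ℚ-ring

  ∑-*ˡ : ∀ (xs : List A) c f → ∑ xs (λ x → c * f x) ≡ c * ∑ xs f
  ∑-*ˡ []       c f = sym (*-zeroʳ c)
  ∑-*ˡ (x ∷ xs) c f = trans (cong (c * f x +_) (∑-*ˡ xs c f)) (sym (*-distribˡ-+ c (f x) (∑ xs f)))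

  ∑-zero : ∀ (xs : List A) {f} → (∀ x → f x ≡ 0ℚ) → ∑ xs f ≡ 0ℚ
  ∑-zero []       h = refl
  ∑-zero (x ∷ xs) h = cong₂ _+_ (h x) (∑-zero xs h)

  ∑-nonneg : ∀ (xs : List A) {f} → (∀ x → 0ℚ ≤ f x) → 0ℚ ≤ ∑ xs f
  ∑-nonneg xs {f} h = subst (_≤ ∑ xs f) (∑-zero xs (λ _ → refl)) (∑-mono xs h)

  ∑-++ : ∀ (xs ys : List A) f → ∑ (xs List.++ ys) f ≡ ∑ xs f + ∑ ys f
  ∑-++ []       ys f = sym (+-identityˡ _)
  ∑-++ (x ∷ xs) ys f = trans (cong (f x +_) (∑-++ xs ys f)) (sym (+-assoc (f x) (∑ xs f) (∑ ys f)))

  ∑-map : ∀ (h : A → B) xs f → ∑ (List.map h xs) f ≡ ∑ xs (f ∘ h)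
  ∑-map h []       f = refl
  ∑-map h (x ∷ xs) f = cong (f (h x) +_) (∑-map h xs f)

  E-∑ : ∀ (M : Mean A) (ys : List B) (f : A → B → ℚ) →
        E M (λ x → ∑ ys (f x)) ≡ ∑ ys (λ y → E M (λ x → f x y))
  E-∑ M []       f = E-const M 0ℚ
  E-∑ M (y ∷ ys) f = trans (E-+ M (λ x → f x y) (λ x → ∑ ys (f x))) (cong (E M (λ x → f x y) +_) (E-∑ M ys f))

  ∑-swap : ∀ (xs : List A) (ys : List B) (f : A → B → ℚ) →
           ∑ xs (λ x → ∑ ys (f x)) ≡ ∑ ys (λ y → ∑ xs (λ x → f x y))
  ∑-swap []       ys f = sym (∑-zero ys (λ _ → refl))
  ∑-swap (x ∷ xs) ys f = trans (cong (∑ ys (f x) +_) (∑-swap xs ys f)) (sym (∑-+ ys (f x) (λ y → ∑ xs (λ x → f x y))))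

-- Moments of forms in random signs

module CubeMoments where

  open FiniteMeans

  sg : Sign → ℚ
  sg Sign.+ = 1ℚ
  sg Sign.- = - 1ℚ

  sg-sq : ∀ s → sg s * sg s ≡ 1ℚ
  sg-sq Sign.+ = refl
  sg-sq Sign.- = refl

  sg-* : ∀ s t → sg (s Sign.* t) ≡ sg s * sg t
  sg-* Sign.+ t      = sym (*-identityˡ (sg t))
  sg-* Sign.- Sign.+ = refl
  sg-* Sign.- Sign.- = refl

  sg-opposite : ∀ s → sg (opposite s) ≡ - sg s
  sg-opposite Sign.+ = refl
  sg-opposite Sign.- = refl

  abstract
    cubeM : ∀ n → Mean (Vec Sign n)
    cubeM zero    = dirac []
    cubeM (suc n) = mix ½ 0≤½ ½≤1 (mapM (Sign.+ ∷_) (cubeM n)) (mapM (Sign.- ∷_) (cubeM n))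

    E-cube-zero : ∀ g → E (cubeM 0) g ≡ g []
    E-cube-zero g = refl

    E-cube-suc : ∀ n g → E (cubeM (suc n)) g ≡
                 ½ * E (cubeM n) (λ σ → g (Sign.+ ∷ σ)) + ½ * E (cubeM n) (λ σ → g (Sign.- ∷ σ))
    E-cube-suc n g = cong₂ (λ x y → ½ * x + ½ * y) (E-map (Sign.+ ∷_) (cubeM n) g) (E-map (Sign.- ∷_) (cubeM n) g)

  flip : ∀ {n} → Fin n → Vec Sign n → Vec Sign n
  flip i σ = updateAt σ i opposite

  E-flip : ∀ {n} (i : Fin n) g → E (cubeM n) (λ σ → g (flip i σ)) ≡ E (cubeM n) g
  E-flip {suc n} zero g = trans (E-cube-suc n (g ∘ flip zero))
    (trans (+-comm (½ * E (cubeM n) (λ σ → g (Sign.- ∷ σ))) _) (sym (E-cube-suc n g)))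
  E-flip {suc n} (suc i) g = trans (E-cube-suc n (g ∘ flip (suc i)))
    (trans (cong₂ (λ x y → ½ * x + ½ * y) (E-flip i (λ σ → g (Sign.+ ∷ σ))) (E-flip i (λ σ → g (Sign.- ∷ σ))))
      (sym (E-cube-suc n g)))

  sg-flip : ∀ {n} (i : Fin n) σ → sg (lookup (flip i σ) i) ≡ - sg (lookup σ i)
  sg-flip i σ = trans (cong sg (Vec.lookup∘updateAt i σ)) (sg-opposite (lookup σ i))

  lookup-flip : ∀ {n} {i j : Fin n} → j ≢ i → ∀ σ → lookup (flip i σ) j ≡ lookup σ j
  lookup-flip {i = i} {j} j≢i σ = Vec.lookup∘updateAt′ j i j≢i σ

  two four : ℚ
  two  = 1ℚ + 1ℚ
  four = two * two

  0≤two : 0ℚ ≤ two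
  0≤two = nonNegative⁻¹ two

  0≤four : 0ℚ ≤ four
  0≤four = nonNegative⁻¹ four

  -- The arithmetic-geometric mean inequality for `a ^ suc p` and `p` copies of `b ^ suc p`, without
  -- roots. By induction: the gap for `suc p` is `a` times the gap for `p` plus `suc p` copies of
  -- `b ^ p * (a - b)²`.
  young : ∀ {a b} p → 0ℚ ≤ a → 0ℚ ≤ b → ι (suc p) * (a * b ^ p) ≤ a ^ suc p + ι p * b ^ suc p
  young {a} {b} p 0≤a 0≤b = diff-0≤ (subst (0ℚ ≤_) (cong (λ x → a ^ suc p + ι p * b ^ suc p - x * (a * b ^ p)) (sym (ι-suc p))) (gap p))
    where
    gap : ∀ p → 0ℚ ≤ a ^ suc p + ι p * b ^ suc p - (1ℚ + ι p) * (a * b ^ p)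
    gap zero = subst (0ℚ ≤_) (trans (lem a b) (cong (λ x → a ^ 1 + x * b ^ 1 - (1ℚ + x) * (a * b ^ 0)) (sym ιℤ-0))) ≤-refl
      where
      lem : ∀ a b → 0ℚ ≡ a * 1ℚ + 0ℚ * (b * 1ℚ) - (1ℚ + 0ℚ) * (a * 1ℚ)
      lem = solve-∀ ℚ-ring
    gap (suc p) = subst (0ℚ ≤_) (trans (lem a b (a ^ p) (b ^ p) (ι p))
        (cong (λ x → a ^ suc (suc p) + x * b ^ suc (suc p) - (1ℚ + x) * (a * b ^ suc p)) (sym (ι-suc p))))
      (0≤+ (0≤* 0≤a (gap p)) (0≤* (0≤* (0≤+ 0≤1 (0≤ι p)) (^-nonneg p 0≤b)) (0≤sq (a - b))))
      where
      lem : ∀ a b x y i → a * (a * x + i * (b * y) - (1ℚ + i) * (a * y)) + (1ℚ + i) * y * ((a - b) * (a - b))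
          ≡ a * (a * x) + (1ℚ + i) * (b * (b * y)) - (1ℚ + (1ℚ + i)) * (a * (b * y))
      lem = solve-∀ ℚ-ring

  private
    -- The polynomial `(X ^ p - Y ^ p) / (X - Y)`.
    S : ℕ → ℚ → ℚ → ℚ
    S zero    X Y = 0ℚ
    S (suc p) X Y = X * S p X Y + Y ^ p

    S-diff : ∀ p X Y → X ^ p - Y ^ p ≡ (X - Y) * S p X Y
    S-diff zero    X Y = lem X Y
      where
      lem : ∀ X Y → 1ℚ - 1ℚ ≡ (X - Y) * 0ℚ
      lem = solve-∀ ℚ-ring
    S-diff (suc p) X Y = trans (lem₁ X Y (X ^ p) (Y ^ p))
      (trans (cong (λ z → X * z + (X - Y) * Y ^ p) (S-diff p X Y)) (lem₂ X Y (S p X Y) (Y ^ p)))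
      where
      lem₁ : ∀ X Y x y → X * x - Y * y ≡ X * (x - y) + (X - Y) * y
      lem₁ = solve-∀ ℚ-ring
      lem₂ : ∀ X Y s y → X * ((X - Y) * s) + (X - Y) * y ≡ (X - Y) * (X * s + y)
      lem₂ = solve-∀ ℚ-ring

    S-nonneg : ∀ p {X Y} → 0ℚ ≤ X → 0ℚ ≤ Y → 0ℚ ≤ S p X Y
    S-nonneg zero    _ _ = ≤-refl
    S-nonneg (suc p) h k = 0≤+ (0≤* h (S-nonneg p h k)) (^-nonneg p k)

    S-max : ∀ p {X Y m} → 0ℚ ≤ X → 0ℚ ≤ Y → X ≤ m → Y ≤ m → S p X Y * m ≤ ι p * m ^ p
    S-max zero    {m = m} 0≤X 0≤Y X≤m Y≤m = ≤-reflexive (trans (*-zeroˡ m) (sym (trans (cong (_* 1ℚ) ιℤ-0) (*-zeroˡ 1ℚ))))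
    S-max (suc p) {X} {Y} {m} 0≤X 0≤Y X≤m Y≤m = begin
      (X * S p X Y + Y ^ p) * m             ≡⟨ lem₁ X (S p X Y) (Y ^ p) m ⟩
      X * (S p X Y * m) + m * Y ^ p         ≤⟨ +-mono-≤
                                                 (*-mono 0≤X (0≤* (S-nonneg p 0≤X 0≤Y) 0≤m) X≤m (S-max p 0≤X 0≤Y X≤m Y≤m))
                                                 (*-monoˡ 0≤m (^-mono p 0≤Y Y≤m)) ⟩
      m * (ι p * m ^ p) + m * m ^ p         ≡⟨ lem₂ m (ι p) (m ^ p) ⟩
      (1ℚ + ι p) * (m * m ^ p)              ≡⟨ cong (_* m ^ suc p) (ι-suc p) ⟨
      ι (suc p) * m ^ suc p ∎
      where
      open ≤-Reasoning
      0≤m = ≤-trans 0≤X X≤m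
      lem₁ : ∀ X s y m → (X * s + y) * m ≡ X * (s * m) + m * y
      lem₁ = solve-∀ ℚ-ring
      lem₂ : ∀ m i y → m * (i * y) + m * y ≡ (1ℚ + i) * (m * y)
      lem₂ = solve-∀ ℚ-ring

    S-sum : ∀ p {X Y} → 0ℚ ≤ X → 0ℚ ≤ Y → (X + Y) * S p X Y ≤ two * ι p * (X ^ p + Y ^ p)
    S-sum p {X} {Y} 0≤X 0≤Y with ≤-total X Y
    ... | inj₁ X≤Y = begin
      (X + Y) * S p X Y             ≤⟨ *-monoʳ (S-nonneg p 0≤X 0≤Y) (+-monoˡ-≤ Y X≤Y) ⟩
      (Y + Y) * S p X Y             ≡⟨ lem Y (S p X Y) ⟩
      two * (S p X Y * Y)           ≤⟨ *-monoˡ 0≤two (S-max p 0≤X 0≤Y X≤Y ≤-refl) ⟩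
      two * (ι p * Y ^ p)           ≤⟨ *-monoˡ 0≤two (*-monoˡ (0≤ι p) (≤-by (^-nonneg p 0≤X) (+-comm (X ^ p) (Y ^ p)))) ⟩
      two * (ι p * (X ^ p + Y ^ p)) ≡⟨ *-assoc two (ι p) _ ⟨
      two * ι p * (X ^ p + Y ^ p) ∎
      where
      open ≤-Reasoning
      lem : ∀ y s → (y + y) * s ≡ two * (s * y)
      lem = solve-∀ ℚ-ring
    ... | inj₂ Y≤X = begin
      (X + Y) * S p X Y             ≤⟨ *-monoʳ (S-nonneg p 0≤X 0≤Y) (+-monoʳ-≤ X Y≤X) ⟩
      (X + X) * S p X Y             ≡⟨ lem X (S p X Y) ⟩
      two * (S p X Y * X)           ≤⟨ *-monoˡ 0≤two (S-max p 0≤X 0≤Y ≤-refl Y≤X) ⟩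
      two * (ι p * X ^ p)           ≤⟨ *-monoˡ 0≤two (*-monoˡ (0≤ι p) (≤-by (^-nonneg p 0≤Y) refl)) ⟩
      two * (ι p * (X ^ p + Y ^ p)) ≡⟨ *-assoc two (ι p) _ ⟨
      two * ι p * (X ^ p + Y ^ p) ∎
      where
      open ≤-Reasoning
      lem : ∀ y s → (y + y) * s ≡ two * (s * y)
      lem = solve-∀ ℚ-ring

  -- A discrete mean value theorem for the power `2p + 1`, with `1 + 4p` in place of the factor
  -- `2p + 1` of the derivative. Symmetrising in `x` and `y` extracts the factor `x - y = 2tw`,
  -- whose product with `w` is `2tw²`, so the signs of `x`, `y` and `w` do not matter.
  odd-power-gap : ∀ p {x y w t} → 0ℚ ≤ t → x - y ≡ t * (w + w) →
    w * (x * (x * x) ^ p - y * (y * y) ^ p) ≤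
    t * (1ℚ + four * ι p) * (w * w * ((x * x) ^ p + (y * y) ^ p))
  odd-power-gap p {x} {y} {w} {t} 0≤t eq = begin
    w * (x * X ^ p - y * Y ^ p)
      ≡⟨ lem₁ w x y (X ^ p) (Y ^ p) ⟩
    ½ * w * ((x - y) * (X ^ p + Y ^ p) + (x + y) * (X ^ p - Y ^ p))
      ≡⟨ cong (λ z → ½ * w * ((x - y) * (X ^ p + Y ^ p) + (x + y) * z)) (S-diff p X Y) ⟩
    ½ * w * ((x - y) * (X ^ p + Y ^ p) + (x + y) * ((X - Y) * S p X Y))
      ≡⟨ lem₂ w x y (X ^ p + Y ^ p) (S p X Y) ⟩
    ½ * w * ((x - y) * (X ^ p + Y ^ p + (x + y) * (x + y) * S p X Y))
      ≡⟨ cong (λ z → ½ * w * (z * (X ^ p + Y ^ p + (x + y) * (x + y) * S p X Y))) eq ⟩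
    ½ * w * (t * (w + w) * (X ^ p + Y ^ p + (x + y) * (x + y) * S p X Y))
      ≡⟨ lem₃ w t (X ^ p + Y ^ p) ((x + y) * (x + y) * S p X Y) ⟩
    t * (w * w) * (X ^ p + Y ^ p + (x + y) * (x + y) * S p X Y)
      ≤⟨ *-monoˡ (0≤* 0≤t (0≤sq w)) (+-monoʳ-≤ (X ^ p + Y ^ p) bound) ⟩
    t * (w * w) * (X ^ p + Y ^ p + four * ι p * (X ^ p + Y ^ p))
      ≡⟨ lem₄ t (w * w) (X ^ p + Y ^ p) (ι p) ⟩
    t * (1ℚ + four * ι p) * (w * w * (X ^ p + Y ^ p)) ∎
    where
    open ≤-Reasoning
    X = x * x
    Y = y * y
    lem₁ : ∀ w x y a b → w * (x * a - y * b) ≡ ½ * w * ((x - y) * (a + b) + (x + y) * (a - b))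
    lem₁ = solve-∀ ℚ-ring
    lem₂ : ∀ w x y a s → ½ * w * ((x - y) * a + (x + y) * ((x * x - y * y) * s)) ≡ ½ * w * ((x - y) * (a + (x + y) * (x + y) * s))
    lem₂ = solve-∀ ℚ-ring
    lem₃ : ∀ w t a s → ½ * w * (t * (w + w) * (a + s)) ≡ t * (w * w) * (a + s)
    lem₃ = solve-∀ ℚ-ring
    lem₄ : ∀ t w a i → t * w * (a + four * i * a) ≡ t * (1ℚ + four * i) * (w * a)
    lem₄ = solve-∀ ℚ-ring
    lem₅ : ∀ x y → two * (x * x + y * y) ≡ (x + y) * (x + y) + (x - y) * (x - y)
    lem₅ = solve-∀ ℚ-ring
    lem₆ : ∀ i a → two * (two * i * a) ≡ four * i * a
    lem₆ = solve-∀ ℚ-ring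
    bound : (x + y) * (x + y) * S p X Y ≤ four * ι p * (X ^ p + Y ^ p)
    bound = begin
      (x + y) * (x + y) * S p X Y         ≤⟨ *-monoʳ {p = (x + y) * (x + y)} (S-nonneg p (0≤sq x) (0≤sq y)) (≤-by {(x + y) * (x + y)} (0≤sq (x - y)) (lem₅ x y)) ⟩
      two * (X + Y) * S p X Y             ≡⟨ *-assoc two (X + Y) (S p X Y) ⟩
      two * ((X + Y) * S p X Y)           ≤⟨ *-monoˡ 0≤two (S-sum p (0≤sq x) (0≤sq y)) ⟩
      two * (two * ι p * (X ^ p + Y ^ p)) ≡⟨ lem₆ (ι p) (X ^ p + Y ^ p) ⟩
      four * ι p * (X ^ p + Y ^ p) ∎

  -- Integration by parts on the cube bounds E Q²ᵖ⁺² by E D Q²ᵖ up to a constant; Young's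
  -- inequality then absorbs the power of Q on the right.
  module Moments {n} {A : Set} (M : Mean A) (ix : A → Fin n) (v : A → Vec Sign n → ℚ)
                 {t : ℚ} (0≤t : 0ℚ ≤ t) where

    form : Vec Sign n → ℚ
    form σ = E M λ a → sg (lookup σ (ix a)) * v a σ

    module _ (v-flip : ∀ a σ → v a (flip (ix a) σ) ≡ v a σ)
             (form-flip : ∀ a σ → form σ - form (flip (ix a) σ) ≡
                          t * (sg (lookup σ (ix a)) * v a σ + sg (lookup σ (ix a)) * v a σ)) where

      private
        D P : Vec Sign n → ℚ
        D σ = E M λ a → v a σ * v a σ
        P σ = form σ * form σ

        W : A → Vec Sign n → ℚ
        W a σ = sg (lookup σ (ix a)) * v a σ

        W-flip : ∀ a σ → W a (flip (ix a) σ) ≡ - W a σ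
        W-flip a σ = trans (cong₂ _*_ (sg-flip (ix a) σ) (v-flip a σ)) (sym (neg-distribˡ-* (sg (lookup σ (ix a))) (v a σ)))

        W² : ∀ a σ → W a σ * W a σ ≡ v a σ * v a σ
        W² a σ = trans (lem (sg (lookup σ (ix a))) (v a σ))
          (trans (cong (_* (v a σ * v a σ)) (sg-sq (lookup σ (ix a)))) (*-identityˡ _))
          where
          lem : ∀ s x → s * x * (s * x) ≡ s * s * (x * x)
          lem = solve-∀ ℚ-ring

        0≤D : ∀ σ → 0ℚ ≤ D σ
        0≤D σ = E-nonneg M (λ a → 0≤sq (v a σ))

        Eσ = E (cubeM n)

        -- Pairing `σ` with its flip at `ix a`, under which `W a` changes sign, replaces the odd
        -- power of `form` by half its difference along this edge of the cube, which `odd-power-gap`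
        -- bounds.
        one : ∀ p a → Eσ (λ σ → W a σ * (form σ * P σ ^ p)) ≤
                      t * (1ℚ + four * ι p) * Eσ (λ σ → v a σ * v a σ * P σ ^ p)
        one p a = *-cancelˡ (positive⁻¹ two) (begin
          two * Eσ f                           ≡⟨ lem₁ (Eσ f) ⟩
          Eσ f - (- Eσ f)                      ≡⟨ cong (λ z → Eσ f - (- z)) (sym (E-flip (ix a) f)) ⟩
          Eσ f - (- Eσ (f ∘ flip (ix a)))      ≡⟨ cong (λ z → Eσ f - z) (sym (E-neg (cubeM n) _)) ⟩
          Eσ f - Eσ (λ σ → - f (flip (ix a) σ)) ≡⟨ sym (E-- (cubeM n) f _) ⟩
          Eσ (λ σ → f σ - (- f (flip (ix a) σ)))
            ≡⟨ E-cong (cubeM n) (λ σ → trans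
                 (cong (λ z → f σ - (- (z * (form (flip (ix a) σ) * P (flip (ix a) σ) ^ p)))) (W-flip a σ))
                 (lem₂ (W a σ) (form σ * P σ ^ p) (form (flip (ix a) σ) * P (flip (ix a) σ) ^ p))) ⟩
          Eσ (λ σ → W a σ * (form σ * P σ ^ p - form (flip (ix a) σ) * P (flip (ix a) σ) ^ p))
            ≤⟨ E-mono (cubeM n) (λ σ → odd-power-gap p {form σ} {form (flip (ix a) σ)} {W a σ} 0≤t (form-flip a σ)) ⟩
          Eσ (λ σ → c * (W a σ * W a σ * (P σ ^ p + P (flip (ix a) σ) ^ p)))
            ≡⟨ E-cong (cubeM n) (λ σ → cong (λ z → c * (z * (P σ ^ p + P (flip (ix a) σ) ^ p))) (W² a σ)) ⟩
          Eσ (λ σ → c * (v a σ * v a σ * (P σ ^ p + P (flip (ix a) σ) ^ p)))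
            ≡⟨ E-*ˡ (cubeM n) c _ ⟩
          c * Eσ (λ σ → v a σ * v a σ * (P σ ^ p + P (flip (ix a) σ) ^ p))
            ≡⟨ cong (c *_) (E-cong (cubeM n) (λ σ → trans (*-distribˡ-+ (v a σ * v a σ) (P σ ^ p) _)
                 (cong (λ z → v a σ * v a σ * P σ ^ p + z * z * P (flip (ix a) σ) ^ p) (sym (v-flip a σ))))) ⟩
          c * Eσ (λ σ → h σ + h (flip (ix a) σ))
            ≡⟨ cong (c *_) (trans (E-+ (cubeM n) h _) (cong (Eσ h +_) (E-flip (ix a) h))) ⟩
          c * (Eσ h + Eσ h)                    ≡⟨ lem₃ c (Eσ h) ⟩
          two * (c * Eσ h) ∎)
          where
          open ≤-Reasoning
          c = t * (1ℚ + four * ι p)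
          f h : Vec Sign n → ℚ
          f σ = W a σ * (form σ * P σ ^ p)
          h σ = v a σ * v a σ * P σ ^ p
          lem₁ : ∀ x → two * x ≡ x - (- x)
          lem₁ = solve-∀ ℚ-ring
          lem₂ : ∀ w x y → w * x - (- (- w * y)) ≡ w * (x - y)
          lem₂ = solve-∀ ℚ-ring
          lem₃ : ∀ c x → c * (x + x) ≡ two * (c * x)
          lem₃ = solve-∀ ℚ-ring

        step : ∀ p → Eσ (λ σ → P σ ^ suc p) ≤ Eσ (λ σ → t * (1ℚ + four * ι p) * D σ * P σ ^ p)
        step p = begin
          Eσ (λ σ → form σ * form σ * P σ ^ p)
            ≡⟨ E-cong (cubeM n) (λ σ → trans (*-assoc (form σ) (form σ) (P σ ^ p)) (sym (E-*ʳ M _ _))) ⟩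
          Eσ (λ σ → E M (λ a → W a σ * (form σ * P σ ^ p)))
            ≡⟨ E-swap (cubeM n) M _ ⟩
          E M (λ a → Eσ (λ σ → W a σ * (form σ * P σ ^ p)))
            ≤⟨ E-mono M (one p) ⟩
          E M (λ a → c * Eσ (λ σ → v a σ * v a σ * P σ ^ p))
            ≡⟨ E-*ˡ M c _ ⟩
          c * E M (λ a → Eσ (λ σ → v a σ * v a σ * P σ ^ p))
            ≡⟨ cong (c *_) (E-swap M (cubeM n) _) ⟩
          c * Eσ (λ σ → E M (λ a → v a σ * v a σ * P σ ^ p))
            ≡⟨ E-*ˡ (cubeM n) c _ ⟨
          Eσ (λ σ → c * E M (λ a → v a σ * v a σ * P σ ^ p))
            ≡⟨ E-cong (cubeM n) (λ σ → trans (cong (c *_) (E-*ʳ M _ _)) (sym (*-assoc c (D σ) (P σ ^ p)))) ⟩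
          Eσ (λ σ → c * D σ * P σ ^ p) ∎
          where
          open ≤-Reasoning
          c = t * (1ℚ + four * ι p)

      moment-bound : ∀ p → Eσ (λ σ → P σ ^ suc p) ≤ (t * (1ℚ + four * ι p)) ^ suc p * Eσ (λ σ → D σ ^ suc p)
      moment-bound p = subst (X ≤_) (trans (E-cong (cubeM n) (λ σ → ^-distrib-* c (D σ) (suc p))) (E-*ˡ (cubeM n) (c ^ suc p) (λ σ → D σ ^ suc p)))
        (diff-0≤ (subst (0ℚ ≤_) (trans (cong (λ z → Y + ι p * X - z * X) (ι-suc p)) (lem Y (ι p) X)) (0≤-diff (begin
        ι (suc p) * X                           ≤⟨ *-monoˡ (0≤ι (suc p)) (step p) ⟩
        ι (suc p) * Eσ (λ σ → c * D σ * P σ ^ p) ≡⟨ E-*ˡ (cubeM n) (ι (suc p)) _ ⟨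
        Eσ (λ σ → ι (suc p) * (c * D σ * P σ ^ p))
          ≤⟨ E-mono (cubeM n) (λ σ → young p (0≤* 0≤c (0≤D σ)) (0≤sq (form σ))) ⟩
        Eσ (λ σ → (c * D σ) ^ suc p + ι p * P σ ^ suc p)
          ≡⟨ trans (E-+ (cubeM n) _ _) (cong (Y +_) (E-*ˡ (cubeM n) (ι p) _)) ⟩
        Y + ι p * X ∎))))
        where
        open ≤-Reasoning
        c = t * (1ℚ + four * ι p)
        0≤c : 0ℚ ≤ c
        0≤c = 0≤* 0≤t (0≤+ 0≤1 (0≤* 0≤four (0≤ι p)))
        X = Eσ (λ σ → P σ ^ suc p)
        Y = Eσ (λ σ → (c * D σ) ^ suc p)
        lem : ∀ y i x → y + i * x - (1ℚ + i) * x ≡ y - x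
        lem = solve-∀ ℚ-ring

-- The level-2 inequality

module LevelTwo where

  open FiniteMeans
  open CubeMoments

  abstract
    recip : ∀ {x} → 0ℚ < x → ∃ λ r → 0ℚ ≤ r × x * r ≡ 1ℚ
    recip {x} 0<x = (1/ x) , <⇒≤ (positive⁻¹ (1/ x) {{1/pos⇒pos x}}) , *-inverseʳ x
      where
      instance
        pos-x : Positive x
        pos-x = positive 0<x
        nz-x : NonZero x
        nz-x = pos⇒nonZero x

  ¼ : ℚ
  ¼ = ½ * ½

  0≤¼ : 0ℚ ≤ ¼
  0≤¼ = nonNegative⁻¹ ¼

  four^*¼^ : ∀ q → four ^ q * ¼ ^ q ≡ 1ℚ
  four^*¼^ q = trans (sym (^-distrib-* four ¼ q)) (1^ q)

  -- A Khintchine constant: its power `suc p` bounds the moment of order `2 * suc p` of a normalised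
  -- linear form in `suc N` random signs against the power `suc p` of the mean square of the
  -- coefficients.
  C : ℕ → ℕ → ℚ
  C N p = τ N * (1ℚ + four * ι p)

  0≤C : ∀ N p → 0ℚ ≤ C N p
  0≤C N p = 0≤* (0≤τ N) (0≤+ 0≤1 (0≤* 0≤four (0≤ι p)))

  module _ {n N} (ix : Fin (suc N) → Fin n) (ix-inj : ∀ {a b} → ix a ≡ ix b → a ≡ b)
           (v : Fin (suc N) → Vec Sign n → ℚ)
           (v-flip : ∀ a b σ → v b (flip (ix a) σ) ≡ v b σ) where

    open Moments (unif N) ix v (0≤τ N)

    private
      form-flip : ∀ a σ → let w = sg (lookup σ (ix a)) * v a σ in
                  form σ - form (flip (ix a) σ) ≡ τ N * (w + w)
      form-flip a σ = trans (cong (λ z → form σ - z) (trans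
          (E-unif-change N (λ b → sg (lookup σ (ix b)) * v b σ)
            (λ b → sg (lookup (flip (ix a) σ) (ix b)) * v b (flip (ix a) σ)) a
            (λ b b≢a → cong₂ _*_ (cong sg (lookup-flip (b≢a ∘ ix-inj) σ)) (v-flip a b σ)))
          (cong (λ z → form σ + τ N * (z - w)) (cong₂ _*_ (sg-flip (ix a) σ) (v-flip a a σ)))))
        (lem (form σ) (τ N) (sg (lookup σ (ix a))) (v a σ))
        where
        w = sg (lookup σ (ix a)) * v a σ
        lem : ∀ f t s x → f - (f + t * (- s * x - s * x)) ≡ t * (s * x + s * x)
        lem = solve-∀ ℚ-ring

    -- Khintchine's inequality in a form that allows random coefficients, as long as they ignore the
    -- signs of the form.
    unif-moment-bound : ∀ p → E (cubeM n) (λ σ → (form σ * form σ) ^ suc p) ≤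
      C N p ^ suc p * E (cubeM n) (λ σ → E (unif N) (λ a → v a σ * v a σ) ^ suc p)
    unif-moment-bound = moment-bound (λ a → v-flip a a) form-flip

  module Bilinear {n N} (α β : Fin (suc N) → Fin n)
    (α-inj : ∀ {a b} → α a ≡ α b → a ≡ b) (β-inj : ∀ {a b} → β a ≡ β b → a ≡ b)
    (α≢β : ∀ a b → β b ≢ α a)
    (M : Fin (suc N) → Fin (suc N) → ℚ) (p : ℕ) where

    private
      U = unif N
      Eσ = E (cubeM n)
      q = suc p
      c = C N p

    L : Fin (suc N) → Vec Sign n → ℚ
    L a σ = E U λ b → sg (lookup σ (β b)) * M a b

    Q : Vec Sign n → ℚ
    Q σ = E U λ a → sg (lookup σ (α a)) * L a σ

    F : ℚ
    F = E U λ a → E U λ b → M a b * M a b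

    private
      G : Fin (suc N) → ℚ
      G a = E U λ b → M a b * M a b

      0≤G : ∀ a → 0ℚ ≤ G a
      0≤G a = E-nonneg U (λ b → 0≤sq (M a b))

      L-moment : ∀ a → Eσ (λ σ → (L a σ * L a σ) ^ q) ≤ c ^ q * G a ^ q
      L-moment a = subst (Eσ (λ σ → (L a σ * L a σ) ^ q) ≤_) (cong (c ^ q *_) (E-const (cubeM n) (G a ^ q)))
        (unif-moment-bound β β-inj (λ b _ → M a b) (λ _ _ _ → refl) p)

      D : Vec Sign n → ℚ
      D σ = E U λ a → L a σ * L a σ

      -- The coefficients `L a` of the outer form are random, but they depend only on signs in the
      -- range of `β`, which flips in the range of `α` leave alone.
      Q-moment : Eσ (λ σ → (Q σ * Q σ) ^ q) ≤ c ^ q * Eσ (λ σ → D σ ^ q)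
      Q-moment = unif-moment-bound α α-inj L
        (λ a a′ σ → E-cong U (λ b → cong (λ z → sg z * M a′ b) (lookup-flip (α≢β a b) σ))) p

    -- Convexity with weights F + G a in place of the row norms G a, which may vanish.
    module _ (0<F : 0ℚ < F) where

      private
        H : Fin (suc N) → ℚ
        H a = G a + F

        0<H : ∀ a → 0ℚ < H a
        0<H a = +-mono-≤-< (0≤G a) 0<F

        2F = two * F

        0<2F : 0ℚ < 2F
        0<2F = 0<* (positive⁻¹ two) 0<F

        0≤2F = <⇒≤ 0<2F

        E-H : E U H ≡ 2F
        E-H = trans (E-+ U G (λ _ → F)) (trans (cong (F +_) (E-const U F)) (lem F))
          where
          lem : ∀ x → x + x ≡ two * x
          lem = solve-∀ ℚ-ring

        r : Fin (suc N) → ℚ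
        r a = proj₁ (recip (^-pos p (0<H a)))

        0≤r : ∀ a → 0ℚ ≤ r a
        0≤r a = proj₁ (proj₂ (recip (^-pos p (0<H a))))

        r-inv : ∀ a → H a ^ p * r a ≡ 1ℚ
        r-inv a = proj₂ (proj₂ (recip (^-pos p (0<H a))))

        0≤D : ∀ σ → 0ℚ ≤ D σ
        0≤D σ = E-nonneg U (λ a → 0≤sq (L a σ))

        -- Young's inequality for `2F * L²` and `H * D`, divided by `H ^ p`. The weights `H` have
        -- mean `2F`, so that in `D-convex` all but one of the `q` copies of `2F * D ^ q` cancel.
        tangent : ∀ a σ → ι q * (2F * (L a σ * L a σ) * D σ ^ p) ≤
                          2F ^ q * (r a * (L a σ * L a σ) ^ q) + ι p * (H a * D σ ^ q)
        tangent a σ = begin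
          ι q * (2F * V * d ^ p)
            ≡⟨ trans (sym (*-identityʳ _)) (cong (ι q * (2F * V * d ^ p) *_) (sym (r-inv a))) ⟩
          ι q * (2F * V * d ^ p) * (H a ^ p * r a)
            ≡⟨ lem₁ (ι q) (2F * V) (d ^ p) (H a ^ p) (r a) ⟩
          ι q * (2F * V * (H a ^ p * d ^ p)) * r a
            ≡⟨ cong (λ z → ι q * (2F * V * z) * r a) (^-distrib-* (H a) d p) ⟨
          ι q * (2F * V * (H a * d) ^ p) * r a
            ≤⟨ *-monoʳ (0≤r a) (young p (0≤* 0≤2F (0≤sq (L a σ))) (0≤* (<⇒≤ (0<H a)) (0≤D σ))) ⟩
          ((2F * V) ^ q + ι p * (H a * d) ^ q) * r a
            ≡⟨ cong₂ (λ x y → (x + ι p * y) * r a) (^-distrib-* 2F V q) (^-distrib-* (H a) d q) ⟩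
          (2F ^ q * V ^ q + ι p * (H a * H a ^ p * d ^ q)) * r a
            ≡⟨ lem₂ (2F ^ q) (V ^ q) (ι p) (H a) (H a ^ p) (d ^ q) (r a) ⟩
          2F ^ q * (r a * V ^ q) + ι p * (H a * d ^ q) * (H a ^ p * r a)
            ≡⟨ cong (λ z → 2F ^ q * (r a * V ^ q) + ι p * (H a * d ^ q) * z) (r-inv a) ⟩
          2F ^ q * (r a * V ^ q) + ι p * (H a * d ^ q) * 1ℚ
            ≡⟨ cong (2F ^ q * (r a * V ^ q) +_) (*-identityʳ _) ⟩
          2F ^ q * (r a * V ^ q) + ι p * (H a * d ^ q) ∎
          where
          open ≤-Reasoning
          V = L a σ * L a σ
          d = D σ
          lem₁ : ∀ i v d h r → i * (v * d) * (h * r) ≡ i * (v * (h * d)) * r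
          lem₁ = solve-∀ ℚ-ring
          lem₂ : ∀ f v i h k d r → (f * v + i * (h * k * d)) * r ≡ f * (r * v) + i * (h * d) * (k * r)
          lem₂ = solve-∀ ℚ-ring

        D-convex : ∀ σ → 2F * D σ ^ q ≤ 2F ^ q * E U (λ a → r a * (L a σ * L a σ) ^ q)
        D-convex σ = diff-0≤ (subst (0ℚ ≤_)
            (trans (cong (λ z → X + ι p * (2F * d ^ q) - z * (2F * (d * d ^ p))) (ι-suc p))
                   (lem X (ι p) 2F d (d ^ p)))
            (0≤-diff (begin
          ι q * (2F * (d * d ^ p))
            ≡⟨ cong (λ z → ι q * z) (lem₁ 2F d (d ^ p)) ⟩
          ι q * (d * (2F * d ^ p))
            ≡⟨ cong (ι q *_) (trans (sym (E-*ʳ U (2F * d ^ p) (λ a → L a σ * L a σ)))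
                 (E-cong U (λ a → lem₂ (L a σ * L a σ) 2F (d ^ p)))) ⟩
          ι q * E U (λ a → 2F * (L a σ * L a σ) * d ^ p)
            ≡⟨ E-*ˡ U (ι q) _ ⟨
          E U (λ a → ι q * (2F * (L a σ * L a σ) * d ^ p))
            ≤⟨ E-mono U (λ a → tangent a σ) ⟩
          E U (λ a → 2F ^ q * (r a * (L a σ * L a σ) ^ q) + ι p * (H a * d ^ q))
            ≡⟨ E-+ U (λ a → 2F ^ q * (r a * (L a σ * L a σ) ^ q)) (λ a → ι p * (H a * d ^ q)) ⟩
          E U (λ a → 2F ^ q * (r a * (L a σ * L a σ) ^ q)) + E U (λ a → ι p * (H a * d ^ q))
            ≡⟨ cong₂ _+_ (E-*ˡ U (2F ^ q) (λ a → r a * (L a σ * L a σ) ^ q))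
                 (trans (E-*ˡ U (ι p) (λ a → H a * d ^ q))
                   (cong (ι p *_) (trans (E-*ʳ U (d ^ q) H) (cong (_* d ^ q) E-H)))) ⟩
          X + ι p * (2F * d ^ q) ∎)))
          where
          open ≤-Reasoning
          d = D σ
          X = 2F ^ q * E U (λ a → r a * (L a σ * L a σ) ^ q)
          lem₁ : ∀ f d x → f * (d * x) ≡ d * (f * x)
          lem₁ = solve-∀ ℚ-ring
          lem₂ : ∀ v f d → v * (f * d) ≡ f * v * d
          lem₂ = solve-∀ ℚ-ring
          lem : ∀ x i f d e → x + i * (f * (d * e)) - (1ℚ + i) * (f * (d * e)) ≡ x - f * (d * e)
          lem = solve-∀ ℚ-ring

        D-moment : Eσ (λ σ → D σ ^ q) ≤ 2F ^ q * c ^ q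
        D-moment = *-cancelˡ 0<2F (begin
          2F * Eσ (λ σ → D σ ^ q)
            ≡⟨ E-*ˡ (cubeM n) 2F _ ⟨
          Eσ (λ σ → 2F * D σ ^ q)
            ≤⟨ E-mono (cubeM n) D-convex ⟩
          Eσ (λ σ → 2F ^ q * E U (λ a → r a * (L a σ * L a σ) ^ q))
            ≡⟨ E-*ˡ (cubeM n) (2F ^ q) _ ⟩
          2F ^ q * Eσ (λ σ → E U (λ a → r a * (L a σ * L a σ) ^ q))
            ≡⟨ cong (2F ^ q *_) (trans (E-swap (cubeM n) U (λ σ a → r a * (L a σ * L a σ) ^ q))
                 (E-cong U (λ a → E-*ˡ (cubeM n) (r a) (λ σ → (L a σ * L a σ) ^ q)))) ⟩
          2F ^ q * E U (λ a → r a * Eσ (λ σ → (L a σ * L a σ) ^ q))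
            ≤⟨ *-monoˡ (^-nonneg q 0≤2F) (E-mono U bound) ⟩
          2F ^ q * E U (λ a → c ^ q * H a)
            ≡⟨ cong (2F ^ q *_) (trans (E-*ˡ U (c ^ q) H) (cong (c ^ q *_) E-H)) ⟩
          2F ^ q * (c ^ q * 2F)
            ≡⟨ lem (2F ^ q) (c ^ q) 2F ⟩
          2F * (2F ^ q * c ^ q) ∎)
          where
          open ≤-Reasoning
          lem : ∀ x y z → x * (y * z) ≡ z * (x * y)
          lem = solve-∀ ℚ-ring
          lem₁ : ∀ r c h k → r * (c * (h * k)) ≡ c * h * (k * r)
          lem₁ = solve-∀ ℚ-ring
          bound : ∀ a → r a * Eσ (λ σ → (L a σ * L a σ) ^ q) ≤ c ^ q * H a
          bound a = begin
            r a * Eσ (λ σ → (L a σ * L a σ) ^ q) ≤⟨ *-monoˡ (0≤r a) (L-moment a) ⟩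
            r a * (c ^ q * G a ^ q)
              ≤⟨ *-monoˡ (0≤r a) (*-monoˡ (^-nonneg q (0≤C N p))
                   (^-mono q (0≤G a) (≤-by (<⇒≤ 0<F) refl))) ⟩
            r a * (c ^ q * (H a * H a ^ p))      ≡⟨ lem₁ (r a) (c ^ q) (H a) (H a ^ p) ⟩
            c ^ q * H a * (H a ^ p * r a)        ≡⟨ cong (c ^ q * H a *_) (r-inv a) ⟩
            c ^ q * H a * 1ℚ                     ≡⟨ *-identityʳ _ ⟩
            c ^ q * H a ∎

      Q-bound : Eσ (λ σ → (Q σ * Q σ) ^ q) ≤ (two * (c * c) * F) ^ q
      Q-bound = begin
        Eσ (λ σ → (Q σ * Q σ) ^ q)     ≤⟨ Q-moment ⟩
        c ^ q * Eσ (λ σ → D σ ^ q)     ≤⟨ *-monoˡ (^-nonneg q (0≤C N p)) D-moment ⟩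
        c ^ q * (2F ^ q * c ^ q)       ≡⟨ cong (c ^ q *_) (sym (^-distrib-* 2F c q)) ⟩
        c ^ q * (2F * c) ^ q           ≡⟨ sym (^-distrib-* c (2F * c) q) ⟩
        (c * (2F * c)) ^ q             ≡⟨ cong (_^ q) (lem c F) ⟩
        (two * (c * c) * F) ^ q ∎
        where
        open ≤-Reasoning
        lem : ∀ c f → c * (two * f * c) ≡ two * (c * c) * f
        lem = solve-∀ ℚ-ring

  -- For `x` at least `¼ ^ suc p` this is of the order of `(C N p * x)²`; with `p` about `log (1/x)`
  -- that is the classical bound on the weight at level 2.
  κ : ℕ → ℕ → ℚ → ℚ
  κ N p x = four * (two * (C N p * C N p)) * (x * (x + ¼ ^ suc p))

  -- The level-2 inequality for densities: x is the mass of g, and the term ¼^q absorbs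
  -- the factor x^(-1/q) that Hölder's inequality leaves behind.
  module _ {n N} (α β : Fin (suc N) → Fin n)
    (α-inj : ∀ {a b} → α a ≡ α b → a ≡ b) (β-inj : ∀ {a b} → β a ≡ β b → a ≡ b)
    (α≢β : ∀ a b → β b ≢ α a) (p : ℕ)
    (g m : Vec Sign n → ℚ) (g≤1 : ∀ σ → g σ ≤ 1ℚ) (m≤g : ∀ σ → m σ ≤ g σ) (-g≤m : ∀ σ → - g σ ≤ m σ)
    where

    private
      U = unif N
      Eσ = E (cubeM n)
      q = suc p
      c = C N p
      x = Eσ g
      θ = ¼ ^ q
      K = two * (c * c)

      M : Fin (suc N) → Fin (suc N) → ℚ
      M a b = Eσ λ σ → m σ * sg (lookup σ (α a)) * sg (lookup σ (β b))

      open Bilinear α β α-inj β-inj α≢β M p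

      0≤g : ∀ σ → 0ℚ ≤ g σ
      0≤g σ = subst (0ℚ ≤_) (lem (g σ)) (0≤* 0≤½ (0≤-diff (≤-trans (-g≤m σ) (m≤g σ))))
        where
        lem : ∀ g → ½ * (g - (- g)) ≡ g
        lem = solve-∀ ℚ-ring

      0≤K : 0ℚ ≤ K
      0≤K = 0≤* 0≤two (0≤* (0≤C N p) (0≤C N p))

      0≤θ : 0ℚ ≤ θ
      0≤θ = ^-nonneg q 0≤¼

      P : Vec Sign n → ℚ
      P σ = Q σ * Q σ

      -- Duality: the matrix of `Q` consists of the correlations of `m` themselves, so pairing `m`
      -- with `Q` gives their mean square, and moments of `Q` become bounds on `F`.
      F≡EmQ : F ≡ Eσ (λ σ → m σ * Q σ)
      F≡EmQ = begin
        E U (λ a → E U λ b → M a b * M a b)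
          ≡⟨ E-cong U (λ a → E-cong U (λ b → E-*ʳ (cubeM n) (M a b) (λ σ → m σ * sg (lookup σ (α a)) * sg (lookup σ (β b))))) ⟨
        E U (λ a → E U λ b → Eσ (λ σ → m σ * sg (lookup σ (α a)) * sg (lookup σ (β b)) * M a b))
          ≡⟨ E-cong U (λ a → E-swap U (cubeM n) _) ⟩
        E U (λ a → Eσ (λ σ → E U λ b → m σ * sg (lookup σ (α a)) * sg (lookup σ (β b)) * M a b))
          ≡⟨ E-swap U (cubeM n) _ ⟩
        Eσ (λ σ → E U (λ a → E U λ b → m σ * sg (lookup σ (α a)) * sg (lookup σ (β b)) * M a b))
          ≡⟨ E-cong (cubeM n) (λ σ → trans
               (E-cong U (λ a → trans
                 (E-cong U (λ b → *-assoc (m σ * sg (lookup σ (α a))) (sg (lookup σ (β b))) (M a b)))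
                 (trans (E-*ˡ U (m σ * sg (lookup σ (α a))) _) (*-assoc (m σ) (sg (lookup σ (α a))) (L a σ)))))
               (E-*ˡ U (m σ) _)) ⟩
        Eσ (λ σ → m σ * Q σ) ∎
        where open ≡-Reasoning

      Y = Eσ (λ σ → g σ * P σ)

      -- As `m` may change sign, the inequality is read off from two squares with the nonnegative
      -- weights `g - m` and `g + m`.
      cauchy-schwarz : 0ℚ < x → F * F ≤ x * Y
      cauchy-schwarz 0<x = *-cancelˡ 0<x (diff-0≤ (subst (0ℚ ≤_) eq
        (E-nonneg (cubeM n) (λ σ → subst (0ℚ ≤_) (lem (g σ) (m σ) (x * Q σ) F)
          (0≤+ (0≤* (0≤-diff (m≤g σ)) (0≤* 0≤½ (0≤sq (x * Q σ + F))))
               (0≤* (0≤g+m σ) (0≤* 0≤½ (0≤sq (x * Q σ - F)))))))))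
        where
        0≤g+m : ∀ σ → 0ℚ ≤ g σ + m σ
        0≤g+m σ = subst (0ℚ ≤_) (lem′ (g σ) (m σ)) (0≤-diff (-g≤m σ))
          where
          lem′ : ∀ g m → m - (- g) ≡ g + m
          lem′ = solve-∀ ℚ-ring
        lem : ∀ g m y f → (g - m) * (½ * ((y + f) * (y + f))) + (g + m) * (½ * ((y - f) * (y - f)))
            ≡ g * (y * y + f * f) - two * (m * (y * f))
        lem = solve-∀ ℚ-ring
        lem₁ : ∀ g x q f m → g * (x * q * (x * q) + f * f) - two * (m * (x * q * f))
            ≡ x * x * (g * (q * q)) + g * (f * f) - two * x * f * (m * q)
        lem₁ = solve-∀ ℚ-ring
        lem₂ : ∀ x y f → x * x * y + x * (f * f) - two * x * f * f ≡ x * (x * y) - x * (f * f)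
        lem₂ = solve-∀ ℚ-ring
        eq : Eσ (λ σ → g σ * (x * Q σ * (x * Q σ) + F * F) - two * (m σ * (x * Q σ * F))) ≡ x * (x * Y) - x * (F * F)
        eq = trans (E-cong (cubeM n) (λ σ → lem₁ (g σ) x (Q σ) F (m σ)))
          (trans (E-- (cubeM n) (λ σ → x * x * (g σ * P σ) + g σ * (F * F)) (λ σ → two * x * F * (m σ * Q σ)))
          (trans (cong₂ _-_
            (trans (E-+ (cubeM n) (λ σ → x * x * (g σ * P σ)) (λ σ → g σ * (F * F)))
              (cong₂ _+_ (E-*ˡ (cubeM n) (x * x) _) (E-*ʳ (cubeM n) (F * F) g)))
            (trans (E-*ˡ (cubeM n) (two * x * F) (λ σ → m σ * Q σ)) (cong (two * x * F *_) (sym F≡EmQ))))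
          (lem₂ x Y F)))

      0≤Y : 0ℚ ≤ Y
      0≤Y = E-nonneg (cubeM n) (λ σ → 0≤* (0≤g σ) (0≤sq (Q σ)))

      -- Jensen's inequality for the measure `g` of mass `x`, by `young` at every point; at the end
      -- `g ≤ 1` removes the density.
      jensen : 0ℚ ≤ x → x * Y ^ q ≤ x ^ q * Eσ (λ σ → P σ ^ q)
      jensen 0≤x = ≤-trans (diff-0≤ (subst (0ℚ ≤_)
          (trans (cong (λ z → Z + ι p * (x * Y ^ q) - z * (x * (Y * Y ^ p))) (ι-suc p)) (lem Z (ι p) x Y (Y ^ p)))
          (0≤-diff (begin
        ι q * (x * (Y * Y ^ p))              ≡⟨ cong (ι q *_) (lem₁ x Y (Y ^ p)) ⟩
        ι q * (Y * (x * Y ^ p))              ≡⟨ cong (ι q *_) (E-*ʳ (cubeM n) (x * Y ^ p) (λ σ → g σ * P σ)) ⟨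
        ι q * Eσ (λ σ → g σ * P σ * (x * Y ^ p)) ≡⟨ E-*ˡ (cubeM n) (ι q) _ ⟨
        Eσ (λ σ → ι q * (g σ * P σ * (x * Y ^ p)))
          ≡⟨ E-cong (cubeM n) (λ σ → lem₂ (ι q) (g σ) (P σ) x (Y ^ p)) ⟩
        Eσ (λ σ → g σ * (ι q * (x * P σ * Y ^ p)))
          ≤⟨ E-mono (cubeM n) (λ σ → *-monoˡ (0≤g σ) (young p (0≤* 0≤x (0≤sq (Q σ))) 0≤Y)) ⟩
        Eσ (λ σ → g σ * ((x * P σ) ^ q + ι p * Y ^ q))
          ≡⟨ E-cong (cubeM n) (λ σ → trans (cong (λ z → g σ * (z + ι p * Y ^ q)) (^-distrib-* x (P σ) q))
               (lem₃ (g σ) (x ^ q) (P σ ^ q) (ι p) (Y ^ q))) ⟩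
        Eσ (λ σ → x ^ q * (g σ * P σ ^ q) + g σ * (ι p * Y ^ q))
          ≡⟨ trans (E-+ (cubeM n) (λ σ → x ^ q * (g σ * P σ ^ q)) (λ σ → g σ * (ι p * Y ^ q)))
               (cong₂ _+_ (E-*ˡ (cubeM n) (x ^ q) _) (trans (E-*ʳ (cubeM n) (ι p * Y ^ q) g) (lem₄ x (ι p) (Y ^ q)))) ⟩
        Z + ι p * (x * Y ^ q) ∎))))
        (*-monoˡ (^-nonneg q 0≤x) (E-mono (cubeM n) (λ σ →
          subst (g σ * P σ ^ q ≤_) (*-identityˡ _) (*-monoʳ (^-nonneg q (0≤sq (Q σ))) (g≤1 σ)))))
        where
        open ≤-Reasoning
        Z = x ^ q * Eσ (λ σ → g σ * P σ ^ q)
        lem : ∀ z i x y e → z + i * (x * (y * e)) - (1ℚ + i) * (x * (y * e)) ≡ z - x * (y * e)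
        lem = solve-∀ ℚ-ring
        lem₁ : ∀ x y e → x * (y * e) ≡ y * (x * e)
        lem₁ = solve-∀ ℚ-ring
        lem₂ : ∀ i g p x y → i * (g * p * (x * y)) ≡ g * (i * (x * p * y))
        lem₂ = solve-∀ ℚ-ring
        lem₃ : ∀ g a b i y → g * (a * b + i * y) ≡ a * (g * b) + g * (i * y)
        lem₃ = solve-∀ ℚ-ring
        lem₄ : ∀ x i y → x * (i * y) ≡ i * (x * y)
        lem₄ = solve-∀ ℚ-ring

      F-power : 0ℚ < x → 0ℚ < F → x * F ^ q ≤ (K * (x * x)) ^ q
      F-power 0<x 0<F = *-cancelˡ (^-pos q 0<F) (begin
        F ^ q * (x * F ^ q)             ≡⟨ lem₁ (F ^ q) x ⟩
        x * (F ^ q * F ^ q)             ≡⟨ cong (x *_) (^-distrib-* F F q) ⟨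
        x * (F * F) ^ q                 ≤⟨ *-monoˡ 0≤x (^-mono q (0≤sq F) (cauchy-schwarz 0<x)) ⟩
        x * (x * Y) ^ q                 ≡⟨ cong (x *_) (^-distrib-* x Y q) ⟩
        x * (x ^ q * Y ^ q)             ≡⟨ lem₂ x (x ^ q) (Y ^ q) ⟩
        x ^ q * (x * Y ^ q)             ≤⟨ *-monoˡ (^-nonneg q 0≤x) (jensen 0≤x) ⟩
        x ^ q * (x ^ q * Eσ (λ σ → P σ ^ q))
          ≤⟨ *-monoˡ (^-nonneg q 0≤x) (*-monoˡ (^-nonneg q 0≤x) (Q-bound 0<F)) ⟩
        x ^ q * (x ^ q * (K * F) ^ q)   ≡⟨ cong (λ z → x ^ q * (x ^ q * z)) (^-distrib-* K F q) ⟩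
        x ^ q * (x ^ q * (K ^ q * F ^ q)) ≡⟨ lem₃ (x ^ q) (K ^ q) (F ^ q) ⟩
        F ^ q * (K ^ q * (x ^ q * x ^ q)) ≡⟨ cong (λ z → F ^ q * (K ^ q * z)) (^-distrib-* x x q) ⟨
        F ^ q * (K ^ q * (x * x) ^ q)   ≡⟨ cong (F ^ q *_) (^-distrib-* K (x * x) q) ⟨
        F ^ q * (K * (x * x)) ^ q ∎)
        where
        open ≤-Reasoning
        0≤x = <⇒≤ 0<x
        lem₁ : ∀ f x → f * (x * f) ≡ x * (f * f)
        lem₁ = solve-∀ ℚ-ring
        lem₂ : ∀ x a b → x * (a * b) ≡ a * (x * b)
        lem₂ = solve-∀ ℚ-ring
        lem₃ : ∀ a k f → a * (a * (k * f)) ≡ f * (k * (a * a))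
        lem₃ = solve-∀ ℚ-ring

    level-2 : 0ℚ < Eσ g → E U (λ a → E U λ b → M a b * M a b) ≤ κ N p (Eσ g)
    level-2 0<x with 0<⊎≤0 F
    ... | inj₂ F≤0 = ≤-trans F≤0 (0≤* (0≤* 0≤four 0≤K) (0≤* 0≤x (0≤+ 0≤x 0≤θ)))
      where 0≤x = <⇒≤ 0<x
    ... | inj₁ 0<F = ^-cancel p (0≤* (0≤* 0≤four 0≤K) (0≤* 0≤x (0≤+ 0≤x 0≤θ))) (*-cancelˡ 0<x (begin
      x * F ^ q                                  ≤⟨ F-power 0<x 0<F ⟩
      (K * (x * x)) ^ q                          ≡⟨ trans (^-distrib-* K (x * x) q) (cong (K ^ q *_) (^-distrib-* x x q)) ⟩
      -- Instead of taking a root of `x`, the factor `1 = four ^ q * θ` is inserted. It leaves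
      -- `θ * x ^ p`, which is at most `(x + θ) ^ q`.
      K ^ q * (x ^ q * (x * x ^ p))              ≡⟨ trans (sym (*-identityʳ _)) (cong (K ^ q * (x ^ q * (x * x ^ p)) *_) (sym (four^*¼^ q))) ⟩
      K ^ q * (x ^ q * (x * x ^ p)) * (four ^ q * θ) ≡⟨ lem₁ (K ^ q) (x ^ q) x (x ^ p) (four ^ q) θ ⟩
      x * (four ^ q * K ^ q * (x ^ q * (θ * x ^ p)))
        ≤⟨ *-monoˡ 0≤x (*-monoˡ (0≤* (^-nonneg q 0≤four) (^-nonneg q 0≤K)) (*-monoˡ (^-nonneg q 0≤x)
             (*-mono 0≤θ (^-nonneg p 0≤x) (≤-by 0≤x (+-comm x θ)) (^-mono p 0≤x (≤-by 0≤θ refl))))) ⟩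
      x * (four ^ q * K ^ q * (x ^ q * (x + θ) ^ q))
        ≡⟨ cong (x *_) (trans (cong₂ _*_ (sym (^-distrib-* four K q)) (sym (^-distrib-* x (x + θ) q)))
             (sym (^-distrib-* (four * K) (x * (x + θ)) q))) ⟩
      x * κ N p x ^ q ∎))
      where
      open ≤-Reasoning
      0≤x = <⇒≤ 0<x
      lem₁ : ∀ k a x b f t → k * (a * (x * b)) * (f * t) ≡ x * (f * k * (a * (t * b)))
      lem₁ = solve-∀ ℚ-ring

-- Random constraints and their Fourier weight

module Draws where

  open FiniteMeans
  open CubeMoments
  open LevelTwo

  -- The variable at position `c` of a random constraint is drawn from block `c`. With disjoint
  -- blocks the variables of a constraint are independent and still distinct, and level 2 meets only
  -- pairs from different blocks.
  Blocks : ℕ → ℕ → ℕ → Set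
  Blocks k N n = Fin k → Fin (suc N) → Fin n

  choose : ∀ {k N n} → Blocks k N n → Vec (Fin (suc N)) k → Vec (Fin n) k
  choose β []       = []
  choose β (a ∷ as) = β zero a ∷ choose (β ∘ suc) as

  masked : ∀ {k N n} → Blocks k N n → Vec Sign n → Vec (Fin (suc N)) k → Vec Sign k → Vec Sign k
  masked β σ as bs = Vec.zipWith Sign._*_ bs (Vec.map (lookup σ) (choose β as))

  Draw : ℕ → ℕ → Set
  Draw N k = Vec (Fin (suc N)) k × Vec Sign k

  abstract
    draws : ∀ N k → Mean (Draw N k)
    draws N zero    = dirac ([] , [])
    draws N (suc k) = bind (unif N) λ a → mix ½ 0≤½ ½≤1
      (mapM (λ (as , bs) → a ∷ as , Sign.+ ∷ bs) (draws N k))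
      (mapM (λ (as , bs) → a ∷ as , Sign.- ∷ bs) (draws N k))

    E-draws-zero : ∀ N g → E (draws N 0) g ≡ g ([] , [])
    E-draws-zero N g = refl

    E-draws-suc : ∀ N k g → E (draws N (suc k)) g ≡ E (unif N) λ a →
      ½ * E (draws N k) (λ (as , bs) → g (a ∷ as , Sign.+ ∷ bs)) +
      ½ * E (draws N k) (λ (as , bs) → g (a ∷ as , Sign.- ∷ bs))
    E-draws-suc N k g = trans (E-bind (unif N) _ g) (E-cong (unif N) λ a →
      cong₂ (λ x y → ½ * x + ½ * y) (E-map (λ (as , bs) → a ∷ as , Sign.+ ∷ bs) (draws N k) g)
                                    (E-map (λ (as , bs) → a ∷ as , Sign.- ∷ bs) (draws N k) g))

  -- Multiplication by a fixed sign only exchanges the two equally likely negations. This gives a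
  -- planted density mean 1 for each single `σ`, not just on average.
  E-draws-masked : ∀ {k N n} (β : Blocks k N n) σ h →
    E (draws N k) (λ (as , bs) → h (masked β σ as bs)) ≡ E (cubeM k) h
  E-draws-masked {zero}  {N} β σ h = trans (E-draws-zero N _) (sym (E-cube-zero h))
  E-draws-masked {suc k} {N} β σ h = trans (E-draws-suc N k _)
    (trans (E-cong (unif N) λ a → step (lookup σ (β zero a))) (E-const (unif N) (E (cubeM (suc k)) h)))
    where
    rest : Sign → ℚ
    rest s = E (draws N k) (λ (as , bs) → h (s ∷ masked (β ∘ suc) σ as bs))
    rest≡ : ∀ s → rest s ≡ E (cubeM k) (λ a → h (s ∷ a))
    rest≡ s = E-draws-masked (β ∘ suc) σ (λ a → h (s ∷ a))
    step : ∀ s → ½ * rest s + ½ * rest (Sign.- Sign.* s) ≡ E (cubeM (suc k)) h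
    step Sign.+ = trans (cong₂ (λ x y → ½ * x + ½ * y) (rest≡ Sign.+) (rest≡ Sign.-)) (sym (E-cube-suc k h))
    step Sign.- = trans (+-comm (½ * rest Sign.-) _)
      (trans (cong₂ (λ x y → ½ * x + ½ * y) (rest≡ Sign.+) (rest≡ Sign.-)) (sym (E-cube-suc k h)))

  -- The parts of the Fourier expansion without and with the first variable. Functions on the cube
  -- are taken apart by this recursion instead of by characters.
  even odd : ∀ {k} → (Vec Sign (suc k) → ℚ) → Vec Sign k → ℚ
  even u a = ½ * (u (Sign.+ ∷ a) + u (Sign.- ∷ a))
  odd  u a = ½ * (u (Sign.+ ∷ a) - u (Sign.- ∷ a))

  even+odd : ∀ {k} (u : Vec Sign (suc k) → ℚ) s a → u (s ∷ a) ≡ even u a + sg s * odd u a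
  even+odd u Sign.+ a = lem (u (Sign.+ ∷ a)) (u (Sign.- ∷ a))
    where
    lem : ∀ x y → x ≡ ½ * (x + y) + 1ℚ * (½ * (x - y))
    lem = solve-∀ ℚ-ring
  even+odd u Sign.- a = lem (u (Sign.+ ∷ a)) (u (Sign.- ∷ a))
    where
    lem : ∀ x y → y ≡ ½ * (x + y) + (- 1ℚ) * (½ * (x - y))
    lem = solve-∀ ℚ-ring

  Bounded : ∀ {k} → ℚ → (Vec Sign k → ℚ) → Set
  Bounded V u = ∀ a → u a * u a ≤ V

  half-sum : ∀ {x y V} → x * x ≤ V → y * y ≤ V → ½ * (x + y) * (½ * (x + y)) ≤ V
  half-sum {x} {y} {V} h h′ = ≤-trans (≤-by (0≤sq (½ * (x - y))) (lem x y))
    (≤-trans (+-mono-≤ (*-monoˡ 0≤½ h) (*-monoˡ 0≤½ h′)) (≤-reflexive (lem′ V)))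
    where
    lem : ∀ x y → ½ * (x * x) + ½ * (y * y) ≡ ½ * (x + y) * (½ * (x + y)) + ½ * (x - y) * (½ * (x - y))
    lem = solve-∀ ℚ-ring
    lem′ : ∀ v → ½ * v + ½ * v ≡ v
    lem′ = solve-∀ ℚ-ring

  even-bounded : ∀ {k V} {u : Vec Sign (suc k) → ℚ} → Bounded V u → Bounded V (even u)
  even-bounded {u = u} b a = half-sum {u (Sign.+ ∷ a)} {u (Sign.- ∷ a)} (b (Sign.+ ∷ a)) (b (Sign.- ∷ a))

  odd-bounded : ∀ {k V} {u : Vec Sign (suc k) → ℚ} → Bounded V u → Bounded V (odd u)
  odd-bounded {V = V} {u} b a = half-sum {u (Sign.+ ∷ a)} {(- u (Sign.- ∷ a))} (b (Sign.+ ∷ a))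
    (subst (_≤ V) (lem (u (Sign.- ∷ a))) (b (Sign.- ∷ a)))
    where
    lem : ∀ x → x * x ≡ - x * - x
    lem = solve-∀ ℚ-ring

  E-even : ∀ {k} (u : Vec Sign (suc k) → ℚ) → E (cubeM k) (even u) ≡ E (cubeM (suc k)) u
  E-even {k} u = trans (E-*ˡ (cubeM k) ½ _) (trans (cong (½ *_) (E-+ (cubeM k) _ _))
    (trans (*-distribˡ-+ ½ (E (cubeM k) (λ a → u (Sign.+ ∷ a))) _) (sym (E-cube-suc k u))))

  E-odd : ∀ {k} (u : Vec Sign (suc k) → ℚ) → E (cubeM k) (odd u) ≡ E (cubeM (suc k)) (λ a → u a * sg (lookup a zero))
  E-odd {k} u = trans (E-*ˡ (cubeM k) ½ _) (trans (cong (½ *_) (E-- (cubeM k) (λ a → u (Sign.+ ∷ a)) (λ a → u (Sign.- ∷ a))))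
    (trans (lem (E (cubeM k) (λ a → u (Sign.+ ∷ a))) (E (cubeM k) (λ a → u (Sign.- ∷ a))))
    (trans (cong₂ (λ x y → ½ * x + ½ * y) (sym (E-*ʳ (cubeM k) 1ℚ (λ a → u (Sign.+ ∷ a)))) (sym (E-*ʳ (cubeM k) (- 1ℚ) (λ a → u (Sign.- ∷ a)))))
      (sym (E-cube-suc k (λ a → u a * sg (lookup a zero)))))))
    where
    lem : ∀ x y → ½ * (x - y) ≡ ½ * (x * 1ℚ) + ½ * (y * (- 1ℚ))
    lem = solve-∀ ℚ-ring

  E-even-coord : ∀ {k} (u : Vec Sign (suc k) → ℚ) i →
    E (cubeM k) (λ a → even u a * sg (lookup a i)) ≡ E (cubeM (suc k)) (λ a → u a * sg (lookup a (suc i)))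
  E-even-coord {k} u i = trans (E-cong (cubeM k) (λ a → lem (u (Sign.+ ∷ a)) (u (Sign.- ∷ a)) (sg (lookup a i))))
    (E-even (λ a → u a * sg (lookup a (suc i))))
    where
    lem : ∀ x y s → ½ * (x + y) * s ≡ ½ * (x * s + y * s)
    lem = solve-∀ ℚ-ring

  module _ {n : ℕ} where

    Eσ : (Vec Sign n → ℚ) → ℚ
    Eσ = E (cubeM n)

    _·[_] : (Vec Sign n → ℚ) → Fin n → Vec Sign n → ℚ
    (m ·[ i ]) σ = m σ * sg (lookup σ i)

    -- If `m` is the weight of a memory state as a function of `σ`, and `u` is the planted density
    -- minus 1, this is, up to normalisation by the mass of the state, the variance of the density
    -- of the next constraint.
    Φ : ∀ {k N} → Blocks k N n → (Vec Sign n → ℚ) → (Vec Sign k → ℚ) → ℚ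
    Φ {k} {N} β m u = E (draws N k) λ (as , bs) →
      Eσ (λ σ → m σ * u (masked β σ as bs)) * Eσ (λ σ → m σ * u (masked β σ as bs))

    -- Parseval in the first sign of the constraint.
    Φ-suc : ∀ {k N} (β : Blocks (suc k) N n) m u →
      Φ β m u ≡ Φ (β ∘ suc) m (even u) + E (unif N) (λ a → Φ (β ∘ suc) (m ·[ β zero a ]) (odd u))
    Φ-suc {k} {N} β m u = trans (E-draws-suc N k _) (trans (E-cong (unif N) step)
      (trans (E-+ (unif N) (λ _ → Φ (β ∘ suc) m (even u)) (λ a → Φ (β ∘ suc) (m ·[ β zero a ]) (odd u)))
        (cong (_+ E (unif N) (λ a → Φ (β ∘ suc) (m ·[ β zero a ]) (odd u))) (E-const (unif N) (Φ (β ∘ suc) m (even u))))))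
      where
      A : Draw N k → ℚ
      A (as , bs) = Eσ (λ σ → m σ * even u (masked (β ∘ suc) σ as bs))
      B : Fin (suc N) → Draw N k → ℚ
      B a (as , bs) = Eσ (λ σ → (m ·[ β zero a ]) σ * odd u (masked (β ∘ suc) σ as bs))
      X : Sign → Fin (suc N) → Draw N k → ℚ
      X s a (as , bs) = Eσ (λ σ → m σ * u (masked β σ (a ∷ as) (s ∷ bs)))
      X≡ : ∀ s a d → X s a d ≡ A d + sg s * B a d
      X≡ s a (as , bs) = trans (E-cong (cubeM n) (λ σ → trans
          (cong (m σ *_) (trans (even+odd u (s Sign.* lookup σ (β zero a)) (masked (β ∘ suc) σ as bs))
            (cong (λ z → even u (masked (β ∘ suc) σ as bs) + z * odd u (masked (β ∘ suc) σ as bs)) (sg-* s (lookup σ (β zero a))))))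
          (lem (m σ) (even u (masked (β ∘ suc) σ as bs)) (sg s) (sg (lookup σ (β zero a))) (odd u (masked (β ∘ suc) σ as bs)))))
        (trans (E-+ (cubeM n) (λ σ → m σ * even u (masked (β ∘ suc) σ as bs)) _)
          (cong (A (as , bs) +_) (E-*ˡ (cubeM n) (sg s) _)))
        where
        lem : ∀ m e s t o → m * (e + s * t * o) ≡ m * e + s * (m * t * o)
        lem = solve-∀ ℚ-ring
      step : ∀ a → ½ * E (draws N k) (λ d → X Sign.+ a d * X Sign.+ a d) + ½ * E (draws N k) (λ d → X Sign.- a d * X Sign.- a d)
                 ≡ E (draws N k) (λ d → A d * A d) + E (draws N k) (λ d → B a d * B a d)
      step a = trans (cong₂ _+_ (sym (E-*ˡ (draws N k) ½ _)) (sym (E-*ˡ (draws N k) ½ _)))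
        (trans (sym (E-+ (draws N k) (λ d → ½ * (X Sign.+ a d * X Sign.+ a d)) (λ d → ½ * (X Sign.- a d * X Sign.- a d))))
        (trans (E-cong (draws N k) (λ d → trans
            (cong₂ (λ x y → ½ * (x * x) + ½ * (y * y)) (X≡ Sign.+ a d) (X≡ Sign.- a d)) (lem (A d) (B a d))))
          (E-+ (draws N k) (λ d → A d * A d) (λ d → B a d * B a d))))
        where
        lem : ∀ x y → ½ * ((x + 1ℚ * y) * (x + 1ℚ * y)) + ½ * ((x + (- 1ℚ) * y) * (x + (- 1ℚ) * y)) ≡ x * x + y * y
        lem = solve-∀ ℚ-ring

    module _ (g : Vec Sign n → ℚ) (g≤1 : ∀ σ → g σ ≤ 1ℚ) (0<x : 0ℚ < Eσ g) where

      -- Splitting off a variable multiplies `m` by its sign, which destroys nonnegativity but not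
      -- the bound by `g`.
      Dominated : (Vec Sign n → ℚ) → Set
      Dominated m = ∀ σ → m σ ≤ g σ × - g σ ≤ m σ

      dominated-· : ∀ {m} → Dominated m → ∀ i → Dominated (m ·[ i ])
      dominated-· {m} d i σ with lookup σ i | d σ
      ... | Sign.+ | m≤g , -g≤m = subst (_≤ g σ) (sym (*-identityʳ (m σ))) m≤g , subst (- g σ ≤_) (sym (*-identityʳ (m σ))) -g≤m
      ... | Sign.- | m≤g , -g≤m = subst₂ _≤_ (lem (m σ)) (lem′ (g σ)) (neg-antimono-≤ -g≤m) ,
                                  subst (- g σ ≤_) (lem (m σ)) (neg-antimono-≤ m≤g)
        where
        lem : ∀ m → - m ≡ m * (- 1ℚ)
        lem = solve-∀ ℚ-ring
        lem′ : ∀ g → - (- g) ≡ g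
        lem′ = solve-∀ ℚ-ring

      module _ (N p : ℕ) {V : ℚ} (0≤V : 0ℚ ≤ V) where

        private
          U = unif N
          K = κ N p (Eσ g)

          bound : ℕ → ℚ
          bound k = two ^ k * (V * K)

          Injective : (Fin (suc N) → Fin n) → Set
          Injective γ = ∀ {a b} → γ a ≡ γ b → a ≡ b

          double : ∀ k {x y} → x ≤ bound k → y ≤ bound k → x + y ≤ bound (suc k)
          double k h h′ = ≤-trans (+-mono-≤ h h′) (≤-reflexive (lem (two ^ k) (V * K)))
            where
            lem : ∀ t v → t * v + t * v ≡ two * t * v
            lem = solve-∀ ℚ-ring

        -- Once two variables are split off, `level-2` applies to them. Further variables are moved
        -- into `m` and averaged outside, so all branches of the recursion end in the same bound,
        -- and each remaining position doubles it.
        Φ-pair : ∀ γ δ → Injective γ → Injective δ → (∀ a b → δ b ≢ γ a) →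
          ∀ {k} (β : Blocks k N n) m → Dominated m → ∀ u → Bounded V u →
          E U (λ a → E U λ b → Φ β (m ·[ γ a ] ·[ δ b ]) u) ≤ bound k
        Φ-pair γ δ γ-inj δ-inj γ≢δ {zero} β m dom u b = begin
          E U (λ a → E U λ b → Φ β (m ·[ γ a ] ·[ δ b ]) u)
            ≡⟨ E-cong U (λ a → trans (E-cong U (λ b → trans (E-draws-zero N _)
                 (trans (cong₂ _*_ (E-*ʳ (cubeM n) (u []) _) (E-*ʳ (cubeM n) (u []) _)) (lem (M a b) (u [])))))
                 (E-*ˡ U (u [] * u []) _)) ⟩
          E U (λ a → u [] * u [] * E U λ b → M a b * M a b)
            ≡⟨ E-*ˡ U (u [] * u []) _ ⟩
          u [] * u [] * E U (λ a → E U λ b → M a b * M a b)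
            ≤⟨ *-mono (0≤sq (u [])) (E-nonneg U (λ a → E-nonneg U (λ b → 0≤sq (M a b)))) (b [])
                 (level-2 γ δ γ-inj δ-inj γ≢δ p g m g≤1 (proj₁ ∘ dom) (proj₂ ∘ dom) 0<x) ⟩
          V * K                  ≡⟨ *-identityˡ (V * K) ⟨
          1ℚ * (V * K) ∎
          where
          open ≤-Reasoning
          M : Fin (suc N) → Fin (suc N) → ℚ
          M a b = Eσ (m ·[ γ a ] ·[ δ b ])
          lem : ∀ m u → m * u * (m * u) ≡ u * u * (m * m)
          lem = solve-∀ ℚ-ring
        Φ-pair γ δ γ-inj δ-inj γ≢δ {suc k} β m dom u b = begin
          E U (λ a → E U λ b → Φ β (m ·[ γ a ] ·[ δ b ]) u)
            ≡⟨ E-cong U (λ a → trans (E-cong U (λ b → Φ-suc β (m ·[ γ a ] ·[ δ b ]) u)) (E-+ U _ _)) ⟩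
          E U (λ a → E U (λ b → Φ (β ∘ suc) (m ·[ γ a ] ·[ δ b ]) (even u)) +
                     E U (λ b → E U λ c → Φ (β ∘ suc) (m ·[ γ a ] ·[ δ b ] ·[ β zero c ]) (odd u)))
            ≡⟨ E-+ U _ _ ⟩
          E U (λ a → E U (λ b → Φ (β ∘ suc) (m ·[ γ a ] ·[ δ b ]) (even u))) +
          E U (λ a → E U (λ b → E U λ c → Φ (β ∘ suc) (m ·[ γ a ] ·[ δ b ] ·[ β zero c ]) (odd u)))
            ≡⟨ cong (E U (λ a → E U (λ b → Φ (β ∘ suc) (m ·[ γ a ] ·[ δ b ]) (even u))) +_)
                 (trans (E-cong U (λ a → E-swap U U _)) (trans (E-swap U U _)
                   (E-cong U (λ c → E-cong U (λ a → E-cong U (λ b → reorder a b c)))))) ⟩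
          E U (λ a → E U (λ b → Φ (β ∘ suc) (m ·[ γ a ] ·[ δ b ]) (even u))) +
          E U (λ c → E U (λ a → E U λ b → Φ (β ∘ suc) (m ·[ β zero c ] ·[ γ a ] ·[ δ b ]) (odd u)))
            ≤⟨ double k (Φ-pair γ δ γ-inj δ-inj γ≢δ (β ∘ suc) m dom (even u) (even-bounded {u = u} b))
                 (E-≤const U (λ c → Φ-pair γ δ γ-inj δ-inj γ≢δ (β ∘ suc) (m ·[ β zero c ]) (dominated-· dom (β zero c)) (odd u) (odd-bounded {u = u} b))) ⟩
          bound (suc k) ∎
          where
          open ≤-Reasoning
          lem : ∀ m x y z → m * x * y * z ≡ m * z * x * y
          lem = solve-∀ ℚ-ring
          reorder : ∀ a b c → Φ (β ∘ suc) (m ·[ γ a ] ·[ δ b ] ·[ β zero c ]) (odd u)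
                            ≡ Φ (β ∘ suc) (m ·[ β zero c ] ·[ γ a ] ·[ δ b ]) (odd u)
          reorder a b c = E-cong (draws N k) (λ (as , bs) → cong₂ _*_ (eq as bs) (eq as bs))
            where
            eq : ∀ as bs → Eσ (λ σ → (m ·[ γ a ] ·[ δ b ] ·[ β zero c ]) σ * odd u (masked (β ∘ suc) σ as bs))
                         ≡ Eσ (λ σ → (m ·[ β zero c ] ·[ γ a ] ·[ δ b ]) σ * odd u (masked (β ∘ suc) σ as bs))
            eq as bs = E-cong (cubeM n) (λ σ → cong (_* odd u (masked (β ∘ suc) σ as bs))
              (lem (m σ) (sg (lookup σ (γ a))) (sg (lookup σ (δ b))) (sg (lookup σ (β zero c)))))

        Distinct : ∀ {k} → Blocks k N n → Set
        Distinct β = ∀ {c c′ a b} → β c a ≡ β c′ b → c ≡ c′ × a ≡ b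

        Φ-vanish : ∀ (β : Blocks 0 N n) m u → E (cubeM 0) u ≡ 0ℚ → Φ β m u ≡ 0ℚ
        Φ-vanish β m u eq = trans (E-draws-zero N _) (trans (cong (λ z → z * z)
          (E-zero (cubeM n) (λ σ → trans (cong (m σ *_) (trans (sym (E-cube-zero u)) eq)) (*-zeroʳ (m σ))))) (*-zeroˡ 0ℚ))

        0≤bound : ∀ k → 0ℚ ≤ bound k
        0≤bound k = 0≤* (^-nonneg k 0≤two) (0≤* 0≤V (0≤* (0≤* 0≤four (0≤* 0≤two (0≤* (0≤C N p) (0≤C N p))))
          (0≤* (<⇒≤ 0<x) (0≤+ (<⇒≤ 0<x) (^-nonneg (suc p) 0≤¼)))))

        -- One variable, from `γ`, is already split off. A second one leads to `Φ-pair`; the branch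
        -- without a second one ends in the mean of `u`, which is 0.
        Φ-single : ∀ γ → Injective γ → ∀ {k} (β : Blocks k N n) → Distinct β → (∀ a c b → β c b ≢ γ a) →
          ∀ m → Dominated m → ∀ u → Bounded V u → E (cubeM k) u ≡ 0ℚ →
          E U (λ a → Φ β (m ·[ γ a ]) u) ≤ bound k
        Φ-single γ γ-inj {zero} β dist γ≢β m dom u b mean = ≤-trans
          (≤-reflexive (E-zero U (λ a → Φ-vanish β (m ·[ γ a ]) u mean))) (0≤bound 0)
        Φ-single γ γ-inj {suc k} β dist γ≢β m dom u b mean = begin
          E U (λ a → Φ β (m ·[ γ a ]) u)
            ≡⟨ trans (E-cong U (λ a → Φ-suc β (m ·[ γ a ]) u)) (E-+ U _ _) ⟩
          E U (λ a → Φ (β ∘ suc) (m ·[ γ a ]) (even u)) +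
          E U (λ a → E U λ c → Φ (β ∘ suc) (m ·[ γ a ] ·[ β zero c ]) (odd u))
            ≤⟨ double k
                 (Φ-single γ γ-inj (β ∘ suc) (λ e → Fin.suc-injective (proj₁ (dist e)) , proj₂ (dist e))
                   (λ a c b → γ≢β a (suc c) b) m dom (even u) (even-bounded {u = u} b) (trans (E-even u) mean))
                 (Φ-pair γ (β zero) γ-inj (proj₂ ∘ dist) (λ a b → γ≢β a zero b) (β ∘ suc) m dom (odd u) (odd-bounded {u = u} b)) ⟩
          bound (suc k) ∎
          where open ≤-Reasoning

        -- Degrees 0 and 1 of `u` vanish, so every surviving branch of the recursion splits off at
        -- least two variables and reaches `Φ-pair`.
        Φ-bound : ∀ {k} (β : Blocks k N n) → Distinct β → ∀ m → Dominated m → ∀ u → Bounded V u →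
          E (cubeM k) u ≡ 0ℚ → (∀ i → E (cubeM k) (λ a → u a * sg (lookup a i)) ≡ 0ℚ) → Φ β m u ≤ bound k
        Φ-bound {zero} β dist m dom u b mean coord = ≤-trans (≤-reflexive (Φ-vanish β m u mean)) (0≤bound 0)
        Φ-bound {suc k} β dist m dom u b mean coord = begin
          Φ β m u
            ≡⟨ Φ-suc β m u ⟩
          Φ (β ∘ suc) m (even u) + E U (λ a → Φ (β ∘ suc) (m ·[ β zero a ]) (odd u))
            ≤⟨ double k
                 (Φ-bound (β ∘ suc) dist′ m dom (even u) (even-bounded {u = u} b) (trans (E-even u) mean)
                   (λ i → trans (E-even-coord u i) (coord (suc i))))
                 (Φ-single (β zero) (proj₂ ∘ dist) (β ∘ suc) dist′ (λ a c b e → Fin.0≢1+n (sym (proj₁ (dist e))))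
                   m dom (odd u) (odd-bounded {u = u} b) (trans (E-odd u) (coord zero))) ⟩
          bound (suc k) ∎
          where
          open ≤-Reasoning
          dist′ : Distinct (β ∘ suc)
          dist′ e = Fin.suc-injective (proj₁ (dist e)) , proj₂ (dist e)

-- The memory of a streaming algorithm

module Memory where

  open FiniteMeans
  open CubeMoments
  open LevelTwo
  open Draws

  -- The concave utility ψ pays for the correlation of the input with the state: the
  -- variance it loses in every step of the uniform stream dominates the linear gain.
  μ eight : ℚ
  μ     = ¼ * ¼ * ½
  eight = two * four

  ψ : ℚ → ℚ
  ψ x = x - μ * (x * x)

  0≤μ : 0ℚ ≤ μ
  0≤μ = nonNegative⁻¹ μ

  ψ≤ : ∀ x → ψ x ≤ x
  ψ≤ x = ≤-by (0≤* 0≤μ (0≤sq x)) (lem x)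
    where
    lem : ∀ x → x ≡ x - μ * (x * x) + μ * (x * x)
    lem = solve-∀ ℚ-ring

  Unit : ℚ → Set
  Unit x = 0ℚ ≤ x × x ≤ 1ℚ

  unit-sq : ∀ {x} → Unit x → x * x ≤ 1ℚ
  unit-sq (p , q) = *-mono p p q q

  ≤ψ+μ : ∀ {x} → Unit x → x ≤ ψ x + μ
  ≤ψ+μ {x} ux = ≤-by (0≤* 0≤μ (0≤-diff (unit-sq ux))) (lem x)
    where
    lem : ∀ x → x - μ * (x * x) + μ ≡ x + μ * (1ℚ - x * x)
    lem = solve-∀ ℚ-ring

  E-unit : ∀ {A : Set} (M : Mean A) {f} → (∀ x → Unit (f x)) → Unit (E M f)
  E-unit M h = E-nonneg M (proj₁ ∘ h) , E-≤const M (proj₂ ∘ h)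

  -- One step: ℓ correlates the draw d with the hidden σ weighted by g.
  module OneStep {n N k : ℕ} (β : Blocks k N n) (dens : Vec Sign k → ℚ)
           (0≤dens : ∀ a → 0ℚ ≤ dens a) (E-dens : E (cubeM k) dens ≡ 1ℚ) where

    private
      M = draws N k

    tilt : Vec Sign n → Draw N k → ℚ
    tilt σ (as , bs) = dens (masked β σ as bs)

    0≤tilt : ∀ σ d → 0ℚ ≤ tilt σ d
    0≤tilt σ (as , bs) = 0≤dens (masked β σ as bs)

    E-tilt : ∀ σ → E M (tilt σ) ≡ 1ℚ
    E-tilt σ = trans (E-draws-masked β σ dens) E-dens

    E-tilt-≤1 : ∀ σ {h : Draw N k → ℚ} → (∀ d → h d ≤ 1ℚ) → E M (λ d → tilt σ d * h d) ≤ 1ℚ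
    E-tilt-≤1 σ {h} b = subst (E M (λ d → tilt σ d * h d) ≤_) (trans (E-cong M (λ d → *-identityʳ (tilt σ d))) (E-tilt σ))
      (E-mono M (λ d → *-monoˡ (0≤tilt σ d) (b d)))

    ℓ : (Vec Sign n → ℚ) → Draw N k → ℚ
    ℓ g (as , bs) = Eσ (λ σ → g σ * (dens (masked β σ as bs) - 1ℚ))

    -- The linear gain is `ℓ * Δψ`, and concavity makes the mean of `Δψ` equal to `-μ` times the
    -- variance of `W`. Since `Δψ` is at most `W - w` in absolute value and `eight` is `1 / (4μ)`,
    -- the arithmetic-geometric mean inequality pays for the gain with this loss and with
    -- `eight * ℓ²`.
    gain-≤ : ∀ g → 0ℚ < Eσ g → ∀ {B} → E M (λ d → ℓ g d * ℓ g d) ≤ B * Eσ g →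
      ∀ W → (∀ d → Unit (W d)) →
      Eσ (λ σ → g σ * E M (λ d → tilt σ d * ψ (W d))) ≤ Eσ g * ψ (E M W) + eight * B
    gain-≤ g 0<x {B} ℓ²≤ W uW = begin
      Eσ (λ σ → g σ * E M (λ d → tilt σ d * ψ (W d)))
        ≡⟨ expand ⟩
      x * ψ w + (E M (λ d → ℓ g d * Δψ d) - x * (μ * E M Δ²))
        ≤⟨ +-monoʳ-≤ (x * ψ w) (*-cancelˡ 0<x (begin
          x * (E M (λ d → ℓ g d * Δψ d) - x * (μ * E M Δ²))
            ≤⟨ diff-0≤ (subst (0ℚ ≤_) total (E-nonneg M pointwise)) ⟩
          eight * E M (λ d → ℓ g d * ℓ g d)
            ≤⟨ *-monoˡ (nonNegative⁻¹ eight) ℓ²≤ ⟩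
          eight * (B * x)
            ≡⟨ lem₀ eight B x ⟩
          x * (eight * B) ∎)) ⟩
      x * ψ w + eight * B ∎
      where
      open ≤-Reasoning
      x = Eσ g
      w = E M W
      uw = E-unit M uW
      Δψ Δ² s : Draw N k → ℚ
      Δψ d = ψ (W d) - ψ w
      Δ² d = (W d - w) * (W d - w)
      s d = 1ℚ - μ * (W d + w)

      lem₀ : ∀ e b x → e * (b * x) ≡ x * (e * b)
      lem₀ = solve-∀ ℚ-ring

      E-Δψ : E M Δψ ≡ - (μ * E M Δ²)
      E-Δψ = trans (trans (E-cong M (λ d → lem (W d) w)) (E-- M (λ d → (1ℚ - two * μ * w) * (W d - w)) (λ d → μ * Δ² d)))
        (trans (cong₂ _-_ (trans (E-*ˡ M (1ℚ - two * μ * w) (λ d → W d - w))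
            (cong ((1ℚ - two * μ * w) *_) (trans (E-- M W (λ _ → w)) (trans (cong (λ z → w - z) (E-const M w)) (+-inverseʳ w)))))
            (E-*ˡ M μ Δ²)) (lem′ (1ℚ - two * μ * w) (μ * E M Δ²)))
        where
        lem : ∀ W w → W - μ * (W * W) - (w - μ * (w * w)) ≡ (1ℚ - two * μ * w) * (W - w) - μ * ((W - w) * (W - w))
        lem = solve-∀ ℚ-ring
        lem′ : ∀ c y → c * 0ℚ - y ≡ - y
        lem′ = solve-∀ ℚ-ring

      expand : Eσ (λ σ → g σ * E M (λ d → tilt σ d * ψ (W d))) ≡ x * ψ w + (E M (λ d → ℓ g d * Δψ d) - x * (μ * E M Δ²))
      expand = trans (E-cong (cubeM n) (λ σ → trans (cong (g σ *_) (inner σ)) (lem₂ (g σ) (ψ w) (E M Δψ) _)))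
        (trans (E-+ (cubeM n) (λ σ → g σ * (ψ w + E M Δψ)) (λ σ → g σ * E M (λ d → (tilt σ d - 1ℚ) * Δψ d)))
        (trans (cong₂ _+_ (trans (E-*ʳ (cubeM n) (ψ w + E M Δψ) g) (cong (λ z → x * (ψ w + z)) E-Δψ)) cross)
          (lem₃ x (ψ w) (μ * E M Δ²) (E M (λ d → ℓ g d * Δψ d)))))
        where
        lem₁ : ∀ t p q → t * p ≡ t * q + (p - q) + (t - 1ℚ) * (p - q)
        lem₁ = solve-∀ ℚ-ring
        lem₂ : ∀ g p e c → g * (p + e + c) ≡ g * (p + e) + g * c
        lem₂ = solve-∀ ℚ-ring
        lem₃ : ∀ x p m c → x * (p + (- m)) + c ≡ x * p + (c - x * m)
        lem₃ = solve-∀ ℚ-ring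
        inner : ∀ σ → E M (λ d → tilt σ d * ψ (W d)) ≡ ψ w + E M Δψ + E M (λ d → (tilt σ d - 1ℚ) * Δψ d)
        inner σ = trans (E-cong M (λ d → lem₁ (tilt σ d) (ψ (W d)) (ψ w)))
          (trans (E-+ M (λ d → tilt σ d * ψ w + Δψ d) (λ d → (tilt σ d - 1ℚ) * Δψ d))
            (cong (_+ E M (λ d → (tilt σ d - 1ℚ) * Δψ d))
              (trans (E-+ M (λ d → tilt σ d * ψ w) Δψ)
                (cong (_+ E M Δψ) (trans (E-*ʳ M (ψ w) (tilt σ)) (trans (cong (_* ψ w) (E-tilt σ)) (*-identityˡ (ψ w))))))))
        cross : Eσ (λ σ → g σ * E M (λ d → (tilt σ d - 1ℚ) * Δψ d)) ≡ E M (λ d → ℓ g d * Δψ d)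
        cross = trans (E-cong (cubeM n) (λ σ → trans (sym (E-*ˡ M (g σ) _)) (E-cong M (λ d → sym (*-assoc (g σ) (tilt σ d - 1ℚ) (Δψ d))))))
          (trans (E-swap (cubeM n) M (λ σ d → g σ * (tilt σ d - 1ℚ) * Δψ d))
            (E-cong M (λ d → E-*ʳ (cubeM n) (Δψ d) (λ σ → g σ * (tilt σ d - 1ℚ)))))

      pointwise : ∀ d → 0ℚ ≤ eight * (ℓ g d * ℓ g d) + μ * (x * x) * Δ² d - x * (ℓ g d * Δψ d)
      pointwise d = subst (0ℚ ≤_) (lem (ℓ g d) x (W d) w)
        (0≤+ (0≤* (nonNegative⁻¹ eight) (0≤sq (ℓ g d - ¼ * ¼ * (x * (W d - w) * s d))))
             (0≤* (0≤* 0≤μ (0≤* (0≤sq x) (0≤sq (W d - w)))) (0≤-diff (unit-sq us))))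
        where
        us : Unit (s d)
        us = 0≤-diff {μ * (W d + w)} {1ℚ} (≤-trans (*-monoˡ 0≤μ (+-mono-≤ (proj₂ (uW d)) (proj₂ uw))) (≤ᵇ⇒≤ _)) ,
             ≤-by {s d} (0≤* 0≤μ (0≤+ (proj₁ (uW d)) (proj₁ uw))) (lem′ (μ * (W d + w)))
          where
          lem′ : ∀ y → 1ℚ ≡ 1ℚ - y + y
          lem′ = solve-∀ ℚ-ring
        lem : ∀ l x W w →
          eight * ((l - ¼ * ¼ * (x * (W - w) * (1ℚ - μ * (W + w)))) * (l - ¼ * ¼ * (x * (W - w) * (1ℚ - μ * (W + w)))))
            + μ * (x * x * ((W - w) * (W - w))) * (1ℚ - (1ℚ - μ * (W + w)) * (1ℚ - μ * (W + w)))
          ≡ eight * (l * l) + μ * (x * x) * ((W - w) * (W - w)) - x * (l * (W - μ * (W * W) - (w - μ * (w * w))))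
        lem = solve-∀ ℚ-ring

      total : E M (λ d → eight * (ℓ g d * ℓ g d) + μ * (x * x) * Δ² d - x * (ℓ g d * Δψ d)) ≡
              eight * E M (λ d → ℓ g d * ℓ g d) - x * (E M (λ d → ℓ g d * Δψ d) - x * (μ * E M Δ²))
      total = trans (E-- M (λ d → eight * (ℓ g d * ℓ g d) + μ * (x * x) * Δ² d) (λ d → x * (ℓ g d * Δψ d)))
        (trans (cong₂ _-_ (trans (E-+ M (λ d → eight * (ℓ g d * ℓ g d)) (λ d → μ * (x * x) * Δ² d))
            (cong₂ _+_ (E-*ˡ M eight (λ d → ℓ g d * ℓ g d)) (E-*ˡ M (μ * (x * x)) Δ²))) (E-*ˡ M x (λ d → ℓ g d * Δψ d)))
          (lem (eight * E M (λ d → ℓ g d * ℓ g d)) x (E M Δ²) (E M (λ d → ℓ g d * Δψ d))))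
        where
        lem : ∀ e x y c → e + μ * (x * x) * y - x * c ≡ e - x * (c - x * (μ * y))
        lem = solve-∀ ℚ-ring

    module Contraction (dist : ∀ {c c′ a b} → β c a ≡ β c′ b → c ≡ c′ × a ≡ b)
             {V : ℚ} (bounded : Bounded V (λ a → dens a - 1ℚ))
             (coord : ∀ i → E (cubeM k) (λ a → (dens a - 1ℚ) * sg (lookup a i)) ≡ 0ℚ)
             (p : ℕ) where

      -- What `Φ-bound` gives apart from the factor `x * (x + θ)`. Dividing by the mass `x` leaves a
      -- bound affine in `x`, which can be added up over the states.
      Λ : ℚ
      Λ = two ^ k * (V * (four * (two * (C N p * C N p))))

      θ : ℚ
      θ = ¼ ^ suc p

      0≤θ : 0ℚ ≤ θ
      0≤θ = ^-nonneg (suc p) 0≤¼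

      0≤V : 0ℚ ≤ V
      0≤V = ≤-trans (0≤sq (dens (Vec.replicate k Sign.+) - 1ℚ)) (bounded (Vec.replicate k Sign.+))

      0≤Λ : 0ℚ ≤ Λ
      0≤Λ = 0≤* (^-nonneg k 0≤two) (0≤* 0≤V (0≤* 0≤four (0≤* 0≤two (0≤* (0≤C N p) (0≤C N p)))))

      state-gain-≤ : ∀ g → (∀ σ → Unit (g σ)) → ∀ W → (∀ d → Unit (W d)) →
        Eσ (λ σ → g σ * E M (λ d → tilt σ d * ψ (W d))) ≤ Eσ g * ψ (E M W) + eight * (Λ * (Eσ g + θ))
      state-gain-≤ g ug W uW with 0<⊎≤0 (Eσ g)
      ... | inj₁ 0<x = gain-≤ g 0<x {Λ * (Eσ g + θ)} (≤-trans
          (Φ-bound g (proj₂ ∘ ug) 0<x N p 0≤V β dist g (λ σ → ≤-refl , -g≤g σ) _ bounded mean coord)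
          (≤-reflexive (lem (two ^ k) V (four * (two * (C N p * C N p))) (Eσ g) θ))) W uW
        where
        lem : ∀ t v c x θ → t * (v * (c * (x * (x + θ)))) ≡ t * (v * c) * (x + θ) * x
        lem = solve-∀ ℚ-ring
        -g≤g : ∀ σ → - g σ ≤ g σ
        -g≤g σ = ≤-trans (neg-antimono-≤ (proj₁ (ug σ))) (proj₁ (ug σ))
        mean : E (cubeM k) (λ a → dens a - 1ℚ) ≡ 0ℚ
        mean = trans (E-- (cubeM k) dens (λ _ → 1ℚ)) (cong₂ _-_ E-dens (E-const (cubeM k) 1ℚ))
      -- A state that is never reached: its weight vanishes in the mean, while the right-hand side
      -- is nonnegative.
      ... | inj₂ x≤0 = begin
        Eσ (λ σ → g σ * E M (λ d → tilt σ d * ψ (W d)))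
          ≤⟨ E-mono (cubeM n) (λ σ → *-monoˡ (proj₁ (ug σ)) (E-tilt-≤1 σ {λ d → ψ (W d)} (λ d → ≤-trans (ψ≤ (W d)) (proj₂ (uW d))))) ⟩
        Eσ (λ σ → g σ * 1ℚ)
          ≡⟨ trans (E-*ʳ (cubeM n) 1ℚ g) (trans (cong (_* 1ℚ) x≡0) (*-zeroˡ 1ℚ)) ⟩
        0ℚ
          ≤⟨ 0≤+ (≤-reflexive (sym (trans (cong (_* ψ (E M W)) x≡0) (*-zeroˡ (ψ (E M W))))))
               (0≤* (nonNegative⁻¹ eight) (0≤* 0≤Λ (0≤+ 0≤x 0≤θ))) ⟩
        Eσ g * ψ (E M W) + eight * (Λ * (Eσ g + θ)) ∎
        where
        open ≤-Reasoning
        0≤x = E-nonneg (cubeM n) (proj₁ ∘ ug)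
        x≡0 : Eσ g ≡ 0ℚ
        x≡0 = ≤-antisym x≤0 0≤x

      module Process {Z : Set} (zs : List Z) (δ : Z → Z → ℚ) (uδ : ∀ x y → Unit (δ x y))
               (∑-δ : ∀ x (h : Z → ℚ) → ∑ zs (λ z → δ x z * h z) ≡ h x)
               (small : ∑ zs (λ _ → θ) ≤ 1ℚ)
               (S : Z → Draw N k → Z) (v : Z → ℚ) (uv : ∀ z → Unit (v z)) where

        uniform : ℕ → Z → ℚ
        uniform zero    z = v z
        uniform (suc t) z = E M λ d → uniform t (S z d)

        -- Planted draws enter only through their density `tilt σ` relative to uniform draws; as it
        -- has mean 1, this is an expectation given `σ`.
        planted : (Z → ℚ) → ℕ → Vec Sign n → Z → ℚ
        planted h zero    σ z = h z
        planted h (suc t) σ z = E M λ d → tilt σ d * planted h t σ (S z d)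

        uniform-unit : ∀ t z → Unit (uniform t z)
        uniform-unit zero    z = uv z
        uniform-unit (suc t) z = E-unit M (λ d → uniform-unit t (S z d))

        planted-mono : ∀ {h h′} → (∀ z → h z ≤ h′ z) → ∀ t σ z → planted h t σ z ≤ planted h′ t σ z
        planted-mono le zero    σ z = le z
        planted-mono le (suc t) σ z = E-mono M (λ d → *-monoˡ (0≤tilt σ d) (planted-mono le t σ (S z d)))

        planted-+const : ∀ h c t σ z → planted (λ z → h z + c) t σ z ≡ planted h t σ z + c
        planted-+const h c zero    σ z = refl
        planted-+const h c (suc t) σ z = trans
          (E-cong M (λ d → trans (cong (tilt σ d *_) (planted-+const h c t σ (S z d))) (*-distribˡ-+ (tilt σ d) _ c)))
          (trans (E-+ M (λ d → tilt σ d * planted h t σ (S z d)) (λ d → tilt σ d * c))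
            (cong (planted h (suc t) σ z +_) (trans (E-*ʳ M c (tilt σ)) (trans (cong (_* c) (E-tilt σ)) (*-identityˡ c)))))

        private
          record Weights (G : Z → Vec Sign n → ℚ) : Set where
            field
              nonneg : ∀ z σ → 0ℚ ≤ G z σ
              total  : ∀ σ → ∑ zs (λ z → G z σ) ≡ 1ℚ

            unit : ∀ z σ → Unit (G z σ)
            unit z σ = nonneg z σ , subst₂ _≤_ (∑-δ z (λ z → G z σ)) (total σ)
              (∑-mono zs (λ z′ → subst (δ z z′ * G z′ σ ≤_) (*-identityˡ (G z′ σ)) (*-monoʳ (nonneg z′ σ) (proj₂ (uδ z z′)))))

          next : (Z → Vec Sign n → ℚ) → Z → Vec Sign n → ℚ
          next G z′ σ = ∑ zs λ z → G z σ * E M (λ d → tilt σ d * δ (S z d) z′)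

          -- Pushing weights forward through one planted step is adjoint to pulling a function of
          -- the state back through it.
          transfer : ∀ G σ h → ∑ zs (λ z′ → next G z′ σ * h z′) ≡ ∑ zs (λ z → G z σ * E M (λ d → tilt σ d * h (S z d)))
          transfer G σ h = begin
            ∑ zs (λ z′ → next G z′ σ * h z′)
              ≡⟨ ∑-cong zs (λ z′ → trans (*-comm (next G z′ σ) (h z′)) (sym (∑-*ˡ zs (h z′) _))) ⟩
            ∑ zs (λ z′ → ∑ zs λ z → h z′ * (G z σ * E M (λ d → tilt σ d * δ (S z d) z′)))
              ≡⟨ ∑-swap zs zs _ ⟩
            ∑ zs (λ z → ∑ zs λ z′ → h z′ * (G z σ * E M (λ d → tilt σ d * δ (S z d) z′)))
              ≡⟨ ∑-cong zs (λ z → trans (∑-cong zs (λ z′ → trans (lem (h z′) (G z σ) _) (cong (G z σ *_) (sym (E-*ʳ M (h z′) _)))))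
                   (∑-*ˡ zs (G z σ) _)) ⟩
            ∑ zs (λ z → G z σ * ∑ zs λ z′ → E M (λ d → tilt σ d * δ (S z d) z′ * h z′))
              ≡⟨ ∑-cong zs (λ z → cong (G z σ *_) (trans (sym (E-∑ M zs (λ d z′ → tilt σ d * δ (S z d) z′ * h z′)))
                   (E-cong M (λ d → trans (∑-cong zs (λ z′ → *-assoc (tilt σ d) (δ (S z d) z′) (h z′)))
                     (trans (∑-*ˡ zs (tilt σ d) _) (cong (tilt σ d *_) (∑-δ (S z d) h))))))) ⟩
            ∑ zs (λ z → G z σ * E M (λ d → tilt σ d * h (S z d))) ∎
            where
            open ≡-Reasoning
            lem : ∀ h g e → h * (g * e) ≡ g * (e * h)
            lem = solve-∀ ℚ-ring

          next-weights : ∀ {G} → Weights G → Weights (next G)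
          next-weights {G} w = record
            { nonneg = λ z′ σ → ∑-nonneg zs (λ z → 0≤* (nonneg z σ) (E-nonneg M (λ d → 0≤* (0≤tilt σ d) (proj₁ (uδ (S z d) z′)))))
            ; total  = λ σ → trans (∑-cong zs (λ z′ → sym (*-identityʳ (next G z′ σ)))) (trans (transfer G σ (λ _ → 1ℚ))
                (trans (∑-cong zs (λ z → trans (cong (G z σ *_) (trans (E-cong M (λ d → *-identityʳ (tilt σ d))) (E-tilt σ))) (*-identityʳ (G z σ))))
                  (total σ)))
            }
            where open Weights w

          -- Over all states the masses Eσ (G z) add up to 1.
          main : ∀ t G → Weights G → Eσ (λ σ → ∑ zs λ z → G z σ * planted (ψ ∘ v) t σ z) ≤
            Eσ (λ σ → ∑ zs λ z → G z σ * ψ (uniform t z)) + ι t * (eight * (Λ * two))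
          main zero G w = ≤-reflexive (sym (trans (cong (λ z → X + z * (eight * (Λ * two))) ιℤ-0) (lem X (eight * (Λ * two)))))
            where
            X = Eσ (λ σ → ∑ zs λ z → G z σ * ψ (v z))
            lem : ∀ x y → x + 0ℚ * y ≡ x
            lem = solve-∀ ℚ-ring
          main (suc t) G w = begin
            Eσ (λ σ → ∑ zs λ z → G z σ * E M (λ d → tilt σ d * planted (ψ ∘ v) t σ (S z d)))
              ≡⟨ E-cong (cubeM n) (λ σ → sym (transfer G σ (planted (ψ ∘ v) t σ))) ⟩
            Eσ (λ σ → ∑ zs λ z → next G z σ * planted (ψ ∘ v) t σ z)
              ≤⟨ main t (next G) (next-weights w) ⟩
            Eσ (λ σ → ∑ zs λ z → next G z σ * ψ (uniform t z)) + rest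
              ≡⟨ cong (_+ rest) (trans (E-cong (cubeM n) (λ σ → transfer G σ (ψ ∘ uniform t))) (E-∑ (cubeM n) zs _)) ⟩
            ∑ zs (λ z → Eσ (λ σ → G z σ * E M (λ d → tilt σ d * ψ (uniform t (S z d))))) + rest
              ≤⟨ +-monoˡ-≤ rest (∑-mono zs (λ z → state-gain-≤ (G z) (unit z) (λ d → uniform t (S z d)) (λ d → uniform-unit t (S z d)))) ⟩
            ∑ zs (λ z → Eσ (G z) * ψ (uniform (suc t) z) + eight * (Λ * (Eσ (G z) + θ))) + rest
              ≡⟨ cong (_+ rest) (trans (∑-+ zs (λ z → Eσ (G z) * ψ (uniform (suc t) z)) (λ z → eight * (Λ * (Eσ (G z) + θ))))
                   (cong₂ _+_ (trans (∑-cong zs (λ z → sym (E-*ʳ (cubeM n) (ψ (uniform (suc t) z)) (G z)))) (sym (E-∑ (cubeM n) zs _)))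
                     (trans (∑-*ˡ zs eight _) (cong (eight *_) (∑-*ˡ zs Λ (λ z → Eσ (G z) + θ)))))) ⟩
            Y + eight * (Λ * ∑ zs (λ z → Eσ (G z) + θ)) + rest
              ≤⟨ +-monoˡ-≤ rest (+-monoʳ-≤ Y (*-monoˡ (nonNegative⁻¹ eight) (*-monoˡ 0≤Λ mass))) ⟩
            Y + eight * (Λ * two) + rest
              ≡⟨ trans (lem Y (eight * (Λ * two)) (ι t)) (cong (λ z → Y + z * (eight * (Λ * two))) (sym (ι-suc t))) ⟩
            Y + ι (suc t) * (eight * (Λ * two)) ∎
            where
            open ≤-Reasoning
            open Weights w
            rest = ι t * (eight * (Λ * two))
            Y = Eσ (λ σ → ∑ zs λ z → G z σ * ψ (uniform (suc t) z))
            lem : ∀ y c i → y + c + i * c ≡ y + (1ℚ + i) * c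
            lem = solve-∀ ℚ-ring
            mass : ∑ zs (λ z → Eσ (G z) + θ) ≤ two
            mass = ≤-trans (≤-reflexive (∑-+ zs (λ z → Eσ (G z)) (λ _ → θ))) (+-mono-≤ (≤-reflexive
              (trans (sym (E-∑ (cubeM n) zs (λ σ z → G z σ))) (trans (E-cong (cubeM n) total) (E-const (cubeM n) 1ℚ)))) small)

        -- Passing from `v` to `ψ ∘ v` costs at most `μ` under the planted stream, and passing back
        -- under the uniform one is free, as `ψ x ≤ x`. At the start all weight lies on `z₀`,
        -- whatever `σ` is.
        planted-≤-uniform : ∀ t z₀ → Eσ (λ σ → planted v t σ z₀) ≤ uniform t z₀ + μ + ι t * (eight * (Λ * two))
        planted-≤-uniform t z₀ = begin
          Eσ (λ σ → planted v t σ z₀)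
            ≤⟨ E-mono (cubeM n) (λ σ → ≤-trans (planted-mono (λ z → ≤ψ+μ (uv z)) t σ z₀) (≤-reflexive (planted-+const (ψ ∘ v) μ t σ z₀))) ⟩
          Eσ (λ σ → planted (ψ ∘ v) t σ z₀ + μ)
            ≡⟨ trans (E-+ (cubeM n) (λ σ → planted (ψ ∘ v) t σ z₀) (λ _ → μ)) (cong₂ _+_
                 (E-cong (cubeM n) (λ σ → sym (∑-δ z₀ (planted (ψ ∘ v) t σ)))) (E-const (cubeM n) μ)) ⟩
          Eσ (λ σ → ∑ zs λ z → δ z₀ z * planted (ψ ∘ v) t σ z) + μ
            ≤⟨ +-monoˡ-≤ μ (main t (λ z _ → δ z₀ z) (record
                 { nonneg = λ z _ → proj₁ (uδ z₀ z)
                 ; total = λ _ → trans (∑-cong zs (λ z → sym (*-identityʳ (δ z₀ z)))) (∑-δ z₀ (λ _ → 1ℚ)) })) ⟩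
          Eσ (λ _ → ∑ zs λ z → δ z₀ z * ψ (uniform t z)) + rest + μ
            ≡⟨ cong (λ x → x + rest + μ) (trans (E-const (cubeM n) _) (∑-δ z₀ (ψ ∘ uniform t))) ⟩
          ψ (uniform t z₀) + rest + μ
            ≤⟨ +-monoˡ-≤ μ (+-monoˡ-≤ rest (ψ≤ (uniform t z₀))) ⟩
          uniform t z₀ + rest + μ
            ≡⟨ lem (uniform t z₀) rest μ ⟩
          uniform t z₀ + μ + rest ∎
          where
          open ≤-Reasoning
          rest = ι t * (eight * (Λ * two))
          lem : ∀ a b c → a + b + c ≡ a + c + b
          lem = solve-∀ ℚ-ring

-- Symmetric predicates and balanced weights

module SymmetricPredicates where

  open FiniteMeans
  open CubeMoments
  open LevelTwo
  open Draws

  ind : Bool → ℚ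
  ind true  = 1ℚ
  ind false = 0ℚ

  0≤ind : ∀ b → 0ℚ ≤ ind b
  0≤ind true  = 0≤1
  0≤ind false = ≤-refl

  ind≤1 : ∀ b → ind b ≤ 1ℚ
  ind≤1 true  = ≤-refl
  ind≤1 false = 0≤1

  ind-∧ : ∀ b c → ind (b ∧ c) ≡ ind b * ind c
  ind-∧ true  c = sym (*-identityˡ (ind c))
  ind-∧ false c = sym (*-zeroˡ (ind c))

  ι-count : ∀ {A : Set} (P : A → Bool) xs → ι (count P xs) ≡ ∑ (List⁺.toList xs) (ind ∘ P)
  ι-count P xs = go (List⁺.toList xs)
    where
    go : ∀ xs → ι (List.length (List.filterᵇ P xs)) ≡ ∑ xs (ind ∘ P)
    go []       = ιℤ-0
    go (x ∷ xs) with P x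
    ... | true  = trans (ι-suc _) (cong (1ℚ +_) (go xs))
    ... | false = trans (go xs) (sym (+-identityˡ _))

  module _ {A : Set} (_≟ᴬ_ : DecidableEquality A) where

    δ : A → A → ℚ
    δ x y = ind (does (x ≟ᴬ y))

    δ-yes : ∀ {x y} → x ≡ y → δ x y ≡ 1ℚ
    δ-yes {x} {y} eq with x ≟ᴬ y
    ... | yes _ = refl
    ... | no ne = ⊥-elim (ne eq)

    δ-no : ∀ {x y} → x ≢ y → δ x y ≡ 0ℚ
    δ-no {x} {y} ne with x ≟ᴬ y
    ... | yes eq = ⊥-elim (ne eq)
    ... | no _   = refl

  δⱽ : ∀ {A : Set} (_≟ᴬ_ : DecidableEquality A) {n} → Vec A n → Vec A n → ℚ
  δⱽ _≟ᴬ_ = δ (Vec.≡-dec _≟ᴬ_)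

  δ-∷ : ∀ {A : Set} (_≟ᴬ_ : DecidableEquality A) {n} x y (a b : Vec A n) →
    δⱽ _≟ᴬ_ (x ∷ a) (y ∷ b) ≡ δ _≟ᴬ_ x y * δⱽ _≟ᴬ_ a b
  δ-∷ _≟ᴬ_ x y a b = ind-∧ (does (x ≟ᴬ y)) (does (Vec.≡-dec _≟ᴬ_ a b))

  δˢ : ∀ {n} → Vec Sign n → Vec Sign n → ℚ
  δˢ = δⱽ Sign._≟_

  E-δ : ∀ n a h → two ^ n * E (cubeM n) (λ b → δˢ a b * h b) ≡ h a
  E-δ zero    [] h = trans (cong (1ℚ *_) (trans (E-cube-zero _) (*-identityˡ (h [])))) (*-identityˡ (h []))
  E-δ (suc n) (x ∷ a) h = trans (cong (two * two ^ n *_) (E-cube-suc n (λ b → δˢ (x ∷ a) b * h b))) (go x)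
    where
    open ≡-Reasoning
    term : ∀ x y → E (cubeM n) (λ b → δˢ (x ∷ a) (y ∷ b) * h (y ∷ b)) ≡ δ Sign._≟_ x y * E (cubeM n) (λ b → δˢ a b * h (y ∷ b))
    term x y = trans (E-cong (cubeM n) (λ b → trans (cong (_* h (y ∷ b)) (δ-∷ Sign._≟_ x y a b)) (*-assoc (δ Sign._≟_ x y) (δˢ a b) (h (y ∷ b)))))
      (E-*ˡ (cubeM n) (δ Sign._≟_ x y) _)
    lem₊ : ∀ t e e′ → two * t * (½ * (1ℚ * e) + ½ * (0ℚ * e′)) ≡ t * e
    lem₊ = solve-∀ ℚ-ring
    lem₋ : ∀ t e e′ → two * t * (½ * (0ℚ * e) + ½ * (1ℚ * e′)) ≡ t * e′
    lem₋ = solve-∀ ℚ-ring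
    go : ∀ x → two * two ^ n * (½ * E (cubeM n) (λ b → δˢ (x ∷ a) (Sign.+ ∷ b) * h (Sign.+ ∷ b)) +
                                ½ * E (cubeM n) (λ b → δˢ (x ∷ a) (Sign.- ∷ b) * h (Sign.- ∷ b))) ≡ h (x ∷ a)
    go Sign.+ = trans (cong₂ (λ u v → two * two ^ n * (½ * u + ½ * v)) (term Sign.+ Sign.+) (term Sign.+ Sign.-))
      (trans (lem₊ (two ^ n) (E (cubeM n) (λ b → δˢ a b * h (Sign.+ ∷ b))) (E (cubeM n) (λ b → δˢ a b * h (Sign.- ∷ b)))) (E-δ n a (λ b → h (Sign.+ ∷ b))))
    go Sign.- = trans (cong₂ (λ u v → two * two ^ n * (½ * u + ½ * v)) (term Sign.- Sign.+) (term Sign.- Sign.-))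
      (trans (lem₋ (two ^ n) (E (cubeM n) (λ b → δˢ a b * h (Sign.+ ∷ b))) (E (cubeM n) (λ b → δˢ a b * h (Sign.- ∷ b)))) (E-δ n a (λ b → h (Sign.- ∷ b))))

  0<two^ : ∀ n → 0ℚ < two ^ n
  0<two^ n = ^-pos n (positive⁻¹ two)

  δ≤1 : ∀ {n} (a b : Vec Sign n) → δˢ a b ≤ 1ℚ
  δ≤1 a b = ind≤1 (does (Vec.≡-dec Sign._≟_ a b))

  point≤mean : ∀ {n} {h : Vec Sign n → ℚ} → (∀ a → 0ℚ ≤ h a) → ∀ a → h a ≤ two ^ n * E (cubeM n) h
  point≤mean {n} {h} 0≤h a = subst (_≤ two ^ n * E (cubeM n) h) (E-δ n a h)
    (*-monoˡ (<⇒≤ (0<two^ n)) (E-mono (cubeM n) (λ b → subst (δˢ a b * h b ≤_) (*-identityˡ (h b)) (*-monoʳ (0≤h b) (δ≤1 a b)))))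

  -- The Kronecker symbol writes `g (φ a)` as a sum over `b`; for fixed `b` it singles out the only
  -- `a` that `φ` maps to `b`.
  E-bijection : ∀ {n} (φ φ⁻¹ : Vec Sign n → Vec Sign n) → (∀ a → φ⁻¹ (φ a) ≡ a) → (∀ a → φ (φ⁻¹ a) ≡ a) →
    ∀ g → E (cubeM n) (g ∘ φ) ≡ E (cubeM n) g
  E-bijection {n} φ φ⁻¹ l r g = begin
    E M (λ a → g (φ a))
      ≡⟨ E-cong M (λ a → E-δ n (φ a) g) ⟨
    E M (λ a → two ^ n * E M (λ b → δˢ (φ a) b * g b))
      ≡⟨ trans (E-*ˡ M (two ^ n) _) (cong (two ^ n *_) (E-swap M M (λ a b → δˢ (φ a) b * g b))) ⟩
    two ^ n * E M (λ b → E M (λ a → δˢ (φ a) b * g b))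
      ≡⟨ E-*ˡ M (two ^ n) _ ⟨
    E M (λ b → two ^ n * E M (λ a → δˢ (φ a) b * g b))
      ≡⟨ E-cong M (λ b → cong (two ^ n *_) (E-cong M (λ a → cong (_* g b) (adjoint a b)))) ⟩
    E M (λ b → two ^ n * E M (λ a → δˢ (φ⁻¹ b) a * g b))
      ≡⟨ E-cong M (λ b → E-δ n (φ⁻¹ b) (λ _ → g b)) ⟩
    E M g ∎
    where
    open ≡-Reasoning
    M = cubeM n
    adjoint : ∀ a b → δˢ (φ a) b ≡ δˢ (φ⁻¹ b) a
    adjoint a b with Vec.≡-dec Sign._≟_ (φ a) b
    ... | yes refl = sym (δ-yes (Vec.≡-dec Sign._≟_) (l a))
    ... | no ne    = sym (δ-no (Vec.≡-dec Sign._≟_) (λ eq → ne (trans (cong φ (sym eq)) (r b))))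

  permute : ∀ {n} → Permutation′ n → Vec Sign n → Vec Sign n
  permute π a = tabulate λ i → lookup a (π ⟨$⟩ʳ i)

  E-permute : ∀ {n} (π : Permutation′ n) g → E (cubeM n) (g ∘ permute π) ≡ E (cubeM n) g
  E-permute π g = E-bijection (permute π) (λ a → tabulate λ i → lookup a (π ⟨$⟩ˡ i))
    (λ a → trans (Vec.tabulate-cong (λ i → trans (Vec.lookup∘tabulate _ (π ⟨$⟩ˡ i)) (cong (lookup a) (Perm.inverseʳ π)))) (Vec.tabulate∘lookup a))
    (λ a → trans (Vec.tabulate-cong (λ i → trans (Vec.lookup∘tabulate _ (π ⟨$⟩ʳ i)) (cong (lookup a) (Perm.inverseˡ π)))) (Vec.tabulate∘lookup a)) g

  transpose-at : ∀ {n} (i j : Fin n) → Perm.transpose i j ⟨$⟩ʳ i ≡ j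
  transpose-at i j with i Fin.≟ i
  ... | yes _ = refl
  ... | no ne = ⊥-elim (ne refl)

  tot : ∀ {k} → Vec Sign k → ℚ
  tot a = sum λ i → sg (lookup a i)

  tot-permute : ∀ {k} (π : Permutation′ k) a → tot (permute π a) ≡ tot a
  tot-permute π a = trans (sum-cong-≗ (λ i → cong sg (Vec.lookup∘tabulate (λ i → lookup a (π ⟨$⟩ʳ i)) i))) (sym (sum-permute (λ i → sg (lookup a i)) π))

  tot-integer : ∀ {k} (a : Vec Sign k) → ∃ λ i → tot a ≡ ιℤ i
  tot-integer []           = pos 0 , sym ιℤ-0
  tot-integer (s ∷ a) with sg-integer s | tot-integer a
    where
    sg-integer : ∀ s → ∃ λ i → sg s ≡ ιℤ i
    sg-integer Sign.+ = pos 1 , sym ιℤ-1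
    sg-integer Sign.- = ℤ.- pos 1 , sym (ιℤ-/1 (ℤ.- pos 1))
  ... | i , p | j , q = i ℤ.+ j , trans (cong₂ _+_ p q) (sym (ιℤ-+ i j))

  E-sum : ∀ {A : Set} (M : Mean A) {n} (f : A → Fin n → ℚ) → E M (λ x → sum (f x)) ≡ sum (λ i → E M (λ x → f x i))
  E-sum M {zero}  f = E-const M 0ℚ
  E-sum M {suc n} f = trans (E-+ M (λ x → f x zero) (λ x → sum (λ i → f x (suc i)))) (cong (E M (λ x → f x zero) +_) (E-sum M (λ x i → f x (suc i))))

  sum-const : ∀ n c → sum {n} (λ _ → c) ≡ ι n * c
  sum-const zero    c = sym (trans (cong (_* c) ιℤ-0) (*-zeroˡ c))
  sum-const (suc n) c = trans (cong (c +_) (sum-const n c)) (trans (lem (ι n) c) (cong (_* c) (sym (ι-suc n))))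
    where
    lem : ∀ i c → c + i * c ≡ (1ℚ + i) * c
    lem = solve-∀ ℚ-ring

  *-sum : ∀ c {n} (f : Fin n → ℚ) → c * sum f ≡ sum (λ i → c * f i)
  *-sum c {zero}  f = *-zeroʳ c
  *-sum c {suc n} f = trans (*-distribˡ-+ c (f zero) _) (cong (c * f zero +_) (*-sum c (f ∘ suc)))

  coords-equal : ∀ {k} (h : Vec Sign k → ℚ) → (∀ π a → h (permute π a) ≡ h a) → ∀ i j →
    E (cubeM k) (λ a → h a * sg (lookup a i)) ≡ E (cubeM k) (λ a → h a * sg (lookup a j))
  coords-equal {k} h inv i j = trans (sym (E-permute π (λ a → h a * sg (lookup a i))))
    (E-cong (cubeM k) (λ a → cong₂ _*_ (inv π a) (cong sg (trans (Vec.lookup∘tabulate (λ i → lookup a (π ⟨$⟩ʳ i)) i) (cong (lookup a) (transpose-at i j))))))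
    where π = Perm.transpose i j

  coords-sum : ∀ {k} (h : Vec Sign k → ℚ) → (∀ π a → h (permute π a) ≡ h a) → ∀ i →
    E (cubeM k) (λ a → h a * tot a) ≡ ι k * E (cubeM k) (λ a → h a * sg (lookup a i))
  coords-sum {k} h inv i = trans (E-cong (cubeM k) (λ a → *-sum (h a) (λ j → sg (lookup a j))))
    (trans (E-sum (cubeM k) (λ a j → h a * sg (lookup a j)))
      (trans (sum-cong-≗ (λ j → coords-equal h inv j i)) (sum-const k _)))

  -- The weights w balance the satisfying assignments of positive total against those of
  -- negative total, so they vanish exactly if one of the two kinds is missing.
  module Balance {k} (f : Predicate k) (sym-f : Symmetric f) where

    private
      M = cubeM k

    t⁺ t⁻ : Vec Sign k → ℚ
    t⁺ a = ind (f a) * (tot a ⊔ 0ℚ)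
    t⁻ a = ind (f a) * (- tot a ⊔ 0ℚ)

    P N : ℚ
    P = E M t⁺
    N = E M t⁻

    -- The masses are crossed: points of negative total carry `P` and points of positive total carry
    -- `N`, so that both sides contribute `P * N` to the mean total, with opposite signs.
    scale : ∀ {x} → Tri (x < 0ℚ) (x ≡ 0ℚ) (0ℚ < x) → ℚ
    scale (tri< _ _ _) = P
    scale (tri≈ _ _ _) = 1ℚ
    scale (tri> _ _ _) = N

    w : Vec Sign k → ℚ
    w a = ind (f a) * scale (<-cmp (tot a) 0ℚ)

    0≤t⁺ : ∀ a → 0ℚ ≤ t⁺ a
    0≤t⁺ a = 0≤* (0≤ind (f a)) (p≤q⊔p (tot a) 0ℚ)

    0≤t⁻ : ∀ a → 0ℚ ≤ t⁻ a
    0≤t⁻ a = 0≤* (0≤ind (f a)) (p≤q⊔p (- tot a) 0ℚ)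

    0≤w : ∀ a → 0ℚ ≤ w a
    0≤w a with <-cmp (tot a) 0ℚ
    ... | tri< _ _ _ = 0≤* (0≤ind (f a)) (E-nonneg M 0≤t⁺)
    ... | tri≈ _ _ _ = 0≤* (0≤ind (f a)) 0≤1
    ... | tri> _ _ _ = 0≤* (0≤ind (f a)) (E-nonneg M 0≤t⁻)

    w-permute : ∀ π a → w (permute π a) ≡ w a
    w-permute π a = cong₂ (λ b t → ind b * scale (<-cmp t 0ℚ)) (sym-f π a) (tot-permute π a)

    w-tot : ∀ a → w a * tot a ≡ N * t⁺ a - P * t⁻ a
    w-tot a with <-cmp (tot a) 0ℚ
    ... | tri< lt _ _ = trans (lem (ind (f a)) P N (tot a)) (cong₂ (λ x y → N * (ind (f a) * x) - P * (ind (f a) * y))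
            (sym (p≤q⇒p⊔q≡q (<⇒≤ lt))) (sym (p≥q⇒p⊔q≡p (neg-antimono-≤ (<⇒≤ lt)))))
      where
      lem : ∀ i P N t → i * P * t ≡ N * (i * 0ℚ) - P * (i * (- t))
      lem = solve-∀ ℚ-ring
    ... | tri≈ _ eq _ rewrite eq = lem (ind (f a)) P N
      where
      lem : ∀ i P N → i * 1ℚ * 0ℚ ≡ N * (i * 0ℚ) - P * (i * 0ℚ)
      lem = solve-∀ ℚ-ring
    ... | tri> _ _ gt = trans (lem (ind (f a)) P N (tot a)) (cong₂ (λ x y → N * (ind (f a) * x) - P * (ind (f a) * y))
            (sym (p≥q⇒p⊔q≡p (<⇒≤ gt))) (sym (p≤q⇒p⊔q≡q (neg-antimono-≤ (<⇒≤ gt)))))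
      where
      lem : ∀ i P N t → i * N * t ≡ N * (i * t) - P * (i * 0ℚ)
      lem = solve-∀ ℚ-ring

    E-w-tot : E M (λ a → w a * tot a) ≡ 0ℚ
    E-w-tot = trans (E-cong M w-tot) (trans (E-- M (λ a → N * t⁺ a) (λ a → P * t⁻ a))
      (trans (cong₂ _-_ (E-*ˡ M N t⁺) (E-*ˡ M P t⁻)) (lem P N)))
      where
      lem : ∀ P N → N * P - P * N ≡ 0ℚ
      lem = solve-∀ ℚ-ring

    -- By symmetry all coordinates have the same mean, and these means add up to the mean total.
    E-w-coord : ∀ i → E M (λ a → w a * sg (lookup a i)) ≡ 0ℚ
    E-w-coord i = ι*-zero i (trans (sym (coords-sum w w-permute i)) E-w-tot)
      where
      ι*-zero : ∀ {n} (i : Fin n) {x} → ι n * x ≡ 0ℚ → x ≡ 0ℚ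
      ι*-zero {suc n} i {x} eq = ≤-antisym
        (*-cancelˡ (0<ιsuc n) (≤-reflexive (trans eq (sym (*-zeroʳ (ι (suc n)))))))
        (*-cancelˡ (0<ιsuc n) (≤-reflexive (trans (*-zeroʳ (ι (suc n))) (sym eq))))

    OneSided : Sign → Set
    OneSided s = ∀ a → f a ≡ true → 1ℚ ≤ sg s * tot a

    private
      0<⇒1≤ : ∀ (a : Vec Sign k) → 0ℚ < tot a → 1ℚ ≤ tot a
      0<⇒1≤ a 0<t with tot-integer a
      ... | i , eq = subst₂ _≤_ ιℤ-1 (sym eq) (ιℤ-mono (ℤ.i<j⇒suc[i]≤j (ℤ.≰⇒> λ i≤0 →
            <-irrefl refl (<-≤-trans 0<t (subst₂ _≤_ (sym eq) ιℤ-0 (ιℤ-mono i≤0))))))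

      <0⇒1≤ : ∀ (a : Vec Sign k) → tot a < 0ℚ → 1ℚ ≤ - tot a
      <0⇒1≤ a t<0 with tot-integer a
      ... | i , eq = subst (1ℚ ≤_) (cong -_ (sym eq)) (subst (_≤ - ιℤ i) (lem 1ℚ) (neg-antimono-≤
          (subst (ιℤ i ≤_) (ιℤ-/1 (ℤ.- pos 1)) (ιℤ-mono (ℤ.i<j⇒i≤pred[j] {j = pos 0} (ℤ.≰⇒> λ 0≤i →
            <-irrefl refl (<-≤-trans t<0 (subst₂ _≤_ ιℤ-0 (sym eq) (ιℤ-mono 0≤i)))))))))
        where
        lem : ∀ x → - (- x) ≡ x
        lem = solve-∀ ℚ-ring

    -- A nonnegative weight without positive mean vanishes. Satisfying points of total 0 would have
    -- weight 1. If `P` is positive it excludes satisfying points of negative total; otherwise there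
    -- are none of positive total. Totals are integers, so nonzero ones have absolute value at least
    -- 1.
    one-sided : E M w ≤ 0ℚ → ∃ OneSided
    one-sided Ew≤0 with 0<⊎≤0 P
    ... | inj₁ 0<P = Sign.+ , λ a fa → subst (1ℚ ≤_) (sym (*-identityˡ (tot a))) (go a fa (<-cmp (tot a) 0ℚ) (w≤0 a))
      where
      w≤0 : ∀ a → w a ≤ 0ℚ
      w≤0 a = ≤-trans (point≤mean 0≤w a) (≤-trans (*-monoˡ (<⇒≤ (0<two^ k)) Ew≤0) (≤-reflexive (*-zeroʳ (two ^ k))))
      go : ∀ a → f a ≡ true → (c : Tri (tot a < 0ℚ) (tot a ≡ 0ℚ) (0ℚ < tot a)) → ind (f a) * scale c ≤ 0ℚ → 1ℚ ≤ tot a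
      go a fa (tri< _ _ _) le rewrite fa = ⊥-elim (<-irrefl refl (<-≤-trans 0<P (subst (_≤ 0ℚ) (*-identityˡ P) le)))
      go a fa (tri≈ _ _ _) le rewrite fa = ⊥-elim (<-irrefl refl (<-≤-trans (positive⁻¹ 1ℚ) le))
      go a fa (tri> _ _ gt) le = 0<⇒1≤ a gt
    ... | inj₂ P≤0 = Sign.- , λ a fa → subst (1ℚ ≤_) (lem (tot a)) (go a fa (<-cmp (tot a) 0ℚ) (w≤0 a))
      where
      lem : ∀ x → - x ≡ - 1ℚ * x
      lem = solve-∀ ℚ-ring
      w≤0 : ∀ a → w a ≤ 0ℚ
      w≤0 a = ≤-trans (point≤mean 0≤w a) (≤-trans (*-monoˡ (<⇒≤ (0<two^ k)) Ew≤0) (≤-reflexive (*-zeroʳ (two ^ k))))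
      t⁺≤0 : ∀ a → t⁺ a ≤ 0ℚ
      t⁺≤0 a = ≤-trans (point≤mean 0≤t⁺ a) (≤-trans (*-monoˡ (<⇒≤ (0<two^ k)) P≤0) (≤-reflexive (*-zeroʳ (two ^ k))))
      go : ∀ a → f a ≡ true → (c : Tri (tot a < 0ℚ) (tot a ≡ 0ℚ) (0ℚ < tot a)) → ind (f a) * scale c ≤ 0ℚ → 1ℚ ≤ - tot a
      go a fa (tri< lt _ _) le = <0⇒1≤ a lt
      go a fa (tri≈ _ _ _) le rewrite fa = ⊥-elim (<-irrefl refl (<-≤-trans (positive⁻¹ 1ℚ) le))
      go a fa (tri> _ _ gt) le = ⊥-elim (<-irrefl refl (<-≤-trans gt (≤-trans (p≤p⊔q (tot a) 0ℚ)
        (subst (_≤ 0ℚ) (trans (cong (λ b → ind b * (tot a ⊔ 0ℚ)) fa) (*-identityˡ (tot a ⊔ 0ℚ))) (t⁺≤0 a)))))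

    module Density (0<Ew : 0ℚ < E M w) where

      private
        r   = proj₁ (recip 0<Ew)
        0≤r = proj₁ (proj₂ (recip 0<Ew))
        r-inv = proj₂ (proj₂ (recip 0<Ew))

      dens : Vec Sign k → ℚ
      dens a = w a * r

      0≤dens : ∀ a → 0ℚ ≤ dens a
      0≤dens a = 0≤* (0≤w a) 0≤r

      E-dens : E M dens ≡ 1ℚ
      E-dens = trans (E-*ʳ M r w) r-inv

      dens-support : ∀ a → f a ≡ false → dens a ≡ 0ℚ
      dens-support a fa rewrite fa = trans (cong (_* r) (*-zeroˡ (scale (<-cmp (tot a) 0ℚ)))) (*-zeroˡ r)

      E-dens-coord : ∀ i → E M (λ a → dens a * sg (lookup a i)) ≡ 0ℚ
      E-dens-coord i = trans (E-cong M (λ a → lem (w a) r (sg (lookup a i))))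
        (trans (E-*ʳ M r (λ a → w a * sg (lookup a i))) (trans (cong (_* r) (E-w-coord i)) (*-zeroˡ r)))
        where
        lem : ∀ w r s → w * r * s ≡ w * s * r
        lem = solve-∀ ℚ-ring

      dens≤ : ∀ a → dens a ≤ two ^ k
      dens≤ a = subst (dens a ≤_) (trans (cong (two ^ k *_) E-dens) (*-identityʳ _)) (point≤mean 0≤dens a)

  E-coord : ∀ {k} (i : Fin k) → E (cubeM k) (λ a → sg (lookup a i)) ≡ 0ℚ
  E-coord {k} i = lem′ (trans (sym (E-flip i (λ a → sg (lookup a i)))) (trans (E-cong (cubeM k) (sg-flip i)) (E-neg (cubeM k) (λ a → sg (lookup a i)))))
    where
    lem′ : ∀ {x} → x ≡ - x → x ≡ 0ℚ
    lem′ {x} eq = trans (lem x) (trans (cong (λ z → ½ * (x + z)) eq) (lem″ x))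
      where
      lem : ∀ x → x ≡ ½ * (x + x)
      lem = solve-∀ ℚ-ring
      lem″ : ∀ x → ½ * (x + (- x)) ≡ 0ℚ
      lem″ = solve-∀ ℚ-ring

  foldr₁-++ : ∀ {A : Set} (_∙_ : A → A → A) → (∀ x y z → (x ∙ y) ∙ z ≡ x ∙ (y ∙ z)) → ∀ xs ys →
    List⁺.foldr₁ _∙_ (xs ⁺++⁺ ys) ≡ List⁺.foldr₁ _∙_ xs ∙ List⁺.foldr₁ _∙_ ys
  foldr₁-++ _∙_ assoc (x ∷ xs) ys = go x xs
    where
    go : ∀ x xs → List⁺.foldr₁ _∙_ ((x ∷ xs) ⁺++⁺ ys) ≡ List⁺.foldr₁ _∙_ (x ∷ xs) ∙ List⁺.foldr₁ _∙_ ys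
    go x []        = refl
    go x (x′ ∷ xs) = trans (cong (x ∙_) (go x′ xs)) (sym (assoc x _ _))

  map-map⁺ : ∀ {A B C : Set} (g : B → C) (h : A → B) xs → List⁺.map g (List⁺.map h xs) ≡ List⁺.map (g ∘ h) xs
  map-map⁺ g h (x ∷ xs) = cong (g (h x) ∷_) (sym (List.map-∘ xs))
    where import Data.List.Properties as List

  map-++⁺ : ∀ {A B : Set} (g : A → B) xs ys → List⁺.map g (xs ⁺++⁺ ys) ≡ List⁺.map g xs ⁺++⁺ List⁺.map g ys
  map-++⁺ g (x ∷ xs) (y ∷ ys) = cong (g x ∷_) (List.map-++ g xs (y ∷ ys))
    where import Data.List.Properties as List

  fold-cube : ∀ {B : Set} (_∙_ : B → B → B) → (∀ x y z → (x ∙ y) ∙ z ≡ x ∙ (y ∙ z)) → ∀ n g →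
    List⁺.foldr₁ _∙_ (List⁺.map g (cube (suc n))) ≡
    List⁺.foldr₁ _∙_ (List⁺.map (λ a → g (Sign.+ ∷ a)) (cube n)) ∙ List⁺.foldr₁ _∙_ (List⁺.map (λ a → g (Sign.- ∷ a)) (cube n))
  fold-cube _∙_ assoc n g = trans (cong (List⁺.foldr₁ _∙_) (map-++⁺ g (List⁺.map (Sign.+ ∷_) (cube n)) (List⁺.map (Sign.- ∷_) (cube n))))
    (trans (foldr₁-++ _∙_ assoc (List⁺.map g (List⁺.map (Sign.+ ∷_) (cube n))) _)
      (cong₂ (λ x y → List⁺.foldr₁ _∙_ x ∙ List⁺.foldr₁ _∙_ y) (map-map⁺ g (Sign.+ ∷_) (cube n)) (map-map⁺ g (Sign.- ∷_) (cube n))))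

  sumcube : ∀ n → (Vec Sign n → ℚ) → ℚ
  sumcube n g = List⁺.foldr₁ _+_ (List⁺.map g (cube n))

  sumcube-E : ∀ n g → sumcube n g ≡ two ^ n * E (cubeM n) g
  sumcube-E zero    g = sym (trans (*-identityˡ _) (E-cube-zero g))
  sumcube-E (suc n) g = trans (fold-cube _+_ +-assoc n g)
    (trans (cong₂ _+_ (sumcube-E n (λ a → g (Sign.+ ∷ a))) (sumcube-E n (λ a → g (Sign.- ∷ a))))
    (trans (lem (two ^ n) (E (cubeM n) (λ a → g (Sign.+ ∷ a))) _) (cong (two * two ^ n *_) (sym (E-cube-suc n g)))))
    where
    lem : ∀ t x y → t * x + t * y ≡ two * t * (½ * x + ½ * y)
    lem = solve-∀ ℚ-ring

  ∑-foldr₁ : ∀ {A : Set} (g : A → ℚ) xs → ∑ (List⁺.toList xs) g ≡ List⁺.foldr₁ _+_ (List⁺.map g xs)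
  ∑-foldr₁ g (x ∷ xs) = go x xs
    where
    go : ∀ x xs → ∑ (x ∷ xs) g ≡ List⁺.foldr₁ _+_ (List⁺.map g (x ∷ xs))
    go x []        = +-identityʳ (g x)
    go x (x′ ∷ xs) = cong (g x +_) (go x′ xs)

  ρ-E : ∀ {k} (f : Predicate k) → ρ f ≡ E (cubeM k) (ind ∘ f)
  ρ-E {k} f = ≤-antisym (*-cancelˡ (0<two^ k) (≤-reflexive eq)) (*-cancelˡ (0<two^ k) (≤-reflexive (sym eq)))
    where
    ι2 : ι 2 ≡ two
    ι2 = trans (ι-suc 1) (cong (1ℚ +_) ιℤ-1)
    eq : two ^ k * ρ f ≡ two ^ k * E (cubeM k) (ind ∘ f)
    eq = trans (cong (_* ρ f) (trans (cong (_^ k) (sym ι2)) (sym (ι-^ 2 k))))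
      (trans (*-/-cancel (pos (count f (cube k))) (2 ℕ.^ k) {{ℕ.m^n≢0 2 k}})
      (trans (ι-count f (cube k)) (trans (∑-foldr₁ (ind ∘ f) (cube k)) (sumcube-E k (ind ∘ f)))))

  ≤maxcube : ∀ n g σ → g σ ≤ maxcube n g
  ≤maxcube zero    g []           = ≤-refl
  ≤maxcube (suc n) g (Sign.+ ∷ σ) = subst (g (Sign.+ ∷ σ) ≤_) (sym (fold-cube _⊔_ ⊔-assoc n g))
    (≤-trans (≤maxcube n (λ a → g (Sign.+ ∷ a)) σ) (p≤p⊔q _ (maxcube n (λ a → g (Sign.- ∷ a)))))
  ≤maxcube (suc n) g (Sign.- ∷ σ) = subst (g (Sign.- ∷ σ) ≤_) (sym (fold-cube _⊔_ ⊔-assoc n g))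
    (≤-trans (≤maxcube n (λ a → g (Sign.- ∷ a)) σ) (p≤q⊔p (maxcube n (λ a → g (Sign.+ ∷ a))) _))

  maxcube-attained : ∀ n g → ∃ λ σ → maxcube n g ≡ g σ
  maxcube-attained zero    g = [] , refl
  maxcube-attained (suc n) g with maxcube-attained n (λ a → g (Sign.+ ∷ a)) | maxcube-attained n (λ a → g (Sign.- ∷ a))
                                | ⊔-sel (maxcube n (λ a → g (Sign.+ ∷ a))) (maxcube n (λ a → g (Sign.- ∷ a)))
  ... | σ , p | _     | inj₁ e = Sign.+ ∷ σ , trans (fold-cube _⊔_ ⊔-assoc n g) (trans e p)
  ... | _     | σ , p | inj₂ e = Sign.- ∷ σ , trans (fold-cube _⊔_ ⊔-assoc n g) (trans e p)

-- Random instances and their values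

module RandomInstances where

  open FiniteMeans
  open CubeMoments
  open LevelTwo
  open Draws
  open Memory
  open SymmetricPredicates

  bernoulli : ∀ {x} n → 0ℚ ≤ 1ℚ + x → 1ℚ + ι n * x ≤ (1ℚ + x) ^ n
  bernoulli {x} zero    h = ≤-reflexive (trans (cong (λ z → 1ℚ + z * x) ιℤ-0) (lem x))
    where
    lem : ∀ x → 1ℚ + 0ℚ * x ≡ 1ℚ
    lem = solve-∀ ℚ-ring
  bernoulli {x} (suc n) h = begin
    1ℚ + ι (suc n) * x          ≡⟨ cong (λ z → 1ℚ + z * x) (ι-suc n) ⟩
    1ℚ + (1ℚ + ι n) * x         ≤⟨ ≤-by (0≤* (0≤ι n) (0≤sq x)) (lem x (ι n)) ⟩
    (1ℚ + x) * (1ℚ + ι n * x)   ≤⟨ *-monoˡ h (bernoulli n h) ⟩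
    (1ℚ + x) * (1ℚ + x) ^ n ∎
    where
    open ≤-Reasoning
    lem : ∀ x i → (1ℚ + x) * (1ℚ + i * x) ≡ 1ℚ + (1ℚ + i) * x + i * (x * x)
    lem = solve-∀ ℚ-ring

  prod : ∀ {A : Set} → (A → ℚ) → List A → ℚ
  prod h []       = 1ℚ
  prod h (x ∷ xs) = h x * prod h xs

  prod-nonneg : ∀ {A : Set} {h : A → ℚ} → (∀ x → 0ℚ ≤ h x) → ∀ xs → 0ℚ ≤ prod h xs
  prod-nonneg p []       = 0≤1
  prod-nonneg p (x ∷ xs) = 0≤* (p x) (prod-nonneg p xs)

  module _ {A : Set} (M : Mean A) where

    iid : ℕ → Mean (List A)
    iid zero    = dirac []
    iid (suc t) = bind M λ x → mapM (x ∷_) (iid t)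

    E-iid-suc : ∀ t g → E (iid (suc t)) g ≡ E M (λ x → E (iid t) (λ xs → g (x ∷ xs)))
    E-iid-suc t g = trans (E-bind M _ g) (E-cong M (λ x → E-map (x ∷_) (iid t) g))

    E-iid-prod : ∀ h → E M h ≡ 1ℚ → ∀ t → E (iid t) (prod h) ≡ 1ℚ
    E-iid-prod h eq zero    = refl
    E-iid-prod h eq (suc t) = trans (E-iid-suc t (prod h)) (trans (E-cong M (λ x →
      trans (E-*ˡ (iid t) (h x) (prod h)) (trans (cong (h x *_) (E-iid-prod h eq t)) (*-identityʳ (h x))))) eq)

    supp-iid : ∀ t → Supp (λ xs → List.length xs ≡ t) (iid t)
    supp-iid zero    = refl
    supp-iid (suc t) = supp-bind M (supp-all M (λ _ → _)) (λ {x} (_ : ⊤) → supp-bind (iid t) (supp-iid t) (cong suc))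

  module _ {A : Set} (P : A → Bool) where

    hits : List A → ℕ
    hits xs = List.length (List.filterᵇ P xs)

    hits-true : ∀ {x} → P x ≡ true → ∀ xs → hits (x ∷ xs) ≡ suc (hits xs)
    hits-true {x} eq xs with P x
    hits-true refl xs | true = refl

    prod-two : ∀ α β xs → ∃ λ m → hits xs ℕ.+ m ≡ List.length xs ×
      prod (λ x → if P x then α else β) xs ≡ α ^ hits xs * β ^ m
    prod-two α β []       = 0 , refl , sym (*-identityˡ 1ℚ)
    prod-two α β (x ∷ xs) with P x | prod-two α β xs
    ... | true  | m , eq , eq′ = m , cong suc eq , trans (cong (α *_) eq′) (sym (*-assoc α _ _))
    ... | false | m , eq , eq′ = suc m , trans (ℕ.+-suc _ m) (cong suc eq) ,
          trans (cong (β *_) eq′) (lem β (α ^ hits xs) (β ^ m))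
      where
      lem : ∀ b x y → b * (x * y) ≡ x * (b * y)
      lem = solve-∀ ℚ-ring

  -- Exponential tilting with rate t = 1/(2Q²) bounds the upper tail; a/Q exceeds the mean r by at least 1/Q.
  module Tail (Q-1 : ℕ) (a : ℕ) {r : ℚ} (0≤r : 0ℚ ≤ r) (r≤1 : r ≤ 1ℚ)
              (excess : 1ℚ + ι (suc Q-1) * r ≤ ι a) where

    private
      Q = suc Q-1
      q = ι Q
      0≤q : 0ℚ ≤ q
      0≤q = 0≤ι Q
      1≤q : 1ℚ ≤ q
      1≤q = 1≤ιsuc Q-1
      0<2q² : 0ℚ < two * (q * q)
      0<2q² = 0<* (positive⁻¹ two) (0<* (0<ιsuc Q-1) (0<ιsuc Q-1))

    t : ℚ
    t = proj₁ (recip 0<2q²)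

    private
      0≤t : 0ℚ ≤ t
      0≤t = proj₁ (proj₂ (recip 0<2q²))
      t-inv : two * (q * q) * t ≡ 1ℚ
      t-inv = proj₂ (proj₂ (recip 0<2q²))

      q*t≤1 : q * t ≤ 1ℚ
      q*t≤1 = begin
        q * t                 ≡⟨ *-identityˡ (q * t) ⟨
        1ℚ * (q * t)          ≤⟨ *-monoʳ {p = 1ℚ} {q = two * q} (0≤* 0≤q 0≤t) (*-mono {b = two} 0≤1 0≤1 (≤ᵇ⇒≤ _) 1≤q) ⟩
        two * q * (q * t)     ≡⟨ lem q t ⟩
        two * (q * q) * t     ≡⟨ t-inv ⟩
        1ℚ ∎
        where
        open ≤-Reasoning
        lem : ∀ q t → two * q * (q * t) ≡ two * (q * q) * t
        lem = solve-∀ ℚ-ring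

      t≤1 : t ≤ 1ℚ
      t≤1 = ≤-trans (subst (_≤ q * t) (*-identityˡ t) (*-monoʳ 0≤t 1≤q)) q*t≤1

      0≤1-r : 0ℚ ≤ 1ℚ - r
      0≤1-r = 0≤-diff r≤1

    hi lo : ℚ
    hi = 1ℚ + t * (1ℚ - r)
    lo = 1ℚ + (- (t * r))

    0≤lo : 0ℚ ≤ lo
    0≤lo = 0≤-diff (*-mono 0≤t 0≤r t≤1 r≤1)

    1≤hi : 1ℚ ≤ hi
    1≤hi = ≤-by (0≤* 0≤t 0≤1-r) refl

    0≤hi : 0ℚ ≤ hi
    0≤hi = ≤-trans 0≤1 1≤hi

    lo≤1 : lo ≤ 1ℚ
    lo≤1 = ≤-by (0≤* 0≤t 0≤r) (lem (t * r))
      where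
      lem : ∀ x → 1ℚ ≡ 1ℚ + (- x) + x
      lem = solve-∀ ℚ-ring

    -- As `t` is `1 / (2Q²)`, Bernoulli's inequality for `H` factors `1 + t/2` gives exactly
    -- `1 + 3`.
    H : ℕ
    H = 12 ℕ.* (Q ℕ.* Q)

    private
      -- Bernoulli's inequality bounds both powers. In the product of the two bounds the terms
      -- linear in `t` add up to at least `t` because of `excess`, and the rate is small enough for
      -- the quadratic term to take away at most `t/2`.
      block : ∀ b → a ℕ.+ b ≡ Q → 1ℚ + ¼ * two * t ≤ hi ^ a * lo ^ b
      block b eq = begin
        1ℚ + ¼ * two * t
          ≤⟨ ≤-by (0≤+ (0≤* 0≤t (0≤-diff excess′)) (0≤* 0≤t (0≤-diff ab≤))) (lem₁ t (ι a) (ι b) r) ⟩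
        (1ℚ + ι a * (t * (1ℚ - r))) * (1ℚ + ι b * (- (t * r)))
          ≤⟨ *-mono (0≤+ 0≤1 (0≤* (0≤ι a) (0≤* 0≤t 0≤1-r))) 0≤B (bernoulli a 0≤hi) (bernoulli b 0≤lo) ⟩
        hi ^ a * lo ^ b ∎
        where
        open ≤-Reasoning
        q≡ : q ≡ ι a + ι b
        q≡ = trans (cong ι (sym eq)) (ι-+ a b)
        excess′ : 1ℚ ≤ ι a * (1ℚ - r) - ι b * r
        excess′ = diff-0≤ (subst (0ℚ ≤_) (trans (cong (λ z → ι a - (1ℚ + z * r)) q≡) (lem (ι a) (ι b) r)) (0≤-diff excess))
          where
          lem : ∀ a b r → a - (1ℚ + (a + b) * r) ≡ a * (1ℚ - r) - b * r - 1ℚ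
          lem = solve-∀ ℚ-ring
        a≤q : ι a ≤ q
        a≤q = ι-mono (subst (a ℕ.≤_) eq (ℕ.m≤m+n a b))
        b≤q : ι b ≤ q
        b≤q = ι-mono (subst (b ℕ.≤_) eq (ℕ.m≤n+m b a))
        0≤B : 0ℚ ≤ 1ℚ + ι b * (- (t * r))
        0≤B = subst (0ℚ ≤_) (lem (ι b) t r) (0≤-diff (≤-trans (*-mono (0≤* (0≤ι b) 0≤t) 0≤r (*-monoʳ 0≤t b≤q) r≤1)
          (≤-trans (≤-reflexive (*-identityʳ (q * t))) q*t≤1)))
          where
          lem : ∀ b t r → 1ℚ - b * t * r ≡ 1ℚ + b * (- (t * r))
          lem = solve-∀ ℚ-ring
        ab≤ : t * (ι a * ι b * (r * (1ℚ - r))) ≤ ½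
        ab≤ = begin
          t * (ι a * ι b * (r * (1ℚ - r)))
            ≤⟨ *-monoˡ 0≤t (*-mono (0≤* (0≤ι a) (0≤ι b)) (0≤* 0≤r 0≤1-r) (*-mono (0≤ι a) (0≤ι b) a≤q b≤q)
                 (*-mono 0≤r 0≤1-r r≤1 (≤-by 0≤r (lem₂ r)))) ⟩
          t * (q * q * (1ℚ * 1ℚ))
            ≡⟨ lem₃ t (q * q) ⟩
          ½ * (two * (q * q) * t)
            ≡⟨ cong (½ *_) t-inv ⟩
          ½ * 1ℚ ≡⟨⟩
          ½ ∎
          where
          lem₂ : ∀ r → 1ℚ ≡ 1ℚ - r + r
          lem₂ = solve-∀ ℚ-ring
          lem₃ : ∀ t q → t * (q * (1ℚ * 1ℚ)) ≡ ½ * (two * q * t)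
          lem₃ = solve-∀ ℚ-ring
        lem₁ : ∀ t a b r → (1ℚ + a * (t * (1ℚ - r))) * (1ℚ + b * (- (t * r))) ≡
          1ℚ + ¼ * two * t + (t * (a * (1ℚ - r) - b * r - 1ℚ) + t * (½ - t * (a * b * (r * (1ℚ - r)))))
        lem₁ = solve-∀ ℚ-ring

      four≤ : four ≤ (1ℚ + ¼ * two * t) ^ H
      four≤ = ≤-trans (≤-reflexive eq) (bernoulli H (0≤+ 0≤1 (0≤* (0≤* 0≤¼ 0≤two) 0≤t)))
        where
        twelve : ℚ
        twelve = four + four + four
        ι12 : ι 12 ≡ twelve
        ι12 = trans (ιℤ-/1 (pos 12)) refl
        eq : four ≡ 1ℚ + ι H * (¼ * two * t)
        eq = trans (trans (lem′ refl) (cong (λ z → 1ℚ + ¼ * twelve * z) (sym t-inv)))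
          (trans (lem q t) (cong (λ z → 1ℚ + z * (¼ * two * t)) (sym (trans (ι-* 12 (Q ℕ.* Q)) (cong₂ _*_ ι12 (ι-* Q Q))))))
          where
          lem′ : four ≡ four → four ≡ 1ℚ + ¼ * twelve * 1ℚ
          lem′ _ = refl
          lem : ∀ q t → 1ℚ + ¼ * twelve * (two * (q * q) * t) ≡ 1ℚ + twelve * (q * q) * (¼ * two * t)
          lem = solve-∀ ℚ-ring

    -- `H` blocks of `Q` draws with `a` hits each have product at least `four`, and further hits
    -- only help, as `hi` is at least 1 and `lo` at most 1. The rate `four` per variable is chosen
    -- to beat the union bound over `2 ^ suc n` assignments.
    tail : ∀ n c m → a ℕ.* (H ℕ.* suc n) ℕ.≤ c → c ℕ.+ m ≡ Q ℕ.* (H ℕ.* suc n) → four ^ suc n ≤ hi ^ c * lo ^ m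
    tail n c m big total = go (a ℕ.≤? Q)
     where
     go : Dec (a ℕ.≤ Q) → four ^ suc n ≤ hi ^ c * lo ^ m
     go (no a≰Q)  = ⊥-elim (a≰Q (ℕ.*-cancelʳ-≤ a Q M
            (ℕ.≤-trans big (ℕ.≤-trans (ℕ.m≤m+n c m) (ℕ.≤-reflexive total)))))
      where M = H ℕ.* suc n
     go (yes a≤Q) = begin
      four ^ suc n                          ≤⟨ ^-mono (suc n) 0≤four (≤-trans four≤ (^-mono H (0≤+ 0≤1 (0≤* (0≤* 0≤¼ 0≤two) 0≤t)) (block b a+b≡Q))) ⟩
      ((hi ^ a * lo ^ b) ^ H) ^ suc n         ≡⟨ ^-assocʳ (hi ^ a * lo ^ b) H (suc n) ⟩
      (hi ^ a * lo ^ b) ^ M                   ≡⟨ ^-distrib-* (hi ^ a) (lo ^ b) M ⟩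
      (hi ^ a) ^ M * (lo ^ b) ^ M             ≡⟨ cong₂ _*_ (^-assocʳ hi a M) (trans (^-assocʳ lo b M) (cong (lo ^_) (sym d+m≡bM))) ⟩
      hi ^ (a ℕ.* M) * lo ^ (d ℕ.+ m)         ≡⟨ cong (hi ^ (a ℕ.* M) *_) (^-homo-* lo d m) ⟩
      hi ^ (a ℕ.* M) * (lo ^ d * lo ^ m)       ≤⟨ *-monoˡ (^-nonneg (a ℕ.* M) 0≤hi) (*-monoʳ (^-nonneg m 0≤lo) (≤-trans (^-mono d 0≤lo lo≤1) (≤-trans (≤-reflexive (1^ d)) (1≤^ d 1≤hi)))) ⟩
      hi ^ (a ℕ.* M) * (hi ^ d * lo ^ m)       ≡⟨ *-assoc (hi ^ (a ℕ.* M)) (hi ^ d) (lo ^ m) ⟨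
      hi ^ (a ℕ.* M) * hi ^ d * lo ^ m         ≡⟨ cong (_* lo ^ m) (trans (sym (^-homo-* hi (a ℕ.* M) d)) (cong (hi ^_) aM+d≡c)) ⟩
      hi ^ c * lo ^ m ∎
      where
      open ≤-Reasoning
      M = H ℕ.* suc n
      b = Q ℕ.∸ a
      d = c ℕ.∸ a ℕ.* M
      a+b≡Q : a ℕ.+ b ≡ Q
      a+b≡Q = ℕ.m+[n∸m]≡n a≤Q
      aM+d≡c : a ℕ.* M ℕ.+ d ≡ c
      aM+d≡c = ℕ.m+[n∸m]≡n big
      d+m≡bM : d ℕ.+ m ≡ b ℕ.* M
      d+m≡bM = ℕ.+-cancelˡ-≡ (a ℕ.* M) (d ℕ.+ m) (b ℕ.* M) (trans (sym (ℕ.+-assoc (a ℕ.* M) d m))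
        (trans (cong (ℕ._+ m) aM+d≡c) (trans total (trans (cong (ℕ._* M) (sym a+b≡Q)) (ℕ.*-distribʳ-+ M a b)))))

  ∑-ι-hits : ∀ {A : Set} (P : A → Bool) xs → ∑ xs (ind ∘ P) ≡ ι (hits P xs)
  ∑-ι-hits P []       = sym ιℤ-0
  ∑-ι-hits P (x ∷ xs) with P x
  ... | true  = trans (cong (1ℚ +_) (∑-ι-hits P xs)) (sym (ι-suc (hits P xs)))
  ... | false = trans (+-identityˡ _) (∑-ι-hits P xs)

  hits-map : ∀ {A B : Set} (P : B → Bool) (h : A → B) xs → hits P (List.map h xs) ≡ hits (P ∘ h) xs
  hits-map P h []       = refl
  hits-map P h (x ∷ xs) with P (h x)
  ... | true  = cong suc (hits-map P h xs)
  ... | false = hits-map P h xs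

  module Instances {k N n} (f : Predicate k) (β : Blocks k N n)
                   (dist : ∀ {c c′ a b} → β c a ≡ β c′ b → c ≡ c′ × a ≡ b) where

    private
      choose-fresh : ∀ {l} (γ : Blocks l N n) i → (∀ c a → i ≢ γ c a) → ∀ as → All (i ≢_) (choose γ as)
      choose-fresh γ i fresh []       = []
      choose-fresh γ i fresh (a ∷ as) = fresh zero a ∷ choose-fresh (γ ∘ suc) i (fresh ∘ suc) as

      choose-unique : ∀ {l} (γ : Blocks l N n) → (∀ {c c′ a b} → γ c a ≡ γ c′ b → c ≡ c′ × a ≡ b) → ∀ as → Unique (choose γ as)
      choose-unique γ d []       = []
      choose-unique γ d (a ∷ as) = choose-fresh (γ ∘ suc) (γ zero a) (λ c b e → Fin.0≢1+n (proj₁ (d e))) as ∷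
        choose-unique (γ ∘ suc) (λ e → Fin.suc-injective (proj₁ (d e)) , proj₂ (d e)) as

    constraint : Draw N k → Constraint k n
    constraint (as , bs) = mkConstraint (choose β as) bs (choose-unique β dist as)

    sat : Vec Sign n → Draw N k → Bool
    sat σ (as , bs) = f (masked β σ as bs)

    Stream⁺ : Set
    Stream⁺ = Draw N k × List (Draw N k)

    inst : Stream⁺ → Instance k n
    inst (d , ds) = constraint d ∷ List.map constraint ds

    flat : Stream⁺ → List (Draw N k)
    flat (d , ds) = d ∷ ds

    streams : ℕ → Mean Stream⁺
    streams m = bind (draws N k) λ d → mapM (d ,_) (iid (draws N k) m)

    E-streams : ∀ m g → E (streams m) (g ∘ flat) ≡ E (iid (draws N k) (suc m)) g
    E-streams m g = trans (E-bind (draws N k) _ (g ∘ flat)) (trans (E-cong (draws N k) (λ d → E-map (d ,_) (iid (draws N k) m) (g ∘ flat)))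
      (sym (E-iid-suc (draws N k) m g)))

    supp-streams : ∀ m → Supp (λ ω → List.length (flat ω) ≡ suc m) (streams m)
    supp-streams m = supp-bind (draws N k) (supp-all (draws N k) (λ _ → _)) (λ {d} (_ : ⊤) →
      supp-bind (iid (draws N k) m) (supp-iid (draws N k) m) (cong suc))

    length-inst : ∀ ω → List⁺.length (inst ω) ≡ List.length (flat ω)
    length-inst (d , ds) = cong suc (List.length-map constraint ds)
      where import Data.List.Properties as List

    ι-valAt : ∀ ω σ → ι (List.length (flat ω)) * valAt f (inst ω) σ ≡ ι (hits (sat σ) (flat ω))
    ι-valAt (d , ds) σ = trans (cong (λ l → ι l * valAt f (inst (d , ds)) σ) (sym (length-inst (d , ds))))
      (trans (*-/-cancel (pos (count (satisfies f σ) (inst (d , ds)))) (List⁺.length (inst (d , ds))))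
        (cong ι (hits-map (satisfies f σ) constraint (d ∷ ds))))

    private
      0<ι-length : ∀ ω → 0ℚ < ι (List.length (flat ω))
      0<ι-length (d , ds) = 0<ιsuc (List.length ds)

    all-sat⇒1≤val : ∀ ω σ → hits (sat σ) (flat ω) ≡ List.length (flat ω) → 1ℚ ≤ val f (inst ω)
    all-sat⇒1≤val ω σ eq = ≤-trans (*-cancelˡ (0<ι-length ω) (≤-reflexive
      (trans (*-identityʳ _) (trans (cong ι (sym eq)) (sym (ι-valAt ω σ)))))) (≤maxcube n (valAt f (inst ω)) σ)

    module Concentration (D-1 : ℕ) where

      private
        M = draws N k
        r = E (cubeM k) (ind ∘ f)
        K = 2 ℕ.^ k
        Q-1 = ℕ.pred (K ℕ.* suc D-1)
        Q-1≡ : suc Q-1 ≡ K ℕ.* suc D-1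
        Q-1≡ = ℕ.suc-pred (K ℕ.* suc D-1) {{ℕ.m*n≢0 K (suc D-1) {{ℕ.m^n≢0 2 k}}}}
        -- Over the common denominator `suc Q-1`, this is the fraction `ρ f + τ D-1`.
        a = count f (cube k) ℕ.* suc D-1 ℕ.+ K
        ιK : ι K ≡ two ^ k
        ιK = trans (ι-^ 2 k) (cong (_^ k) (trans (ι-suc 1) (cong (1ℚ +_) ιℤ-1)))
        ι-count-f : ι (count f (cube k)) ≡ ι K * r
        ι-count-f = trans (ι-count f (cube k)) (trans (∑-foldr₁ (ind ∘ f) (cube k)) (trans (sumcube-E k (ind ∘ f)) (cong (_* r) (sym ιK))))
        ιa : ι a ≡ ι (suc Q-1) * r + ι K
        ιa = trans (ι-+ (count f (cube k) ℕ.* suc D-1) K) (cong (_+ ι K) (trans (ι-* (count f (cube k)) (suc D-1))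
          (trans (cong (_* ι (suc D-1)) ι-count-f) (trans (lem (ι K) r (ι (suc D-1)))
            (cong (_* r) (trans (sym (ι-* K (suc D-1))) (cong ι (sym Q-1≡))))))))
          where
          lem : ∀ k r d → k * r * d ≡ k * d * r
          lem = solve-∀ ℚ-ring
        1≤K : 1ℚ ≤ ι K
        1≤K = subst (_≤ ι K) ιℤ-1 (ι-mono (ℕ.m^n>0 2 k))
        excess : 1ℚ + ι (suc Q-1) * r ≤ ι a
        excess = ≤-trans (+-monoˡ-≤ (ι (suc Q-1) * r) 1≤K) (≤-reflexive (trans (+-comm (ι K) _) (sym ιa)))

      open Tail Q-1 a (E-nonneg (cubeM k) (0≤ind ∘ f)) (E-≤const (cubeM k) (ind≤1 ∘ f)) excess

      Q : ℕ
      Q = suc Q-1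

      Q≡ : Q ≡ 2 ℕ.^ k ℕ.* suc D-1
      Q≡ = Q-1≡

      H≡ : H ≡ 12 ℕ.* (Q ℕ.* Q)
      H≡ = refl

      steps : ℕ → ℕ
      steps n′ = Q ℕ.* (H ℕ.* suc n′)

      factor : Vec Sign n → Draw N k → ℚ
      factor σ d = if sat σ d then hi else lo

      private
        factor≡ : ∀ b → (if b then hi else lo) ≡ lo + t * ind b
        factor≡ true  = lem t r
          where
          lem : ∀ t r → 1ℚ + t * (1ℚ - r) ≡ 1ℚ + (- (t * r)) + t * 1ℚ
          lem = solve-∀ ℚ-ring
        factor≡ false = lem lo t
          where
          lem : ∀ b t → b ≡ b + t * 0ℚ
          lem = solve-∀ ℚ-ring

        E-factor : ∀ σ → E M (factor σ) ≡ 1ℚ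
        E-factor σ = trans (E-draws-masked β σ (λ a → if f a then hi else lo))
          (trans (E-cong (cubeM k) (λ a → factor≡ (f a))) (trans (E-+ (cubeM k) (λ _ → lo) (λ a → t * ind (f a)))
            (trans (cong₂ _+_ (E-const (cubeM k) lo) (E-*ˡ (cubeM k) t (ind ∘ f))) (lem t r))))
          where
          lem : ∀ t r → 1ℚ + (- (t * r)) + t * r ≡ 1ℚ
          lem = solve-∀ ℚ-ring

        0≤factor : ∀ σ d → 0ℚ ≤ factor σ d
        0≤factor σ d = go (sat σ d)
          where
          go : ∀ b → 0ℚ ≤ (if b then hi else lo)
          go true  = 0≤hi
          go false = 0≤lo

      bad : ℚ → Stream⁺ → ℚ
      bad θ ω = ind (does (θ <? val f (inst ω)))

      -- Markov's inequality with the union bound built in. If the value is large, `tail` makes the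
      -- product for the best `σ` at least `four ^ n`; the mean over all assignments is smaller by a
      -- factor of at most `two ^ n`, which leaves room for `½ ^ n`.
      bad-bound : ∀ {θ} → r + τ D-1 ≤ θ → ∀ n′ ω → List.length (flat ω) ≡ steps n′ → n ≡ suc n′ →
        bad θ ω ≤ ½ ^ n * E (cubeM n) (λ σ → prod (factor σ) (flat ω))
      bad-bound {θ} r+τ≤θ n′ ω len refl = go (θ <? val f (inst ω))
       where
       rhs = ½ ^ n * E (cubeM n) (λ σ → prod (factor σ) (flat ω))
       go : (d : Dec (θ < val f (inst ω))) → ind (does d) ≤ rhs
       go (no _) = 0≤* (^-nonneg n 0≤½) (E-nonneg (cubeM n) (λ σ → prod-nonneg (0≤factor σ) (flat ω)))
       go (yes θ<val) = begin
         1ℚ                             ≡⟨ trans (sym (1^ n)) (trans (^-distrib-* ½ two n) (trans (cong (½ ^ n *_) (trans (sym (*-identityʳ (two ^ n))) (cong (two ^ n *_) (sym (1^ n))))) (cong (λ z → ½ ^ n * (two ^ n * z)) (^-distrib-* two ½ n)))) ⟩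
         ½ ^ n * (two ^ n * (two ^ n * ½ ^ n)) ≡⟨ lem₁ (½ ^ n) (two ^ n) ⟩
         ½ ^ n * (½ ^ n * (two ^ n * two ^ n)) ≡⟨ cong (λ z → ½ ^ n * (½ ^ n * z)) (^-distrib-* two two n) ⟨
         ½ ^ n * (½ ^ n * four ^ n)     ≤⟨ *-monoˡ (^-nonneg n 0≤½) (*-monoˡ (^-nonneg n 0≤½) (tail n′ c m big (trans total len))) ⟩
         ½ ^ n * (½ ^ n * (hi ^ c * lo ^ m)) ≡⟨ cong (λ z → ½ ^ n * (½ ^ n * z)) prod≡ ⟨
         ½ ^ n * (½ ^ n * prod (factor σ) (flat ω)) ≤⟨ *-monoˡ (^-nonneg n 0≤½) (*-monoˡ (^-nonneg n 0≤½) (point≤mean (λ σ → prod-nonneg (0≤factor σ) (flat ω)) σ)) ⟩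
         ½ ^ n * (½ ^ n * (two ^ n * EG)) ≡⟨ cong (½ ^ n *_) (trans (sym (*-assoc (½ ^ n) (two ^ n) EG)) (trans (cong (_* EG) (trans (sym (^-distrib-* ½ two n)) (1^ n))) (*-identityˡ EG))) ⟩
         ½ ^ n * EG ∎
         where
         open ≤-Reasoning
         σ = proj₁ (maxcube-attained n (valAt f (inst ω)))
         eq = proj₂ (maxcube-attained n (valAt f (inst ω)))
         m = proj₁ (prod-two (sat σ) hi lo (flat ω))
         total = proj₁ (proj₂ (prod-two (sat σ) hi lo (flat ω)))
         prod≡ = proj₂ (proj₂ (prod-two (sat σ) hi lo (flat ω)))
         c = hits (sat σ) (flat ω)
         EG = E (cubeM n) (λ σ → prod (factor σ) (flat ω))
         lem₁ : ∀ h t → h * (t * (t * h)) ≡ h * (h * (t * t))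
         lem₁ = solve-∀ ℚ-ring
         L = H ℕ.* suc n′
         big : a ℕ.* L ℕ.≤ c
         big = ι-cancel (begin
           ι (a ℕ.* L)                         ≡⟨ trans (ι-* a L) (cong (_* ι L) ιa) ⟩
           (ι Q * r + ι K) * ι L               ≡⟨ cong (λ z → (ι Q * r + z) * ι L) K≡ ⟩
           (ι Q * r + ι Q * τ D-1) * ι L       ≡⟨ lem₂ (ι Q) r (τ D-1) (ι L) ⟩
           ι Q * ι L * (r + τ D-1)             ≤⟨ *-monoˡ (0≤* (0≤ι Q) (0≤ι L)) (≤-trans r+τ≤θ (≤-trans (<⇒≤ θ<val) (≤-reflexive eq))) ⟩
           ι Q * ι L * valAt f (inst ω) σ      ≡⟨ cong (_* valAt f (inst ω) σ) (trans (sym (ι-* Q L)) (cong ι (sym len))) ⟩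
           ι (List.length (flat ω)) * valAt f (inst ω) σ ≡⟨ ι-valAt ω σ ⟩
           ι c ∎)
           where
           lem₂ : ∀ q r d l → (q * r + q * d) * l ≡ q * l * (r + d)
           lem₂ = solve-∀ ℚ-ring
           K≡ : ι K ≡ ι Q * τ D-1
           K≡ = sym (trans (cong (λ z → ι z * τ D-1) Q-1≡) (trans (cong (_* τ D-1) (ι-* K (suc D-1)))
             (trans (*-assoc (ι K) (ι (suc D-1)) (τ D-1)) (trans (cong (ι K *_) (ι*τ D-1)) (*-identityʳ (ι K))))))

      E-bad : ∀ {θ} → r + τ D-1 ≤ θ → ∀ n′ T → suc T ≡ steps n′ → n ≡ suc n′ → E (streams T) (bad θ) ≤ ½ ^ n
      E-bad {θ} r+τ≤θ n′ T T≡ n≡ = begin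
        E (streams T) (bad θ)
          ≡⟨ trans (E-bind M _ (bad θ)) (E-cong M (λ d → E-map (d ,_) (iid M T) (bad θ))) ⟩
        E M (λ d → E (iid M T) (λ ds → bad θ (d , ds)))
          ≤⟨ E-mono M (λ d → E-mono-supp (iid M T) (supp-map (iid M T) (λ {ds} eq → bad-bound r+τ≤θ n′ (d , ds) (trans (cong suc eq) T≡) n≡) (supp-iid M T))) ⟩
        E M (λ d → E (iid M T) (λ ds → g (d ∷ ds)))
          ≡⟨ E-iid-suc M T g ⟨
        E (iid M (suc T)) g
          ≡⟨ trans (E-*ˡ (iid M (suc T)) (½ ^ n) _) (cong (½ ^ n *_) (trans (E-swap (iid M (suc T)) (cubeM n) _)
               (trans (E-cong (cubeM n) (λ σ → E-iid-prod M (factor σ) (E-factor σ) (suc T))) (E-const (cubeM n) 1ℚ)))) ⟩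
        ½ ^ n * 1ℚ
          ≡⟨ *-identityʳ _ ⟩
        ½ ^ n ∎
        where
        open ≤-Reasoning
        g : List (Draw N k) → ℚ
        g ds = ½ ^ n * E (cubeM n) (λ σ → prod (factor σ) ds)

-- Real inequalities and integration

module RealMeans where

  open FiniteMeans
  open LevelTwo using (recip)

  private
    variable
      A B : Set

  -- An inequality of reals holds from some index on, up to an error. Finitely many of them hold at
  -- a common index, where they are rational inequalities.
  Ev : (ℕ → Set) → Set
  Ev P = ∃ λ N → ∀ {n} → N ℕ.≤ n → P n

  ev-map : ∀ {P Q : ℕ → Set} → (∀ {n} → P n → Q n) → Ev P → Ev Q
  ev-map h (N , p) = N , λ le → h (p le)

  ev-∧ : ∀ {P Q : ℕ → Set} → Ev P → Ev Q → Ev (λ n → P n × Q n)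
  ev-∧ (N , p) (N′ , q) = N ℕ.⊔ N′ , λ le → p (ℕ.m⊔n≤o⇒m≤o N N′ le) , q (ℕ.m⊔n≤o⇒n≤o N N′ le)

  ev-fin : ∀ {m} {P : Fin m → ℕ → Set} → (∀ i → Ev (P i)) → Ev (λ n → ∀ i → P i n)
  ev-fin {zero}  h = 0 , λ _ ()
  ev-fin {suc m} h = ev-map (λ { (p , q) zero → p ; (p , q) (suc i) → q i }) (ev-∧ (h zero) (ev-fin (λ i → h (suc i))))

  module _ (all : ∀ {P : A → ℕ → Set} → (∀ a → Ev (P a)) → Ev (λ n → ∀ a → P a n)) where

    ev-vec : ∀ {m} {P : Vec A m → ℕ → Set} → (∀ a → Ev (P a)) → Ev (λ n → ∀ a → P a n)
    ev-vec {zero}  h = ev-map (λ { p [] → p }) (h [])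
    ev-vec {suc m} h = ev-map (λ { p (x ∷ a) → p x a }) (all (λ x → ev-vec (λ a → h (x ∷ a))))

  ev-extract : ∀ {X : Set} → Ev (λ _ → X) → X
  ev-extract (N , p) = p (ℕ.≤-refl {N})

  ≤-by-ε : ∀ {p q} → (∀ ε → 0ℚ < ε → p ≤ q + ε) → p ≤ q
  ≤-by-ε {p} {q} h with p ≤? q
  ... | yes p≤q = p≤q
  ... | no p≰q  = ⊥-elim (<-irrefl refl (<-≤-trans 0<ε (≤-trans (≤-by (0≤-diff (h ε 0<ε)) (lem p q)) (≤-reflexive refl))))
    where
    ε = ½ * (p - q)
    0<ε : 0ℚ < ε
    0<ε = 0<* (positive⁻¹ ½) (subst (_< p - q) (+-inverseʳ q) (+-monoˡ-< (- q) (≰⇒> p≰q)))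
    lem : ∀ p q → 0ℚ ≡ ½ * (p - q) + (q + ½ * (p - q) - p)
    lem = solve-∀ ℚ-ring

  0<½* : ∀ {ε} → 0ℚ < ε → 0ℚ < ½ * ε
  0<½* = 0<* (positive⁻¹ ½)

  ½+½ : ∀ x ε → x + ½ * ε + ½ * ε ≡ x + ε
  ½+½ = solve-∀ ℚ-ring

  ≤ℝ-trans : ∀ {x y z} → x R.≤ y → y R.≤ z → x R.≤ z
  ≤ℝ-trans {x} {y} {z} p q ε 0<ε = ev-map
    (λ {n} (h , h′) → ≤-trans h (≤-trans (+-monoˡ-≤ (½ * ε) h′) (≤-reflexive (½+½ (seq z n) ε))))
    (ev-∧ (p (½ * ε) (0<½* 0<ε)) (q (½ * ε) (0<½* 0<ε)))

  ≤ℝ-pointwise : ∀ {x y} → (∀ n → seq x n ≤ seq y n) → x R.≤ y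
  ≤ℝ-pointwise {x} {y} h ε 0<ε = 0 , λ {n} _ → ≤-trans (h n) (≤-by (<⇒≤ 0<ε) refl)

  ≤ℝ-≡ : ∀ {x y} → (∀ n → seq x n ≡ seq y n) → x R.≤ y
  ≤ℝ-≡ {x} {y} h = ≤ℝ-pointwise {x} {y} (λ n → ≤-reflexive (h n))

  ≈-≡ : ∀ {x y} → (∀ n → seq x n ≡ seq y n) → x R.≈ y
  ≈-≡ {x} {y} h = ≤ℝ-≡ {x} {y} h , ≤ℝ-≡ {y} {x} (sym ∘ h)

  fromℚ-mono : ∀ {p q} → p ≤ q → fromℚ p R.≤ fromℚ q
  fromℚ-mono {p} {q} h = ≤ℝ-pointwise {fromℚ p} {fromℚ q} (λ _ → h)

  fromℚ-cancel : ∀ {p q} → fromℚ p R.≤ fromℚ q → p ≤ q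
  fromℚ-cancel h = ≤-by-ε (λ ε 0<ε → ev-extract (h ε 0<ε))

  +ℝ-mono : ∀ {x y z w} → x R.≤ y → z R.≤ w → x R.+ z R.≤ y R.+ w
  +ℝ-mono {x} {y} {z} {w} p q ε 0<ε = ev-map
    (λ {n} (h , h′) → ≤-trans (+-mono-≤ h h′) (≤-reflexive (lem (seq y n) (seq w n) ε)))
    (ev-∧ (p (½ * ε) (0<½* 0<ε)) (q (½ * ε) (0<½* 0<ε)))
    where
    lem : ∀ y w ε → y + ½ * ε + (w + ½ * ε) ≡ y + w + ε
    lem = solve-∀ ℚ-ring

  *ℝ-mono : ∀ {w x y} → 0ℚ ≤ w → w ≤ 1ℚ → x R.≤ y → fromℚ w R.* x R.≤ fromℚ w R.* y
  *ℝ-mono {w} {x} {y} 0≤w w≤1 p ε 0<ε = ev-map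
    (λ {n} h → ≤-trans (*-monoˡ 0≤w h) (≤-trans (≤-reflexive (*-distribˡ-+ w (seq y n) ε))
      (+-monoʳ-≤ (w * seq y n) (≤-trans (*-monoʳ (<⇒≤ 0<ε) w≤1) (≤-reflexive (*-identityˡ ε)))))) (p ε 0<ε)

  Eℝ : Mean A → (A → ℝ) → ℝ
  Eℝ (dirac a)       g = g a
  Eℝ (mix w _ _ M N) g = fromℚ w R.* Eℝ M g R.+ fromℚ (1ℚ - w) R.* Eℝ N g

  seq-Eℝ : ∀ (M : Mean A) g n → seq (Eℝ M g) n ≡ E M (λ a → seq (g a) n)
  seq-Eℝ (dirac a)       g n = refl
  seq-Eℝ (mix w _ _ M N) g n = cong₂ (λ x y → w * x + (1ℚ - w) * y) (seq-Eℝ M g n) (seq-Eℝ N g n)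

  1-w≤1 : ∀ {w} → 0ℚ ≤ w → 1ℚ - w ≤ 1ℚ
  1-w≤1 {w} 0≤w = ≤-by 0≤w (lem w)
    where
    lem : ∀ w → 1ℚ ≡ 1ℚ - w + w
    lem = solve-∀ ℚ-ring

  Eℝ-mono : ∀ (M : Mean A) {g h} → Supp (λ a → g a R.≤ h a) M → Eℝ M g R.≤ Eℝ M h
  Eℝ-mono (dirac a)           le = le
  Eℝ-mono (mix w 0≤w w≤1 M N) {g} {h} (p , q) = +ℝ-mono
    {fromℚ w R.* Eℝ M g} {fromℚ w R.* Eℝ M h} {fromℚ (1ℚ - w) R.* Eℝ N g} {fromℚ (1ℚ - w) R.* Eℝ N h}
    (*ℝ-mono {w} {Eℝ M g} {Eℝ M h} 0≤w w≤1 (Eℝ-mono M p))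
    (*ℝ-mono {1ℚ - w} {Eℝ N g} {Eℝ N h} (0≤-diff w≤1) (1-w≤1 0≤w) (Eℝ-mono N q))

  Eℝ-fromℚ : ∀ (M : Mean A) g n → seq (Eℝ M (fromℚ ∘ g)) n ≡ E M g
  Eℝ-fromℚ M g n = seq-Eℝ M (fromℚ ∘ g) n

  module Law {B : Set} (D : Distribution B) where

    open Distribution D using (Integrable; int-const; int-+; int-*)
      renaming (E to 𝔼; E-one to 𝔼-one; E-+ to 𝔼-+; E-* to 𝔼-*; E-mono to 𝔼-mono) public

    𝔼-const : ∀ {c} → 0ℚ ≤ c → c ≤ 1ℚ → 𝔼 (λ _ → fromℚ c) (int-const (fromℚ c)) R.≈ fromℚ c
    𝔼-const {c} 0≤c c≤1 =
      ≤ℝ-trans {𝔼 (λ _ → fromℚ c) (int-const (fromℚ c))} {𝔼 (λ _ → fromℚ c R.* 1ℝ) ic} {fromℚ c}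
        (𝔼-mono (int-const (fromℚ c)) ic (λ _ → ≤ℝ-≡ {fromℚ c} {fromℚ c R.* 1ℝ} (λ _ → sym (*-identityʳ c))))
        (≤ℝ-trans {𝔼 (λ _ → fromℚ c R.* 1ℝ) ic} {fromℚ c R.* 𝔼 (λ _ → 1ℝ) i1} {fromℚ c} (proj₁ (𝔼-* (fromℚ c) i1))
          (≤ℝ-trans {fromℚ c R.* 𝔼 (λ _ → 1ℝ) i1} {fromℚ c R.* 1ℝ} {fromℚ c}
            (*ℝ-mono {c} {𝔼 (λ _ → 1ℝ) i1} {1ℝ} 0≤c c≤1 (proj₁ 𝔼-one)) (≤ℝ-≡ {fromℚ c R.* 1ℝ} {fromℚ c} (λ _ → *-identityʳ c)))) ,
      ≤ℝ-trans {fromℚ c} {𝔼 (λ _ → fromℚ c R.* 1ℝ) ic} {𝔼 (λ _ → fromℚ c) (int-const (fromℚ c))}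
        (≤ℝ-trans {fromℚ c} {fromℚ c R.* 𝔼 (λ _ → 1ℝ) i1} {𝔼 (λ _ → fromℚ c R.* 1ℝ) ic}
          (≤ℝ-trans {fromℚ c} {fromℚ c R.* 1ℝ} {fromℚ c R.* 𝔼 (λ _ → 1ℝ) i1} (≤ℝ-≡ {fromℚ c} {fromℚ c R.* 1ℝ} (λ _ → sym (*-identityʳ c)))
            (*ℝ-mono {c} {1ℝ} {𝔼 (λ _ → 1ℝ) i1} 0≤c c≤1 (proj₂ 𝔼-one)))
          (proj₂ (𝔼-* (fromℚ c) i1)))
        (𝔼-mono ic (int-const (fromℚ c)) (λ _ → ≤ℝ-≡ {fromℚ c R.* 1ℝ} {fromℚ c} (λ _ → *-identityʳ c)))
      where
      i1 = int-const 1ℝ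
      ic = int-* (fromℚ c) i1

    module _ (c : A → ℚ) (g : A → B → ℝ) (ig : ∀ a → Integrable (g a)) where

      int-mean : ∀ M → Integrable (λ b → Eℝ M (λ a → fromℚ (c a) R.* g a b))
      int-mean (dirac a)       = int-* (fromℚ (c a)) (ig a)
      int-mean (mix w _ _ M N) = int-+ (int-* (fromℚ w) (int-mean M)) (int-* (fromℚ (1ℚ - w)) (int-mean N))

      -- A finite mean is an iterated convex combination, so exchanging it with the integral takes
      -- only additivity and homogeneity.
      mean-≤-𝔼 : ∀ M → Eℝ M (λ a → fromℚ (c a) R.* 𝔼 (g a) (ig a)) R.≤ 𝔼 _ (int-mean M)
      mean-≤-𝔼 (dirac a)           = proj₂ (𝔼-* (fromℚ (c a)) (ig a))
      mean-≤-𝔼 (mix w 0≤w w≤1 M N) =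
        ≤ℝ-trans {fromℚ w R.* X M R.+ fromℚ (1ℚ - w) R.* X N} {𝔼 _ jM R.+ 𝔼 _ jN} {𝔼 _ (int-+ jM jN)}
          (+ℝ-mono {fromℚ w R.* X M} {𝔼 _ jM} {fromℚ (1ℚ - w) R.* X N} {𝔼 _ jN}
            (≤ℝ-trans {fromℚ w R.* X M} {fromℚ w R.* 𝔼 _ (int-mean M)} {𝔼 _ jM}
              (*ℝ-mono {w} {X M} {𝔼 _ (int-mean M)} 0≤w w≤1 (mean-≤-𝔼 M)) (proj₂ (𝔼-* (fromℚ w) (int-mean M))))
            (≤ℝ-trans {fromℚ (1ℚ - w) R.* X N} {fromℚ (1ℚ - w) R.* 𝔼 _ (int-mean N)} {𝔼 _ jN}
              (*ℝ-mono {1ℚ - w} {X N} {𝔼 _ (int-mean N)} (0≤-diff w≤1) (1-w≤1 0≤w) (mean-≤-𝔼 N)) (proj₂ (𝔼-* (fromℚ (1ℚ - w)) (int-mean N)))))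
          (proj₂ (𝔼-+ jM jN))
        where
        X = λ K → Eℝ K (λ a → fromℚ (c a) R.* 𝔼 (g a) (ig a))
        jM = int-* (fromℚ w) (int-mean M)
        jN = int-* (fromℚ (1ℚ - w)) (int-mean N)

  -- W - 1 is the difference of the planted and the uniform weight of a stream.
  reweight-≥ : ∀ {W a b} h → 0ℚ ≤ W → fromℚ a R.≤ h → h R.≤ fromℚ b → fromℚ (W * a - b) R.≤ fromℚ (W - 1ℚ) R.* h
  reweight-≥ {W} {a} {b} h 0≤W lo hi ε 0<ε = ev-map
    (λ {n} (p , q) → ≤-trans (≤-by (0≤+ (0≤* 0≤W (0≤-diff p)) (0≤-diff q)) (lem W a b (seq h n) η)) (≤-reflexive (eq (seq h n))))
    (ev-∧ (lo η 0<η) (hi η 0<η))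
    where
    0<W+1 : 0ℚ < W + 1ℚ
    0<W+1 = +-mono-≤-< 0≤W (positive⁻¹ 1ℚ)
    r = proj₁ (recip 0<W+1)
    r-inv : (W + 1ℚ) * r ≡ 1ℚ
    r-inv = proj₂ (proj₂ (recip 0<W+1))
    -- The error of `h` occurs once with the factor `W` and once with the factor 1.
    η = r * ε
    0<r : 0ℚ < r
    0<r = 0≤∧≢0⇒0< (proj₁ (proj₂ (recip 0<W+1))) (λ e → 1≢0 (trans (sym r-inv) (trans (cong ((W + 1ℚ) *_) e) (*-zeroʳ (W + 1ℚ)))))
    0<η : 0ℚ < η
    0<η = 0<* 0<r 0<ε
    lem : ∀ W a b x η → (W - 1ℚ) * x + (W + 1ℚ) * η ≡ W * a - b + (W * (x + η - a) + (b + η - x))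
    lem = solve-∀ ℚ-ring
    eq : ∀ x → (W - 1ℚ) * x + (W + 1ℚ) * η ≡ (W - 1ℚ) * x + ε
    eq x = cong ((W - 1ℚ) * x +_) (trans (sym (*-assoc (W + 1ℚ) r ε)) (trans (cong (_* ε) r-inv) (*-identityˡ ε)))

-- One-wise independence and the balanced weights

module OneWiseIndependence where

  open FiniteMeans
  open CubeMoments
  open SymmetricPredicates
  open LevelTwo
  open RealMeans

  seq-foldr₁ : ∀ {A : Set} (g : A → ℝ) xs n →
    seq (List⁺.foldr₁ R._+_ (List⁺.map g xs)) n ≡ List⁺.foldr₁ _+_ (List⁺.map (λ a → seq (g a) n) xs)
  seq-foldr₁ g (x ∷ xs) n = go x xs
    where
    go : ∀ x xs → seq (List⁺.foldr₁ R._+_ (List⁺.map g (x ∷ xs))) n ≡ List⁺.foldr₁ _+_ (List⁺.map (λ a → seq (g a) n) (x ∷ xs))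
    go x []        = refl
    go x (x′ ∷ xs) = cong (seq (g x) n +_) (go x′ xs)

  seq-∑cube : ∀ k g n → seq (∑cube k g) n ≡ two ^ k * E (cubeM k) (λ a → seq (g a) n)
  seq-∑cube k g n = trans (seq-foldr₁ g (cube k) n) (sumcube-E k (λ a → seq (g a) n))

  seq-signℝ : ∀ s n → seq (signℝ s) n ≡ sg s
  seq-signℝ Sign.+ n = refl
  seq-signℝ Sign.- n = refl

  sg*-≤ : ∀ s {x ε} → x ≤ ε → - ε ≤ x → sg s * x ≤ ε
  sg*-≤ Sign.+ {x} {ε} x≤ε -ε≤x = subst (_≤ ε) (sym (*-identityˡ x)) x≤ε
  sg*-≤ Sign.- {x} {ε} x≤ε -ε≤x = subst₂ _≤_ (lem x) (lem′ ε) (neg-antimono-≤ -ε≤x)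
    where
    lem : ∀ x → - x ≡ - 1ℚ * x
    lem = solve-∀ ℚ-ring
    lem′ : ∀ x → - (- x) ≡ x
    lem′ = solve-∀ ℚ-ring

  ∣tot∣≤ : ∀ {k} (a : Vec Sign k) → tot a ≤ ι k × - ι k ≤ tot a
  ∣tot∣≤ []      = ≤-reflexive (sym ιℤ-0) , ≤-reflexive (cong -_ ιℤ-0)
  ∣tot∣≤ {suc k} (s ∷ a) with ∣tot∣≤ a
  ... | hi , lo = subst (tot (s ∷ a) ≤_) (sym (ι-suc k)) (+-mono-≤ (proj₁ (sg-bound s)) hi) ,
                  subst (_≤ tot (s ∷ a)) (trans (lem (ι k)) (cong -_ (sym (ι-suc k)))) (+-mono-≤ (proj₂ (sg-bound s)) lo)
    where
    sg-bound : ∀ s → sg s ≤ 1ℚ × - 1ℚ ≤ sg s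
    sg-bound Sign.+ = ≤-refl , ≤ᵇ⇒≤ _
    sg-bound Sign.- = ≤ᵇ⇒≤ _ , ≤-refl
    lem : ∀ x → - 1ℚ + - x ≡ - (1ℚ + x)
    lem = solve-∀ ℚ-ring

  module _ {k} (f : Predicate k) (sym-f : Symmetric f) where

    open Balance f sym-f

    private
      M = cubeM k

    positive⇒independent : 0ℚ < E M w → SupportsOneWiseIndependent f
    positive⇒independent 0<Ew = record
      { D         = λ a → fromℚ (dens a * ½ ^ k)
      ; D-nonneg  = λ a → fromℚ-mono (0≤* (0≤dens a) (^-nonneg k 0≤½))
      ; D-total   = ≈-≡ {∑cube k (λ a → fromℚ (dens a * ½ ^ k))} {1ℝ} (λ n → trans (seq-∑cube k (λ a → fromℚ (dens a * ½ ^ k)) n)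
          (trans (cong (two ^ k *_) (trans (E-*ʳ M (½ ^ k) dens) (trans (cong (_* ½ ^ k) E-dens) (*-identityˡ _)))) two^*½^))
      ; D-support = λ a fa → ≈-≡ {fromℚ (dens a * ½ ^ k)} {0ℝ} (λ _ → trans (cong (_* ½ ^ k) (dens-support a fa)) (*-zeroˡ (½ ^ k)))
      ; D-mean    = λ j → ≈-≡ {∑cube k (λ a → fromℚ (dens a * ½ ^ k) R.* signℝ (lookup a j))} {0ℝ}
          (λ n → trans (seq-∑cube k (λ a → fromℚ (dens a * ½ ^ k) R.* signℝ (lookup a j)) n)
            (trans (cong (two ^ k *_) (trans (E-cong M (λ a → trans (cong (dens a * ½ ^ k *_) (seq-signℝ (lookup a j) n))
                (lem (dens a) (½ ^ k) (sg (lookup a j))))) (trans (E-*ʳ M (½ ^ k) (λ a → dens a * sg (lookup a j)))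
                (trans (cong (_* ½ ^ k) (E-dens-coord j)) (*-zeroˡ (½ ^ k)))))) (*-zeroʳ (two ^ k))))
      }
      where
      open Density 0<Ew
      two^*½^ : two ^ k * ½ ^ k ≡ 1ℚ
      two^*½^ = trans (sym (^-distrib-* two ½ k)) (1^ k)
      lem : ∀ d h s → d * h * s ≡ d * s * h
      lem = solve-∀ ℚ-ring

    -- If all satisfying assignments lean to the side `s`, then `sg s * tot` is at least 1 on the
    -- support of `D`, although its mean is 0. As `D` is real, this is carried out at an index where
    -- all the conditions hold up to `ε`.
    independent⇒positive : SupportsOneWiseIndependent f → 0ℚ < E M w
    independent⇒positive owi with 0<⊎≤0 (E M w)
    ... | inj₁ h = h
    ... | inj₂ Ew≤0 = ⊥-elim (contradiction (one-sided Ew≤0))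
      where
      open SupportsOneWiseIndependent owi

      -- The errors add up to `K * ε`: the summand 1 is for the total mass, `ι k` for the
      -- coordinates and `two ^ k * (ι k + 1ℚ)` for the points of the cube. As `ε` is half the
      -- reciprocal of `K`, the contradiction reads `1 ≤ ½`.
      K : ℚ
      K = 1ℚ + ι k + two ^ k * (ι k + 1ℚ)

      0<K : 0ℚ < K
      0<K = <-≤-trans (positive⁻¹ 1ℚ) (≤-by (0≤+ (0≤ι k) (0≤* (^-nonneg k 0≤two) (0≤+ (0≤ι k) 0≤1))) (+-assoc 1ℚ (ι k) _))

      r = proj₁ (recip 0<K)
      ε = ½ * r

      K*ε : K * ε ≡ ½
      K*ε = trans (lem K r) (trans (cong (½ *_) (proj₂ (proj₂ (recip 0<K)))) (*-identityʳ ½))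
        where
        lem : ∀ k r → k * (½ * r) ≡ ½ * (k * r)
        lem = solve-∀ ℚ-ring

      0≤ε : 0ℚ ≤ ε
      0≤ε = 0≤* 0≤½ (proj₁ (proj₂ (recip 0<K)))

      0<ε : 0ℚ < ε
      0<ε = 0≤∧≢0⇒0< 0≤ε (λ e → 0<⇒≢ (positive⁻¹ ½) (trans (sym K*ε) (trans (cong (K *_) e) (*-zeroʳ K))))

      ev-vecs = ev-vec {Sign} (λ {P} h → ev-map (λ { (p , q) Sign.+ → p ; (p , q) Sign.- → q }) (ev-∧ (h Sign.+) (h Sign.-)))

      Small : Vec Sign k → ℕ → Set
      Small a n = 0ℚ ≤ seq (D a) n + ε × (f a ≡ false → seq (D a) n ≤ ε)

      small : ∀ a → Ev (Small a)
      small a = ev-∧ (D-nonneg a ε 0<ε) (go (f a) refl)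
        where
        go : ∀ b → f a ≡ b → Ev (λ n → b ≡ false → seq (D a) n ≤ ε)
        go true  fa = 0 , λ _ ()
        go false fa = ev-map (λ {n} h _ → subst (seq (D a) n ≤_) (+-identityˡ ε) h) (proj₁ (D-support a fa) ε 0<ε)

      Centred : Fin k → ℕ → Set
      Centred j n = seq (∑cube k (λ a → D a R.* signℝ (lookup a j))) n ≤ 0ℚ + ε × 0ℚ ≤ seq (∑cube k (λ a → D a R.* signℝ (lookup a j))) n + ε

      contradiction : ∃ OneSided → ⊥
      contradiction (s , one) = ev-extract (ev-map (λ {n} (sm , ce , to) → <-irrefl refl (<-≤-trans ½<1 (final n sm ce to)))
        (ev-∧ (ev-vecs small) (ev-∧ (ev-fin (λ j → ev-∧ (proj₁ (D-mean j) ε 0<ε) (proj₂ (D-mean j) ε 0<ε))) (proj₂ D-total ε 0<ε))))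
        where
        ½<1 : ½ < 1ℚ
        ½<1 = ≰⇒> (λ h → <-irrefl refl (<-≤-trans (positive⁻¹ ½) (≤-trans (+-monoˡ-≤ (- ½) h) (≤-reflexive refl))))

        final : ∀ n → (∀ a → Small a n) → (∀ j → Centred j n) → 1ℚ ≤ seq (∑cube k D) n + ε → 1ℚ ≤ ½
        final n sm ce to = begin
          1ℚ                                     ≤⟨ subst (λ z → 1ℚ ≤ z + ε) (seq-∑cube k D n) to ⟩
          two ^ k * E M d + ε                    ≤⟨ +-monoˡ-≤ ε (*-monoˡ (^-nonneg k 0≤two) (E-mono M pointwise)) ⟩
          two ^ k * E M (λ a → d a * (sg s * tot a) + (ι k + 1ℚ) * ε) + ε
            ≡⟨ cong (λ z → two ^ k * z + ε) (trans (E-+ M (λ a → d a * (sg s * tot a)) (λ _ → (ι k + 1ℚ) * ε))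
                 (cong (E M (λ a → d a * (sg s * tot a)) +_) (E-const M ((ι k + 1ℚ) * ε)))) ⟩
          two ^ k * (E M (λ a → d a * (sg s * tot a)) + (ι k + 1ℚ) * ε) + ε
            ≡⟨ cong (_+ ε) (*-distribˡ-+ (two ^ k) (E M (λ a → d a * (sg s * tot a))) ((ι k + 1ℚ) * ε)) ⟩
          two ^ k * E M (λ a → d a * (sg s * tot a)) + two ^ k * ((ι k + 1ℚ) * ε) + ε
            ≤⟨ +-monoˡ-≤ ε (+-monoˡ-≤ (two ^ k * ((ι k + 1ℚ) * ε)) linear) ⟩
          ι k * ε + two ^ k * ((ι k + 1ℚ) * ε) + ε
            ≡⟨ lem (ι k) (two ^ k) ε ⟩
          K * ε                                  ≡⟨ K*ε ⟩
          ½ ∎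
          where
          open ≤-Reasoning
          d : Vec Sign k → ℚ
          d a = seq (D a) n
          lem : ∀ k t ε → k * ε + t * ((k + 1ℚ) * ε) + ε ≡ (1ℚ + k + t * (k + 1ℚ)) * ε
          lem = solve-∀ ℚ-ring

          linear : two ^ k * E M (λ a → d a * (sg s * tot a)) ≤ ι k * ε
          linear = begin
            two ^ k * E M (λ a → d a * (sg s * tot a))
              ≡⟨ cong (two ^ k *_) (E-cong M (λ a → trans (lem₁ (d a) (sg s) (tot a)) (*-sum (sg s * d a) (λ j → sg (lookup a j))))) ⟩
            two ^ k * E M (λ a → sum (λ j → sg s * d a * sg (lookup a j)))
              ≡⟨ trans (cong (two ^ k *_) (E-sum M (λ a j → sg s * d a * sg (lookup a j)))) (*-sum (two ^ k) (λ j → E M (λ a → sg s * d a * sg (lookup a j)))) ⟩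
            sum (λ j → two ^ k * E M (λ a → sg s * d a * sg (lookup a j)))
              ≤⟨ sum-mono (λ j → ≤-trans (≤-reflexive (eq j)) (sg*-≤ s (≤-trans (proj₁ (ce j)) (≤-reflexive (+-identityˡ ε))) (neg-≤ (proj₂ (ce j))))) ⟩
            sum {k} (λ _ → ε)
              ≡⟨ sum-const k ε ⟩
            ι k * ε ∎
            where
            lem₁ : ∀ d s t → d * (s * t) ≡ s * d * t
            lem₁ = solve-∀ ℚ-ring
            lem₂ : ∀ x ε → - ε + (x + ε) ≡ x
            lem₂ = solve-∀ ℚ-ring
            neg-≤ : ∀ {x} → 0ℚ ≤ x + ε → - ε ≤ x
            neg-≤ {x} h = subst₂ _≤_ (+-identityʳ (- ε)) (lem₂ x ε) (+-monoʳ-≤ (- ε) h)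
            sum-mono : ∀ {n} {g h : Fin n → ℚ} → (∀ i → g i ≤ h i) → sum g ≤ sum h
            sum-mono {zero}  le = ≤-refl
            sum-mono {suc n} le = +-mono-≤ (le zero) (sum-mono (le ∘ suc))
            eq : ∀ j → two ^ k * E M (λ a → sg s * d a * sg (lookup a j)) ≡ sg s * seq (∑cube k (λ a → D a R.* signℝ (lookup a j))) n
            eq j = trans (cong (two ^ k *_) (trans (E-cong M (λ a → trans (*-assoc (sg s) (d a) (sg (lookup a j)))
                (cong (λ z → sg s * (d a * z)) (sym (seq-signℝ (lookup a j) n))))) (E-*ˡ M (sg s) (λ a → seq (D a R.* signℝ (lookup a j)) n))))
              (trans (lem₃ (two ^ k) (sg s) (E M (λ a → seq (D a R.* signℝ (lookup a j)) n))) (cong (sg s *_) (sym (seq-∑cube k (λ a → D a R.* signℝ (lookup a j)) n))))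
              where
              lem₃ : ∀ t s e → t * (s * e) ≡ s * (t * e)
              lem₃ = solve-∀ ℚ-ring

          pointwise : ∀ a → d a ≤ d a * (sg s * tot a) + (ι k + 1ℚ) * ε
          pointwise a = go (f a) refl
            where
            y = sg s * tot a
            y≤ : y ≤ ι k
            y≤ = sg*-≤ s (proj₁ (∣tot∣≤ a)) (proj₂ (∣tot∣≤ a))
            -y≤ : - y ≤ ι k
            -y≤ = subst (_≤ ι k) (lem₄ (sg s) (tot a)) (sg*-≤ s (subst (- tot a ≤_) (lem₅ (ι k)) (neg-antimono-≤ (proj₂ (∣tot∣≤ a)))) (neg-antimono-≤ (proj₁ (∣tot∣≤ a))))
              where
              lem₄ : ∀ s t → s * - t ≡ - (s * t)
              lem₄ = solve-∀ ℚ-ring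
              lem₅ : ∀ x → - (- x) ≡ x
              lem₅ = solve-∀ ℚ-ring
            go : ∀ b → f a ≡ b → d a ≤ d a * y + (ι k + 1ℚ) * ε
            go true  fa = ≤-by (0≤+ (0≤* (proj₁ (sm a)) (0≤-diff (one a fa))) (0≤* 0≤ε (0≤+ (0≤-diff y≤) (0≤+ 0≤1 0≤1)))) (lem₆ (d a) y (ι k) ε)
              where
              lem₆ : ∀ d y k ε → d * y + (k + 1ℚ) * ε ≡ d + ((d + ε) * (y - 1ℚ) + ε * (k - y + (1ℚ + 1ℚ)))
              lem₆ = solve-∀ ℚ-ring
            go false fa = go′ (≤-total 1ℚ y)
              where
              lem₆ : ∀ d y k ε → d * y + (k + 1ℚ) * ε ≡ d + ((d + ε) * (y - 1ℚ) + ε * (k - y + (1ℚ + 1ℚ)))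
              lem₆ = solve-∀ ℚ-ring
              lem₇ : ∀ d y k ε → d * y + (k + 1ℚ) * ε ≡ d + ((ε - d) * (1ℚ - y) + ε * (k - (- y)))
              lem₇ = solve-∀ ℚ-ring
              go′ : 1ℚ ≤ y ⊎ y ≤ 1ℚ → d a ≤ d a * y + (ι k + 1ℚ) * ε
              go′ (inj₁ 1≤y) = ≤-by (0≤+ (0≤* (proj₁ (sm a)) (0≤-diff 1≤y)) (0≤* 0≤ε (0≤+ (0≤-diff y≤) (0≤+ 0≤1 0≤1)))) (lem₆ (d a) y (ι k) ε)
              go′ (inj₂ y≤1) = ≤-by (0≤+ (0≤* (0≤-diff (proj₂ (sm a) fa)) (0≤-diff y≤1)) (0≤* 0≤ε (0≤-diff -y≤))) (lem₇ (d a) y (ι k) ε)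

-- Distinguishing planted from uniform streams

module LowerBounds where

  open FiniteMeans
  open CubeMoments
  open LevelTwo
  open Draws
  open Memory
  open SymmetricPredicates
  open RandomInstances
  open RealMeans

  boolVecs : ∀ s → List (Vec Bool s)
  boolVecs zero    = [] ∷ []
  boolVecs (suc s) = List.map (false ∷_) (boolVecs s) List.++ List.map (true ∷_) (boolVecs s)

  δᵇ : ∀ {s} → Vec Bool s → Vec Bool s → ℚ
  δᵇ = δⱽ Bool._≟_

  ∑-boolVecs : ∀ s h → ∑ (boolVecs (suc s)) h ≡ ∑ (boolVecs s) (λ z → h (false ∷ z)) + ∑ (boolVecs s) (λ z → h (true ∷ z))
  ∑-boolVecs s h = trans (∑-++ (List.map (false ∷_) (boolVecs s)) _ h) (cong₂ _+_ (∑-map (false ∷_) (boolVecs s) h) (∑-map (true ∷_) (boolVecs s) h))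

  ∑-δᵇ : ∀ {s} x h → ∑ (boolVecs s) (λ z → δᵇ x z * h z) ≡ h x
  ∑-δᵇ {zero}  []      h = trans (+-identityʳ _) (*-identityˡ (h []))
  ∑-δᵇ {suc s} (b ∷ x) h = trans (∑-boolVecs s (λ z → δᵇ (b ∷ x) z * h z)) (trans (cong₂ _+_ (term b false) (term b true)) (go b))
    where
    term : ∀ b c → ∑ (boolVecs s) (λ z → δᵇ (b ∷ x) (c ∷ z) * h (c ∷ z)) ≡ δ Bool._≟_ b c * h (c ∷ x)
    term b c = trans (∑-cong (boolVecs s) (λ z → trans (cong (_* h (c ∷ z)) (δ-∷ Bool._≟_ b c x z)) (*-assoc (δ Bool._≟_ b c) (δᵇ x z) (h (c ∷ z)))))
      (trans (∑-*ˡ (boolVecs s) (δ Bool._≟_ b c) (λ z → δᵇ x z * h (c ∷ z))) (cong (δ Bool._≟_ b c *_) (∑-δᵇ x (λ z → h (c ∷ z)))))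
    lem₁ : ∀ x y → 1ℚ * x + 0ℚ * y ≡ x
    lem₁ = solve-∀ ℚ-ring
    lem₂ : ∀ x y → 0ℚ * x + 1ℚ * y ≡ y
    lem₂ = solve-∀ ℚ-ring
    go : ∀ b → δ Bool._≟_ b false * h (false ∷ x) + δ Bool._≟_ b true * h (true ∷ x) ≡ h (b ∷ x)
    go false = lem₁ (h (false ∷ x)) (h (true ∷ x))
    go true  = lem₂ (h (false ∷ x)) (h (true ∷ x))

  ∑-boolVecs-const : ∀ s c → ∑ (boolVecs s) (λ _ → c) ≡ two ^ s * c
  ∑-boolVecs-const zero    c = trans (+-identityʳ c) (sym (*-identityˡ c))
  ∑-boolVecs-const (suc s) c = trans (∑-boolVecs s (λ _ → c)) (trans (cong₂ _+_ (∑-boolVecs-const s c) (∑-boolVecs-const s c)) (lem (two ^ s) c))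
    where
    lem : ∀ t c → t * c + t * c ≡ two * t * c
    lem = solve-∀ ℚ-ring

  -- The additive error in the level-2 inequality has to survive summation over `2 ^ s` states; this
  -- fixes the exponent of the moments.
  states-small : ∀ s → ∑ (boolVecs s) (λ _ → ¼ ^ suc s) ≤ 1ℚ
  states-small s = begin
    ∑ (boolVecs s) (λ _ → ¼ * ¼ ^ s) ≡⟨ ∑-boolVecs-const s (¼ * ¼ ^ s) ⟩
    two ^ s * (¼ * ¼ ^ s)            ≡⟨ lem (two ^ s) (¼ ^ s) ⟩
    ¼ * (two ^ s * ¼ ^ s)            ≡⟨ cong (¼ *_) (^-distrib-* two ¼ s) ⟨
    ¼ * ½ ^ s                        ≤⟨ *-mono {b = 1ℚ} {d = 1ℚ} 0≤¼ (^-nonneg s 0≤½) (≤ᵇ⇒≤ _) (≤-trans (^-mono s 0≤½ ½≤1) (≤-reflexive (1^ s))) ⟩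
    1ℚ * 1ℚ                          ≡⟨⟩
    1ℚ ∎
    where
    open ≤-Reasoning
    lem : ∀ t q → t * (¼ * q) ≡ ¼ * (t * q)
    lem = solve-∀ ℚ-ring

  foldl-map : ∀ {A B C : Set} (S : A → C → A) (h : B → C) z xs → List.foldl S z (List.map h xs) ≡ List.foldl (λ z x → S z (h x)) z xs
  foldl-map S h z []       = refl
  foldl-map S h z (x ∷ xs) = foldl-map S h (S z (h x)) xs

  ⅓ ⅔ three : ℚ
  ⅓ = pos 1 / 3
  ⅔ = pos 2 / 3
  three = 1ℚ + two

  module LowerBound {k N n : ℕ} (f : Predicate k) (sym-f : Symmetric f) (0<Ew : 0ℚ < E (cubeM k) (Balance.w f sym-f))
    (β : Blocks k N n) (dist : ∀ {c c′ a b} → β c a ≡ β c′ b → c ≡ c′ × a ≡ b) (T s : ℕ) where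

    open Balance f sym-f using (module Density)
    open Density 0<Ew
    open Instances f β dist
    open OneStep β dens 0≤dens E-dens

    -- The planted density lies between 0 and `two ^ k`, hence differs from 1 by at most `two ^ k`.
    V : ℚ
    V = two ^ k * two ^ k

    private
      bounded : Bounded V (λ a → dens a - 1ℚ)
      bounded a = diff-0≤ (subst (0ℚ ≤_) (lem (two ^ k) (dens a)) 
        (0≤* (0≤+ (0≤-diff (dens≤ a)) 0≤1) (0≤+ (0≤dens a) (0≤-diff (1≤^ k (≤ᵇ⇒≤ _))))))
        where
        lem : ∀ t d → (t - d + 1ℚ) * (d + (t - 1ℚ)) ≡ t * t - (d - 1ℚ) * (d - 1ℚ)
        lem = solve-∀ ℚ-ring

      coord : ∀ i → E (cubeM k) (λ a → (dens a - 1ℚ) * sg (lookup a i)) ≡ 0ℚ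
      coord i = trans (E-cong (cubeM k) (λ a → lem (dens a) (sg (lookup a i))))
        (trans (E-- (cubeM k) (λ a → dens a * sg (lookup a i)) (λ a → sg (lookup a i))) (cong₂ _-_ (E-dens-coord i) (E-coord i)))
        where
        lem : ∀ d s → (d - 1ℚ) * s ≡ d * s - s
        lem = solve-∀ ℚ-ring

    open module Ct = Contraction dist bounded coord s public using (Λ; 0≤Λ)

    gap : ℚ
    gap = μ + ι (suc T) * (eight * (Λ * two))

    private
      M = draws N k

      -- The stream is uniform and independent of `σ`; planting is expressed by `weight`, so that
      -- both kinds of streams live on one probability space.
      joint : Mean (Vec Sign n × Stream⁺)
      joint = bind (cubeM n) λ σ → mapM (σ ,_) (streams T)

      E-joint : ∀ (h : Vec Sign n → List (Draw N k) → ℚ) →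
        E joint (λ (σ , ω) → h σ (flat ω)) ≡ E (cubeM n) (λ σ → E (iid M (suc T)) (h σ))
      E-joint h = trans (E-bind (cubeM n) _ _) (E-cong (cubeM n) (λ σ →
        trans (E-map (σ ,_) (streams T) (λ (σ , ω) → h σ (flat ω))) (E-streams T (h σ))))

      weight : Vec Sign n × Stream⁺ → ℚ
      weight (σ , ω) = prod (tilt σ) (flat ω)

      0≤weight : ∀ x → 0ℚ ≤ weight x
      0≤weight (σ , ω) = prod-nonneg (0≤tilt σ) (flat ω)

      E-weight : E joint weight ≡ 1ℚ
      E-weight = trans (E-joint (λ σ → prod (tilt σ))) (trans (E-cong (cubeM n) (λ σ → E-iid-prod M (tilt σ) (E-tilt σ) (suc T))) (E-const (cubeM n) 1ℚ))

      module _ (A : DetAlgorithm k n s) where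

        open DetAlgorithm A

        Sᵈ : Vec Bool s → Draw N k → Vec Bool s
        Sᵈ z d = S z (constraint d)

        z₀ : Vec Bool s
        z₀ = Vec.replicate s false

        final : Stream⁺ → Vec Bool s
        final ω = List.foldl Sᵈ z₀ (flat ω)

        output-final : ∀ ω → output (inst ω) ≡ v (final ω)
        output-final (d , ds) = cong v (foldl-map S constraint (Sᵈ z₀ d) ds)

        module _ (v′ : Vec Bool s → ℚ) (uv : ∀ z → Unit (v′ z)) where

          open Ct.Process (boolVecs s) δᵇ (λ x y → 0≤ind (does (Vec.≡-dec Bool._≟_ x y)) , ind≤1 (does (Vec.≡-dec Bool._≟_ x y)))
            ∑-δᵇ (states-small s) Sᵈ v′ uv

          planted-iid : ∀ t σ z → planted v′ t σ z ≡ E (iid M t) (λ ds → prod (tilt σ) ds * v′ (List.foldl Sᵈ z ds))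
          planted-iid zero    σ z = sym (*-identityˡ (v′ z))
          planted-iid (suc t) σ z = trans (E-cong M (λ d → trans (cong (tilt σ d *_) (planted-iid t σ (Sᵈ z d)))
              (trans (sym (E-*ˡ (iid M t) (tilt σ d) _)) (E-cong (iid M t) (λ ds → sym (*-assoc (tilt σ d) (prod (tilt σ) ds) _))))))
            (sym (E-iid-suc M t (λ ds → prod (tilt σ) ds * v′ (List.foldl Sᵈ z ds))))

          uniform-iid : ∀ t z → uniform t z ≡ E (iid M t) (λ ds → v′ (List.foldl Sᵈ z ds))
          uniform-iid zero    z = refl
          uniform-iid (suc t) z = trans (E-cong M (λ d → uniform-iid t (Sᵈ z d))) (sym (E-iid-suc M t (λ ds → v′ (List.foldl Sᵈ z ds))))

          unit-gap : E joint (λ (σ , ω) → (weight (σ , ω) - 1ℚ) * v′ (final ω)) ≤ gap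
          unit-gap = begin
            E joint (λ (σ , ω) → (prod (tilt σ) (flat ω) - 1ℚ) * v′ (List.foldl Sᵈ z₀ (flat ω)))
              ≡⟨ E-joint (λ σ ds → (prod (tilt σ) ds - 1ℚ) * v′ (List.foldl Sᵈ z₀ ds)) ⟩
            Eσ (λ σ → E (iid M (suc T)) (λ ds → (prod (tilt σ) ds - 1ℚ) * v′ (List.foldl Sᵈ z₀ ds)))
              ≡⟨ E-cong (cubeM n) (λ σ → trans (E-cong (iid M (suc T)) (λ ds → lem₁ (prod (tilt σ) ds) (v′ (List.foldl Sᵈ z₀ ds))))
                   (trans (E-- (iid M (suc T)) (λ ds → prod (tilt σ) ds * v′ (List.foldl Sᵈ z₀ ds)) (λ ds → v′ (List.foldl Sᵈ z₀ ds)))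
                     (cong₂ _-_ (sym (planted-iid (suc T) σ z₀)) (sym (uniform-iid (suc T) z₀))))) ⟩
            Eσ (λ σ → planted v′ (suc T) σ z₀ - uniform (suc T) z₀)
              ≡⟨ trans (E-- (cubeM n) (λ σ → planted v′ (suc T) σ z₀) (λ _ → uniform (suc T) z₀)) (cong (λ z → Eσ (λ σ → planted v′ (suc T) σ z₀) - z) (E-const (cubeM n) (uniform (suc T) z₀))) ⟩
            Eσ (λ σ → planted v′ (suc T) σ z₀) - uniform (suc T) z₀
              ≤⟨ +-monoˡ-≤ (- uniform (suc T) z₀) (planted-≤-uniform (suc T) z₀) ⟩
            uniform (suc T) z₀ + μ + ι (suc T) * (eight * (Λ * two)) - uniform (suc T) z₀
              ≡⟨ lem₂ (uniform (suc T) z₀) μ (ι (suc T) * (eight * (Λ * two))) ⟩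
            gap ∎
            where
            open ≤-Reasoning
            lem₁ : ∀ p v → (p - 1ℚ) * v ≡ p * v - v
            lem₁ = solve-∀ ℚ-ring
            lem₂ : ∀ u m r → u + m + r - u ≡ m + r
            lem₂ = solve-∀ ℚ-ring

        -- At a fixed index the approximations to the outputs are only known to lie in `[-1, 2]`.
        -- Rescaling brings them into the unit interval, and the added constant drops out because
        -- `weight - 1` has mean 0.
        affine-gap : ∀ (v′ : Vec Bool s → ℚ) → (∀ z → 0ℚ ≤ v′ z + 1ℚ × v′ z ≤ 1ℚ + 1ℚ) →
          E joint (λ x → (weight x - 1ℚ) * v′ (final (proj₂ x))) ≤ three * gap
        affine-gap v′ b = begin
          E joint (λ x → (weight x - 1ℚ) * v′ (final (proj₂ x)))
            ≡⟨ E-cong joint (λ x → lem (weight x) (v′ (final (proj₂ x)))) ⟩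
          E joint (λ x → three * ((weight x - 1ℚ) * v″ (final (proj₂ x))) - (weight x - 1ℚ))
            ≡⟨ trans (E-- joint (λ x → three * ((weight x - 1ℚ) * v″ (final (proj₂ x)))) (λ x → weight x - 1ℚ))
                 (cong₂ _-_ (E-*ˡ joint three _) (trans (E-- joint weight (λ _ → 1ℚ)) (cong₂ _-_ E-weight (E-const joint 1ℚ)))) ⟩
          three * E joint (λ x → (weight x - 1ℚ) * v″ (final (proj₂ x))) - 0ℚ
            ≡⟨ +-identityʳ _ ⟩
          three * E joint (λ x → (weight x - 1ℚ) * v″ (final (proj₂ x)))
            ≤⟨ *-monoˡ (nonNegative⁻¹ three) (unit-gap v″ unit) ⟩
          three * gap ∎
          where
          open ≤-Reasoning
          v″ : Vec Bool s → ℚ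
          v″ z = ⅓ * (v′ z + 1ℚ)
          unit : ∀ z → Unit (v″ z)
          unit z = 0≤* (nonNegative⁻¹ ⅓) (proj₁ (b z)) , ≤-trans (*-monoˡ {⅓} (nonNegative⁻¹ ⅓) (+-monoˡ-≤ 1ℚ (proj₂ (b z)))) (≤-reflexive refl)
          lem : ∀ w v → (w - 1ℚ) * v ≡ three * ((w - 1ℚ) * (⅓ * (v + 1ℚ))) - (w - 1ℚ)
          lem = solve-∀ ℚ-ring

        output-gap : Eℝ joint (λ x → fromℚ (weight x - 1ℚ) R.* output (inst (proj₂ x))) R.≤ fromℚ (three * gap)
        output-gap ε 0<ε = ev-map
          (λ {i} h → ≤-trans (≤-reflexive (trans (seq-Eℝ joint _ i)
              (E-cong joint (λ x → cong (λ y → (weight x - 1ℚ) * seq y i) (output-final (proj₂ x))))))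
            (≤-trans (affine-gap (λ z → seq (v z) i) h) (≤-by (<⇒≤ 0<ε) refl)))
          (ev-vec {Bool} (λ h → ev-map (λ { (p , q) false → p ; (p , q) true → q }) (ev-∧ (h false) (h true)))
            (λ z → ev-∧ (0≤v z 1ℚ (positive⁻¹ 1ℚ)) (v≤1 z 1ℚ (positive⁻¹ 1ℚ))))

      -- The sense in which planted streams have value 1: the density is supported on satisfying
      -- signs, so a single violated constraint makes the weight 0.
      sat-or-zero : ∀ σ ds → hits (sat σ) ds ≡ List.length ds ⊎ prod (tilt σ) ds ≡ 0ℚ
      sat-or-zero σ []       = inj₁ refl
      sat-or-zero σ (d ∷ ds) = go (sat σ d) refl (sat-or-zero σ ds)
        where
        go : ∀ b → sat σ d ≡ b → hits (sat σ) ds ≡ List.length ds ⊎ prod (tilt σ) ds ≡ 0ℚ →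
             hits (sat σ) (d ∷ ds) ≡ suc (List.length ds) ⊎ tilt σ d * prod (tilt σ) ds ≡ 0ℚ
        go true  eq (inj₁ h) = inj₁ (trans (hits-true (sat σ) eq ds) (cong suc h))
        go true  eq (inj₂ z) = inj₂ (trans (cong (tilt σ d *_) z) (*-zeroʳ (tilt σ d)))
        go false eq _        = inj₂ (trans (cong (_* prod (tilt σ) ds) (dens-support (masked β σ (proj₁ d) (proj₂ d)) eq)) (*-zeroˡ (prod (tilt σ) ds)))

    module _ (P : Polynomial) (ε : ℝ) (𝒜 : RandAlgorithm k n s) (solves : Solves P f 1ℝ (fromℚ (ρ f) R.+ ε) 𝒜)
             (short : suc T ℕ.≤ eval P n) {θ : ℚ} (θ≤ : fromℚ θ R.≤ fromℚ (ρ f) R.+ ε) (D-1 : ℕ) where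

      open RandAlgorithm 𝒜
      open Law law
      open Concentration D-1

      private
        length-streams : ∀ ω → List.length (flat ω) ≡ suc T → List⁺.length (inst ω) ℕ.≤ eval P n
        length-streams ω eq = subst (ℕ._≤ eval P n) (sym (trans (length-inst ω) eq)) short

        0≤Pr1 : ∀ Ψ → 0ℝ R.≤ Pr1 Ψ
        0≤Pr1 Ψ = ≤ℝ-trans {0ℝ} {𝔼 (λ _ → 0ℝ) (int-const 0ℝ)} {Pr1 Ψ} (proj₂ (𝔼-const ≤-refl 0≤1))
          (𝔼-mono (int-const 0ℝ) (measurable Ψ) (λ A → DetAlgorithm.0≤v A _))

        Pr1≤1 : ∀ Ψ → Pr1 Ψ R.≤ 1ℝ
        Pr1≤1 Ψ = ≤ℝ-trans {Pr1 Ψ} {𝔼 (λ _ → 1ℝ) (int-const 1ℝ)} {1ℝ}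
          (𝔼-mono (measurable Ψ) (int-const 1ℝ) (λ A → DetAlgorithm.v≤1 A _)) (proj₁ 𝔼-one)

        Pr1-upper : ∀ ω → List.length (flat ω) ≡ suc T → Pr1 (inst ω) R.≤ fromℚ (⅓ + bad θ ω)
        Pr1-upper ω len = go (θ <? val f (inst ω))
          where
          go : (d : Dec (θ < val f (inst ω))) → Pr1 (inst ω) R.≤ fromℚ (⅓ + ind (does d))
          go (yes _) = ≤ℝ-trans {Pr1 (inst ω)} {1ℝ} {fromℚ (⅓ + 1ℚ)} (Pr1≤1 (inst ω)) (fromℚ-mono {1ℚ} {⅓ + 1ℚ} (≤ᵇ⇒≤ _))
          go (no ¬h) = ≤ℝ-trans {Pr1 (inst ω)} {fromℚ ⅓} {fromℚ (⅓ + 0ℚ)} (proj₂ (solves (inst ω) (length-streams ω len))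
            (≤ℝ-trans {fromℚ (val f (inst ω))} {fromℚ θ} {fromℚ (ρ f) R.+ ε} (fromℚ-mono (≮⇒≥ ¬h)) θ≤)) (fromℚ-mono (≤-reflexive (sym (+-identityʳ ⅓))))

        b : Vec Sign n × Stream⁺ → ℚ
        b (σ , ω) = weight (σ , ω) * ⅔ - (⅓ + bad θ ω)

        -- For positive weight `σ` satisfies the whole stream, and the promise gives acceptance with
        -- probability `⅔`. For weight 0 the value may be anything, but then `Pr1 ≥ 0` suffices.
        b-≤ : ∀ σ ω → List.length (flat ω) ≡ suc T → fromℚ (b (σ , ω)) R.≤ fromℚ (weight (σ , ω) - 1ℚ) R.* Pr1 (inst ω)
        b-≤ σ ω len = go (sat-or-zero σ (flat ω))
          where
          W = weight (σ , ω)
          go : hits (sat σ) (flat ω) ≡ List.length (flat ω) ⊎ W ≡ 0ℚ → fromℚ (b (σ , ω)) R.≤ fromℚ (W - 1ℚ) R.* Pr1 (inst ω)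
          go (inj₁ h) = reweight-≥ (Pr1 (inst ω)) (0≤weight (σ , ω))
            (proj₁ (solves (inst ω) (length-streams ω len)) (fromℚ-mono (all-sat⇒1≤val ω σ h))) (Pr1-upper ω len)
          go (inj₂ z) = ≤ℝ-trans {fromℚ (b (σ , ω))} {fromℚ (W * 0ℚ - (⅓ + bad θ ω))} {fromℚ (W - 1ℚ) R.* Pr1 (inst ω)}
            (fromℚ-mono (≤-reflexive (cong (_- (⅓ + bad θ ω)) (trans (trans (cong (_* ⅔) z) (*-zeroˡ ⅔)) (sym (*-zeroʳ W))))))
            (reweight-≥ (Pr1 (inst ω)) (0≤weight (σ , ω)) (0≤Pr1 (inst ω)) (Pr1-upper ω len))

        supp-joint : Supp (λ x → List.length (flat (proj₂ x)) ≡ suc T) joint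
        supp-joint = supp-bind (cubeM n) (supp-all (cubeM n) (λ _ → _)) (λ {σ} (_ : ⊤) →
          supp-bind (streams T) (supp-streams T) id)

        E-b : E joint b ≡ ⅔ - (⅓ + E (streams T) (bad θ))
        E-b = trans (E-- joint (λ x → weight x * ⅔) (λ x → ⅓ + bad θ (proj₂ x)))
          (cong₂ _-_ (trans (E-*ʳ joint ⅔ weight) (trans (cong (_* ⅔) E-weight) (*-identityˡ ⅔)))
            (trans (E-+ joint (λ _ → ⅓) (λ x → bad θ (proj₂ x))) (cong₂ _+_ (E-const joint ⅓)
              (trans (E-bind (cubeM n) _ _) (trans (E-cong (cubeM n) (λ σ → E-map (σ ,_) (streams T) (λ x → bad θ (proj₂ x))))
                (E-const (cubeM n) (E (streams T) (bad θ))))))))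

      -- The algorithm has to separate planted streams from uniform streams that are not bad. By
      -- `output-gap` no deterministic algorithm does so by more than `three * gap`, hence neither
      -- does their mean.
      gap-lower : 0ℚ ≤ gap → three * gap ≤ 1ℚ → ⅔ - (⅓ + E (streams T) (bad θ)) ≤ three * gap
      gap-lower 0≤gap gap≤ = subst (_≤ three * gap) E-b (fromℚ-cancel
        (≤ℝ-trans {fromℚ (E joint b)} {Eℝ joint (λ x → fromℚ (weight x - 1ℚ) R.* Pr1 (inst (proj₂ x)))} {fromℚ (three * gap)}
          (≤ℝ-trans {fromℚ (E joint b)} {Eℝ joint (fromℚ ∘ b)} {Eℝ joint (λ x → fromℚ (weight x - 1ℚ) R.* Pr1 (inst (proj₂ x)))}
            (≤ℝ-≡ {fromℚ (E joint b)} {Eℝ joint (fromℚ ∘ b)} (λ i → sym (Eℝ-fromℚ joint b i)))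
            (Eℝ-mono joint (supp-map joint (λ {x} len → b-≤ (proj₁ x) (proj₂ x) len) supp-joint)))
          (≤ℝ-trans {Eℝ joint (λ x → fromℚ (weight x - 1ℚ) R.* Pr1 (inst (proj₂ x)))} {𝔼 _ int} {fromℚ (three * gap)}
            (mean-≤-𝔼 c g ig joint)
            (≤ℝ-trans {𝔼 _ int} {𝔼 (λ _ → fromℚ (three * gap)) (int-const (fromℚ (three * gap)))} {fromℚ (three * gap)}
              (𝔼-mono int (int-const (fromℚ (three * gap))) output-gap)
              (proj₁ (𝔼-const (0≤* (nonNegative⁻¹ three) 0≤gap) gap≤))))))
        where
        c : Vec Sign n × Stream⁺ → ℚ
        c x = weight x - 1ℚ
        g : Vec Sign n × Stream⁺ → DetAlgorithm k n s → ℝ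
        g x A = DetAlgorithm.output A (inst (proj₂ x))
        ig = λ x → measurable (inst (proj₂ x))
        int = int-mean c g ig joint

-- One-wise independence implies resistance

module Resistance where

  open FiniteMeans
  open CubeMoments
  open LevelTwo
  open Draws
  open Memory
  open SymmetricPredicates
  open RandomInstances
  open RealMeans
  open OneWiseIndependence
  open LowerBounds

  abstract
    -- The denominator of `x` serves, as the numerator is at least 1.
    archimedes : ∀ {x} → 0ℚ < x → ∃ λ D → τ D ≤ x
    archimedes {x} 0<x = d , (begin
      τ d               ≡⟨ *-identityʳ (τ d) ⟨
      τ d * 1ℚ          ≤⟨ *-monoˡ (0≤τ d) 1≤ ⟩
      τ d * (ι (suc d) * x) ≡⟨ lem (τ d) (ι (suc d)) x ⟩
      ι (suc d) * τ d * x ≡⟨ trans (cong (_* x) (ι*τ d)) (*-identityˡ x) ⟩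
      x ∎)
      where
      open ≤-Reasoning
      d : ℕ
      d = ℚ.denominator-1 x
      lem : ∀ t i x → t * (i * x) ≡ i * t * x
      lem = solve-∀ ℚ-ring
      eq : ι (suc d) * x ≡ ιℤ (↥ x)
      eq = trans (cong (ι (suc d) *_) (sym (↥p/↧p≡p x))) (*-/-cancel (↥ x) (suc d))
      1≤ : 1ℚ ≤ ι (suc d) * x
      1≤ = subst₂ _≤_ ιℤ-1 (sym eq) (ιℤ-mono (ℤ.i<j⇒suc[i]≤j (ℤ.≰⇒> λ i≤0 →
        <-irrefl refl (<-≤-trans (0<* (0<ιsuc d) 0<x) (subst₂ _≤_ (sym eq) ιℤ-0 (ιℤ-mono i≤0))))))

  ^-monoʳ : ∀ {x m n} → 1ℚ ≤ x → m ℕ.≤ n → x ^ m ≤ x ^ n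
  ^-monoʳ {x} {m} {n} 1≤x m≤n = begin
    x ^ m                     ≡⟨ *-identityʳ (x ^ m) ⟨
    x ^ m * 1ℚ                ≤⟨ *-monoˡ (^-nonneg m (≤-trans 0≤1 1≤x)) (1≤^ (n ℕ.∸ m) 1≤x) ⟩
    x ^ m * x ^ (n ℕ.∸ m)     ≡⟨ ^-homo-* x m (n ℕ.∸ m) ⟨
    x ^ (m ℕ.+ (n ℕ.∸ m))     ≡⟨ cong (x ^_) (ℕ.m+[n∸m]≡n m≤n) ⟩
    x ^ n ∎
    where open ≤-Reasoning

  ^-antitoneʳ : ∀ {x m n} → 0ℚ ≤ x → x ≤ 1ℚ → m ℕ.≤ n → x ^ n ≤ x ^ m
  ^-antitoneʳ {x} {m} {n} 0≤x x≤1 m≤n = begin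
    x ^ n                     ≡⟨ cong (x ^_) (ℕ.m+[n∸m]≡n m≤n) ⟨
    x ^ (m ℕ.+ (n ℕ.∸ m))     ≡⟨ ^-homo-* x m (n ℕ.∸ m) ⟩
    x ^ m * x ^ (n ℕ.∸ m)     ≤⟨ *-monoˡ (^-nonneg m 0≤x) (≤-trans (^-mono (n ℕ.∸ m) 0≤x x≤1) (≤-reflexive (1^ (n ℕ.∸ m)))) ⟩
    x ^ m * 1ℚ                ≡⟨ *-identityʳ (x ^ m) ⟩
    x ^ m ∎
    where open ≤-Reasoning

  seq-^ : ∀ c q i → seq (c R.^ q) i ≡ seq c i ^ q
  seq-^ c zero    i = refl
  seq-^ c (suc q) i = cong (seq c i *_) (seq-^ c q i)

  -- An exponent `p / q` below `½` has `2p ≤ q`. The `p`-th power of `τ B-1` cancels that of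
  -- `suc B-1`, and the further powers of `τ B-1` are at most 1.
  sqrt-bound : ∀ B-1 n s → 1 ℕ.≤ s → n ℕ.≤ suc B-1 ℕ.* (s ℕ.* s) → fromℚ (τ B-1) · n ^ fromℚ ½ ≤ˢ s
  sqrt-bound B-1 n s 1≤s n≤ p q-1 (η , 0<η , lt) = ≤ℝ-pointwise {fromℚ (τ B-1) R.^ q R.* R.fromℕ (n ℕ.^ p)} {R.fromℕ (s ℕ.^ q)} (λ i → begin
    seq (fromℚ c R.^ q) i * (pos (n ℕ.^ p) / 1) ≡⟨ cong₂ _*_ (seq-^ (fromℚ c) q i) (trans (sym (ιℤ-/1 (pos (n ℕ.^ p)))) (ι-^ n p)) ⟩
    c ^ q * ι n ^ p                    ≤⟨ *-mono (^-nonneg q (0≤τ B-1)) (^-nonneg p (0≤ι n)) (^-antitoneʳ (0≤τ B-1) (τ≤1 B-1) p≤q) (^-mono p (0≤ι n) ιn≤) ⟩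
    c ^ p * (ι B * (ι s * ι s)) ^ p    ≡⟨ cong (c ^ p *_) (^-distrib-* (ι B) (ι s * ι s) p) ⟩
    c ^ p * (ι B ^ p * (ι s * ι s) ^ p) ≡⟨ *-assoc (c ^ p) (ι B ^ p) _ ⟨
    c ^ p * ι B ^ p * (ι s * ι s) ^ p  ≡⟨ cong (_* (ι s * ι s) ^ p) (trans (sym (^-distrib-* c (ι B) p)) (trans (cong (_^ p) (trans (*-comm c (ι B)) (ι*τ B-1))) (1^ p))) ⟩
    1ℚ * (ι s * ι s) ^ p               ≡⟨ trans (*-identityˡ _) (trans (^-distrib-* (ι s) (ι s) p) (sym (^-homo-* (ι s) p p))) ⟩
    ι s ^ (p ℕ.+ p)                    ≤⟨ ^-monoʳ (subst (_≤ ι s) ιℤ-1 (ι-mono 1≤s)) 2p≤q ⟩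
    ι s ^ q                            ≡⟨ trans (sym (ι-^ s q)) (ιℤ-/1 (pos (s ℕ.^ q))) ⟩
    pos (s ℕ.^ q) / 1 ∎)
    where
    open ≤-Reasoning
    B = suc B-1
    q = suc q-1
    c = τ B-1
    ιn≤ : ι n ≤ ι B * (ι s * ι s)
    ιn≤ = ≤-trans (ι-mono n≤) (≤-reflexive (trans (ι-* B (s ℕ.* s)) (cong (ι B *_) (ι-* s s))))
    p/q≤½ : pos p / q ≤ ½
    p/q≤½ = ≤-trans (≤-by (<⇒≤ 0<η) refl) (ev-extract lt)
    2p≤q : p ℕ.+ p ℕ.≤ q
    2p≤q = ι-cancel (begin
      ι (p ℕ.+ p)                   ≡⟨ ι-+ p p ⟩
      ι p + ι p                     ≡⟨ cong₂ _+_ (*-/-cancel (pos p) q) (*-/-cancel (pos p) q) ⟨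
      ι q * (pos p / q) + ι q * (pos p / q) ≤⟨ +-mono-≤ (*-monoˡ (0≤ι q) p/q≤½) (*-monoˡ (0≤ι q) p/q≤½) ⟩
      ι q * ½ + ι q * ½             ≡⟨ lem (ι q) ⟩
      ι q ∎)
      where
      lem : ∀ x → x * ½ + x * ½ ≡ x
      lem = solve-∀ ℚ-ring
    p≤q : p ℕ.≤ q
    p≤q = ℕ.≤-trans (ℕ.m≤m+n p p) 2p≤q

  block : ∀ {k N n} → k ℕ.* suc N ℕ.≤ n → Blocks k N n
  block le c a = Fin.inject≤ (Fin.combine c a) le

  block-distinct : ∀ k N {n} (le : k ℕ.* suc N ℕ.≤ n) {c c′ a b} → block {k} {N} le c a ≡ block {k} {N} le c′ b → c ≡ c′ × a ≡ b
  block-distinct k N le {c} {c′} {a} {b} eq = Fin.combine-injective c a c′ b (Fin.inject≤-injective le le _ _ eq)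

  -- The polynomial `n ^ 2`. The hard streams have `A * n` constraints with `A` independent of `n`,
  -- and only `n ≥ A` is considered.
  P₀ : Polynomial
  P₀ = 0 ∷ 0 ∷ 1 ∷ []

  n²≤P₀ : ∀ n → n ℕ.* n ℕ.≤ eval P₀ n
  n²≤P₀ n = ℕ.*-monoʳ-≤ n (subst (ℕ._≤ n ℕ.* (1 ℕ.+ n ℕ.* 0)) (ℕ.*-identityʳ n) (ℕ.*-monoʳ-≤ n (ℕ.m≤m+n 1 (n ℕ.* 0))))

  module _ {k : ℕ} .{{_ : ℕ.NonZero k}} (f : Predicate k) (sym-f : Symmetric f)
           (0<Ew : 0ℚ < E (cubeM k) (Balance.w f sym-f)) (P : Polynomial) (P₀≼P : P₀ ≼ P)
           (ε : ℝ) {θ : ℚ} (θ≤ : fromℚ θ R.≤ fromℚ (ρ f) R.+ ε) (D-1 : ℕ) (ρ+τ≤θ : ρ f + τ D-1 ≤ θ) where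

    private
      Q A B : ℕ
      -- The streams have length `A * n`. `K₁` collects `A` and the constants of the gap, where
      -- `8 ^ k` is `two ^ k` times `V`. In `B`, the factor 32 is `1 / μ`, and `4 * k²` bounds the
      -- square of `n / suc N`, as a block has at least `n / (2k)` variables.
      Q = 2 ℕ.^ k ℕ.* suc D-1
      A = Q ℕ.* (12 ℕ.* (Q ℕ.* Q))
      K₁ = 128 ℕ.* (A ℕ.* (8 ℕ.^ k))
      B = 32 ℕ.* (K₁ ℕ.* (4 ℕ.* (k ℕ.* k)))

      ι-4s : ∀ s → ι (1 ℕ.+ 4 ℕ.* s) ≡ 1ℚ + four * ι s
      ι-4s s = trans (ι-suc (4 ℕ.* s)) (cong (1ℚ +_) (trans (ι-* 4 s) (cong (_* ι s) (ιℤ-/1 (pos 4)))))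

      module _ {n n′ N s : ℕ} (n≡ : n ≡ suc n′) (fits : k ℕ.* suc N ℕ.≤ n) (wide : n ℕ.≤ 2 ℕ.* (k ℕ.* suc N))
               (A≤n : A ℕ.≤ n) (3≤n : 3 ℕ.≤ n) (small : B ℕ.* ((1 ℕ.+ 4 ℕ.* s) ℕ.* (1 ℕ.+ 4 ℕ.* s)) ℕ.≤ n) where

        β : Blocks k N n
        β = block {k} {N} fits

        module C = Instances.Concentration f β (block-distinct k N fits) D-1

        T : ℕ
        T = ℕ.pred (C.steps n′)

        steps≡ : C.steps n′ ≡ A ℕ.* n
        steps≡ = trans (cong₂ (λ q h → q ℕ.* (h ℕ.* suc n′)) C.Q≡ (trans C.H≡ (cong (λ q → 12 ℕ.* (q ℕ.* q)) C.Q≡)))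
          (trans (sym (ℕ.*-assoc Q (12 ℕ.* (Q ℕ.* Q)) (suc n′))) (cong (A ℕ.*_) (sym n≡)))

        sucT : suc T ≡ C.steps n′
        sucT = ℕ.suc-pred (C.steps n′) {{subst ℕ.NonZero (sym steps≡) (ℕ.m*n≢0 A n {{A≢0}} {{subst ℕ.NonZero (sym n≡) _}})}}
          where
          Q≢0 : ℕ.NonZero Q
          Q≢0 = ℕ.m*n≢0 (2 ℕ.^ k) (suc D-1) {{ℕ.m^n≢0 2 k}}
          A≢0 : ℕ.NonZero A
          A≢0 = ℕ.m*n≢0 Q _ {{Q≢0}} {{ℕ.m*n≢0 12 (Q ℕ.* Q) {{_}} {{ℕ.m*n≢0 Q Q {{Q≢0}} {{Q≢0}}}}}}

        short : suc T ℕ.≤ eval P n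
        short = ℕ.≤-trans (ℕ.≤-reflexive (trans sucT steps≡)) (ℕ.≤-trans (ℕ.*-monoˡ-≤ n A≤n) (ℕ.≤-trans (n²≤P₀ n) (P₀≼P n)))

        open LowerBound f sym-f 0<Ew β (block-distinct k N fits) T s

        ν = ι n
        t = τ N
        z = 1ℚ + four * ι s

        0<ν : 0ℚ < ν
        0<ν = subst (λ n → 0ℚ < ι n) (sym n≡) (0<ιsuc n′)

        νt≤ : ν * t ≤ two * ι k
        νt≤ = begin
          ν * t                               ≤⟨ *-monoʳ (0≤τ N) (ι-mono wide) ⟩
          ι (2 ℕ.* (k ℕ.* suc N)) * t         ≡⟨ cong (_* t) (trans (ι-* 2 (k ℕ.* suc N)) (cong₂ _*_ (ιℤ-/1 (pos 2)) (ι-* k (suc N)))) ⟩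
          two * (ι k * ι (suc N)) * t         ≡⟨ lem two (ι k) (ι (suc N)) t ⟩
          two * ι k * (ι (suc N) * t)         ≡⟨ trans (cong (two * ι k *_) (ι*τ N)) (*-identityʳ (two * ι k)) ⟩
          two * ι k ∎
          where
          open ≤-Reasoning
          lem : ∀ w k i t → w * (k * i) * t ≡ w * k * (i * t)
          lem = solve-∀ ℚ-ring

        -- Each step costs at most a constant times `z² / n²`, with `z = 1 + 4s` from the moment of
        -- order `2 * suc s`. The `A * n` steps together cost a constant times `z² / n`, which
        -- `small` controls.
        noise : ι (suc T) * (eight * (Λ * two)) ≤ μ
        noise = *-cancelˡ 0<ν (begin
          ν * (ι (suc T) * (eight * (Λ * two)))
            ≡⟨ cong (λ y → ν * (y * (eight * (Λ * two)))) (trans (cong ι (trans sucT steps≡)) (ι-* A n)) ⟩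
          ν * (ι A * ν * (eight * (two ^ k * (two ^ k * two ^ k * (four * (two * (t * z * (t * z))))) * two)))
            ≡⟨ lem₁ ν (ι A) (two ^ k) t z ⟩
          c128 * (ι A * (two ^ k * two ^ k * two ^ k)) * (z * z) * (ν * t * (ν * t))
            ≡⟨ cong (λ y → y * (z * z) * (ν * t * (ν * t))) K₁≡ ⟨
          ι K₁ * (z * z) * (ν * t * (ν * t))
            ≤⟨ *-monoˡ (0≤* (0≤ι K₁) (0≤sq z)) (*-mono 0≤νt 0≤νt νt≤ νt≤) ⟩
          ι K₁ * (z * z) * (two * ι k * (two * ι k))
            ≡⟨ lem₂ (ι K₁) z (ι k) ⟩
          μ * (c32 * (ι K₁ * (four * (ι k * ι k))) * (z * z))
            ≡⟨ cong (λ y → μ * (y * (z * z))) B≡ ⟨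
          μ * (ι B * (z * z))
            ≡⟨ cong (λ y → μ * (ι B * (y * y))) (ι-4s s) ⟨
          μ * (ι B * (ι (1 ℕ.+ 4 ℕ.* s) * ι (1 ℕ.+ 4 ℕ.* s)))
            ≡⟨ cong (μ *_) (trans (cong (ι B *_) (sym (ι-* (1 ℕ.+ 4 ℕ.* s) (1 ℕ.+ 4 ℕ.* s)))) (sym (ι-* B _))) ⟩
          μ * ι (B ℕ.* ((1 ℕ.+ 4 ℕ.* s) ℕ.* (1 ℕ.+ 4 ℕ.* s)))
            ≤⟨ *-monoˡ 0≤μ (ι-mono small) ⟩
          μ * ν
            ≡⟨ *-comm μ ν ⟩
          ν * μ ∎)
          where
          open ≤-Reasoning
          c32 c128 : ℚ
          c32  = four * eight
          c128 = four * c32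
          0≤νt = 0≤* (0≤ι n) (0≤τ N)
          lem₁ : ∀ ν A x t z → ν * (A * ν * (eight * (x * (x * x * (four * (two * (t * z * (t * z))))) * two)))
               ≡ c128 * (A * (x * x * x)) * (z * z) * (ν * t * (ν * t))
          lem₁ = solve-∀ ℚ-ring
          lem₂ : ∀ K z k → K * (z * z) * (two * k * (two * k)) ≡ μ * (c32 * (K * (four * (k * k))) * (z * z))
          lem₂ = solve-∀ ℚ-ring
          8^ : ι (8 ℕ.^ k) ≡ two ^ k * two ^ k * two ^ k
          8^ = trans (ι-^ 8 k) (trans (cong (_^ k) (ιℤ-/1 (pos 8))) (trans (^-distrib-* (two * two) two k) (cong (_* two ^ k) (^-distrib-* two two k))))
          K₁≡ : ι K₁ ≡ c128 * (ι A * (two ^ k * two ^ k * two ^ k))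
          K₁≡ = trans (ι-* 128 (A ℕ.* (8 ℕ.^ k))) (cong₂ _*_ (ιℤ-/1 (pos 128)) (trans (ι-* A (8 ℕ.^ k)) (cong (ι A *_) 8^)))
          B≡ : ι B ≡ c32 * (ι K₁ * (four * (ι k * ι k)))
          B≡ = trans (ι-* 32 (K₁ ℕ.* (4 ℕ.* (k ℕ.* k)))) (cong₂ _*_ (ιℤ-/1 (pos 32)) (trans (ι-* K₁ (4 ℕ.* (k ℕ.* k)))
            (cong (ι K₁ *_) (trans (ι-* 4 (k ℕ.* k)) (cong₂ _*_ (ιℤ-/1 (pos 4)) (ι-* k k))))))

        impossible : (𝒜 : RandAlgorithm k n s) → ¬ Solves P f 1ℝ (fromℚ (ρ f) R.+ ε) 𝒜
        impossible 𝒜 solves = <-irrefl refl (<-≤-trans const-< (begin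
          ⅔ - (⅓ + ¼ * ½)
            ≤⟨ +-monoʳ-≤ ⅔ (neg-antimono-≤ (+-monoʳ-≤ ⅓ bad≤)) ⟩
          ⅔ - (⅓ + E (streams T) (C.bad θ))
            ≤⟨ gap-lower P ε 𝒜 solves short θ≤ D-1 0≤gap (≤-trans gap≤ (≤ᵇ⇒≤ _)) ⟩
          three * gap
            ≤⟨ gap≤ ⟩
          three * (μ + μ) ∎))
          where
          open ≤-Reasoning
          open Instances f β (block-distinct k N fits) using (streams)
          gap≤ : three * gap ≤ three * (μ + μ)
          gap≤ = *-monoˡ {three} (nonNegative⁻¹ three) (+-monoʳ-≤ μ noise)
          0≤gap : 0ℚ ≤ gap
          0≤gap = 0≤+ 0≤μ (0≤* (0≤ι (suc T)) (0≤* (nonNegative⁻¹ eight) (0≤* 0≤Λ 0≤two)))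
          bad≤ : E (streams T) (C.bad θ) ≤ ¼ * ½
          bad≤ = ≤-trans (C.E-bad (≤-trans (≤-reflexive (cong (_+ τ D-1) (sym (ρ-E f)))) ρ+τ≤θ) n′ T sucT n≡)
            (≤-trans (^-antitoneʳ 0≤½ ½≤1 3≤n) (≤-reflexive refl))
          -- This is `3/16 < 5/24`, the reason for `μ = 1/32` and for `n ≥ 3`, which makes `½ ^ n`
          -- at most `1/8`.
          const-< : three * (μ + μ) < ⅔ - (⅓ + ¼ * ½)
          const-< = from-yes (three * (μ + μ) <? ⅔ - (⅓ + ¼ * ½))

    space-bound : ∃ λ B-1 → ∃ λ n₀ → ∀ n → n₀ ℕ.≤ n → ∀ s → (𝒜 : RandAlgorithm k n s) →
      Solves P f 1ℝ (fromℚ (ρ f) R.+ ε) 𝒜 → 1 ℕ.≤ s × n ℕ.≤ suc B-1 ℕ.* (s ℕ.* s)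
    -- In the threshold, 3 is for the concentration bound, `k` for nonempty blocks, `A` for streams
    -- of admissible length and `B` for excluding `s = 0`. For `s ≥ 1` the inequality `1 + 4s ≤ 5s`
    -- gives the factor 25.
    space-bound = 25 ℕ.* B , 3 ℕ.+ (k ℕ.+ (A ℕ.+ B)) , λ n n₀≤n s 𝒜 solves → bound n n₀≤n s
      (λ small → impossible′ n n₀≤n s small 𝒜 solves)
      where
      impossible′ : ∀ n → 3 ℕ.+ (k ℕ.+ (A ℕ.+ B)) ℕ.≤ n → ∀ s → B ℕ.* ((1 ℕ.+ 4 ℕ.* s) ℕ.* (1 ℕ.+ 4 ℕ.* s)) ℕ.≤ n →
        (𝒜 : RandAlgorithm k n s) → ¬ Solves P f 1ℝ (fromℚ (ρ f) R.+ ε) 𝒜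
      impossible′ n n₀≤n s small = impossible {N = N} (sym (ℕ.suc-pred n {{ℕ.>-nonZero (ℕ.≤-trans (ℕ.s≤s ℕ.z≤n) 3≤n)}})) fits wide
        A≤n 3≤n small
        where
        3≤n : 3 ℕ.≤ n
        3≤n = ℕ.m+n≤o⇒m≤o 3 n₀≤n
        k≤n : k ℕ.≤ n
        k≤n = ℕ.m+n≤o⇒m≤o k (ℕ.m+n≤o⇒n≤o 3 n₀≤n)
        A≤n : A ℕ.≤ n
        A≤n = ℕ.m+n≤o⇒m≤o A (ℕ.m+n≤o⇒n≤o k (ℕ.m+n≤o⇒n≤o 3 n₀≤n))
        N = ℕ.pred (n ℕ./ k)
        sucN : suc N ≡ n ℕ./ k
        sucN = ℕ.suc-pred (n ℕ./ k) {{ℕ.>-nonZero (ℕ.m≥n⇒m/n>0 k≤n)}}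
        fits : k ℕ.* suc N ℕ.≤ n
        fits = subst (ℕ._≤ n) (trans (ℕ.*-comm (n ℕ./ k) k) (cong (k ℕ.*_) (sym sucN))) (ℕ.m/n*n≤m n k)
        wide : n ℕ.≤ 2 ℕ.* (k ℕ.* suc N)
        wide = begin
          n                                  ≡⟨ ℕ.m≡m%n+[m/n]*n n k ⟩
          n ℕ.% k ℕ.+ n ℕ./ k ℕ.* k          ≤⟨ ℕ.+-mono-≤ (ℕ.≤-trans (ℕ.<⇒≤ (ℕ.m%n<n n k)) (ℕ.m≤m*n k (suc N))) (ℕ.≤-reflexive (trans (ℕ.*-comm (n ℕ./ k) k) (cong (k ℕ.*_) (sym sucN)))) ⟩
          k ℕ.* suc N ℕ.+ k ℕ.* suc N        ≡⟨ cong (k ℕ.* suc N ℕ.+_) (sym (ℕ.+-identityʳ (k ℕ.* suc N))) ⟩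
          2 ℕ.* (k ℕ.* suc N) ∎
          where open ℕ.≤-Reasoning
      bound : ∀ n → 3 ℕ.+ (k ℕ.+ (A ℕ.+ B)) ℕ.≤ n → ∀ s → ¬ (B ℕ.* ((1 ℕ.+ 4 ℕ.* s) ℕ.* (1 ℕ.+ 4 ℕ.* s)) ℕ.≤ n) →
        1 ℕ.≤ s × n ℕ.≤ suc (25 ℕ.* B) ℕ.* (s ℕ.* s)
      bound n n₀≤n zero    large = ⊥-elim (large (ℕ.≤-trans (ℕ.≤-reflexive (ℕ.*-identityʳ B))
        (ℕ.m+n≤o⇒n≤o A (ℕ.m+n≤o⇒n≤o k (ℕ.m+n≤o⇒n≤o 3 n₀≤n)))))
      bound n n₀≤n s@(suc s′) large = ℕ.s≤s ℕ.z≤n , (begin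
        n                                          ≤⟨ ℕ.<⇒≤ (ℕ.≰⇒> large) ⟩
        B ℕ.* ((1 ℕ.+ 4 ℕ.* s) ℕ.* (1 ℕ.+ 4 ℕ.* s)) ≤⟨ ℕ.*-monoʳ-≤ B (ℕ.*-mono-≤ 1+4s≤ 1+4s≤) ⟩
        B ℕ.* ((5 ℕ.* s) ℕ.* (5 ℕ.* s))            ≡⟨ lem B s ⟩
        25 ℕ.* B ℕ.* (s ℕ.* s)                     ≤⟨ ℕ.*-monoˡ-≤ (s ℕ.* s) (ℕ.n≤1+n (25 ℕ.* B)) ⟩
        suc (25 ℕ.* B) ℕ.* (s ℕ.* s) ∎)
        where
        open ℕ.≤-Reasoning
        1+4s≤ : 1 ℕ.+ 4 ℕ.* s ℕ.≤ 5 ℕ.* s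
        1+4s≤ = ℕ.+-monoˡ-≤ (4 ℕ.* s) (ℕ.s≤s ℕ.z≤n)
        import Data.Nat.Tactic.RingSolver as ℕR
        lem : ∀ B s → B ℕ.* ((5 ℕ.* s) ℕ.* (5 ℕ.* s)) ≡ 25 ℕ.* B ℕ.* (s ℕ.* s)
        lem = ℕR.solve-∀

  independent⇒resistant : ∀ (P : Polynomial) → P₀ ≼ P → ∀ k .{{_ : ℕ.NonZero k}} (f : Predicate k) → Symmetric f →
    SupportsOneWiseIndependent f → ApproximationResistant P f
  independent⇒resistant P P₀≼P k f sym-f owi ε (ε₀ , 0<ε₀ , below) =
    fromℚ ½ , (½ , positive⁻¹ ½ , 0 , λ _ → ≤ᵇ⇒≤ _) ,
    fromℚ (τ B-1) , (τ B-1 , 0<τ B-1 , 0 , λ _ → ≤-reflexive (+-identityˡ (τ B-1))) ,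
    n₀ , λ n n₀≤n s 𝒜 solves → sqrt-bound B-1 n s (proj₁ (bound n n₀≤n s 𝒜 solves)) (proj₂ (bound n n₀≤n s 𝒜 solves))
    where
    D = archimedes 0<ε₀
    θ≤ : fromℚ (ρ f + ε₀) R.≤ fromℚ (ρ f) R.+ ε
    θ≤ η 0<η = ev-map (λ {i} h → ≤-trans (+-monoʳ-≤ (ρ f) (≤-trans (≤-reflexive (sym (+-identityˡ ε₀))) h)) (≤-by (<⇒≤ 0<η) refl)) below
    sb = space-bound f sym-f (independent⇒positive f sym-f owi) P P₀≼P ε θ≤ (proj₁ D) (+-monoʳ-≤ (ρ f) (proj₂ D))
    B-1 = proj₁ sb
    n₀ = proj₁ (proj₂ sb)
    bound = proj₂ (proj₂ sb)

-- Reservoir sampling and Chebyshev's inequality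

module Reservoir where

  open FiniteMeans
  open CubeMoments
  open SymmetricPredicates
  open LowerBounds using (⅓; ⅔)

  sgℤ : Sign → ℤ
  sgℤ Sign.+ = pos 1
  sgℤ Sign.- = ℤ.- pos 1

  ι-sgℤ : ∀ s → ιℤ (sgℤ s) ≡ sg s
  ι-sgℤ Sign.+ = ιℤ-1
  ι-sgℤ Sign.- = ιℤ-/1 (ℤ.- pos 1)

  ∣sg∣ : ∀ s → ∣ sg s ∣ ≡ 1ℚ
  ∣sg∣ Sign.+ = refl
  ∣sg∣ Sign.- = refl

  hd : List Bool → Bool
  hd []      = false
  hd (b ∷ _) = b

  tl : List Bool → List Bool
  tl []      = []
  tl (_ ∷ ω) = ω

  -- The coin for item `t`, counted from 0, has probability `1 / suc t`, the rate at which a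
  -- reservoir of size one replaces its content. The first item is always taken.
  coins : ℕ → ℕ → Mean (List Bool)
  coins t zero    = dirac []
  coins t (suc r) = mix (τ t) (0≤τ t) (τ≤1 t) (mapM (true ∷_) (coins (suc t) r)) (mapM (false ∷_) (coins (suc t) r))

  -- A sample is a variable, the sign of its sampled occurrence and the sum of its later signs.
  Sample : Set
  Sample = ℕ × Sign × ℤ

  sum-cong : ∀ {m} (g h : Fin m → ℚ) → (∀ i → g i ≡ h i) → sum g ≡ sum h
  sum-cong {zero}  g h eq = refl
  sum-cong {suc m} g h eq = cong₂ _+_ (eq zero) (sum-cong (g ∘ suc) (h ∘ suc) (eq ∘ suc))

  module _ {n : ℕ} where

    Item : Set
    Item = Fin n × Sign

    new : Item → Sample
    new (i , b) = toℕ i , b , pos 0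

    upd : Sample → Item → Sample
    upd (c , s , r) (i , b) = c , s , (if does (c ℕ.≟ toℕ i) then sgℤ b else pos 0) ℤ.+ r

    -- If `r` is the sum of the later signs of the variable, this is the change of its absolute
    -- value when the sampled occurrence is put in front. Earlier occurrences do not enter, so
    -- sampling can begin anywhere in the stream.
    z-value : Sample → ℚ
    z-value (c , s , r) = ∣ sg s + ιℤ r ∣ - ∣ ιℤ r ∣

    run : List Bool → Sample → List Item → Sample
    run ω smp []      = smp
    run ω smp (x ∷ L) = run (tl ω) (if hd ω then new x else upd smp x) L

    suffixes : (Sample → ℚ) → List Item → ℚ
    suffixes h []      = 0ℚ
    suffixes h (x ∷ L) = h (List.foldl upd (new x) L) + suffixes h L

    -- The current sample stands for the first `t` items with weight `t`. The next item takes over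
    -- with probability `1 / suc t`, so old and new are weighted `t` to 1. For `t = 0` the initial
    -- sample drops out and a uniform position remains.
    reservoir : ∀ (h : Sample → ℚ) L t r smp → List.length L ℕ.≤ r →
      ι (t ℕ.+ List.length L) * E (coins t r) (λ ω → h (run ω smp L)) ≡ ι t * h (List.foldl upd smp L) + suffixes h L
    reservoir h []      t r smp _ = trans (cong₂ (λ m e → ι m * e) (ℕ.+-identityʳ t) (E-const (coins t r) (h smp))) (sym (+-identityʳ _))
    reservoir h (x ∷ L) t (suc r) smp (ℕ.s≤s le) = begin
      ι (t ℕ.+ suc l) * (τ t * E (mapM (true ∷_) (coins (suc t) r)) H + (1ℚ - τ t) * E (mapM (false ∷_) (coins (suc t) r)) H)
        ≡⟨ cong₂ _*_ (cong ι (ℕ.+-suc t l)) (cong₂ (λ a b → τ t * a + (1ℚ - τ t) * b)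
             (E-map (true ∷_) (coins (suc t) r) H) (E-map (false ∷_) (coins (suc t) r) H)) ⟩
      m * (τ t * e₁ + (1ℚ - τ t) * e₂)
        ≡⟨ lem₁ m (τ t) e₁ e₂ ⟩
      τ t * (m * e₁) + (1ℚ - τ t) * (m * e₂)
        ≡⟨ cong₂ (λ a b → τ t * a + (1ℚ - τ t) * b) (reservoir h L (suc t) r (new x) le) (reservoir h L (suc t) r (upd smp x) le) ⟩
      τ t * (ι (suc t) * A + s) + (1ℚ - τ t) * (ι (suc t) * B + s)
        ≡⟨ lem₂ (τ t) (ι (suc t)) A B s ⟩
      ι (suc t) * τ t * A + s + (ι (suc t) - ι (suc t) * τ t) * B
        ≡⟨ cong₂ (λ a b → a * A + s + (b - a) * B) (ι*τ t) (ι-suc t) ⟩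
      1ℚ * A + s + (1ℚ + ι t - 1ℚ) * B
        ≡⟨ lem₃ A s (ι t) B ⟩
      ι t * B + (A + s) ∎
      where
      open ≡-Reasoning
      l = List.length L
      m = ι (suc t ℕ.+ l)
      H : List Bool → ℚ
      H ω = h (run ω smp (x ∷ L))
      e₁ = E (coins (suc t) r) (λ ω → h (run ω (new x) L))
      e₂ = E (coins (suc t) r) (λ ω → h (run ω (upd smp x) L))
      A = h (List.foldl upd (new x) L)
      B = h (List.foldl upd (upd smp x) L)
      s = suffixes h L
      lem₁ : ∀ m t a b → m * (t * a + (1ℚ - t) * b) ≡ t * (m * a) + (1ℚ - t) * (m * b)
      lem₁ = solve-∀ ℚ-ring
      lem₂ : ∀ t i A B s → t * (i * A + s) + (1ℚ - t) * (i * B + s) ≡ i * t * A + s + (i - i * t) * B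
      lem₂ = solve-∀ ℚ-ring
      lem₃ : ∀ A s i B → 1ℚ * A + s + (1ℚ + i - 1ℚ) * B ≡ i * B + (A + s)
      lem₃ = solve-∀ ℚ-ring

    X : ℕ → List Item → ℤ
    X c []            = pos 0
    X c ((i , b) ∷ L) = (if does (c ℕ.≟ toℕ i) then sgℤ b else pos 0) ℤ.+ X c L

    X-here : ∀ i b L → ιℤ (X (toℕ i) ((i , b) ∷ L)) ≡ sg b + ιℤ (X (toℕ i) L)
    X-here i b L rewrite dec-true (toℕ i ℕ.≟ toℕ i) refl = trans (ιℤ-+ (sgℤ b) _) (cong (_+ ιℤ (X (toℕ i) L)) (ι-sgℤ b))

    X-there : ∀ {i j} b L → j ≢ i → X (toℕ j) ((i , b) ∷ L) ≡ X (toℕ j) L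
    X-there {i} {j} b L j≢i rewrite dec-false (toℕ j ℕ.≟ toℕ i) (j≢i ∘ Fin.toℕ-injective) = ℤ.+-identityˡ _

    foldl-upd : ∀ c s r L → List.foldl upd (c , s , r) L ≡ (c , s , X c L ℤ.+ r)
    foldl-upd c s r []            = cong (λ z → c , s , z) (sym (ℤ.+-identityˡ r))
    foldl-upd c s r ((i , b) ∷ L) = trans (foldl-upd c s _ L) (cong (λ z → c , s , z)
      (trans (sym (ℤ.+-assoc (X c L) y r)) (cong (ℤ._+ r) (ℤ.+-comm (X c L) y))))
      where y = if does (c ℕ.≟ toℕ i) then sgℤ b else pos 0

    bias : List Item → ℚ
    bias L = sum {n} λ i → ∣ ιℤ (X (toℕ i) L) ∣

    sum-change : ∀ {m} (g h : Fin m → ℚ) a → (∀ b → b ≢ a → h b ≡ g b) → sum h ≡ (h a - g a) + sum g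
    sum-change {suc m} g h zero    eq = trans (cong (h zero +_) (sum-cong (h ∘ suc) (g ∘ suc) (λ b → eq (suc b) (λ ())))) (lem (h zero) (g zero) (sum (g ∘ suc)))
      where
      lem : ∀ h g s → h + s ≡ h - g + (g + s)
      lem = solve-∀ ℚ-ring
    sum-change {suc m} g h (suc a) eq = trans (cong₂ _+_ (eq zero (λ ())) (sum-change (g ∘ suc) (h ∘ suc) a (λ b ne → eq (suc b) (ne ∘ Fin.suc-injective))))
      (lem (g zero) (h (suc a) - g (suc a)) (sum (g ∘ suc)))
      where
      lem : ∀ g d s → g + (d + s) ≡ d + (g + s)
      lem = solve-∀ ℚ-ring

    sum-0 : ∀ m → sum {m} (λ _ → 0ℚ) ≡ 0ℚ
    sum-0 m = trans (sum-const m 0ℚ) (*-zeroʳ (ι m))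

    -- The increments of |X| along the stream telescope to the total bias.
    suffixes-bias : ∀ L → suffixes z-value L ≡ bias L
    suffixes-bias []            = sym (trans (sum-cong {n} (λ _ → ∣ ιℤ (pos 0) ∣) (λ _ → 0ℚ) (λ i → cong ∣_∣ ιℤ-0)) (sum-0 n))
    suffixes-bias ((i , b) ∷ L) = begin
      z-value (List.foldl upd (toℕ i , b , pos 0) L) + suffixes z-value L
        ≡⟨ cong₂ (λ s e → z-value s + e) (trans (foldl-upd (toℕ i) b (pos 0) L) (cong (λ z → toℕ i , b , z) (ℤ.+-identityʳ _))) (suffixes-bias L) ⟩
      ∣ sg b + ιℤ (X (toℕ i) L) ∣ - ∣ ιℤ (X (toℕ i) L) ∣ + bias L
        ≡⟨ cong (λ z → ∣ z ∣ - ∣ ιℤ (X (toℕ i) L) ∣ + bias L) (X-here i b L) ⟨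
      ∣ ιℤ (X (toℕ i) ((i , b) ∷ L)) ∣ - ∣ ιℤ (X (toℕ i) L) ∣ + bias L
        ≡⟨ sum-change (λ j → ∣ ιℤ (X (toℕ j) L) ∣) (λ j → ∣ ιℤ (X (toℕ j) ((i , b) ∷ L)) ∣) i (λ j ne → cong (λ z → ∣ ιℤ z ∣) (X-there b L ne)) ⟨
      bias ((i , b) ∷ L) ∎
      where open ≡-Reasoning

    ∑-items : ∀ L (η : Fin n → ℚ) → ∑ L (λ (i , b) → sg b * η i) ≡ sum (λ i → ιℤ (X (toℕ i) L) * η i)
    ∑-items []            η = sym (trans (sum-cong {n} (λ i → ιℤ (pos 0) * η i) (λ _ → 0ℚ) (λ i → trans (cong (_* η i) ιℤ-0) (*-zeroˡ (η i)))) (sum-0 n))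
    ∑-items ((i , b) ∷ L) η = begin
      sg b * η i + ∑ L (λ (i , b) → sg b * η i)
        ≡⟨ cong (sg b * η i +_) (∑-items L η) ⟩
      sg b * η i + sum (λ j → ιℤ (X (toℕ j) L) * η j)
        ≡⟨ cong (_+ sum (λ j → ιℤ (X (toℕ j) L) * η j)) (trans (lem (sg b) (ιℤ (X (toℕ i) L)) (η i)) (cong (λ z → z * η i - ιℤ (X (toℕ i) L) * η i) (sym (X-here i b L)))) ⟩
      ιℤ (X (toℕ i) ((i , b) ∷ L)) * η i - ιℤ (X (toℕ i) L) * η i + sum (λ j → ιℤ (X (toℕ j) L) * η j)
        ≡⟨ sum-change (λ j → ιℤ (X (toℕ j) L) * η j) (λ j → ιℤ (X (toℕ j) ((i , b) ∷ L)) * η j) i (λ j ne → cong (λ z → ιℤ z * η j) (X-there b L ne)) ⟨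
      sum (λ j → ιℤ (X (toℕ j) ((i , b) ∷ L)) * η j) ∎
      where
      open ≡-Reasoning
      lem : ∀ s x e → s * e ≡ (s + x) * e - x * e
      lem = solve-∀ ℚ-ring

    sum-mono : ∀ {m} {g h : Fin m → ℚ} → (∀ i → g i ≤ h i) → sum g ≤ sum h
    sum-mono {zero}  le = ≤-refl
    sum-mono {suc m} {g} {h} le = +-mono-≤ (le zero) (sum-mono {m} {g ∘ suc} {h ∘ suc} (le ∘ suc))

    ∑-items-≤ : ∀ L (η : Fin n → ℚ) → (∀ i → ∣ η i ∣ ≡ 1ℚ) → ∑ L (λ (i , b) → sg b * η i) ≤ bias L
    ∑-items-≤ L η b = subst (_≤ bias L) (sym (∑-items L η)) (sum-mono {n} {λ i → ιℤ (X (toℕ i) L) * η i} {λ i → ∣ ιℤ (X (toℕ i) L) ∣} (λ i → ≤-trans (≤∣∣ (ιℤ (X (toℕ i) L) * η i))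
      (≤-reflexive (trans (∣p*q∣≡∣p∣*∣q∣ (ιℤ (X (toℕ i) L)) (η i)) (trans (cong (∣ ιℤ (X (toℕ i) L) ∣ *_) (b i)) (*-identityʳ _))))))
      where
      ≤∣∣ : ∀ x → x ≤ ∣ x ∣
      ≤∣∣ x with ≤-total 0ℚ x
      ... | inj₁ h = ≤-reflexive (sym (0≤p⇒∣p∣≡p h))
      ... | inj₂ h = ≤-trans h (0≤∣p∣ x)

    majority : List Item → Fin n → Sign
    majority L i = ℤ.sign (X (toℕ i) L)

    ∑-items-majority : ∀ L → ∑ L (λ (i , b) → sg b * sg (majority L i)) ≡ bias L
    ∑-items-majority L = trans (∑-items L (λ i → sg (majority L i))) (sum-cong (λ i → ιℤ (X (toℕ i) L) * sg (majority L i)) (λ i → ∣ ιℤ (X (toℕ i) L) ∣) (λ i → eq (X (toℕ i) L)))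
      where
      eq : ∀ x → ιℤ x * sg (ℤ.sign x) ≡ ∣ ιℤ x ∣
      eq x@(pos m)    = trans (*-identityʳ (ιℤ x)) (sym (0≤p⇒∣p∣≡p (0≤ι m)))
      eq x@(ℤ.-[1+ m ]) = trans (trans (cong (_* - 1ℚ) ι-neg) (lem (ι (suc m)))) (ιℤ-abs x)
        where
        ι-neg : ιℤ x ≡ - ι (suc m)
        ι-neg = trans (lem′ (ιℤ x) (ι (suc m))) (trans (cong (_- ι (suc m)) (trans (sym (ιℤ-+ x (pos (suc m)))) (trans (cong ιℤ (ℤ.+-inverseˡ (pos (suc m)))) ιℤ-0))) (+-identityˡ _))
          where
          lem′ : ∀ x y → x ≡ x + y - y
          lem′ = solve-∀ ℚ-ring
        lem : ∀ y → - y * - 1ℚ ≡ y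
        lem = solve-∀ ℚ-ring

    z-value-sq : ∀ smp → z-value smp * z-value smp ≤ 1ℚ
    z-value-sq (c , s , r) = sq≤ (upper (sg s) (ιℤ r) (∣sg∣ s)) (lower (sg s) (ιℤ r) (∣sg∣ s))
      where
      upper : ∀ a x → ∣ a ∣ ≡ 1ℚ → ∣ a + x ∣ - ∣ x ∣ ≤ 1ℚ
      upper a x a1 = ≤-trans (+-monoˡ-≤ (- ∣ x ∣) (∣p+q∣≤∣p∣+∣q∣ a x)) (≤-reflexive (trans (lem ∣ a ∣ ∣ x ∣) a1))
        where
        lem : ∀ a x → a + x - x ≡ a
        lem = solve-∀ ℚ-ring
      lower : ∀ a x → ∣ a ∣ ≡ 1ℚ → - 1ℚ ≤ ∣ a + x ∣ - ∣ x ∣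
      lower a x a1 = diff-0≤ (subst (0ℚ ≤_) (lem₂ ∣ a + x ∣ ∣ x ∣) (0≤-diff (≤-trans (≤-reflexive (cong ∣_∣ (lem₁ a x)))
        (≤-trans (∣p+q∣≤∣p∣+∣q∣ (a + x) (- a)) (≤-reflexive (cong (∣ a + x ∣ +_) (trans (∣-p∣≡∣p∣ a) a1)))))))
        where
        lem₁ : ∀ a x → x ≡ a + x + (- a)
        lem₁ = solve-∀ ℚ-ring
        lem₂ : ∀ y x → y + 1ℚ - x ≡ y - x - - 1ℚ
        lem₂ = solve-∀ ℚ-ring
      sq≤ : ∀ {z} → z ≤ 1ℚ → - 1ℚ ≤ z → z * z ≤ 1ℚ
      sq≤ {z} h h′ = diff-0≤ (subst (0ℚ ≤_) (lem z) (0≤* (0≤-diff h) (0≤-diff h′)))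
        where
        lem : ∀ z → (1ℚ - z) * (z - - 1ℚ) ≡ 1ℚ - z * z
        lem = solve-∀ ℚ-ring

    length*E-z : ∀ L r smp → List.length L ℕ.≤ r → ι (List.length L) * E (coins 0 r) (λ ω → z-value (run ω smp L)) ≡ bias L
    length*E-z L r smp le = trans (reservoir z-value L 0 r smp le)
      (trans (cong (_+ suffixes z-value L) (trans (cong (_* z-value (List.foldl upd smp L)) ιℤ-0) (*-zeroˡ (z-value (List.foldl upd smp L)))))
        (trans (+-identityˡ _) (suffixes-bias L)))

  module Repeat {A : Set} (M : Mean A) (Z : A → ℚ) (Z²≤1 : ∀ a → Z a * Z a ≤ 1ℚ) where

    mean : ℚ
    mean = E M Z

    tally : ∀ {R} → Vec A R → ℚ
    tally []       = 0ℚ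
    tally (ω ∷ ωs) = Z ω + tally ωs

    private
      Y : A → ℚ
      Y ω = Z ω - mean

      E-Y : E M Y ≡ 0ℚ
      E-Y = trans (E-- M Z (λ _ → mean)) (trans (cong (λ z → mean - z) (E-const M mean)) (+-inverseʳ mean))

      E-Y² : E M (λ ω → Y ω * Y ω) ≤ 1ℚ
      E-Y² = begin
        E M (λ ω → Y ω * Y ω)
          ≡⟨ E-cong M (λ ω → lem (Z ω) mean) ⟩
        E M (λ ω → Z ω * Z ω - (two * mean * Y ω + mean * mean))
          ≡⟨ trans (E-- M (λ ω → Z ω * Z ω) (λ ω → two * mean * Y ω + mean * mean)) (cong (λ z → E M (λ ω → Z ω * Z ω) - z)
               (trans (E-+ M (λ ω → two * mean * Y ω) (λ _ → mean * mean)) (cong₂ _+_ (trans (E-*ˡ M (two * mean) Y) (trans (cong (two * mean *_) E-Y) (*-zeroʳ (two * mean)))) (E-const M (mean * mean))))) ⟩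
        E M (λ ω → Z ω * Z ω) - (0ℚ + mean * mean)
          ≤⟨ ≤-by (0≤sq mean) (lem′ (E M (λ ω → Z ω * Z ω)) (mean * mean)) ⟩
        E M (λ ω → Z ω * Z ω)
          ≤⟨ E-≤const M Z²≤1 ⟩
        1ℚ ∎
        where
        open ≤-Reasoning
        lem : ∀ z m → (z - m) * (z - m) ≡ z * z - (two * m * (z - m) + m * m)
        lem = solve-∀ ℚ-ring
        lem′ : ∀ x y → x ≡ x - (0ℚ + y) + y
        lem′ = solve-∀ ℚ-ring

      dev : ∀ {R} → Vec A R → ℚ
      dev []       = 0ℚ
      dev (ω ∷ ωs) = Y ω + dev ωs

      dev-tally : ∀ {R} (ωs : Vec A R) → dev ωs ≡ tally ωs - ι R * mean
      dev-tally []       = sym (trans (cong (λ z → 0ℚ - z * mean) ιℤ-0) (lem mean))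
        where
        lem : ∀ m → 0ℚ - 0ℚ * m ≡ 0ℚ
        lem = solve-∀ ℚ-ring
      dev-tally {suc R} (ω ∷ ωs) = trans (cong (Y ω +_) (dev-tally ωs)) (trans (lem (Z ω) mean (tally ωs) (ι R)) (cong (λ z → Z ω + tally ωs - z * mean) (sym (ι-suc R))))
        where
        lem : ∀ z m t r → z - m + (t - r * m) ≡ z + t - (1ℚ + r) * m
        lem = solve-∀ ℚ-ring

      copies : ∀ R → Mean (Vec A R)
      copies R = prodM (replicate R M)

      E-dev : ∀ R → E (copies R) dev ≡ 0ℚ
      E-dev zero    = refl
      E-dev (suc R) = trans (E-prod M (replicate R M) dev) (trans (E-cong M (λ ω → trans (E-+ (copies R) (λ _ → Y ω) dev) (cong₂ _+_ (E-const (copies R) (Y ω)) (E-dev R))))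
        (trans (E-+ M Y (λ _ → 0ℚ)) (cong₂ _+_ E-Y (E-const M 0ℚ))))

      E-dev² : ∀ R → E (copies R) (λ ωs → dev ωs * dev ωs) ≤ ι R
      E-dev² zero    = ≤-reflexive (sym ιℤ-0)
      E-dev² (suc R) = begin
        E (copies (suc R)) (λ ωs → dev ωs * dev ωs)
          ≡⟨ E-prod M (replicate R M) (λ ωs → dev ωs * dev ωs) ⟩
        E M (λ ω → E (copies R) (λ ωs → (Y ω + dev ωs) * (Y ω + dev ωs)))
          ≡⟨ E-cong M (λ ω → trans (E-cong (copies R) (λ ωs → lem (Y ω) (dev ωs)))
               (trans (E-+ (copies R) (λ ωs → Y ω * Y ω + two * Y ω * dev ωs) (λ ωs → dev ωs * dev ωs))
                 (cong (_+ v) (trans (E-+ (copies R) (λ _ → Y ω * Y ω) (λ ωs → two * Y ω * dev ωs))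
                   (cong₂ _+_ (E-const (copies R) (Y ω * Y ω)) (trans (E-*ˡ (copies R) (two * Y ω) dev) (trans (cong (two * Y ω *_) (E-dev R)) (*-zeroʳ (two * Y ω))))))))) ⟩
        E M (λ ω → Y ω * Y ω + 0ℚ + v)
          ≡⟨ trans (E-cong M (λ ω → cong (_+ v) (+-identityʳ (Y ω * Y ω)))) (trans (E-+ M (λ ω → Y ω * Y ω) (λ _ → v)) (cong (E M (λ ω → Y ω * Y ω) +_) (E-const M v))) ⟩
        E M (λ ω → Y ω * Y ω) + v
          ≤⟨ +-mono-≤ E-Y² (E-dev² R) ⟩
        1ℚ + ι R ≡⟨ ι-suc R ⟨
        ι (suc R) ∎
        where
        open ≤-Reasoning
        v = E (copies R) (λ ωs → dev ωs * dev ωs)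
        lem : ∀ y d → (y + d) * (y + d) ≡ y * y + two * y * d + d * d
        lem = solve-∀ ℚ-ring

    -- Chebyshev's inequality for a threshold `κ` at distance `d` from the mean. Here `e` stands for
    -- `1 / (R d)²`, and `e * R ≤ ⅓` bounds the failure probability because each sample has variance
    -- at most 1.
    module _ (R : ℕ) (κ d e : ℚ) (0≤d : 0ℚ ≤ d) (0≤e : 0ℚ ≤ e) (1≤ : 1ℚ ≤ e * (ι R * d * (ι R * d))) (eR≤ : e * ι R ≤ ⅓) where

      test : Vec A R → Bool
      test ωs = does (ι R * κ ≤? tally ωs)

      private
        E-e : E (copies R) (λ ωs → e * (dev ωs * dev ωs)) ≤ ⅓
        E-e = ≤-trans (≤-reflexive (E-*ˡ (copies R) e _)) (≤-trans (*-monoˡ 0≤e (E-dev² R)) eR≤)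

        0≤Rd : 0ℚ ≤ ι R * d
        0≤Rd = 0≤* (0≤ι R) 0≤d

      test-high : κ + d ≤ mean → ⅔ ≤ E (copies R) (ind ∘ test)
      test-high κ+d≤ = ≤-trans (≤-trans (≤-reflexive refl) (+-monoʳ-≤ 1ℚ (neg-antimono-≤ E-e)))
        (≤-trans (≤-reflexive (sym (trans (E-- (copies R) (λ _ → 1ℚ) (λ ωs → e * (dev ωs * dev ωs))) (cong (_- E (copies R) (λ ωs → e * (dev ωs * dev ωs))) (E-const (copies R) 1ℚ)))))
          (E-mono (copies R) (λ ωs → go ωs (ι R * κ ≤? tally ωs))))
        where
        go : ∀ ωs (t : Dec (ι R * κ ≤ tally ωs)) → 1ℚ - e * (dev ωs * dev ωs) ≤ ind (does t)
        go ωs (yes _) = ≤-by (0≤* 0≤e (0≤sq (dev ωs))) (lem (e * (dev ωs * dev ωs)))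
          where
          lem : ∀ x → 1ℚ ≡ 1ℚ - x + x
          lem = solve-∀ ℚ-ring
        go ωs (no ¬h) = diff-0≤ (subst (0ℚ ≤_) (lem (e * (dev ωs * dev ωs))) (0≤-diff (≤-trans 1≤ (*-monoˡ 0≤e (≤-trans (*-mono 0≤Rd 0≤Rd Rd≤ Rd≤) (≤-reflexive (lem′ (dev ωs))))))))
          where
          lem : ∀ x → x - 1ℚ ≡ 0ℚ - (1ℚ - x)
          lem = solve-∀ ℚ-ring
          lem′ : ∀ x → - x * - x ≡ x * x
          lem′ = solve-∀ ℚ-ring
          Rd≤ : ι R * d ≤ - dev ωs
          Rd≤ = subst (λ z → ι R * d ≤ - z) (sym (dev-tally ωs)) (diff-0≤ (subst (0ℚ ≤_) (lem₁ (ι R) κ d mean (tally ωs))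
            (0≤+ (0≤* (0≤ι R) (0≤-diff κ+d≤)) (0≤-diff (<⇒≤ (≰⇒> ¬h))))))
            where
            lem₁ : ∀ r k d m t → r * (m - (k + d)) + (r * k - t) ≡ - (t - r * m) - r * d
            lem₁ = solve-∀ ℚ-ring

      test-low : mean + d ≤ κ → E (copies R) (ind ∘ test) ≤ ⅓
      test-low m+d≤ = ≤-trans (E-mono (copies R) (λ ωs → go ωs (ι R * κ ≤? tally ωs))) E-e
        where
        go : ∀ ωs (t : Dec (ι R * κ ≤ tally ωs)) → ind (does t) ≤ e * (dev ωs * dev ωs)
        go ωs (no _)  = 0≤* 0≤e (0≤sq (dev ωs))
        go ωs (yes h) = ≤-trans 1≤ (*-monoˡ 0≤e (*-mono 0≤Rd 0≤Rd Rd≤ Rd≤))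
          where
          Rd≤ : ι R * d ≤ dev ωs
          Rd≤ = subst (ι R * d ≤_) (sym (dev-tally ωs)) (diff-0≤ (subst (0ℚ ≤_) (lem₁ (ι R) κ d mean (tally ωs))
            (0≤+ (0≤* (0≤ι R) (0≤-diff m+d≤)) (0≤-diff h))))
            where
            lem₁ : ∀ r k d m t → r * (k - (m + d)) + (t - r * k) ≡ t - r * m - r * d
            lem₁ = solve-∀ ℚ-ring

-- The bias of an instance and its value

module Bias where

  open FiniteMeans
  open CubeMoments
  open LevelTwo
  open Draws
  open SymmetricPredicates
  open RandomInstances using (hits; hits-true; ∑-ι-hits)
  open Reservoir
  open Memory using (eight)

  module _ {A : Set} where

    -- By the last hypothesis `G x` ignores coordinate `i`; under a product measure this coordinate
    -- is independent of the others.
    E-prod-split : ∀ {n} (Ms : Vec (Mean A) n) i (G : A → Vec A n → ℚ) → (∀ x y σ → G x (σ [ i ]≔ y) ≡ G x σ) →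
      E (prodM Ms) (λ σ → G (lookup σ i) σ) ≡ E (lookup Ms i) (λ x → E (prodM Ms) (G x))
    E-prod-split (M ∷ Ms) zero    G inv = trans (E-prod M Ms _) (E-cong M (λ x →
      sym (trans (E-prod M Ms (G x)) (trans (E-cong M (λ y → E-cong (prodM Ms) (λ σ → sym (inv x x (y ∷ σ))))) (E-const M _)))))
    E-prod-split (M ∷ Ms) (suc i) G inv = trans (E-prod M Ms _)
      (trans (E-cong M (λ y → E-prod-split Ms i (λ x σ → G x (y ∷ σ)) (λ x z σ → inv x z (y ∷ σ))))
        (trans (E-swap M (lookup Ms i) _) (E-cong (lookup Ms i) (λ x → sym (E-prod M Ms (G x))))))

    map-lookup-update : ∀ {n k} (σ : Vec A n) i y {j : Vec (Fin n) k} → All (i ≢_) j →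
      Vec.map (lookup (σ [ i ]≔ y)) j ≡ Vec.map (lookup σ) j
    map-lookup-update σ i y []         = refl
    map-lookup-update σ i y (ne ∷ nes) = cong₂ _∷_ (Vec.lookup∘update′ (ne ∘ sym) σ y) (map-lookup-update σ i y nes)

    -- Distinctness of the variables of a constraint enters here: their values under an independent
    -- random assignment are independent again.
    E-prod-lookup : ∀ {n k} (Ms : Vec (Mean A) n) {j : Vec (Fin n) k} → Unique j → (h : Vec A k → ℚ) →
      E (prodM Ms) (λ σ → h (Vec.map (lookup σ) j)) ≡ E (prodM (Vec.map (lookup Ms) j)) h
    E-prod-lookup Ms []                    h = E-const (prodM Ms) (h [])
    E-prod-lookup Ms {i ∷ j} (fresh ∷ uniq) h = trans
      (E-prod-split Ms i (λ x σ → h (x ∷ Vec.map (lookup σ) j)) (λ x y σ → cong (λ a → h (x ∷ a)) (map-lookup-update σ i y fresh)))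
      (trans (E-cong (lookup Ms i) (λ x → E-prod-lookup Ms uniq (λ a → h (x ∷ a))))
        (sym (E-prod (lookup Ms i) (Vec.map (lookup Ms) j) h)))

  Within : ℚ → ℚ → Set
  Within c x = - c ≤ x × x ≤ c

  within-neg : ∀ {c x} → Within c x → Within c (- x)
  within-neg {c} {x} (p , q) = neg-antimono-≤ q , ≤-trans (neg-antimono-≤ p) (≤-reflexive (lem c))
    where
    lem : ∀ c → - (- c) ≡ c
    lem = solve-∀ ℚ-ring

  within-sg : ∀ {c x} s → Within c x → Within c (sg s * x)
  within-sg {c} {x} Sign.+ h = subst (Within c) (sym (*-identityˡ x)) h
  within-sg {c} {x} Sign.- h = subst (Within c) (lem x) (within-neg h)
    where
    lem : ∀ x → - x ≡ - 1ℚ * x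
    lem = solve-∀ ℚ-ring

  within-scale : ∀ {γ c x} → 0ℚ ≤ γ → Within c x → Within (γ * c) (γ * x)
  within-scale {γ} {c} {x} 0≤γ (p , q) = ≤-trans (≤-reflexive (lem γ c)) (*-monoˡ 0≤γ p) , *-monoˡ 0≤γ q
    where
    lem : ∀ γ c → - (γ * c) ≡ γ * - c
    lem = solve-∀ ℚ-ring

  within-+ : ∀ {c d x y} → Within c x → Within d y → Within (c + d) (x + y)
  within-+ {c} {d} (p , q) (p′ , q′) = ≤-trans (≤-reflexive (neg-distrib-+ c d)) (+-mono-≤ p p′) , +-mono-≤ q q′

  within-even : ∀ {k} {h : Vec Sign (suc k) → ℚ} → (∀ a → Within 1ℚ (h a)) → ∀ a → Within 1ℚ (even h a)
  within-even {h = h} b a = within-scale {½} {two} {h (Sign.+ ∷ a) + h (Sign.- ∷ a)} 0≤½ (within-+ {1ℚ} {1ℚ} (b (Sign.+ ∷ a)) (b (Sign.- ∷ a)))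

  within-odd : ∀ {k} {h : Vec Sign (suc k) → ℚ} → (∀ a → Within 1ℚ (h a)) → ∀ a → Within 1ℚ (odd h a)
  within-odd {h = h} b a = within-scale {½} {two} {h (Sign.+ ∷ a) - h (Sign.- ∷ a)} 0≤½ (within-+ {1ℚ} {1ℚ} (b (Sign.+ ∷ a)) (within-neg {1ℚ} {h (Sign.- ∷ a)} (b (Sign.- ∷ a))))

  within-E : ∀ {A : Set} (M : Mean A) {h : A → ℚ} {c} → (∀ a → Within c (h a)) → Within c (E M h)
  within-E M {h} {c} b = subst (_≤ E M h) (E-const M (- c)) (E-mono M (proj₁ ∘ b)) , E-≤const M (proj₂ ∘ b)

  module Biased (γ : ℚ) (0≤γ : 0ℚ ≤ γ) (γ≤1 : γ ≤ 1ℚ) where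

    private
      weight : Sign → ℚ
      weight y = ½ * (1ℚ + γ * sg y)

      0≤weight : ∀ y → 0ℚ ≤ weight y
      0≤weight Sign.+ = 0≤* 0≤½ (0≤+ 0≤1 (0≤* 0≤γ 0≤1))
      0≤weight Sign.- = 0≤* 0≤½ (subst (0ℚ ≤_) (lem γ) (0≤-diff γ≤1))
        where
        lem : ∀ γ → 1ℚ - γ ≡ 1ℚ + γ * - 1ℚ
        lem = solve-∀ ℚ-ring

      weight≤1 : ∀ y → weight y ≤ 1ℚ
      weight≤1 Sign.+ = ≤-by (0≤* 0≤½ (0≤-diff γ≤1)) (lem γ)
        where
        lem : ∀ γ → 1ℚ ≡ ½ * (1ℚ + γ * 1ℚ) + ½ * (1ℚ - γ)
        lem = solve-∀ ℚ-ring
      weight≤1 Sign.- = ≤-by (0≤* 0≤½ (0≤+ 0≤1 0≤γ)) (lem γ)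
        where
        lem : ∀ γ → 1ℚ ≡ ½ * (1ℚ + γ * - 1ℚ) + ½ * (1ℚ + γ)
        lem = solve-∀ ℚ-ring

    bcoin : Sign → Mean Sign
    bcoin y = mix (weight y) (0≤weight y) (weight≤1 y) (dirac Sign.+) (dirac Sign.-)

    E-bcoin-* : ∀ b y (g : Sign → ℚ) → E (bcoin y) (λ t → g (b Sign.* t)) ≡ E (bcoin (b Sign.* y)) g
    E-bcoin-* Sign.+ y      g = refl
    E-bcoin-* Sign.- Sign.+ g = lem γ (g Sign.-) (g Sign.+)
      where
      lem : ∀ γ a b → ½ * (1ℚ + γ * 1ℚ) * a + (1ℚ - ½ * (1ℚ + γ * 1ℚ)) * b ≡ ½ * (1ℚ + γ * - 1ℚ) * b + (1ℚ - ½ * (1ℚ + γ * - 1ℚ)) * a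
      lem = solve-∀ ℚ-ring
    E-bcoin-* Sign.- Sign.- g = lem γ (g Sign.-) (g Sign.+)
      where
      lem : ∀ γ a b → ½ * (1ℚ + γ * - 1ℚ) * a + (1ℚ - ½ * (1ℚ + γ * - 1ℚ)) * b ≡ ½ * (1ℚ + γ * 1ℚ) * b + (1ℚ - ½ * (1ℚ + γ * 1ℚ)) * a
      lem = solve-∀ ℚ-ring

    biased : ∀ {k} → Vec Sign k → (Vec Sign k → ℚ) → ℚ
    biased ys h = E (prodM (Vec.map bcoin ys)) h

    biased-* : ∀ {k} (bs ys : Vec Sign k) h → biased ys (λ a → h (Vec.zipWith Sign._*_ bs a)) ≡ biased (Vec.zipWith Sign._*_ bs ys) h
    biased-* []       []       h = refl
    biased-* (b ∷ bs) (y ∷ ys) h = trans (E-prod (bcoin y) (Vec.map bcoin ys) _)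
      (trans (E-cong (bcoin y) (λ t → biased-* bs ys (λ a → h (b Sign.* t ∷ a))))
        (trans (E-bcoin-* b y (λ t → biased (Vec.zipWith Sign._*_ bs ys) (λ a → h (t ∷ a))))
          (sym (E-prod (bcoin (b Sign.* y)) (Vec.map bcoin (Vec.zipWith Sign._*_ bs ys)) h))))

    biased-∷ : ∀ {k} y (ys : Vec Sign k) h → biased (y ∷ ys) h ≡ biased ys (even h) + γ * (sg y * biased ys (odd h))
    biased-∷ y ys h = trans (E-prod (bcoin y) (Vec.map bcoin ys) h) (trans (lem γ (sg y) (biased ys (λ a → h (Sign.+ ∷ a))) (biased ys (λ a → h (Sign.- ∷ a))))
      (cong₂ (λ x z → x + γ * (sg y * z))
        (sym (trans (E-*ˡ M ½ _) (cong (½ *_) (E-+ M (λ a → h (Sign.+ ∷ a)) (λ a → h (Sign.- ∷ a))))))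
        (sym (trans (E-*ˡ M ½ _) (cong (½ *_) (E-- M (λ a → h (Sign.+ ∷ a)) (λ a → h (Sign.- ∷ a))))))))
      where
      M = prodM (Vec.map bcoin ys)
      lem : ∀ γ s a b → ½ * (1ℚ + γ * s) * a + (1ℚ - ½ * (1ℚ + γ * s)) * b ≡ ½ * (a + b) + γ * (s * (½ * (a - b)))
      lem = solve-∀ ℚ-ring

    -- The derivative of `biased ys h` in `γ` at 0, that is, the linear Fourier part of `h`
    -- evaluated at `ys`.
    lin : ∀ {k} → Vec Sign k → (Vec Sign k → ℚ) → ℚ
    lin []       h = 0ℚ
    lin {suc k} (y ∷ ys) h = sg y * E (cubeM k) (odd h) + lin ys (even h)

    lin-coords : ∀ {k} (ys : Vec Sign k) h → lin ys h ≡ sum (λ i → sg (lookup ys i) * E (cubeM k) (λ a → h a * sg (lookup a i)))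
    lin-coords []       h = refl
    lin-coords {suc k} (y ∷ ys) h = cong₂ _+_ (cong (sg y *_) (E-odd h)) (trans (lin-coords ys (even h))
      (sum-cong (λ i → sg (lookup ys i) * E (cubeM k) (λ a → even h a * sg (lookup a i)))
                (λ i → sg (lookup ys i) * E (cubeM (suc k)) (λ a → h a * sg (lookup a (suc i))))
                (λ i → cong (sg (lookup ys i) *_) (E-even-coord h i))))

    first-order : ∀ {k} (ys : Vec Sign k) h → (∀ a → Within 1ℚ (h a)) → Within (γ * ι k) (biased ys h - E (cubeM k) h)
    first-order []       h b = subst₂ Within (sym (trans (cong (γ *_) ιℤ-0) (*-zeroʳ γ)))
        (sym (trans (cong (λ z → h [] - z) (E-cube-zero h)) (+-inverseʳ (h [])))) (≤-refl , ≤-refl)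
    first-order {suc k} (y ∷ ys) h b = subst₂ Within (trans (lem₁ γ (ι k)) (cong (γ *_) (sym (ι-suc k))))
        (trans (lem₂ (biased ys (even h)) (E (cubeM k) (even h)) (γ * (sg y * biased ys (odd h)))) (cong₂ _-_ (sym (biased-∷ y ys h)) (E-even h)))
        (within-+ {γ * ι k} {γ * 1ℚ} (first-order ys (even h) (within-even {h = h} b))
          (within-scale 0≤γ (within-sg y (within-E (prodM (Vec.map bcoin ys)) (within-odd {h = h} b)))))
      where
      lem₁ : ∀ γ k → γ * k + γ * 1ℚ ≡ γ * (1ℚ + k)
      lem₁ = solve-∀ ℚ-ring
      lem₂ : ∀ x e z → x - e + z ≡ x + z - e
      lem₂ = solve-∀ ℚ-ring

    -- A Taylor expansion in `γ`. By `biased-∷` the even part is treated by induction, while the odd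
    -- part already has a factor `γ`, so `first-order` suffices for it. The growth of `ι k * ι k`
    -- with `k` dominates the errors `ι k` of these steps.
    second-order : ∀ {k} (ys : Vec Sign k) h → (∀ a → Within 1ℚ (h a)) →
      E (cubeM k) h + γ * lin ys h - γ * γ * (ι k * ι k) ≤ biased ys h
    second-order []       h b = ≤-by (0≤* (0≤* 0≤γ 0≤γ) (0≤sq (ι 0))) (trans (sym (E-cube-zero h)) (lem (E (cubeM 0) h) γ (ι 0 * ι 0)))
      where
      lem : ∀ e γ i → e ≡ e + γ * 0ℚ - γ * γ * i + γ * γ * i
      lem = solve-∀ ℚ-ring
    second-order {suc k} (y ∷ ys) h b = begin
      E (cubeM (suc k)) h + γ * (sg y * o + lin ys (even h)) - γ * γ * (ι (suc k) * ι (suc k))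
        ≡⟨ cong₂ (λ e i → e + γ * (sg y * o + lin ys (even h)) - γ * γ * (i * i)) (sym (E-even h)) (ι-suc k) ⟩
      e + γ * (sg y * o + lin ys (even h)) - γ * γ * ((1ℚ + ι k) * (1ℚ + ι k))
        ≤⟨ ≤-by (0≤+ (0≤* (0≤* 0≤γ 0≤γ) (0≤+ 0≤1 (0≤ι k)))
             (0≤* 0≤γ (0≤-diff (proj₁ (within-sg y (first-order ys (odd h) (within-odd {h = h} b))))))) (lem e γ (sg y) o (lin ys (even h)) (ι k) (biased ys (odd h))) ⟩
      e + γ * lin ys (even h) - γ * γ * (ι k * ι k) + γ * (sg y * biased ys (odd h))
        ≤⟨ +-monoˡ-≤ (γ * (sg y * biased ys (odd h))) (second-order ys (even h) (within-even {h = h} b)) ⟩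
      biased ys (even h) + γ * (sg y * biased ys (odd h))
        ≡⟨ biased-∷ y ys h ⟨
      biased (y ∷ ys) h ∎
      where
      open ≤-Reasoning
      e = E (cubeM k) (even h)
      o = E (cubeM k) (odd h)
      lem : ∀ e γ s o l i b → e + γ * l - γ * γ * (i * i) + γ * (s * b) ≡
        e + γ * (s * o + l) - γ * γ * ((1ℚ + i) * (1ℚ + i)) + (γ * γ * (1ℚ + i) + γ * (s * (b - o) - - (γ * i)))
      lem = solve-∀ ℚ-ring

  items : ∀ {k n} → Constraint k n → List (Item {n})
  items C = Vec.toList (Vec.zip j b)
    where open Constraint C

  tot-items : ∀ {k n} (js : Vec (Fin n) k) bs (σ : Vec Sign n) →
    tot (Vec.zipWith Sign._*_ bs (Vec.map (lookup σ) js)) ≡ ∑ (Vec.toList (Vec.zip js bs)) (λ (i , b) → sg b * sg (lookup σ i))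
  tot-items []       []       σ = refl
  tot-items (i ∷ js) (b ∷ bs) σ = cong₂ _+_ (sg-* b (lookup σ i)) (tot-items js bs σ)

  ∑-concatMap : ∀ {A B : Set} (h : A → List B) xs f → ∑ (List.concatMap h xs) f ≡ ∑ xs (λ x → ∑ (h x) f)
  ∑-concatMap h []       f = refl
  ∑-concatMap h (x ∷ xs) f = trans (∑-++ (h x) (List.concatMap h xs) f) (cong (∑ (h x) f +_) (∑-concatMap h xs f))

  ∑-const : ∀ {A : Set} (xs : List A) c → ∑ xs (λ _ → c) ≡ ι (List.length xs) * c
  ∑-const []       c = sym (trans (cong (_* c) ιℤ-0) (*-zeroˡ c))
  ∑-const (x ∷ xs) c = trans (cong (c +_) (∑-const xs c)) (trans (lem (ι (List.length xs)) c) (cong (_* c) (sym (ι-suc (List.length xs)))))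
    where
    lem : ∀ i c → c + i * c ≡ (1ℚ + i) * c
    lem = solve-∀ ℚ-ring

  hits≤length : ∀ {A : Set} (P : A → Bool) xs → hits P xs ℕ.≤ List.length xs
  hits≤length P []       = ℕ.z≤n
  hits≤length P (x ∷ xs) with P x
  ... | true  = ℕ.s≤s (hits≤length P xs)
  ... | false = ℕ.m≤n⇒m≤1+n (hits≤length P xs)

  all-hit-≤ : ∀ {A : Set} (P : A → Bool) (g : A → ℚ) → (∀ x → P x ≡ true → 1ℚ ≤ g x) → ∀ xs →
    List.length xs ℕ.≤ hits P xs → ι (List.length xs) ≤ ∑ xs g
  all-hit-≤ P g le []       _ = ≤-reflexive ιℤ-0
  all-hit-≤ P g le (x ∷ xs) h = go (P x) refl
    where
    hits-false : P x ≡ false → hits P (x ∷ xs) ≡ hits P xs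
    hits-false eq with P x
    hits-false refl | false = refl
    go : ∀ b → P x ≡ b → ι (suc (List.length xs)) ≤ g x + ∑ xs g
    go true  eq = subst (_≤ g x + ∑ xs g) (sym (ι-suc (List.length xs)))
      (+-mono-≤ (le x eq) (all-hit-≤ P g le xs (ℕ.≤-pred (ℕ.≤-trans h (ℕ.≤-reflexive (hits-true P eq xs))))))
    go false eq = ⊥-elim (ℕ.<-irrefl refl (ℕ.≤-trans h (ℕ.≤-trans (ℕ.≤-reflexive (hits-false eq)) (hits≤length P xs))))

  module _ {k n : ℕ} (f : Predicate k) (Ψ : Instance k n) where

    constraints : List (Constraint k n)
    constraints = List⁺.toList Ψ

    stream : List (Item {n})
    stream = List.concatMap items constraints

    m : ℕ
    m = List⁺.length Ψ

    m*valAt : ∀ σ → ι m * valAt f Ψ σ ≡ ι (hits (satisfies f σ) constraints)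
    m*valAt σ = *-/-cancel (pos (count (satisfies f σ) Ψ)) m

    0<ιm : 0ℚ < ι m
    0<ιm = 0<ιsuc (List.length (List⁺.tail Ψ))

    ∑-stream : ∀ σ → ∑ stream (λ (i , b) → sg b * sg (lookup σ i)) ≡
      ∑ constraints (λ C → tot (Vec.zipWith Sign._*_ (Constraint.b C) (Vec.map (lookup σ) (Constraint.j C))))
    ∑-stream σ = trans (∑-concatMap items constraints _)
      (∑-cong constraints (λ C → sym (tot-items (Constraint.j C) (Constraint.b C) σ)))

    val-one : 1ℚ ≤ val f Ψ → ∃ λ σ → List.length constraints ℕ.≤ hits (satisfies f σ) constraints
    val-one 1≤val = proj₁ best , ι-cancel (subst₂ _≤_ (*-identityʳ (ι m)) (m*valAt (proj₁ best))
        (*-monoˡ (0≤ι m) (≤-trans 1≤val (≤-reflexive (proj₂ best)))))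
      where best = maxcube-attained n (valAt f Ψ)

    -- Every satisfied constraint contributes at least 1 to `sg ς * tot`. Grouped by variables, the
    -- sum over the stream is a combination of the numbers `X` with coefficients of absolute value
    -- 1, hence at most the sum of their absolute values.
    bias-high : ∀ {ς} → (∀ a → f a ≡ true → 1ℚ ≤ sg ς * tot a) → 1ℚ ≤ val f Ψ → ι m ≤ bias stream
    bias-high {ς} one 1≤val = begin
      ι m
        ≤⟨ all-hit-≤ (satisfies f σ) (λ C → sg ς * tot (Vec.zipWith Sign._*_ (Constraint.b C) (Vec.map (lookup σ) (Constraint.j C))))
             (λ C sat → one _ sat) constraints (proj₂ (val-one 1≤val)) ⟩
      ∑ constraints (λ C → sg ς * tot (Vec.zipWith Sign._*_ (Constraint.b C) (Vec.map (lookup σ) (Constraint.j C))))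
        ≡⟨ trans (∑-*ˡ constraints (sg ς) _) (trans (cong (sg ς *_) (sym (∑-stream σ))) (sym (∑-*ˡ stream (sg ς) _))) ⟩
      ∑ stream (λ (i , b) → sg ς * (sg b * sg (lookup σ i)))
        ≡⟨ ∑-cong stream (λ (i , b) → lem (sg ς) (sg b) (sg (lookup σ i))) ⟩
      ∑ stream (λ (i , b) → sg b * (sg ς * sg (lookup σ i)))
        ≤⟨ ∑-items-≤ stream (λ i → sg ς * sg (lookup σ i)) (λ i → trans (∣p*q∣≡∣p∣*∣q∣ (sg ς) (sg (lookup σ i))) (cong₂ _*_ (∣sg∣ ς) (∣sg∣ (lookup σ i)))) ⟩
      bias stream ∎
      where
      open ≤-Reasoning
      σ = proj₁ (val-one 1≤val)
      lem : ∀ s b x → s * (b * x) ≡ b * (s * x)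
      lem = solve-∀ ℚ-ring

    module _ (sym-f : Symmetric f) (ς : Sign) (g : ℚ) (coord : ∀ i → E (cubeM k) (λ a → ind (f a) * sg (lookup a i)) ≡ sg ς * g)
             (γ : ℚ) (0≤γ : 0ℚ ≤ γ) (γ≤1 : γ ≤ 1ℚ) where

      open Biased γ 0≤γ γ≤1

      private
        s : Vec Sign n
        -- The random assignment leans towards the majority sign of each variable, or against it
        -- when `ς` is negative.
        s = tabulate (λ i → ς Sign.* majority stream i)

        Ms : Vec (Mean Sign) n
        Ms = Vec.map bcoin s

        y : Constraint k n → Vec Sign k
        y C = Vec.zipWith Sign._*_ (Constraint.b C) (Vec.map (lookup s) (Constraint.j C))

        unique : ∀ (C : Constraint k n) → Unique (Constraint.j C)
        -- Distinctness is stored irrelevantly, but it is decidable and so can be recovered.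
        unique (mkConstraint j b d) = recompute (AllPairs.allPairs? (λ a b → ¬? (a Fin.≟ b)) j) d

        E-sat : ∀ C → E (prodM Ms) (λ σ → ind (satisfies f σ C)) ≡ biased (y C) (ind ∘ f)
        E-sat C = trans (E-prod-lookup Ms (unique C) (λ a → ind (f (Vec.zipWith Sign._*_ (Constraint.b C) a))))
          (trans (cong (λ z → E (prodM z) (λ a → ind (f (Vec.zipWith Sign._*_ (Constraint.b C) a)))) (map-lookup-map (Constraint.j C)))
            (biased-* (Constraint.b C) (Vec.map (lookup s) (Constraint.j C)) (ind ∘ f)))
          where
          map-lookup-map : ∀ {l} (j : Vec (Fin n) l) → Vec.map (lookup Ms) j ≡ Vec.map bcoin (Vec.map (lookup s) j)
          map-lookup-map []      = refl
          map-lookup-map (i ∷ j) = cong₂ _∷_ (Vec.lookup-map i bcoin s) (map-lookup-map j)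

        -- Symmetry makes all linear coefficients of `f` equal, so the linear part sees only the
        -- total of the signs.
        lin-y : ∀ ys → lin ys (ind ∘ f) ≡ sg ς * g * tot ys
        lin-y ys = trans (lin-coords ys (ind ∘ f)) (trans
          (sum-cong (λ i → sg (lookup ys i) * E (cubeM k) (λ a → ind (f a) * sg (lookup a i))) (λ i → sg ς * g * sg (lookup ys i))
            (λ i → trans (cong (sg (lookup ys i) *_) (coord i)) (*-comm (sg (lookup ys i)) (sg ς * g))))
          (sym (*-sum (sg ς * g) (λ i → sg (lookup ys i)))))

        E-sat-≥ : ∀ C → E (cubeM k) (ind ∘ f) + γ * (sg ς * g * tot (y C)) - γ * γ * (ι k * ι k) ≤ E (prodM Ms) (λ σ → ind (satisfies f σ C))
        E-sat-≥ C = subst₂ _≤_ (cong (λ z → E (cubeM k) (ind ∘ f) + γ * z - γ * γ * (ι k * ι k)) (lin-y (y C))) (sym (E-sat C))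
          (second-order (y C) (ind ∘ f) (λ a → ≤-trans (≤ᵇ⇒≤ _) (0≤ind (f a)) , ind≤1 (f a)))

        direction : ∑ constraints (λ C → tot (y C)) ≡ sg ς * bias stream
        direction = trans (sym (∑-stream s)) (trans (∑-cong stream (λ (i , b) → trans (cong (sg b *_) (trans (cong sg (Vec.lookup∘tabulate (λ i → ς Sign.* majority stream i) i)) (sg-* ς (majority stream i)))) (lem (sg b) (sg ς) (sg (majority stream i)))))
          (trans (∑-*ˡ stream (sg ς) (λ (i , b) → sg b * sg (majority stream i))) (cong (sg ς *_) (∑-items-majority stream))))
          where
          lem : ∀ b s x → b * (s * x) ≡ s * (b * x)
          lem = solve-∀ ℚ-ring

      val-≥ : ι m * ρ f + γ * g * bias stream - ι m * (γ * γ * (ι k * ι k)) ≤ ι m * val f Ψ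
      val-≥ = begin
        ι m * ρ f + γ * g * bias stream - ι m * K
          ≡⟨ trans (cong (λ z → ι m * z + γ * g * bias stream - ι m * K) (ρ-E f)) (lem (ι m) r γ g (bias stream) K) ⟩
        ι m * (r - K) + γ * (1ℚ * g * bias stream)
          ≡⟨ cong (λ z → ι m * (r - K) + γ * (z * g * bias stream)) (sg-sq ς) ⟨
        ι m * (r - K) + γ * (sg ς * sg ς * g * bias stream)
          ≡⟨ cong₂ _+_ (sym (∑-const constraints (r - K))) (trans (lem₁ γ (sg ς) g (bias stream)) (trans (cong (γ * (sg ς * g) *_) (sym direction)) (sym (∑-*ˡ constraints (γ * (sg ς * g)) (λ C → tot (y C)))))) ⟩
        ∑ constraints (λ _ → r - K) + ∑ constraints (λ C → γ * (sg ς * g) * tot (y C))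
          ≡⟨ ∑-+ constraints (λ _ → r - K) (λ C → γ * (sg ς * g) * tot (y C)) ⟨
        ∑ constraints (λ C → r - K + γ * (sg ς * g) * tot (y C))
          ≤⟨ ∑-mono constraints (λ C → ≤-trans (≤-reflexive (lem₂ r K γ (sg ς * g) (tot (y C)))) (E-sat-≥ C)) ⟩
        ∑ constraints (λ C → E (prodM Ms) (λ σ → ind (satisfies f σ C)))
          ≡⟨ E-∑ (prodM Ms) constraints (λ σ C → ind (satisfies f σ C)) ⟨
        E (prodM Ms) (λ σ → ∑ constraints (λ C → ind (satisfies f σ C)))
          ≤⟨ E-≤const (prodM Ms) (λ σ → ≤-trans (≤-reflexive (trans (∑-ι-hits (satisfies f σ) constraints) (sym (m*valAt σ))))
               (*-monoˡ (0≤ι m) (≤maxcube n (valAt f Ψ) σ))) ⟩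
        ι m * val f Ψ ∎
        where
        open ≤-Reasoning
        r = E (cubeM k) (ind ∘ f)
        K = γ * γ * (ι k * ι k)
        lem : ∀ m r γ g b K → m * r + γ * g * b - m * K ≡ m * (r - K) + γ * (1ℚ * g * b)
        lem = solve-∀ ℚ-ring
        lem₁ : ∀ γ s g b → γ * (s * s * g * b) ≡ γ * (s * g) * (s * b)
        lem₁ = solve-∀ ℚ-ring
        lem₂ : ∀ r K γ x t → r - K + γ * x * t ≡ r + γ * (x * t) - K
        lem₂ = solve-∀ ℚ-ring

      -- The biased assignment gains `γ * g` times the bias and loses at most `m γ² k²`. If the
      -- value exceeds `ρ f` by at most `γ² k²`, the bias is at most `2 γ k² m / g`, and the
      -- equation for `γ` makes this `m / 4`.
      bias-low : 0ℚ < γ → 0ℚ < g → eight * (ι k * ι k) * γ ≡ g → val f Ψ ≤ ρ f + γ * γ * (ι k * ι k) → four * bias stream ≤ ι m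
      bias-low 0<γ 0<g γ-def val≤ = *-cancelˡ (0<* 0<γ 0<g) (begin
        γ * g * (four * bias stream)
          ≡⟨ lem (γ * g) (bias stream) (ι m * ρ f) (ι m * K) ⟩
        four * (ι m * ρ f + γ * g * bias stream - ι m * K - ι m * ρ f + ι m * K)
          ≤⟨ *-monoˡ 0≤four (+-monoˡ-≤ (ι m * K) (+-monoˡ-≤ (- (ι m * ρ f)) (≤-trans val-≥ (*-monoˡ (0≤ι m) val≤)))) ⟩
        four * (ι m * (ρ f + K) - ι m * ρ f + ι m * K)
          ≡⟨ lem₂ (ι m) (ρ f) γ (ι k) ⟩
        γ * (eight * (ι k * ι k) * γ) * ι m
          ≡⟨ cong (λ z → γ * z * ι m) γ-def ⟩
        γ * g * ι m ∎)
        where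
        open ≤-Reasoning
        K = γ * γ * (ι k * ι k)
        lem : ∀ x b r K → x * (four * b) ≡ four * (r + x * b - K - r + K)
        lem = solve-∀ ℚ-ring
        lem₂ : ∀ m r γ k → four * (m * (r + γ * γ * (k * k)) - m * r + m * (γ * γ * (k * k))) ≡ γ * (eight * (k * k) * γ) * m
        lem₂ = solve-∀ ℚ-ring

-- The streaming algorithm

module Trackers where

  open FiniteMeans
  open CubeMoments
  open LevelTwo using (recip; ¼)
  open Draws
  open Memory using (eight)
  open SymmetricPredicates
  open RandomInstances using (hits)
  open LowerBounds using (⅓; ⅔)
  open Resistance using (archimedes; seq-^)
  open RealMeans
  open OneWiseIndependence
  open Coding
  open Reservoir
  open Bias

  Eℝ-converges : ∀ {A : Set} (M : Mean A) (g : ℕ → A → ℝ) → (∀ a → ConvergesTo0 λ i → g i a) → ConvergesTo0 λ i → Eℝ M (g i)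
  Eℝ-converges (dirac a)           g h ε 0<ε = h a ε 0<ε
  Eℝ-converges (mix w 0≤w w≤1 M N) g h ε 0<ε with Eℝ-converges M g h ε 0<ε | Eℝ-converges N g h ε 0<ε
  ... | K , p | K′ , q = K ℕ.⊔ K′ , λ {j} le η 0<η → ev-map
    (λ {l} (x , y) → ≤-trans (∣p+q∣≤∣p∣+∣q∣ (w * seq (Eℝ M (g j)) l) ((1ℚ - w) * seq (Eℝ N (g j)) l)) (≤-trans
      (+-mono-≤ (≤-trans (≤-reflexive (scale 0≤w (seq (Eℝ M (g j)) l))) (*-monoˡ 0≤w x)) (≤-trans (≤-reflexive (scale (0≤-diff w≤1) (seq (Eℝ N (g j)) l))) (*-monoˡ (0≤-diff w≤1) y)))
      (≤-reflexive (lem w (seq ε l + η)))))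
    (ev-∧ (p (ℕ.m⊔n≤o⇒m≤o K K′ le) η 0<η) (q (ℕ.m⊔n≤o⇒n≤o K K′ le) η 0<η))
    where
    scale : ∀ {c} → 0ℚ ≤ c → ∀ x → ∣ c * x ∣ ≡ c * ∣ x ∣
    scale {c} 0≤c x = trans (∣p*q∣≡∣p∣*∣q∣ c x) (cong (_* ∣ x ∣) (0≤p⇒∣p∣≡p 0≤c))
    lem : ∀ w e → w * e + (1ℚ - w) * e ≡ e
    lem = solve-∀ ℚ-ring

  finite : ∀ {A : Set} → Mean A → Distribution A
  finite M = record
    { Integrable = λ _ → ⊤
    ; E          = λ g _ → Eℝ M g
    ; int-resp   = λ _ _ → tt
    ; int-const  = λ _ → tt
    ; int-+      = λ _ _ → tt
    ; int-*      = λ _ _ → tt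
    ; int-abs    = λ _ → tt
    ; E-one      = ≈-≡ {Eℝ M (λ _ → 1ℝ)} {1ℝ} (λ i → trans (seq-Eℝ M (λ _ → 1ℝ) i) (E-const M 1ℚ))
    ; E-+        = λ {g} {h} _ _ → ≈-≡ {Eℝ M (λ a → g a R.+ h a)} {Eℝ M g R.+ Eℝ M h} (λ i →
        trans (seq-Eℝ M (λ a → g a R.+ h a) i) (trans (E-+ M (λ a → seq (g a) i) (λ a → seq (h a) i))
          (cong₂ _+_ (sym (seq-Eℝ M g i)) (sym (seq-Eℝ M h i)))))
    ; E-*        = λ c {g} _ → ≈-≡ {Eℝ M (λ a → c R.* g a)} {c R.* Eℝ M g} (λ i →
        trans (seq-Eℝ M (λ a → c R.* g a) i) (trans (E-*ˡ M (seq c i) (λ a → seq (g a) i)) (cong (seq c i *_) (sym (seq-Eℝ M g i)))))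
    ; E-mono     = λ _ _ le → Eℝ-mono M (supp-all M le)
    ; E-cont     = λ g _ _ conv → Eℝ-converges M g conv
    }

  -- Logarithmic space is below every n^δ, so resistance at ε excludes it.
  log-space-refutes : ∀ {k} (f : Predicate k) (P : Polynomial) {ε} → 0ℚ < ε → (D : ℕ) (s : ℕ → ℕ) → (∀ h → s h ℕ.≤ D ℕ.* suc h) →
    (∀ h → ∃ λ (𝒜 : RandAlgorithm k (2 ℕ.^ h) (s h)) → Solves P f 1ℝ (fromℚ (ρ f) R.+ fromℚ ε) 𝒜) →
    ¬ ApproximationResistant P f
  log-space-refutes {k} f P {ε} 0<ε D s s≤ algorithm resistant = go (resistant (fromℚ ε) (ε , 0<ε , 0 , λ _ → ≤-reflexive (+-identityˡ ε)))
   where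
   go : (∃ λ δ → 0ℝ R.< δ × R.RequiresΩ P f 1ℝ (fromℚ (ρ f) R.+ fromℚ ε) δ) → ⊥
   go (δ , (δ₀ , 0<δ₀ , δ-below) , c , (c₀ , 0<c₀ , c-below) , n₀ , requires) = ev-extract (ev-map contra (ev-∧ c-below (bound 1ℚ (positive⁻¹ 1ℚ))))
    where
    q-1 q C-1 C h S : ℕ
    -- As `1 / q` is below `δ`, resistance with `n = 2 ^ h` would give `c ^ q * 2 ^ h ≤ S ^ q`,
    -- whereas `S` is at most linear in `h`.
    q-1 = proj₁ (archimedes (0<½* 0<δ₀))
    q = suc q-1
    C-1 = proj₁ (archimedes 0<c₀)
    C = suc C-1
    gr = growth n₀ C D q-1
    h = proj₁ gr
    S = s h
    lt : fromℚ (pos 1 / q) R.< δ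
    lt = ½ * δ₀ , 0<½* 0<δ₀ , ev-map (λ {i} b → ≤-trans (+-monoˡ-≤ (½ * δ₀)
        (≤-trans (≤-reflexive (sym (τ-/ q-1))) (proj₂ (archimedes (0<½* 0<δ₀)))))
        (≤-trans (≤-reflexive (lem δ₀)) b)) δ-below
      where
      lem : ∀ d → ½ * d + ½ * d ≡ 0ℚ + d
      lem = solve-∀ ℚ-ring
    bound = requires (2 ℕ.^ h) (ℕ.≤-trans (proj₁ (proj₂ gr)) (ℕ.<⇒≤ (n<2^n h))) S (proj₁ (algorithm h)) (proj₂ (algorithm h)) 1 q-1 lt
    contra : ∀ {i} → 0ℚ + c₀ ≤ seq c i × seq (c R.^ q R.* R.fromℕ ((2 ℕ.^ h) ℕ.^ 1)) i ≤ seq (R.fromℕ (S ℕ.^ q)) i + 1ℚ → ⊥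
    contra {i} (c₀≤ , le) = ℕ.<-irrefl refl (ℕ.<-≤-trans (proj₂ (proj₂ gr)) (ℕ.≤-trans (ι-cancel (begin
      ι (2 ℕ.^ h)                                  ≡⟨ *-identityˡ (ι (2 ℕ.^ h)) ⟨
      1ℚ * ι (2 ℕ.^ h)                             ≡⟨ cong (_* ι (2 ℕ.^ h)) (trans (sym (1^ q)) (trans (cong (_^ q) (sym (ι*τ C-1))) (^-distrib-* (ι C) (τ C-1) q))) ⟩
      ι C ^ q * τ C-1 ^ q * ι (2 ℕ.^ h)            ≡⟨ *-assoc (ι C ^ q) (τ C-1 ^ q) (ι (2 ℕ.^ h)) ⟩
      ι C ^ q * (τ C-1 ^ q * ι (2 ℕ.^ h))          ≤⟨ *-monoˡ (^-nonneg q (0≤ι C)) (*-monoʳ (0≤ι (2 ℕ.^ h)) (^-mono q (0≤τ C-1) τ≤c)) ⟩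
      ι C ^ q * (seq c i ^ q * ι (2 ℕ.^ h))        ≡⟨ cong (ι C ^ q *_) (cong₂ _*_ (sym (seq-^ c q i)) (trans (cong ι (sym (ℕ.*-identityʳ (2 ℕ.^ h)))) (ιℤ-/1 (pos ((2 ℕ.^ h) ℕ.^ 1))))) ⟩
      ι C ^ q * (seq (c R.^ q) i * (pos ((2 ℕ.^ h) ℕ.^ 1) / 1)) ≤⟨ *-monoˡ (^-nonneg q (0≤ι C)) le ⟩
      ι C ^ q * (pos (S ℕ.^ q) / 1 + 1ℚ)           ≡⟨ cong₂ (λ x y → x * (y + 1ℚ)) (sym (ι-^ C q)) (sym (ιℤ-/1 (pos (S ℕ.^ q)))) ⟩
      ι (C ℕ.^ q) * (ι (S ℕ.^ q) + 1ℚ)             ≡⟨ cong (ι (C ℕ.^ q) *_) (trans (cong (ι (S ℕ.^ q) +_) (sym ιℤ-1)) (sym (ι-+ (S ℕ.^ q) 1))) ⟩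
      ι (C ℕ.^ q) * ι (S ℕ.^ q ℕ.+ 1)              ≡⟨ ι-* (C ℕ.^ q) (S ℕ.^ q ℕ.+ 1) ⟨
      ι (C ℕ.^ q ℕ.* (S ℕ.^ q ℕ.+ 1)) ∎))
      (ℕ.*-monoʳ-≤ (C ℕ.^ q) (ℕ.+-monoˡ-≤ 1 (ℕ.^-monoˡ-≤ q (s≤ h))))))
      where
      open ≤-Reasoning
      τ≤c : τ C-1 ≤ seq c i
      τ≤c = ≤-trans (proj₂ (archimedes 0<c₀)) (≤-trans (≤-reflexive (sym (+-identityˡ c₀))) c₀≤)

  module Tracker (e R : ℕ) (κ : ℚ) where

    State : Set
    State = ℕ × Vec Sample R

    sampleCode : Code Sample (λ (c , s , r) → c ℕ.< 2 ℕ.^ e × ⊤ × ℤ.∣ r ∣ ℕ.< 2 ℕ.^ e)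
    sampleCode = pairCode (natCode e) (pairCode signCode (intCode e))

    stateCode : Code State (λ (t , ss) → t ℕ.< 2 ℕ.^ e × All (λ (c , s , r) → c ℕ.< 2 ℕ.^ e × ⊤ × ℤ.∣ r ∣ ℕ.< 2 ℕ.^ e) ss)
    stateCode = pairCode (natCode e) (vecCode R sampleCode)

    start : Sample
    start = 0 , Sign.+ , pos 0

    -- The leading bit tells whether the stream has started, as the initial memory is all zeros.
    space : ℕ
    space = suc (bits stateCode)

    decode : Vec Bool space → State
    decode (false ∷ _) = 0 , replicate R start
    decode (true ∷ z)  = dec stateCode z

    encode : State → Vec Bool space
    encode st = true ∷ enc stateCode st

    total : ∀ {r} → Vec Sample r → ℚ
    total []       = 0ℚ
    total (x ∷ xs) = z-value {0} x + total xs

    accept : State → Bool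
    accept (t , ss) = does (ι R * κ ≤? total ss)

    module _ {n : ℕ} (ωs : Vec (List Bool) R) where

      -- The whole tape of coins belongs to the choice of the deterministic algorithm; the memory
      -- has to hold only the position `t` at which the tape is read.
      stepSample : ℕ → Item {n} → List Bool → Sample → Sample
      stepSample t x ω smp = if hd (List.drop t ω) then new x else upd smp x

      stepItem : State → Item {n} → State
      stepItem (t , ss) x = suc t , zipWith (stepSample t x) ωs ss

      zipWith-∘ : ∀ {A B : Set} {r} (F G : A → B → B) (xs : Vec A r) ys →
        zipWith F xs (zipWith G xs ys) ≡ zipWith (λ x y → F x (G x y)) xs ys
      zipWith-∘ F G []       []       = refl
      zipWith-∘ F G (x ∷ xs) (y ∷ ys) = cong (F x (G x y) ∷_) (zipWith-∘ F G xs ys)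

      zipWith-cong : ∀ {A B C : Set} {r} {F G : A → B → C} → (∀ x y → F x y ≡ G x y) → ∀ (xs : Vec A r) ys → zipWith F xs ys ≡ zipWith G xs ys
      zipWith-cong eq []       []       = refl
      zipWith-cong eq (x ∷ xs) (y ∷ ys) = cong₂ _∷_ (eq x y) (zipWith-cong eq xs ys)

      zipWith-second : ∀ {A B : Set} {r} (xs : Vec A r) (ys : Vec B r) → zipWith (λ _ y → y) xs ys ≡ ys
      zipWith-second []       []       = refl
      zipWith-second (x ∷ xs) (y ∷ ys) = cong (y ∷_) (zipWith-second xs ys)

      tl-drop : ∀ t (ω : List Bool) → tl (List.drop t ω) ≡ List.drop (suc t) ω
      tl-drop zero    []      = refl
      tl-drop zero    (b ∷ ω) = refl
      tl-drop (suc t) []      = refl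
      tl-drop (suc t) (b ∷ ω) = tl-drop t ω

      foldl-stepItem : ∀ L t ss → List.foldl stepItem (t , ss) L ≡ (t ℕ.+ List.length L , zipWith (λ ω smp → run (List.drop t ω) smp L) ωs ss)
      foldl-stepItem []      t ss = cong₂ _,_ (sym (ℕ.+-identityʳ t)) (sym (zipWith-second ωs ss))
      foldl-stepItem (x ∷ L) t ss = trans (foldl-stepItem L (suc t) (zipWith (stepSample t x) ωs ss)) (cong₂ _,_ (sym (ℕ.+-suc t (List.length L)))
        (trans (zipWith-∘ (λ ω smp → run (List.drop (suc t) ω) smp L) (stepSample t x) ωs ss)
          (zipWith-cong (λ ω smp → cong (λ ω′ → run ω′ (stepSample t x ω smp) L) (sym (tl-drop t ω))) ωs ss)))

      -- A sum of at most `t` signs is at most `t` in absolute value, so a bound on the item counter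
      -- also bounds the sums that the samples store.
      Bounded-by : ℕ → Sample → Set
      Bounded-by t (c , s , r) = c ℕ.< 2 ℕ.^ e × ℤ.∣ r ∣ ℕ.≤ t

      Inv : State → Set
      Inv (t , ss) = All (Bounded-by t) ss

      module _ (n≤2^e : n ℕ.≤ 2 ℕ.^ e) where

        inv-sample : ∀ t x ω smp → Bounded-by t smp → Bounded-by (suc t) (stepSample t x ω smp)
        inv-sample t (i , b) ω (c , s , r) (c< , r≤) with hd (List.drop t ω)
        ... | true  = ℕ.<-≤-trans (Fin.toℕ<n i) n≤2^e , ℕ.z≤n
        ... | false = c< , ℕ.≤-trans (ℤ.∣i+j∣≤∣i∣+∣j∣ (if does (c ℕ.≟ toℕ i) then sgℤ b else pos 0) r) (ℕ.+-mono-≤ (y≤ (does (c ℕ.≟ toℕ i)) b) r≤)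
          where
          y≤ : ∀ d b → ℤ.∣ (if d then sgℤ b else pos 0) ∣ ℕ.≤ 1
          y≤ false b      = ℕ.z≤n
          y≤ true  Sign.+ = ℕ.≤-refl
          y≤ true  Sign.- = ℕ.≤-refl

        inv-item : ∀ st x → Inv st → Inv (stepItem st x)
        inv-item (t , ss) x inv = go ωs ss inv
          where
          go : ∀ {r} (ωs : Vec (List Bool) r) ss → All (Bounded-by t) ss → All (Bounded-by (suc t)) (zipWith (stepSample t x) ωs ss)
          go []       []         []       = []
          go (ω ∷ ωs) (smp ∷ ss) (p ∷ ps) = inv-sample t x ω smp p ∷ go ωs ss ps

        inv-items : ∀ L st → Inv st → Inv (List.foldl stepItem st L)
        inv-items []      st inv = inv
        inv-items (x ∷ L) st inv = inv-items L (stepItem st x) (inv-item st x inv)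

        decode-encode : ∀ st → Inv st → proj₁ st ℕ.< 2 ℕ.^ e → decode (encode st) ≡ st
        decode-encode (t , ss) inv t< = dec-enc stateCode (t< , All.map (λ (c< , r≤) → c< , tt , ℕ.≤-<-trans r≤ t<) inv)

        module _ {k : ℕ} where

          S : Vec Bool space → Constraint k n → Vec Bool space
          S z C = encode (List.foldl stepItem (decode z) (items C))

          -- Between constraints the state passes through its code, which is faithful only while the
          -- counter is below `2 ^ e`; therefore the whole remaining stream is required to fit.
          simulate : ∀ Cs st → Inv st → proj₁ st ℕ.+ List.length (List.concatMap items Cs) ℕ.< 2 ℕ.^ e →
            decode (List.foldl S (encode st) Cs) ≡ List.foldl stepItem st (List.concatMap items Cs)
          simulate []       st inv lt = decode-encode st inv (ℕ.≤-<-trans (ℕ.m≤m+n (proj₁ st) 0) lt)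
          simulate (C ∷ Cs) st inv lt = trans (cong (λ st′ → decode (List.foldl S (encode (List.foldl stepItem st′ (items C))) Cs)) (decode-encode st inv (ℕ.≤-<-trans (ℕ.m≤m+n (proj₁ st) _) lt)))
            (trans (simulate Cs (List.foldl stepItem st (items C)) (inv-items (items C) st inv) lt′)
              (sym (List.foldl-++ stepItem st (items C) (List.concatMap items Cs))))
            where
            rest = List.length (List.concatMap items Cs)
            lt′ : proj₁ (List.foldl stepItem st (items C)) ℕ.+ rest ℕ.< 2 ℕ.^ e
            lt′ = subst (ℕ._< 2 ℕ.^ e) (sym (trans (cong (λ z → proj₁ z ℕ.+ rest) (foldl-stepItem (items C) (proj₁ st) (proj₂ st)))
              (trans (ℕ.+-assoc (proj₁ st) (List.length (items C)) rest) (cong (proj₁ st ℕ.+_) (sym (List.length-++ (items C))))))) lt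

          abstract
            algorithm : DetAlgorithm k n space
            algorithm = record
              { S   = S
              ; v   = λ z → fromℚ (ind (accept (decode z)))
              ; 0≤v = λ z → fromℚ-mono (0≤ind (accept (decode z)))
              ; v≤1 = λ z → fromℚ-mono (ind≤1 (accept (decode z)))
              }

            output-algorithm : ∀ (Ψ : Instance k n) (f : Predicate k) → List.length (stream f Ψ) ℕ.< 2 ℕ.^ e → ∀ i →
              seq (DetAlgorithm.output algorithm Ψ) i ≡ ind (does (ι R * κ ≤? total (zipWith (λ ω smp → run ω smp (stream f Ψ)) ωs (replicate R start))))
            -- The first constraint is treated apart, since it meets the memory of zeros, which is
            -- not a value of `encode`.
            output-algorithm (C ∷ Cs) f lt i = cong (ind ∘ accept) (trans
              (simulate Cs (List.foldl stepItem init (items C)) (inv-items (items C) init inv-init) lt′)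
              (trans (sym (List.foldl-++ stepItem init (items C) (List.concatMap items Cs))) (foldl-stepItem (stream f (C ∷ Cs)) 0 (replicate R start))))
              where
              init : State
              init = 0 , replicate R start
              rest : ℕ
              rest = List.length (List.concatMap items Cs)
              inv-init : Inv init
              inv-init = go R
                where
                go : ∀ r → All (Bounded-by 0) (replicate r start)
                go zero    = []
                go (suc r) = (ℕ.m^n>0 2 e , ℕ.z≤n) ∷ go r
              lt′ : proj₁ (List.foldl stepItem init (items C)) ℕ.+ rest ℕ.< 2 ℕ.^ e
              lt′ = subst (ℕ._< 2 ℕ.^ e) (sym (trans (cong (λ z → proj₁ z ℕ.+ rest) (foldl-stepItem (items C) 0 (replicate R start)))
                (sym (List.length-++ (items C))))) lt

-- One-sided predicates are not resistant

module Algorithms where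

  open FiniteMeans
  open CubeMoments
  open Memory using (eight)
  open LevelTwo using (recip; ¼)
  open SymmetricPredicates
  open LowerBounds using (⅓; ⅔)
  open Resistance using (P₀; independent⇒resistant)
  open RealMeans
  open OneWiseIndependence
  open Coding
  open Reservoir
  open Bias
  open Trackers

  -- An exponent linear in `h` means that counters for streams of admissible length need a number of
  -- bits linear in `h`.
  eval-bound : ∀ P → ∃ λ a → ∃ λ b → ∀ h → eval P (2 ℕ.^ h) ℕ.≤ 2 ℕ.^ (a ℕ.* h ℕ.+ b)
  eval-bound []      = 0 , 0 , λ _ → ℕ.z≤n
  eval-bound (c ∷ P) with eval-bound P
  ... | a , b , bound = suc a , b ℕ.+ suc c , λ h → begin
      c ℕ.+ 2 ℕ.^ h ℕ.* eval P (2 ℕ.^ h)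
        ≤⟨ ℕ.+-mono-≤ (ℕ.≤-trans (ℕ.<⇒≤ (n<2^n c)) (ℕ.^-monoʳ-≤ 2 (ℕ.m≤n+m c (h ℕ.+ (a ℕ.* h ℕ.+ b)))))
             (ℕ.≤-trans (ℕ.*-monoʳ-≤ (2 ℕ.^ h) (bound h)) (ℕ.≤-trans (ℕ.≤-reflexive (sym (ℕ.^-distribˡ-+-* 2 h (a ℕ.* h ℕ.+ b))))
               (ℕ.^-monoʳ-≤ 2 (ℕ.m≤m+n (h ℕ.+ (a ℕ.* h ℕ.+ b)) c)))) ⟩
      top h ℕ.+ top h
        ≡⟨ cong (top h ℕ.+_) (ℕ.+-identityʳ (top h)) ⟨
      2 ℕ.^ suc (h ℕ.+ (a ℕ.* h ℕ.+ b) ℕ.+ c)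
        ≡⟨ cong (2 ℕ.^_) (lem (a ℕ.* h) h b c) ⟩
      2 ℕ.^ (suc a ℕ.* h ℕ.+ (b ℕ.+ suc c)) ∎
    where
    open ℕ.≤-Reasoning
    top : ℕ → ℕ
    top h = 2 ℕ.^ (h ℕ.+ (a ℕ.* h ℕ.+ b) ℕ.+ c)
    lem : ∀ x h b c → suc (h ℕ.+ (x ℕ.+ b) ℕ.+ c) ≡ h ℕ.+ x ℕ.+ (b ℕ.+ suc c)
    lem = ℕR.solve-∀

  length-stream : ∀ {k n} (f : Predicate k) (Ψ : Instance k n) → List.length (stream f Ψ) ≡ k ℕ.* List⁺.length Ψ
  length-stream {k} f Ψ = go (List⁺.toList Ψ)
    where
    go : ∀ Cs → List.length (List.concatMap items Cs) ≡ k ℕ.* List.length Cs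
    go []       = sym (ℕ.*-zeroʳ k)
    go (C ∷ Cs) = trans (List.length-++ (items C)) (trans (cong₂ ℕ._+_ (Vec.length-toList (Vec.zip (Constraint.j C) (Constraint.b C))) (go Cs))
      (sym (ℕ.*-suc k (List.length Cs))))

  -- No instance has value 1, so rejecting everything is correct. This case stands apart because the
  -- linear coefficients of `f` vanish in it.
  unsatisfiable-algorithm : ∀ {k} (f : Predicate k) P β {n} → (∀ a → f a ≢ true) →
    ∃ λ (𝒜 : RandAlgorithm k n 0) → Solves P f 1ℝ β 𝒜
  unsatisfiable-algorithm f P β {n} unsat = record { law = finite (dirac never) ; measurable = λ _ → tt } ,
    λ Ψ _ → (λ 1≤val → ⊥-elim (<-irrefl refl (<-≤-trans (0<ιm f Ψ) (≤-trans
        (all-hit-≤ (satisfies f (proj₁ (val-one f Ψ (fromℚ-cancel 1≤val)))) (λ _ → 0ℚ) (λ _ eq → ⊥-elim (unsat _ eq)) (constraints f Ψ) (proj₂ (val-one f Ψ (fromℚ-cancel 1≤val))))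
        (≤-reflexive (trans (∑-const (constraints f Ψ) 0ℚ) (*-zeroʳ (ι (List.length (constraints f Ψ)))))))))) ,
      (λ _ → fromℚ-mono {0ℚ} {⅓} (≤ᵇ⇒≤ _))
    where
    never : DetAlgorithm _ n 0
    never = record { S = λ z _ → z ; v = λ _ → 0ℝ ; 0≤v = λ _ → fromℚ-mono ≤-refl ; v≤1 = λ _ → fromℚ-mono 0≤1 }

  module OneSidedAlgorithm {k-1 : ℕ} (f : Predicate (suc k-1)) (sym-f : Symmetric f) (P : Polynomial) (ς : Sign)
    (one : ∀ a → f a ≡ true → 1ℚ ≤ sg ς * tot a) (0<ρ : 0ℚ < E (cubeM (suc k-1)) (ind ∘ f)) where

    private
      k = suc k-1
      M = cubeM k

      inv : ∀ π a → ind (f (permute π a)) ≡ ind (f a)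
      inv π a = cong ind (sym-f π a)

      e₀ : ℚ
      e₀ = E M (λ a → ind (f a) * sg (lookup a zero))

      g : ℚ
      g = sg ς * e₀

      sg-sg : ∀ x → sg ς * (sg ς * x) ≡ x
      sg-sg x = trans (sym (*-assoc (sg ς) (sg ς) x)) (trans (cong (_* x) (sg-sq ς)) (*-identityˡ x))

      coord : ∀ i → E M (λ a → ind (f a) * sg (lookup a i)) ≡ sg ς * g
      coord i = trans (coords-equal (ind ∘ f) inv i zero) (sym (sg-sg e₀))

      -- By symmetry `ι k * g` is the mean of `sg ς * tot` restricted to the satisfying assignments,
      -- each of which counts at least 1; so it is at least `ρ f`.
      0<kg : 0ℚ < ι k * g
      0<kg = <-≤-trans 0<ρ (begin
        E M (ind ∘ f)                           ≤⟨ E-mono M (λ a → go (f a) (tot a) (one a)) ⟩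
        E M (λ a → sg ς * (ind (f a) * tot a))  ≡⟨ trans (E-*ˡ M (sg ς) _) (cong (sg ς *_) (coords-sum (ind ∘ f) inv zero)) ⟩
        sg ς * (ι k * e₀)                       ≡⟨ lem (sg ς) (ι k) e₀ ⟩
        ι k * g ∎)
        where
        open ≤-Reasoning
        lem : ∀ s k e → s * (k * e) ≡ k * (s * e)
        lem = solve-∀ ℚ-ring
        go : ∀ b t → (b ≡ true → 1ℚ ≤ sg ς * t) → ind b ≤ sg ς * (ind b * t)
        go true  t h = subst (λ z → 1ℚ ≤ sg ς * z) (sym (*-identityˡ t)) (h refl)
        go false t h = ≤-reflexive (sym (trans (cong (sg ς *_) (*-zeroˡ t)) (*-zeroʳ (sg ς))))

      0<g : 0ℚ < g
      0<g with 0<⊎≤0 g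
      ... | inj₁ h = h
      ... | inj₂ h = ⊥-elim (<-irrefl refl (<-≤-trans 0<kg (≤-trans (*-monoˡ (0≤ι k) h) (≤-reflexive (*-zeroʳ (ι k))))))

      g≤1 : g ≤ 1ℚ
      g≤1 = proj₂ (within-sg ς (within-E M (λ a → go (f a) (lookup a zero))))
        where
        go : ∀ b s → Within 1ℚ (ind b * sg s)
        go true  Sign.+ = ≤ᵇ⇒≤ _ , ≤ᵇ⇒≤ _
        go true  Sign.- = ≤ᵇ⇒≤ _ , ≤ᵇ⇒≤ _
        go false Sign.+ = ≤ᵇ⇒≤ _ , ≤ᵇ⇒≤ _
        go false Sign.- = ≤ᵇ⇒≤ _ , ≤ᵇ⇒≤ _

      k² : ℚ
      k² = ι k * ι k

      1≤k² : 1ℚ ≤ k²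
      1≤k² = *-mono 0≤1 0≤1 (1≤ιsuc k-1) (1≤ιsuc k-1)

      0<8k² : 0ℚ < eight * k²
      0<8k² = 0<* (positive⁻¹ eight) (<-≤-trans (positive⁻¹ 1ℚ) 1≤k²)

      r : ℚ
      r = proj₁ (recip 0<8k²)

      γ : ℚ
      γ = g * r

      γ-def : eight * k² * γ ≡ g
      γ-def = trans (lem (eight * k²) g r) (trans (cong (g *_) (proj₂ (proj₂ (recip 0<8k²)))) (*-identityʳ g))
        where
        lem : ∀ x g r → x * (g * r) ≡ g * (x * r)
        lem = solve-∀ ℚ-ring

      0≤γ : 0ℚ ≤ γ
      0≤γ = 0≤* (<⇒≤ 0<g) (proj₁ (proj₂ (recip 0<8k²)))

      0<γ : 0ℚ < γ
      0<γ = 0≤∧≢0⇒0< 0≤γ (λ γ≡0 → 0<⇒≢ 0<g (trans (sym γ-def) (trans (cong (eight * k² *_) γ≡0) (*-zeroʳ (eight * k²)))))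

      γ≤1 : γ ≤ 1ℚ
      γ≤1 = ≤-trans (subst (_≤ eight * k² * γ) (*-identityˡ γ) (*-monoʳ {p = 1ℚ} {q = eight * k²} 0≤γ
        (*-mono {b = eight} 0≤1 0≤1 (≤ᵇ⇒≤ _) 1≤k²))) (≤-trans (≤-reflexive γ-def) g≤1)

    ε : ℚ
    ε = γ * γ * k²

    0<ε : 0ℚ < ε
    0<ε = 0<* (0<* 0<γ 0<γ) (<-≤-trans (positive⁻¹ 1ℚ) 1≤k²)

    private
      -- The mean of a sample is the bias divided by `k m`: at least `1/k` if the value is 1, at
      -- most `1/(4k)` if it is low. The threshold `1/(2k)` is at distance at least `1/(4k)` from
      -- both. With `R = 48k²` one has `R d = 12k`, so that `e₁ = 1/(144k²)` is `1/(R d)²` and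
      -- `e₁ R` is `⅓`.
      u κ d c e₁ : ℚ
      u  = τ k-1
      κ  = ½ * u
      d  = ¼ * u
      c  = pos 1 / 144
      e₁ = c * (u * u)

      abstract
        R : ℕ
        R = 48 ℕ.* (k ℕ.* k)

        R-def : R ≡ 48 ℕ.* (k ℕ.* k)
        R-def = refl

      a b : ℕ
      a = proj₁ (eval-bound P)
      b = proj₁ (proj₂ (eval-bound P))

      -- Enough bits both for the index of one of `2 ^ h` variables and for the number of items of
      -- the longest admissible stream.
      width : ℕ → ℕ
      width h = suc a ℕ.* h ℕ.+ (b ℕ.+ suc k)

      fits : ∀ h → k ℕ.* eval P (2 ℕ.^ h) ℕ.< 2 ℕ.^ width h
      fits h = begin-strict
        k ℕ.* eval P (2 ℕ.^ h)                    ≤⟨ ℕ.*-mono-≤ (ℕ.<⇒≤ (n<2^n k)) (proj₂ (proj₂ (eval-bound P)) h) ⟩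
        2 ℕ.^ k ℕ.* 2 ℕ.^ (a ℕ.* h ℕ.+ b)         ≡⟨ ℕ.^-distribˡ-+-* 2 k (a ℕ.* h ℕ.+ b) ⟨
        2 ℕ.^ (k ℕ.+ (a ℕ.* h ℕ.+ b))             <⟨ ℕ.^-monoʳ-< 2 (ℕ.s≤s (ℕ.s≤s ℕ.z≤n)) (ℕ.≤-trans (ℕ.m≤m+n _ h) (ℕ.≤-reflexive (lem k (a ℕ.* h) b h))) ⟩
        2 ℕ.^ width h ∎
        where
        open ℕ.≤-Reasoning
        lem : ∀ k x b h → suc (k ℕ.+ (x ℕ.+ b)) ℕ.+ h ≡ h ℕ.+ x ℕ.+ (b ℕ.+ suc k)
        lem = ℕR.solve-∀

      n≤ : ∀ h → 2 ℕ.^ h ℕ.≤ 2 ℕ.^ width h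
      n≤ h = ℕ.^-monoʳ-≤ 2 (ℕ.≤-trans (ℕ.m≤m+n h (a ℕ.* h)) (ℕ.m≤m+n (suc a ℕ.* h) (b ℕ.+ suc k)))

      module T h = Tracker (width h) R κ

    space : ℕ → ℕ
    space h = T.space h

    D : ℕ
    D = suc (w ℕ.+ R ℕ.* (w ℕ.+ (1 ℕ.+ (1 ℕ.+ w))))
      where w = suc a ℕ.+ (b ℕ.+ suc k)

    space≤ : ∀ h → space h ℕ.≤ D ℕ.* suc h
    space≤ h = begin
      suc (width h ℕ.+ bits (vecCode R (T.sampleCode h)))
        ≡⟨ cong (λ x → suc (width h ℕ.+ x)) (bits-vecCode R (T.sampleCode h)) ⟩
      suc (width h ℕ.+ R ℕ.* (width h ℕ.+ (1 ℕ.+ (1 ℕ.+ width h))))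
        ≤⟨ ℕ.+-mono-≤ 1≤ (ℕ.+-mono-≤ width≤ (ℕ.*-monoʳ-≤ R (ℕ.+-mono-≤ width≤ (ℕ.+-mono-≤ 1≤ (ℕ.+-mono-≤ 1≤ width≤))))) ⟩
      suc h ℕ.+ (w ℕ.* suc h ℕ.+ R ℕ.* (w ℕ.* suc h ℕ.+ (suc h ℕ.+ (suc h ℕ.+ w ℕ.* suc h))))
        ≡⟨ lem (suc h) w R ⟩
      D ℕ.* suc h ∎
      where
      open ℕ.≤-Reasoning
      w = suc a ℕ.+ (b ℕ.+ suc k)
      1≤ : 1 ℕ.≤ suc h
      1≤ = ℕ.s≤s ℕ.z≤n
      width≤ : width h ℕ.≤ w ℕ.* suc h
      width≤ = ℕ.≤-trans (ℕ.+-mono-≤ (ℕ.*-monoʳ-≤ (suc a) (ℕ.n≤1+n h)) (ℕ.m≤m*n (b ℕ.+ suc k) (suc h)))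
        (ℕ.≤-reflexive (sym (ℕ.*-distribʳ-+ (suc h) (suc a) (b ℕ.+ suc k))))
      lem : ∀ h w R → h ℕ.+ (w ℕ.* h ℕ.+ R ℕ.* (w ℕ.* h ℕ.+ (h ℕ.+ (h ℕ.+ w ℕ.* h)))) ≡ suc (w ℕ.+ R ℕ.* (w ℕ.+ (1 ℕ.+ (1 ℕ.+ w)))) ℕ.* h
      lem = ℕR.solve-∀

    module _ (h : ℕ) where

      private
        open module T′ = T h using (start; total)

        n rounds : ℕ
        n = 2 ℕ.^ h
        rounds = k ℕ.* eval P n

        seeds : Mean (List Bool)
        seeds = coins 0 rounds

        trackers : Mean (DetAlgorithm k n (space h))
        trackers = mapM (λ ωs → T′.algorithm ωs (n≤ h)) (prodM (replicate R seeds))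

      tracker : RandAlgorithm k n (space h)
      tracker = record { law = finite trackers ; measurable = λ _ → tt }

      private
        module _ (Ψ : Instance k n) (short : List⁺.length Ψ ℕ.≤ eval P n) where

          L : List (Item {n})
          L = stream f Ψ

          L≤ : List.length L ℕ.≤ rounds
          L≤ = ℕ.≤-trans (ℕ.≤-reflexive (length-stream f Ψ)) (ℕ.*-monoʳ-≤ k short)

          Z : List Bool → ℚ
          Z ω = z-value {n} (run ω start L)

          open Repeat seeds Z (λ ω → z-value-sq {n} (run ω start L)) using (mean; tally; test; test-high; test-low)

          total-tally : ∀ {l} (ωs : Vec (List Bool) l) → total (zipWith (λ ω smp → run ω smp L) ωs (replicate l start)) ≡ tally ωs
          total-tally []       = refl
          total-tally (ω ∷ ωs) = cong (Z ω +_) (total-tally ωs)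

          ι48 : ι R ≡ (pos 48 / 1) * k²
          ι48 = trans (trans (cong ι R-def) (ι-* 48 (k ℕ.* k))) (cong₂ _*_ (ιℤ-/1 (pos 48)) (ι-* k k))

          ku : ι k * u ≡ 1ℚ
          ku = ι*τ k-1

          0≤d : 0ℚ ≤ d
          0≤d = 0≤* (nonNegative⁻¹ ¼) (0≤τ k-1)

          0≤e₁ : 0ℚ ≤ e₁
          0≤e₁ = 0≤* (nonNegative⁻¹ c) (0≤sq u)

          1≤e₁ : 1ℚ ≤ e₁ * (ι R * d * (ι R * d))
          1≤e₁ = ≤-reflexive (sym (trans (cong (λ x → e₁ * (x * d * (x * d))) ι48) (trans (lem (ι k) u) (cong (λ x → x * x * (x * x)) ku))))
            where
            lem : ∀ k u → c * (u * u) * ((pos 48 / 1) * (k * k) * (¼ * u) * ((pos 48 / 1) * (k * k) * (¼ * u))) ≡ k * u * (k * u) * (k * u * (k * u))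
            lem = solve-∀ ℚ-ring

          e₁R≤ : e₁ * ι R ≤ ⅓
          e₁R≤ = ≤-reflexive (trans (cong (e₁ *_) ι48) (trans (lem (ι k) u) (trans (cong (λ x → ⅓ * (x * x)) ku) refl)))
            where
            lem : ∀ k u → c * (u * u) * ((pos 48 / 1) * (k * k)) ≡ ⅓ * (k * u * (k * u))
            lem = solve-∀ ℚ-ring

          accepts : Vec (List Bool) R → Bool
          accepts = test R κ d e₁ 0≤d 0≤e₁ 1≤e₁ e₁R≤

          Pr1-tracker : ∀ i → seq (RandAlgorithm.Pr1 tracker Ψ) i ≡ E (prodM (replicate R seeds)) (ind ∘ accepts)
          Pr1-tracker i = trans (seq-Eℝ trackers (λ A → DetAlgorithm.output A Ψ) i)
            (trans (E-map (λ ωs → T′.algorithm ωs (n≤ h)) (prodM (replicate R seeds)) (λ A → seq (DetAlgorithm.output A Ψ) i))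
              (E-cong (prodM (replicate R seeds)) (λ ωs → trans (T′.output-algorithm ωs (n≤ h) Ψ f (ℕ.≤-<-trans L≤ (fits h)) i)
                (cong (λ x → ind (does (ι R * κ ≤? x))) (total-tally ωs)))))

          m*k*mean : ι (List⁺.length Ψ) * (ι k * mean) ≡ bias L
          m*k*mean = trans (trans (lem (ι (List⁺.length Ψ)) (ι k) mean) (cong (_* mean) (trans (sym (ι-* k (List⁺.length Ψ))) (cong ι (sym (length-stream f Ψ))))))
            (length*E-z L rounds start L≤)
            where
            lem : ∀ m k x → m * (k * x) ≡ k * m * x
            lem = solve-∀ ℚ-ring

          u*k*mean : u * (ι k * mean) ≡ mean
          u*k*mean = trans (lem u (ι k) mean) (trans (cong (_* mean) ku) (*-identityˡ mean))
            where
            lem : ∀ u k x → u * (k * x) ≡ k * u * x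
            lem = solve-∀ ℚ-ring

          high : 1ℚ ≤ val f Ψ → ⅔ ≤ E (prodM (replicate R seeds)) (ind ∘ accepts)
          high 1≤val = test-high R κ d e₁ 0≤d 0≤e₁ 1≤e₁ e₁R≤ (begin
            ½ * u + ¼ * u            ≤⟨ ≤-by {d = ¼ * u} 0≤d (lem u) ⟩
            u * 1ℚ                   ≤⟨ *-monoˡ (0≤τ k-1) 1≤kmean ⟩
            u * (ι k * mean)         ≡⟨ u*k*mean ⟩
            mean ∎)
            where
            open ≤-Reasoning
            lem : ∀ u → u * 1ℚ ≡ ½ * u + ¼ * u + ¼ * u
            lem = solve-∀ ℚ-ring
            1≤kmean : 1ℚ ≤ ι k * mean
            1≤kmean = *-cancelˡ (0<ιm f Ψ) (≤-trans (≤-reflexive (*-identityʳ (ι (List⁺.length Ψ)))) (≤-trans (bias-high f Ψ {ς} one 1≤val) (≤-reflexive (sym m*k*mean))))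

          low : val f Ψ ≤ ρ f + ε → E (prodM (replicate R seeds)) (ind ∘ accepts) ≤ ⅓
          low val≤ = test-low R κ d e₁ 0≤d 0≤e₁ 1≤e₁ e₁R≤ (begin
            mean + ¼ * u             ≡⟨ cong (_+ ¼ * u) u*k*mean ⟨
            u * (ι k * mean) + ¼ * u ≤⟨ +-monoˡ-≤ (¼ * u) (*-monoˡ (0≤τ k-1) kmean≤) ⟩
            u * ¼ + ¼ * u            ≡⟨ lem u ⟩
            ½ * u ∎)
            where
            open ≤-Reasoning
            lem : ∀ u → u * ¼ + ¼ * u ≡ ½ * u
            lem = solve-∀ ℚ-ring
            lem′ : ∀ m x → four * (m * x) ≡ m * (four * x)
            lem′ = solve-∀ ℚ-ring
            kmean≤ : ι k * mean ≤ ¼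
            kmean≤ = *-cancelˡ {four} (positive⁻¹ four) (≤-trans (*-cancelˡ (0<ιm f Ψ) (begin
              ι (List⁺.length Ψ) * (four * (ι k * mean)) ≡⟨ lem′ (ι (List⁺.length Ψ)) (ι k * mean) ⟨
              four * (ι (List⁺.length Ψ) * (ι k * mean)) ≡⟨ cong (four *_) m*k*mean ⟩
              four * bias L                              ≤⟨ bias-low f Ψ sym-f ς g coord γ 0≤γ γ≤1 0<γ 0<g γ-def val≤ ⟩
              ι (List⁺.length Ψ)                         ≡⟨ *-identityʳ _ ⟨
              ι (List⁺.length Ψ) * 1ℚ ∎)) (≤-reflexive refl))

      private
        solves-high : ∀ Ψ → List⁺.length Ψ ℕ.≤ eval P n → 1ℚ ≤ val f Ψ → fromℚ ⅔ R.≤ RandAlgorithm.Pr1 tracker Ψ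
        solves-high Ψ short 1≤val = ≤ℝ-pointwise {fromℚ ⅔} {RandAlgorithm.Pr1 tracker Ψ} (λ i →
          ≤-trans (high Ψ short 1≤val) (≤-reflexive (sym (Pr1-tracker Ψ short i))))

        solves-low : ∀ Ψ → List⁺.length Ψ ℕ.≤ eval P n → val f Ψ ≤ ρ f + ε → RandAlgorithm.Pr1 tracker Ψ R.≤ fromℚ ⅓
        solves-low Ψ short val≤ = ≤ℝ-pointwise {RandAlgorithm.Pr1 tracker Ψ} {fromℚ ⅓} (λ i →
          ≤-trans (≤-reflexive (Pr1-tracker Ψ short i)) (low Ψ short val≤))

        below : ∀ (p q r : ℚ) → fromℚ p R.≤ fromℚ q R.+ fromℚ r → p ≤ q + r
        below p q r h = ≤-by-ε (λ η 0<η → ev-extract (h η 0<η))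

      tracker-solves : Solves P f 1ℝ (fromℚ (ρ f) R.+ fromℚ ε) tracker
      tracker-solves Ψ short =
        (λ 1≤val → solves-high Ψ short (fromℚ-cancel {1ℚ} {val f Ψ} 1≤val)) ,
        (λ val≤ → solves-low Ψ short (below (val f Ψ) (ρ f) ε val≤))

  one-sided-not-resistant : ∀ {k-1} (f : Predicate (suc k-1)) → Symmetric f → ∀ P ς → (∀ a → f a ≡ true → 1ℚ ≤ sg ς * tot a) →
    ¬ ApproximationResistant P f
  one-sided-not-resistant {k-1} f sym-f P ς one = go (0<⊎≤0 (E (cubeM (suc k-1)) (ind ∘ f)))
    where
    unsat : E (cubeM (suc k-1)) (ind ∘ f) ≤ 0ℚ → ∀ a → f a ≢ true
    unsat ρ≤0 a fa = <-irrefl refl (<-≤-trans (positive⁻¹ 1ℚ) (subst (λ b → ind b ≤ 0ℚ) fa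
      (≤-trans (point≤mean (0≤ind ∘ f) a) (≤-trans (*-monoˡ (<⇒≤ (0<two^ (suc k-1))) ρ≤0) (≤-reflexive (*-zeroʳ (two ^ suc k-1)))))))
    go : 0ℚ < E (cubeM (suc k-1)) (ind ∘ f) ⊎ E (cubeM (suc k-1)) (ind ∘ f) ≤ 0ℚ → ¬ ApproximationResistant P f
    go (inj₁ 0<ρ) = log-space-refutes f P 0<ε D space space≤ (λ h → tracker h , tracker-solves h)
      where open OneSidedAlgorithm f sym-f P ς one 0<ρ
    go (inj₂ ρ≤0) = log-space-refutes f P (positive⁻¹ 1ℚ) 0 (λ _ → 0) (λ _ → ℕ.z≤n)
      (λ h → unsatisfiable-algorithm f P (fromℚ (ρ f) R.+ fromℚ 1ℚ) (unsat ρ≤0))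

  resistant⇒independent : ∀ P k .{{_ : ℕ.NonZero k}} (f : Predicate k) → Symmetric f → ApproximationResistant P f → SupportsOneWiseIndependent f
  resistant⇒independent P zero    f sym-f ar = ⊥-elim (ℕ.≢-nonZero⁻¹ 0 refl)
  resistant⇒independent P (suc k) f sym-f ar = go (0<⊎≤0 (E (cubeM (suc k)) (Balance.w f sym-f)))
    where
    go : 0ℚ < E (cubeM (suc k)) (Balance.w f sym-f) ⊎ E (cubeM (suc k)) (Balance.w f sym-f) ≤ 0ℚ → SupportsOneWiseIndependent f
    go (inj₁ 0<Ew) = positive⇒independent f sym-f 0<Ew
    go (inj₂ Ew≤0) = ⊥-elim (one-sided-not-resistant f sym-f P (proj₁ side) (proj₂ side) ar)
      where side = Balance.one-sided f sym-f Ew≤0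

open Algorithms using (resistant⇒independent)
open Resistance using (P₀; independent⇒resistant)

lemma2p14 : ∃ λ (P₀ : Polynomial) → ∀ (P : Polynomial) → P₀ ≼ P →
    ∀ (k : ℕ) .{{_ : ℕ.NonZero k}} (f : Predicate k) → Symmetric f →
    ApproximationResistant P f ⇔ SupportsOneWiseIndependent f
lemma2p14 = P₀ , λ P P₀≼P k f sym-f →
  mk⇔ (resistant⇒independent P k f sym-f) (independent⇒resistant P P₀≼P k f sym-f)
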